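{- Let $\mathbb{F}$ be a prime field and let $f \in \mathbb{F}[x_1,\ldots,x_n]$ be a degree four polynomial such that $\|f\|_{U^4}=\delta$. Then there exists a partition of a subspace $V\subseteq \mathbb{F}^{n}$, of dimension $\dim(V) \geq n-O(\log(1/\delta))$, into (affine) subspaces $\{ V_{\alpha}\}_{\alpha\in I}$, satisfying $\dim(V_\alpha) =\Omega\left(n/|\mathbb{F}|^{\log^2(1/\delta)}\right)$, such that for every $\alpha\in I$, $f|_{V_{\alpha}}$ is a cubic polynomial.
   Context: For $f:\mathbb{F}^n\to\mathbb{F}$ and $y\in\mathbb{F}^n$, $\Delta_y(f)(x)=f(x+y)-f(x)$. The $d$-th Gowers norm is $\|f\|_{U^d} = \left|\mathbb{E}_{x,y_1,\ldots,y_d\in\mathbb{F}^n}[\omega^{\Delta_{y_d}\cdots\Delta_{y_1}(f)(x)}]\right|^{1/2^d}$ with $\omega=e^{2\pi i/|\mathbb{F}|}$. Polynomials are identified with the functions $\mathbb{F}^n\to\mathbb{F}$ they define (one works modulo $x_i^{p}-x_i$, where $p=|\mathbb{F}|$). "$f|_{V_\alpha}$ is a cubic polynomial" means that $f$ agrees on $V_\alpha$ with a polynomial of degree at most $3$; this polynomial may depend on $\alpha$. -}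

module Defs where

open import Data.Fin.Base using (Fin; toℕ)
open import Data.Integer.Base using (+_)
open import Data.List.Base as List using (List; []; _∷_; allFin; cartesianProductWith; cartesianProduct; upTo)
open import Data.Nat.Base as ℕ using (ℕ; zero; suc; NonZero; _!)
open import Data.Nat.DivMod using (_mod_)
open import Data.Nat.ListAction using (sum)
open import Data.Nat.Properties using (_!≢0; m^n≢0)
open import Data.Product using (Σ; ∃; ∃-syntax; ∃!; _×_; _,_)
open import Data.Rational.Base as ℚ using (ℚ; 0ℚ; 1ℚ; _/_; ∣_∣)
open import Data.Vec.Base as Vec using (Vec; []; _∷_; zipWith)
open import Relation.Binary.PropositionalEquality using (_≡_; _≢_)

------------------------------------------------------------------------
-- Real numbers

-- A sequence of rationals stands for its limit, and operations on reals
-- are carried out termwise on the approximating sequences.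

infix 4 _≲_ _≃_

_≲_ : (ℕ → ℚ) → (ℕ → ℚ) → Set
x ≲ y = ∀ ε → 0ℚ ℚ.< ε → ∃[ N ] (∀ k → N ℕ.≤ k → x k ℚ.≤ y k ℚ.+ ε)

_≃_ : (ℕ → ℚ) → (ℕ → ℚ) → Set
x ≃ y = x ≲ y × y ≲ x

record ℝ : Set where
  field
    approx : ℕ → ℚ
    cauchy : ∀ ε → 0ℚ ℚ.< ε →
             ∃[ N ] (∀ j k → N ℕ.≤ j → N ℕ.≤ k → ∣ approx j ℚ.- approx k ∣ ℚ.≤ ε)

open ℝ public

fromℕ : ℕ → ℚ
fromℕ m = + m / 1

infixr 8 _^_

_^_ : ℚ → ℕ → ℚ
x ^ zero  = 1ℚ
x ^ suc k = x ℚ.* x ^ k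

------------------------------------------------------------------------
-- Gaussian rationals, whose sequences likewise stand for complex numbers

record ℚ[i] : Set where
  constructor _+i_
  field
    re im : ℚ

open ℚ[i] public

infix  5 _+i_
infixl 6 _+ᶜ_
infixl 7 _*ᶜ_ _·ᶜ_
infixr 8 _^ᶜ_

0ᶜ 1ᶜ : ℚ[i]
0ᶜ = 0ℚ +i 0ℚ
1ᶜ = 1ℚ +i 0ℚ

_+ᶜ_ _*ᶜ_ : ℚ[i] → ℚ[i] → ℚ[i]
(a +i b) +ᶜ (c +i d) = (a ℚ.+ c) +i (b ℚ.+ d)
(a +i b) *ᶜ (c +i d) = (a ℚ.* c ℚ.- b ℚ.* d) +i (a ℚ.* d ℚ.+ b ℚ.* c)

_·ᶜ_ : ℚ → ℚ[i] → ℚ[i]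
q ·ᶜ (a +i b) = (q ℚ.* a) +i (q ℚ.* b)

_^ᶜ_ : ℚ[i] → ℕ → ℚ[i]
z ^ᶜ zero  = 1ᶜ
z ^ᶜ suc k = z *ᶜ z ^ᶜ k

∣_∣² : ℚ[i] → ℚ
∣ a +i b ∣² = a ℚ.* a ℚ.+ b ℚ.* b

sumᶜ : List ℚ[i] → ℚ[i]
sumᶜ = List.foldr _+ᶜ_ 0ᶜ

-- The partial sums 1 + z + ⋯ + zᵏ/k! converge locally uniformly, so if
-- z k converges to w then expᶜ k (z k) converges to eʷ.
expᶜ : ℕ → ℚ[i] → ℚ[i]
expᶜ k z = sumᶜ (List.map (λ j → _/_ (+ 1) (j !) {{j !≢0}} ·ᶜ z ^ᶜ j) (upTo (suc k)))

exp : (ℕ → ℚ) → (ℕ → ℚ)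
exp x k = re (expᶜ k (x k +i 0ℚ))

-- The natural logarithm: y = log x.
IsLog : (ℕ → ℚ) → (ℕ → ℚ) → Set
IsLog x y = exp y ≃ x

-- y = log (1/x), written as eʸ · x = 1.
IsLogInverse : (ℕ → ℚ) → (ℕ → ℚ) → Set
IsLogInverse x y = (λ k → exp y k ℚ.* x k) ≃ (λ _ → 1ℚ)

-- π is the only real t in [0 , 4] with e^(it) = -1.
IsPi : (ℕ → ℚ) → Set
IsPi t = (λ _ → 0ℚ) ≲ t × t ≲ (λ _ → fromℕ 4)
       × (λ k → re (expᶜ k (0ℚ +i t k))) ≃ (λ _ → ℚ.- 1ℚ)
       × (λ k → im (expᶜ k (0ℚ +i t k))) ≃ (λ _ → 0ℚ)

-- Approximations to ω = e^(2πi/p), given approximations t to π.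
root : (p : ℕ) .{{_ : NonZero p}} → (ℕ → ℚ) → ℕ → ℚ[i]
root p t k = expᶜ k (0ℚ +i (+ 2 / p) ℚ.* t k)

------------------------------------------------------------------------
-- The field with p elements and its coordinate spaces

-- All vectors of length d with entries from a list.
vectors : {A : Set} → List A → (d : ℕ) → List (Vec A d)
vectors xs zero    = [] ∷ []
vectors xs (suc d) = cartesianProductWith _∷_ xs (vectors xs d)

𝔽 : ℕ → Set
𝔽 p = Fin p

𝔽^ : ℕ → ℕ → Set
𝔽^ p n = Vec (𝔽 p) n

points : (p n : ℕ) → List (𝔽^ p n)
points p n = vectors (allFin p) n

module _ {p : ℕ} .{{_ : NonZero p}} where

  infixl 6 _+ᶠ_ _-ᶠ_ _⊕_
  infixl 7 _*ᶠ_
  infix  4 _∈_ _∈ᴬ_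

  0ᶠ : 𝔽 p
  0ᶠ = 0 mod p

  _+ᶠ_ _-ᶠ_ _*ᶠ_ : 𝔽 p → 𝔽 p → 𝔽 p
  a +ᶠ b = (toℕ a ℕ.+ toℕ b) mod p
  a -ᶠ b = (toℕ a ℕ.+ (p ℕ.∸ toℕ b)) mod p
  a *ᶠ b = (toℕ a ℕ.* toℕ b) mod p

  _⊕_ : ∀ {n} → 𝔽^ p n → 𝔽^ p n → 𝔽^ p n
  _⊕_ = zipWith _+ᶠ_

  𝟘 : ∀ {n} → 𝔽^ p n
  𝟘 = Vec.replicate _ 0ᶠ

  combination : ∀ {n d} → 𝔽^ p d → Vec (𝔽^ p n) d → 𝔽^ p n
  combination []       []       = 𝟘
  combination (a ∷ as) (v ∷ vs) = Vec.map (a *ᶠ_) v ⊕ combination as vs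

  record Subspace (n : ℕ) : Set where
    field
      dim         : ℕ
      basis       : Vec (𝔽^ p n) dim
      independent : ∀ (a : 𝔽^ p dim) → combination a basis ≡ 𝟘 → a ≡ 𝟘

  record AffineSubspace (n : ℕ) : Set where
    field
      origin    : 𝔽^ p n
      direction : Subspace n

  dimᴬ : ∀ {n} → AffineSubspace n → ℕ
  dimᴬ A = Subspace.dim (AffineSubspace.direction A)

  _∈_ : ∀ {n} → 𝔽^ p n → Subspace n → Set
  x ∈ V = ∃[ a ] x ≡ combination a (Subspace.basis V)

  _∈ᴬ_ : ∀ {n} → 𝔽^ p n → AffineSubspace n → Set
  x ∈ᴬ A = ∃[ v ] (v ∈ AffineSubspace.direction A × x ≡ AffineSubspace.origin A ⊕ v)

  IsPartition : ∀ {n m} → Subspace n → (Fin m → AffineSubspace n) → Set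
  IsPartition V A = (∀ α x → x ∈ᴬ A α → x ∈ V)
                  × (∀ x → x ∈ V → ∃! _≡_ (λ α → x ∈ᴬ A α))

  ----------------------------------------------------------------------
  -- Polynomials

  -- A polynomial modulo the relations xᵢᵖ = xᵢ, given by the coefficients
  -- of the monomials all of whose exponents are less than p.
  Poly : ℕ → Set
  Poly n = Vec (Fin p) n → 𝔽 p

  totalDegree : ∀ {n} → Vec (Fin p) n → ℕ
  totalDegree e = Vec.sum (Vec.map toℕ e)

  DegreeAtMost : ∀ {n} → ℕ → Poly n → Set
  DegreeAtMost d f = ∀ e → f e ≢ 0ᶠ → totalDegree e ℕ.≤ d

  HasDegree : ∀ {n} → ℕ → Poly n → Set
  HasDegree d f = DegreeAtMost d f × ∃[ e ] (f e ≢ 0ᶠ × totalDegree e ≡ d)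

  monomial : ∀ {n} → Vec (Fin p) n → 𝔽^ p n → ℕ
  monomial e x = Vec.foldr′ ℕ._*_ 1 (zipWith (λ k a → toℕ a ℕ.^ toℕ k) e x)

  eval : ∀ {n} → Poly n → 𝔽^ p n → 𝔽 p
  eval {n} f x = sum (List.map (λ e → toℕ (f e) ℕ.* monomial e x) (points p n)) mod p

  CubicOn : ∀ {n} → AffineSubspace n → Poly n → Set
  CubicOn {n} A f = Σ (Poly n) λ g → DegreeAtMost 3 g × (∀ x → x ∈ᴬ A → eval f x ≡ eval g x)

  ----------------------------------------------------------------------
  -- Gowers norms

  Δ : ∀ {n} → 𝔽^ p n → (𝔽^ p n → 𝔽 p) → (𝔽^ p n → 𝔽 p)
  Δ y f x = f (x ⊕ y) -ᶠ f x

  -- Δ* (y₁ ∷ ⋯ ∷ y_d ∷ []) f = Δ y_d (⋯ (Δ y₁ f))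
  Δ* : ∀ {n d} → Vec (𝔽^ p n) d → (𝔽^ p n → 𝔽 p) → (𝔽^ p n → 𝔽 p)
  Δ* []       f = f
  Δ* (y ∷ ys) f = Δ* ys (Δ y f)

  -- The average over x, y₁, …, y_d of ω raised to Δ_{y_d}⋯Δ_{y₁} f (x).
  gowersMean : ∀ {n} → ℕ → (𝔽^ p n → 𝔽 p) → ℚ[i] → ℚ[i]
  gowersMean {n} d f ω =
    _/_ (+ 1) (p ℕ.^ (n ℕ.* suc d)) {{m^n≢0 p (n ℕ.* suc d)}} ·ᶜ
    sumᶜ (List.map (λ (x , ys) → ω ^ᶜ toℕ (Δ* ys f x))
                   (cartesianProduct (points p n) (vectors (points p n) d)))

  -- δ is the 2ᵈ-th root of the modulus of the mean: δ ≥ 0 and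
  -- (δ^(2ᵈ))² = |mean|², squared to keep the modulus rational.
  IsGowersNorm : ∀ {n} → ℕ → (𝔽^ p n → 𝔽 p) → ℝ → Set
  IsGowersNorm d f δ =
    Σ ℝ λ π → IsPi (approx π)
            × (λ _ → 0ℚ) ≲ approx δ
            × (λ k → (approx δ k ^ (2 ℕ.^ d)) ^ 2)
              ≃ (λ k → ∣ gowersMean d f (root p (approx π) k) ∣²)

module Submission where

-- The fourth difference T of f is a symmetric 4-linear form, and the Gowers
-- mean is the proportion β of the triples (x , y , z) with T(x, y, z, ·) = 0,
-- up to multiples of the sum of all p-th roots of unity, which tends to 0 with
-- the approximations. If T vanishes on a subspace W, then f is cubic on each
-- coset of W, so the whole space may be partitioned into the cosets of W.
--
-- Such a W is built greedily, one vector at a time, each at the price of a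
-- subspace of index at most p to a power polynomial in 1/β. A biased symmetric
-- trilinear form vanishes on a subspace of bounded index, for otherwise there
-- would be a long triangular system of vectors, and too few zeros. Many slices
-- T(x, ·, ·, ·) are biased, which yields many vectors x with T(x, N, N, N) = 0
-- for a subspace N of bounded index. Among their combinations, the pigeonhole
-- principle gives vectors w with T(w, w, N, N) = 0 and then T(w, w, w, N) = 0,
-- and by the Chevalley–Warning theorem a nonzero combination of five of these
-- satisfies T(w, w, w, w) = 0 as well. Hence dim W ≥ n / 2^(17 + 4 (a + 1)) where
-- 2^(-a-1) ≤ β ≤ 2^(-a), and 2^(4 a) is at most a constant times e^(L ℓ²) for
-- ℓ = log (1/δ) and L = log p, since δ^16 = β and L ≥ 1/2.

open import Defs
open import Algebra.Bundles using (CommutativeRing; AbelianGroup; CommutativeMonoid)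
import Algebra.Properties.CommutativeMonoid.Sum as MonoidSum
import Algebra.Solver.Ring.NaturalCoefficients.Default as NatSolver
open import Algebra.Structures using (IsCommutativeRing)
open import Data.Fin.Base as Fin using (Fin; toℕ)
import Data.Fin.Properties as Fin
open import Data.Integer.Base as ℤ using (+_)
import Data.Integer.Properties as ℤ
open import Data.List.Base as List using (List; []; _∷_; cartesianProductWith; allFin; tabulate; filter; applyUpTo; cartesianProduct)
import Data.List.Properties as List
open import Data.Nat.Base as ℕ using (ℕ; zero; suc; NonZero; _≤_; _<_; z≤n; s≤s; _!)
open import Data.Nat.DivMod using (_mod_; _%_; %-distribˡ-+; %-distribˡ-*; m<n⇒m%n≡m; n%n≡0; [m+n]%n≡m%n; m%n<n; m≡m%n+[m/n]*n)
open import Data.Nat.Divisibility using (divides; _∣_; m%n≡0⇒n∣m; ∣⇒≤)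
open import Data.Nat.Primality using (Prime; euclidsLemma; prime⇒nonTrivial)
import Data.Nat.Properties as ℕ
open import Data.Nat.Solver using (module +-*-Solver)
open import Data.Product using (Σ; ∃; ∃-syntax; _×_; _,_; proj₁; proj₂)
open import Data.Rational.Base as ℚ using (ℚ; 0ℚ; 1ℚ; _/_; toℚᵘ; ∣_∣; ½)
import Data.Rational.Properties as ℚ
import Data.Rational.Solver as ℚ-Solver
open import Data.Rational.Unnormalised.Base as ℚᵘ using (mkℚᵘ; *≡*; *≤*)
import Data.Rational.Unnormalised.Properties as ℚᵘ
open import Data.Sum.Base using (_⊎_; inj₁; inj₂)
open import Data.Unit using (⊤; tt)
open import Data.Vec.Base as Vec using (Vec; []; _∷_; lookup; zipWith; replicate)
import Data.Vec.Properties as Vec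
open import Function.Base using (_∘_; id)
open import Level using (0ℓ; Level; _⊔_) renaming (suc to lsuc)
open import Relation.Binary.PropositionalEquality
open import Relation.Nullary using (Dec; contradiction; ¬_; yes; no; does)
open import Relation.Nullary.Decidable using (map′; _×-dec_; ¬?; _→-dec_; decidable-stable; toWitness)

module PrimeField (p : ℕ) .{{nz : NonZero p}} (prime : Prime p) where
  open import Data.Nat.Coprimality using (coprime-Bézout; prime⇒coprime)
  open import Data.Nat.GCD using (module Bézout)

  1<p : 1 ℕ.< p
  1<p = ℕ.nonTrivial⇒n>1 p {{prime⇒nonTrivial prime}}

  F : Set
  F = 𝔽 p

  ⟦_⟧ : ℕ → F
  ⟦ m ⟧ = m mod p

  toℕ-⟦⟧ : ∀ m → toℕ ⟦ m ⟧ ≡ m % p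
  toℕ-⟦⟧ m = Fin.toℕ-fromℕ< (m%n<n m p)

  ⟦⟧-cong : ∀ {m n} → m % p ≡ n % p → ⟦ m ⟧ ≡ ⟦ n ⟧
  ⟦⟧-cong {m} {n} e = Fin.toℕ-injective (trans (toℕ-⟦⟧ m) (trans e (sym (toℕ-⟦⟧ n))))

  ⟦⟧-toℕ : ∀ (a : F) → ⟦ toℕ a ⟧ ≡ a
  ⟦⟧-toℕ a = Fin.toℕ-injective (trans (toℕ-⟦⟧ (toℕ a)) (m<n⇒m%n≡m (Fin.toℕ<n a)))

  ⟦⟧-+ : ∀ m n → ⟦ m ℕ.+ n ⟧ ≡ ⟦ m ⟧ +ᶠ ⟦ n ⟧
  ⟦⟧-+ m n = ⟦⟧-cong (trans (%-distribˡ-+ m n p) (cong (_% p) (cong₂ ℕ._+_ (sym (toℕ-⟦⟧ m)) (sym (toℕ-⟦⟧ n)))))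

  ⟦⟧-* : ∀ m n → ⟦ m ℕ.* n ⟧ ≡ ⟦ m ⟧ *ᶠ ⟦ n ⟧
  ⟦⟧-* m n = ⟦⟧-cong (trans (%-distribˡ-* m n p) (cong (_% p) (cong₂ ℕ._*_ (sym (toℕ-⟦⟧ m)) (sym (toℕ-⟦⟧ n)))))

  1ᶠ : F
  1ᶠ = ⟦ 1 ⟧

  neg : F → F
  neg a = 0ᶠ -ᶠ a

  private
    lift1 : {f g : F → F} → (∀ m → f ⟦ m ⟧ ≡ g ⟦ m ⟧) → ∀ a → f a ≡ g a
    lift1 {f} {g} h a = subst (λ a → f a ≡ g a) (⟦⟧-toℕ a) (h (toℕ a))

  +ᶠ-comm : ∀ a b → a +ᶠ b ≡ b +ᶠ a
  +ᶠ-comm a b = cong ⟦_⟧ (ℕ.+-comm (toℕ a) (toℕ b))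

  *ᶠ-comm : ∀ a b → a *ᶠ b ≡ b *ᶠ a
  *ᶠ-comm a b = cong ⟦_⟧ (ℕ.*-comm (toℕ a) (toℕ b))

  +ᶠ-assoc : ∀ a b c → (a +ᶠ b) +ᶠ c ≡ a +ᶠ (b +ᶠ c)
  +ᶠ-assoc a b c = begin
    ⟦ toℕ a ℕ.+ toℕ b ⟧ +ᶠ c                ≡⟨ cong (⟦ _ ⟧ +ᶠ_) (sym (⟦⟧-toℕ c)) ⟩
    ⟦ toℕ a ℕ.+ toℕ b ⟧ +ᶠ ⟦ toℕ c ⟧        ≡⟨ sym (⟦⟧-+ _ _) ⟩
    ⟦ toℕ a ℕ.+ toℕ b ℕ.+ toℕ c ⟧           ≡⟨ cong ⟦_⟧ (ℕ.+-assoc (toℕ a) _ _) ⟩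
    ⟦ toℕ a ℕ.+ (toℕ b ℕ.+ toℕ c) ⟧         ≡⟨ ⟦⟧-+ _ _ ⟩
    ⟦ toℕ a ⟧ +ᶠ ⟦ toℕ b ℕ.+ toℕ c ⟧        ≡⟨ cong (_+ᶠ ⟦ _ ⟧) (⟦⟧-toℕ a) ⟩
    a +ᶠ (b +ᶠ c)                           ∎
    where open ≡-Reasoning

  *ᶠ-assoc : ∀ a b c → (a *ᶠ b) *ᶠ c ≡ a *ᶠ (b *ᶠ c)
  *ᶠ-assoc a b c = begin
    ⟦ toℕ a ℕ.* toℕ b ⟧ *ᶠ c                ≡⟨ cong (⟦ _ ⟧ *ᶠ_) (sym (⟦⟧-toℕ c)) ⟩
    ⟦ toℕ a ℕ.* toℕ b ⟧ *ᶠ ⟦ toℕ c ⟧        ≡⟨ sym (⟦⟧-* _ _) ⟩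
    ⟦ toℕ a ℕ.* toℕ b ℕ.* toℕ c ⟧           ≡⟨ cong ⟦_⟧ (ℕ.*-assoc (toℕ a) _ _) ⟩
    ⟦ toℕ a ℕ.* (toℕ b ℕ.* toℕ c) ⟧         ≡⟨ ⟦⟧-* _ _ ⟩
    ⟦ toℕ a ⟧ *ᶠ ⟦ toℕ b ℕ.* toℕ c ⟧        ≡⟨ cong (_*ᶠ ⟦ _ ⟧) (⟦⟧-toℕ a) ⟩
    a *ᶠ (b *ᶠ c)                           ∎
    where open ≡-Reasoning

  +ᶠ-identityˡ : ∀ a → 0ᶠ +ᶠ a ≡ a
  +ᶠ-identityˡ = lift1 λ m → sym (⟦⟧-+ 0 m)

  *ᶠ-identityˡ : ∀ a → 1ᶠ *ᶠ a ≡ a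
  *ᶠ-identityˡ = lift1 λ m → trans (sym (⟦⟧-* 1 m)) (cong ⟦_⟧ (ℕ.*-identityˡ m))

  *ᶠ-distribʳ : ∀ a b c → (b +ᶠ c) *ᶠ a ≡ b *ᶠ a +ᶠ c *ᶠ a
  *ᶠ-distribʳ a b c = begin
    ⟦ toℕ b ℕ.+ toℕ c ⟧ *ᶠ a                  ≡⟨ cong (⟦ _ ⟧ *ᶠ_) (sym (⟦⟧-toℕ a)) ⟩
    ⟦ toℕ b ℕ.+ toℕ c ⟧ *ᶠ ⟦ toℕ a ⟧          ≡⟨ sym (⟦⟧-* _ _) ⟩
    ⟦ (toℕ b ℕ.+ toℕ c) ℕ.* toℕ a ⟧           ≡⟨ cong ⟦_⟧ (ℕ.*-distribʳ-+ (toℕ a) (toℕ b) _) ⟩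
    ⟦ toℕ b ℕ.* toℕ a ℕ.+ toℕ c ℕ.* toℕ a ⟧   ≡⟨ ⟦⟧-+ _ _ ⟩
    b *ᶠ a +ᶠ c *ᶠ a                          ∎
    where open ≡-Reasoning

  ⟦p⟧≡0 : ⟦ p ⟧ ≡ 0ᶠ
  ⟦p⟧≡0 = ⟦⟧-cong (trans (n%n≡0 p) (sym (m<n⇒m%n≡m (ℕ.<-trans ℕ.z<s 1<p))))

  -ᶠ-cancel : ∀ a b → (a -ᶠ b) +ᶠ b ≡ a
  -ᶠ-cancel a b = begin
    ⟦ toℕ a ℕ.+ (p ℕ.∸ toℕ b) ⟧ +ᶠ b              ≡⟨ cong (⟦ toℕ a ℕ.+ (p ℕ.∸ toℕ b) ⟧ +ᶠ_) (sym (⟦⟧-toℕ b)) ⟩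
    ⟦ toℕ a ℕ.+ (p ℕ.∸ toℕ b) ⟧ +ᶠ ⟦ toℕ b ⟧      ≡⟨ sym (⟦⟧-+ _ _) ⟩
    ⟦ toℕ a ℕ.+ (p ℕ.∸ toℕ b) ℕ.+ toℕ b ⟧         ≡⟨ cong ⟦_⟧ (ℕ.+-assoc (toℕ a) _ _) ⟩
    ⟦ toℕ a ℕ.+ ((p ℕ.∸ toℕ b) ℕ.+ toℕ b) ⟧       ≡⟨ cong (λ x → ⟦ toℕ a ℕ.+ x ⟧) (ℕ.m∸n+n≡m (ℕ.<⇒≤ (Fin.toℕ<n b))) ⟩
    ⟦ toℕ a ℕ.+ p ⟧                               ≡⟨ ⟦⟧-cong ([m+n]%n≡m%n (toℕ a) p) ⟩
    ⟦ toℕ a ⟧                                     ≡⟨ ⟦⟧-toℕ a ⟩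
    a                                             ∎
    where open ≡-Reasoning

  𝔽-ring : CommutativeRing 0ℓ 0ℓ
  𝔽-ring = record
    { Carrier = F ; _≈_ = _≡_ ; _+_ = _+ᶠ_ ; _*_ = _*ᶠ_ ; -_ = neg ; 0# = 0ᶠ ; 1# = 1ᶠ
    ; isCommutativeRing = record
      { isRing = record
        { +-isAbelianGroup = record
          { isGroup = record
            { isMonoid = record
              { isSemigroup = record
                { isMagma = record { isEquivalence = isEquivalence ; ∙-cong = cong₂ _+ᶠ_ }
                ; assoc = +ᶠ-assoc }
              ; identity = +ᶠ-identityˡ , λ a → trans (+ᶠ-comm a 0ᶠ) (+ᶠ-identityˡ a) }
            ; inverse = -ᶠ-cancel 0ᶠ , λ a → trans (+ᶠ-comm a _) (-ᶠ-cancel 0ᶠ a)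
            ; ⁻¹-cong = cong neg }
          ; comm = +ᶠ-comm }
        ; *-cong = cong₂ _*ᶠ_
        ; *-assoc = *ᶠ-assoc
        ; *-identity = *ᶠ-identityˡ , λ a → trans (*ᶠ-comm a 1ᶠ) (*ᶠ-identityˡ a)
        ; distrib = (λ a b c → trans (*ᶠ-comm a _) (trans (*ᶠ-distribʳ a b c) (cong₂ _+ᶠ_ (*ᶠ-comm b a) (*ᶠ-comm c a)))) , *ᶠ-distribʳ }
      ; *-comm = *ᶠ-comm } }

  open CommutativeRing 𝔽-ring public
    using () renaming (+-identityʳ to +ᶠ-identityʳ; zeroˡ to *ᶠ-zeroˡ; zeroʳ to *ᶠ-zeroʳ;
      *-identityʳ to *ᶠ-identityʳ; -‿inverseʳ to +ᶠ-inverseʳ; -‿inverseˡ to +ᶠ-inverseˡ; distribˡ to *ᶠ-distribˡ)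

  -ᶠ-def : ∀ a b → a -ᶠ b ≡ a +ᶠ neg b
  -ᶠ-def a b = begin
    a -ᶠ b                      ≡⟨ sym (+ᶠ-identityʳ _) ⟩
    (a -ᶠ b) +ᶠ 0ᶠ              ≡⟨ cong ((a -ᶠ b) +ᶠ_) (sym (+ᶠ-inverseʳ b)) ⟩
    (a -ᶠ b) +ᶠ (b +ᶠ neg b)   ≡⟨ sym (+ᶠ-assoc _ _ _) ⟩
    ((a -ᶠ b) +ᶠ b) +ᶠ neg b   ≡⟨ cong (_+ᶠ neg b) (-ᶠ-cancel a b) ⟩
    a +ᶠ neg b                 ∎
    where open ≡-Reasoning

  -ᶠ-self : ∀ a → a -ᶠ a ≡ 0ᶠ
  -ᶠ-self a = trans (-ᶠ-def a a) (+ᶠ-inverseʳ a)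

  -ᶠ-unique : ∀ {a b c} → a ≡ c +ᶠ b → a -ᶠ b ≡ c
  -ᶠ-unique {a} {b} {c} e = begin
    a -ᶠ b                 ≡⟨ -ᶠ-def a b ⟩
    a +ᶠ neg b             ≡⟨ cong (_+ᶠ neg b) e ⟩
    (c +ᶠ b) +ᶠ neg b      ≡⟨ +ᶠ-assoc c b _ ⟩
    c +ᶠ (b +ᶠ neg b)      ≡⟨ cong (c +ᶠ_) (+ᶠ-inverseʳ b) ⟩
    c +ᶠ 0ᶠ                ≡⟨ +ᶠ-identityʳ c ⟩
    c                      ∎
    where open ≡-Reasoning

  -ᶠ≡0 : ∀ {a b} → a -ᶠ b ≡ 0ᶠ → a ≡ b
  -ᶠ≡0 {a} {b} e = trans (sym (-ᶠ-cancel a b)) (trans (cong (_+ᶠ b) e) (+ᶠ-identityˡ b))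

  +ᶠ-cancelʳ : ∀ {a b} c → a +ᶠ c ≡ b +ᶠ c → a ≡ b
  +ᶠ-cancelʳ {a} {b} c e = trans (sym (-ᶠ-unique refl)) (trans (cong (_-ᶠ c) e) (-ᶠ-unique refl))

  ⟦⟧≡0⇒∣ : ∀ m → ⟦ m ⟧ ≡ 0ᶠ → p ∣ m
  ⟦⟧≡0⇒∣ m e = m%n≡0⇒n∣m m p (trans (sym (toℕ-⟦⟧ m)) (trans (cong toℕ e) (trans (toℕ-⟦⟧ 0) (m<n⇒m%n≡m (ℕ.<-trans ℕ.z<s 1<p)))))

  ∣⇒⟦⟧≡0 : ∀ {m} → p ∣ m → ⟦ m ⟧ ≡ 0ᶠ
  ∣⇒⟦⟧≡0 {m} (divides q refl) = trans (⟦⟧-* q p) (trans (cong (⟦ q ⟧ *ᶠ_) ⟦p⟧≡0) (*ᶠ-zeroʳ ⟦ q ⟧))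

  ⟦⟧≢0 : ∀ {m} → 0 ℕ.< m → m ℕ.< p → ⟦ m ⟧ ≢ 0ᶠ
  ⟦⟧≢0 {suc m} _ m<p e = ℕ.<⇒≱ m<p (∣⇒≤ (⟦⟧≡0⇒∣ (suc m) e))

  1≢0 : 1ᶠ ≢ 0ᶠ
  1≢0 = ⟦⟧≢0 ℕ.z<s 1<p

  infix 4 _≟ᶠ_
  _≟ᶠ_ : (a b : F) → Dec (a ≡ b)
  _≟ᶠ_ = Fin._≟_

  *ᶠ-domain : ∀ {a b} → a *ᶠ b ≡ 0ᶠ → a ≡ 0ᶠ ⊎ b ≡ 0ᶠ
  *ᶠ-domain {a} {b} e with euclidsLemma (toℕ a) (toℕ b) prime (⟦⟧≡0⇒∣ _ e)
  ... | inj₁ d = inj₁ (trans (sym (⟦⟧-toℕ a)) (∣⇒⟦⟧≡0 d))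
  ... | inj₂ d = inj₂ (trans (sym (⟦⟧-toℕ b)) (∣⇒⟦⟧≡0 d))

  *ᶠ-nonzero : ∀ {a b} → a ≢ 0ᶠ → b ≢ 0ᶠ → a *ᶠ b ≢ 0ᶠ
  *ᶠ-nonzero a≢0 b≢0 e with *ᶠ-domain e
  ... | inj₁ a≡0 = a≢0 a≡0
  ... | inj₂ b≡0 = b≢0 b≡0

  neg-*ˡ : ∀ a b → neg a *ᶠ b ≡ neg (a *ᶠ b)
  neg-*ˡ a b = sym (-ᶠ-unique (begin
    0ᶠ                       ≡⟨ sym (*ᶠ-zeroˡ b) ⟩
    0ᶠ *ᶠ b                  ≡⟨ cong (_*ᶠ b) (sym (+ᶠ-inverseˡ a)) ⟩
    (neg a +ᶠ a) *ᶠ b        ≡⟨ *ᶠ-distribʳ b (neg a) a ⟩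
    neg a *ᶠ b +ᶠ a *ᶠ b     ∎))
    where open ≡-Reasoning

  inverse : ∀ a → a ≢ 0ᶠ → ∃[ b ] b *ᶠ a ≡ 1ᶠ
  inverse a a≢0 = result (toℕ a) refl
    where
    open ≡-Reasoning
    result : ∀ m → toℕ a ≡ m → ∃[ b ] b *ᶠ a ≡ 1ᶠ
    result zero e = contradiction (trans (sym (⟦⟧-toℕ a)) (cong ⟦_⟧ e)) a≢0
    result (suc m) e with coprime-Bézout (prime⇒coprime prime {{_}} (subst (ℕ._< p) e (Fin.toℕ<n a)))
    ... | Bézout.+- x y eq = neg ⟦ y ⟧ , trans (neg-*ˡ ⟦ y ⟧ a) (-ᶠ-unique (begin
      0ᶠ                        ≡⟨ sym (*ᶠ-zeroʳ ⟦ x ⟧) ⟩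
      ⟦ x ⟧ *ᶠ 0ᶠ               ≡⟨ cong (⟦ x ⟧ *ᶠ_) (sym ⟦p⟧≡0) ⟩
      ⟦ x ⟧ *ᶠ ⟦ p ⟧            ≡⟨ sym (⟦⟧-* x p) ⟩
      ⟦ x ℕ.* p ⟧               ≡⟨ cong ⟦_⟧ (sym eq) ⟩
      ⟦ 1 ℕ.+ y ℕ.* suc m ⟧     ≡⟨ ⟦⟧-+ 1 _ ⟩
      1ᶠ +ᶠ ⟦ y ℕ.* suc m ⟧     ≡⟨ cong (1ᶠ +ᶠ_) (⟦⟧-* y (suc m)) ⟩
      1ᶠ +ᶠ ⟦ y ⟧ *ᶠ ⟦ suc m ⟧  ≡⟨ cong (λ z → 1ᶠ +ᶠ ⟦ y ⟧ *ᶠ ⟦ z ⟧) (sym e) ⟩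
      1ᶠ +ᶠ ⟦ y ⟧ *ᶠ ⟦ toℕ a ⟧  ≡⟨ cong (λ z → 1ᶠ +ᶠ ⟦ y ⟧ *ᶠ z) (⟦⟧-toℕ a) ⟩
      1ᶠ +ᶠ ⟦ y ⟧ *ᶠ a          ∎))
    ... | Bézout.-+ x y eq = ⟦ y ⟧ , (begin
      ⟦ y ⟧ *ᶠ a                ≡⟨ cong (⟦ y ⟧ *ᶠ_) (sym (⟦⟧-toℕ a)) ⟩
      ⟦ y ⟧ *ᶠ ⟦ toℕ a ⟧        ≡⟨ cong (λ z → ⟦ y ⟧ *ᶠ ⟦ z ⟧) e ⟩
      ⟦ y ⟧ *ᶠ ⟦ suc m ⟧        ≡⟨ sym (⟦⟧-* y (suc m)) ⟩
      ⟦ y ℕ.* suc m ⟧           ≡⟨ cong ⟦_⟧ (sym eq) ⟩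
      ⟦ 1 ℕ.+ x ℕ.* p ⟧         ≡⟨ ⟦⟧-+ 1 _ ⟩
      1ᶠ +ᶠ ⟦ x ℕ.* p ⟧         ≡⟨ cong (1ᶠ +ᶠ_) (trans (⟦⟧-* x p) (trans (cong (⟦ x ⟧ *ᶠ_) ⟦p⟧≡0) (*ᶠ-zeroʳ ⟦ x ⟧))) ⟩
      1ᶠ +ᶠ 0ᶠ                  ≡⟨ +ᶠ-identityʳ 1ᶠ ⟩
      1ᶠ                        ∎)

  V : ℕ → Set
  V n = 𝔽^ p n

  infixl 6 _⊖_
  infixr 7 _·_

  ⊝_ : ∀ {n} → V n → V n
  ⊝_ = Vec.map neg

  _⊖_ : ∀ {n} → V n → V n → V n
  x ⊖ y = x ⊕ (⊝ y)

  _·_ : ∀ {n} → F → V n → V n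
  a · x = Vec.map (a *ᶠ_) x

  V-group : ℕ → AbelianGroup 0ℓ 0ℓ
  V-group n = record
    { Carrier = V n ; _≈_ = _≡_ ; _∙_ = _⊕_ ; ε = 𝟘 ; _⁻¹ = ⊝_
    ; isAbelianGroup = record
      { isGroup = record
        { isMonoid = record
          { isSemigroup = record
            { isMagma = record { isEquivalence = isEquivalence ; ∙-cong = cong₂ _⊕_ }
            ; assoc = Vec.zipWith-assoc +ᶠ-assoc }
          ; identity = Vec.zipWith-identityˡ +ᶠ-identityˡ , Vec.zipWith-identityʳ +ᶠ-identityʳ }
        ; inverse = Vec.zipWith-inverseˡ +ᶠ-inverseˡ , Vec.zipWith-inverseʳ +ᶠ-inverseʳ
        ; ⁻¹-cong = cong ⊝_ }
      ; comm = Vec.zipWith-comm +ᶠ-comm } }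

  module _ {n : ℕ} where
    open AbelianGroup (V-group n) public using ()
      renaming (assoc to ⊕-assoc; comm to ⊕-comm; identityˡ to ⊕-identityˡ; identityʳ to ⊕-identityʳ;
                inverseˡ to ⊕-inverseˡ; inverseʳ to ⊕-inverseʳ)

  ⊖-⊕ : ∀ {n} (x y : V n) → (x ⊖ y) ⊕ y ≡ x
  ⊖-⊕ x y = trans (⊕-assoc x _ y) (trans (cong (x ⊕_) (⊕-inverseˡ y)) (⊕-identityʳ x))

  ⊕-⊖ : ∀ {n} (x y : V n) → (x ⊕ y) ⊖ y ≡ x
  ⊕-⊖ x y = trans (⊕-assoc x y _) (trans (cong (x ⊕_) (⊕-inverseʳ y)) (⊕-identityʳ x))

  ·-distribʳ : ∀ {n} a b (x : V n) → (a +ᶠ b) · x ≡ a · x ⊕ b · x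
  ·-distribʳ a b []       = refl
  ·-distribʳ a b (x ∷ xs) = cong₂ _∷_ (*ᶠ-distribʳ x a b) (·-distribʳ a b xs)

  ·-zeroˡ : ∀ {n} (x : V n) → 0ᶠ · x ≡ 𝟘
  ·-zeroˡ []       = refl
  ·-zeroˡ (x ∷ xs) = cong₂ _∷_ (*ᶠ-zeroˡ x) (·-zeroˡ xs)

  ·-zeroʳ : ∀ {n} a → a · 𝟘 {n = n} ≡ 𝟘
  ·-zeroʳ {zero}  a = refl
  ·-zeroʳ {suc n} a = cong₂ _∷_ (*ᶠ-zeroʳ a) (·-zeroʳ a)

  ·-identityˡ : ∀ {n} (x : V n) → 1ᶠ · x ≡ x
  ·-identityˡ []       = refl
  ·-identityˡ (x ∷ xs) = cong₂ _∷_ (*ᶠ-identityˡ x) (·-identityˡ xs)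

  lookup-⊕ : ∀ {n} (i : Fin n) (x y : V n) → Vec.lookup (x ⊕ y) i ≡ Vec.lookup x i +ᶠ Vec.lookup y i
  lookup-⊕ i x y = Vec.lookup-zipWith _+ᶠ_ i x y

  lookup-· : ∀ {n} (i : Fin n) a (x : V n) → Vec.lookup (a · x) i ≡ a *ᶠ Vec.lookup x i
  lookup-· i a x = Vec.lookup-map i (a *ᶠ_) x

  infix 4 _≟ⱽ_
  _≟ⱽ_ : ∀ {n} (x y : V n) → Dec (x ≡ y)
  _≟ⱽ_ = Vec.≡-dec _≟ᶠ_

  Additive : ∀ {m n} → (V m → V n) → Set
  Additive φ = ∀ x y → φ (x ⊕ y) ≡ φ x ⊕ φ y

  Functional : ∀ {m} → (V m → F) → Set
  Functional ℓ = ∀ x y → ℓ (x ⊕ y) ≡ ℓ x +ᶠ ℓ y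

  functional-0 : ∀ {m} (ℓ : V m → F) → Functional ℓ → ℓ 𝟘 ≡ 0ᶠ
  functional-0 ℓ add = +ᶠ-cancelʳ (ℓ 𝟘) (trans (sym (add 𝟘 𝟘)) (trans (cong ℓ (⊕-identityˡ 𝟘)) (sym (+ᶠ-identityˡ _))))

  functional-⊖ : ∀ {m} (ℓ : V m → F) → Functional ℓ → ∀ x y → ℓ (x ⊖ y) ≡ ℓ x -ᶠ ℓ y
  functional-⊖ ℓ add x y = sym (-ᶠ-unique (trans (cong ℓ (sym (⊖-⊕ x y))) (add _ y)))

  functional-· : ∀ {m} (ℓ : V m → F) → Functional ℓ → ∀ a x → ℓ (a · x) ≡ a *ᶠ ℓ x
  functional-· ℓ add a x = subst (λ a → ℓ (a · x) ≡ a *ᶠ ℓ x) (⟦⟧-toℕ a) (go (toℕ a))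
    where
    go : ∀ k → ℓ (⟦ k ⟧ · x) ≡ ⟦ k ⟧ *ᶠ ℓ x
    go zero    = trans (cong ℓ (·-zeroˡ x)) (trans (functional-0 ℓ add) (sym (*ᶠ-zeroˡ (ℓ x))))
    go (suc k) = begin
      ℓ (⟦ suc k ⟧ · x)                 ≡⟨ cong (λ z → ℓ (z · x)) (⟦⟧-+ 1 k) ⟩
      ℓ ((1ᶠ +ᶠ ⟦ k ⟧) · x)             ≡⟨ cong ℓ (·-distribʳ 1ᶠ ⟦ k ⟧ x) ⟩
      ℓ (1ᶠ · x ⊕ ⟦ k ⟧ · x)            ≡⟨ add _ _ ⟩
      ℓ (1ᶠ · x) +ᶠ ℓ (⟦ k ⟧ · x)       ≡⟨ cong₂ _+ᶠ_ (trans (cong ℓ (·-identityˡ x)) (sym (*ᶠ-identityˡ (ℓ x)))) (go k) ⟩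
      1ᶠ *ᶠ ℓ x +ᶠ ⟦ k ⟧ *ᶠ ℓ x         ≡⟨ sym (*ᶠ-distribʳ (ℓ x) 1ᶠ ⟦ k ⟧) ⟩
      (1ᶠ +ᶠ ⟦ k ⟧) *ᶠ ℓ x              ≡⟨ cong (_*ᶠ ℓ x) (sym (⟦⟧-+ 1 k)) ⟩
      ⟦ suc k ⟧ *ᶠ ℓ x                  ∎
      where open ≡-Reasoning

  additive-0 : ∀ {m n} (φ : V m → V n) → Additive φ → φ 𝟘 ≡ 𝟘
  additive-0 φ add = trans (sym (⊕-⊖ (φ 𝟘) (φ 𝟘))) (trans (cong (_⊖ φ 𝟘) (trans (sym (add 𝟘 𝟘)) (cong φ (⊕-identityˡ 𝟘)))) (⊕-inverseʳ (φ 𝟘)))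

  additive-⊖ : ∀ {m n} (φ : V m → V n) → Additive φ → ∀ x y → φ (x ⊖ y) ≡ φ x ⊖ φ y
  additive-⊖ φ add x y = trans (sym (⊕-⊖ (φ (x ⊖ y)) (φ y))) (cong (_⊖ φ y) (trans (sym (add _ y)) (cong φ (⊖-⊕ x y))))

  ⊕-interchange : ∀ {n} (a b c d : V n) → (a ⊕ b) ⊕ (c ⊕ d) ≡ (a ⊕ c) ⊕ (b ⊕ d)
  ⊕-interchange a b c d = begin
    (a ⊕ b) ⊕ (c ⊕ d)   ≡⟨ ⊕-assoc a b _ ⟩
    a ⊕ (b ⊕ (c ⊕ d))   ≡⟨ cong (a ⊕_) (sym (⊕-assoc b c d)) ⟩
    a ⊕ ((b ⊕ c) ⊕ d)   ≡⟨ cong (λ z → a ⊕ (z ⊕ d)) (⊕-comm b c) ⟩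
    a ⊕ ((c ⊕ b) ⊕ d)   ≡⟨ cong (a ⊕_) (⊕-assoc c b d) ⟩
    a ⊕ (c ⊕ (b ⊕ d))   ≡⟨ sym (⊕-assoc a c _) ⟩
    (a ⊕ c) ⊕ (b ⊕ d)   ∎
    where open ≡-Reasoning

  ⊖-interchange : ∀ {n} (a b c d : V n) → (a ⊕ b) ⊖ (c ⊕ d) ≡ (a ⊖ c) ⊕ (b ⊖ d)
  ⊖-interchange a b c d = begin
    (a ⊕ b) ⊖ (c ⊕ d)                             ≡⟨ cong (_⊖ (c ⊕ d)) (sym (cong₂ _⊕_ (⊖-⊕ a c) (⊖-⊕ b d))) ⟩
    (((a ⊖ c) ⊕ c) ⊕ ((b ⊖ d) ⊕ d)) ⊖ (c ⊕ d)     ≡⟨ cong (_⊖ (c ⊕ d)) (⊕-interchange _ c _ d) ⟩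
    (((a ⊖ c) ⊕ (b ⊖ d)) ⊕ (c ⊕ d)) ⊖ (c ⊕ d)     ≡⟨ ⊕-⊖ _ (c ⊕ d) ⟩
    (a ⊖ c) ⊕ (b ⊖ d)                             ∎
    where open ≡-Reasoning

  combination-additive : ∀ {n d} (vs : Vec (V n) d) → Additive (λ a → combination a vs)
  combination-additive []       []       []       = sym (⊕-identityˡ 𝟘)
  combination-additive (v ∷ vs) (a ∷ as) (b ∷ bs) =
    trans (cong₂ _⊕_ (·-distribʳ a b v) (combination-additive vs as bs)) (⊕-interchange _ _ _ _)

module Count (p : ℕ) .{{nz : NonZero p}} (prime : Prime p) where
  open import Data.Bool.Base using (if_then_else_)
  open import Data.Fin.Permutation using (Permutation; permutation)
  open PrimeField p prime

  module SumV (M : CommutativeMonoid 0ℓ 0ℓ) where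
    open CommutativeMonoid M using (Carrier; _≈_; _∙_; ε; reflexive) renaming (refl to ≈refl; sym to ≈sym; trans to ≈trans; ∙-cong to ∙cong; ∙-congˡ to ∙congˡ)
    open MonoidSum M using (sum; sum-cong-≋; ∑-distrib-+; ∑-comm; ∑-permute; sum-replicate-zero)

    ∑ : ∀ n → (V n → Carrier) → Carrier
    ∑ zero    f = f []
    ∑ (suc n) f = sum λ a → ∑ n λ x → f (a ∷ x)

    ∑-cong : ∀ n {f g : V n → Carrier} → (∀ x → f x ≈ g x) → ∑ n f ≈ ∑ n g
    ∑-cong zero    h = h []
    ∑-cong (suc n) h = sum-cong-≋ λ a → ∑-cong n λ x → h (a ∷ x)

    ∑-ε : ∀ n → ∑ n (λ _ → ε) ≈ ε
    ∑-ε zero    = ≈refl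
    ∑-ε (suc n) = ≈trans (sum-cong-≋ {p} {λ _ → ∑ n λ _ → ε} {λ _ → ε} λ _ → ∑-ε n) (sum-replicate-zero p)

    ∑-distrib : ∀ n (f g : V n → Carrier) → ∑ n (λ x → f x ∙ g x) ≈ ∑ n f ∙ ∑ n g
    ∑-distrib zero    f g = ≈refl
    ∑-distrib (suc n) f g = ≈trans
      (sum-cong-≋ {p} {λ a → ∑ n λ x → f (a ∷ x) ∙ g (a ∷ x)} {λ a → ∑ n (λ x → f (a ∷ x)) ∙ ∑ n (λ x → g (a ∷ x))}
        λ a → ∑-distrib n (λ x → f (a ∷ x)) (λ x → g (a ∷ x)))
      (∑-distrib-+ (λ a → ∑ n λ x → f (a ∷ x)) (λ a → ∑ n λ x → g (a ∷ x)))

    sum-∑-swap : ∀ {k} n (f : Fin k → V n → Carrier) → sum (λ i → ∑ n (f i)) ≈ ∑ n (λ x → sum (λ i → f i x))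
    sum-∑-swap {zero}  n f = ≈sym (∑-ε n)
    sum-∑-swap {suc k} n f = ≈trans (∙congˡ (sum-∑-swap n (f ∘ Fin.suc))) (≈sym (∑-distrib n _ _))

    ∑-swap : ∀ m n (f : V m → V n → Carrier) → ∑ m (λ x → ∑ n (f x)) ≈ ∑ n (λ y → ∑ m (λ x → f x y))
    ∑-swap zero    n f = ≈refl
    ∑-swap (suc m) n f = ≈trans
      (sum-cong-≋ {p} {λ a → ∑ m λ x → ∑ n (f (a ∷ x))} {λ a → ∑ n λ y → ∑ m λ x → f (a ∷ x) y}
        λ a → ∑-swap m n λ x → f (a ∷ x))
      (sum-∑-swap n (λ a y → ∑ m λ x → f (a ∷ x) y))

    shift : F → Permutation p p
    shift b = permutation (_+ᶠ b) (_-ᶠ b) (λ a → -ᶠ-cancel a b) (λ a → -ᶠ-unique refl)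

    ∑-translate : ∀ n (f : V n → Carrier) (y : V n) → ∑ n f ≈ ∑ n (λ x → f (x ⊕ y))
    ∑-translate zero    f []      = ≈refl
    ∑-translate (suc n) f (b ∷ y) = ≈trans
      (∑-permute (λ a → ∑ n λ x → f (a ∷ x)) (shift b))
      (sum-cong-≋ λ a → ∑-translate n (λ x → f ((a +ᶠ b) ∷ x)) y)

  open SumV ℕ.+-0-commutativeMonoid public
  open MonoidSum ℕ.+-0-commutativeMonoid public using (sum; sum-cong-≗)

  sum-mono : ∀ {k} {f g : Fin k → ℕ} → (∀ i → f i ≤ g i) → sum f ≤ sum g
  sum-mono {zero}  h = z≤n
  sum-mono {suc k} h = ℕ.+-mono-≤ (h Fin.zero) (sum-mono (h ∘ Fin.suc))

  sum-*ˡ : ∀ {k} c (f : Fin k → ℕ) → sum (λ i → c ℕ.* f i) ≡ c ℕ.* sum f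
  sum-*ˡ {zero}  c f = sym (ℕ.*-zeroʳ c)
  sum-*ˡ {suc k} c f = trans (cong (c ℕ.* f Fin.zero ℕ.+_) (sum-*ˡ c (f ∘ Fin.suc))) (sym (ℕ.*-distribˡ-+ c _ _))

  sum-const : ∀ k c → sum {k} (λ _ → c) ≡ k ℕ.* c
  sum-const zero    c = refl
  sum-const (suc k) c = cong (c ℕ.+_) (sum-const k c)

  ∑-mono : ∀ n {f g : V n → ℕ} → (∀ x → f x ≤ g x) → ∑ n f ≤ ∑ n g
  ∑-mono zero    h = h []
  ∑-mono (suc n) h = sum-mono λ a → ∑-mono n λ x → h (a ∷ x)

  ∑-*ˡ : ∀ n c (f : V n → ℕ) → ∑ n (λ x → c ℕ.* f x) ≡ c ℕ.* ∑ n f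
  ∑-*ˡ zero    c f = refl
  ∑-*ˡ (suc n) c f = trans
    (sum-cong-≗ {p} {λ a → ∑ n λ x → c ℕ.* f (a ∷ x)} λ a → ∑-*ˡ n c (λ x → f (a ∷ x)))
    (sum-*ˡ c (λ a → ∑ n λ x → f (a ∷ x)))

  ∑-*ʳ : ∀ n (f : V n → ℕ) c → ∑ n (λ x → f x ℕ.* c) ≡ ∑ n f ℕ.* c
  ∑-*ʳ n f c = trans (∑-cong n λ x → ℕ.*-comm (f x) c) (trans (∑-*ˡ n c f) (ℕ.*-comm c _))

  ∑-const : ∀ n c → ∑ n (λ _ → c) ≡ p ℕ.^ n ℕ.* c
  ∑-const zero    c = sym (ℕ.*-identityˡ c)
  ∑-const (suc n) c = trans (sum-cong-≗ {p} λ a → ∑-const n c) (trans (sum-const p _) (sym (ℕ.*-assoc p _ c)))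

  ∀? : ∀ {n} {P : V n → Set} → (∀ x → Dec (P x)) → Dec (∀ x → P x)
  ∀? {zero}  P? = map′ (λ { h [] → h }) (λ h → h []) (P? [])
  ∀? {suc n} P? = map′ (λ { h (a ∷ x) → h a x }) (λ h a x → h (a ∷ x)) (Fin.all? λ a → ∀? λ x → P? (a ∷ x))

  ∃? : ∀ {n} {P : V n → Set} → (∀ x → Dec (P x)) → Dec (∃ P)
  ∃? {zero}  P? = map′ (λ h → [] , h) (λ { ([] , h) → h }) (P? [])
  ∃? {suc n} P? = map′ (λ { (a , x , h) → a ∷ x , h }) (λ { (a ∷ x , h) → a , x , h }) (Fin.any? λ a → ∃? λ x → P? (a ∷ x))

  ind : {P : Set} → Dec P → ℕ
  ind P? = if does P? then 1 else 0

  ind-yes : {P : Set} (P? : Dec P) → P → ind P? ≡ 1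
  ind-yes (yes _) _ = refl
  ind-yes (no ¬h) h = contradiction h ¬h

  ind-no : {P : Set} (P? : Dec P) → ¬ P → ind P? ≡ 0
  ind-no (yes h) ¬h = contradiction h ¬h
  ind-no (no _)  _  = refl

  ind-mono : {P Q : Set} (P? : Dec P) (Q? : Dec Q) → (P → Q) → ind P? ≤ ind Q?
  ind-mono (no _)  _  _ = z≤n
  ind-mono (yes h) Q? f = ℕ.≤-reflexive (sym (ind-yes Q? (f h)))

  ind-cong : {P Q : Set} (P? : Dec P) (Q? : Dec Q) → (P → Q) → (Q → P) → ind P? ≡ ind Q?
  ind-cong P? Q? f g = ℕ.≤-antisym (ind-mono P? Q? f) (ind-mono Q? P? g)

  ind-× : {P Q : Set} (P? : Dec P) (Q? : Dec Q) → ind (P? ×-dec Q?) ≡ ind P? ℕ.* ind Q?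
  ind-× (yes _) (yes _) = refl
  ind-× (yes _) (no _)  = refl
  ind-× (no _)  _       = refl

  ind≤1 : {P : Set} (P? : Dec P) → ind P? ≤ 1
  ind≤1 (yes _) = ℕ.≤-refl
  ind≤1 (no _)  = z≤n

  # : ∀ {n} {P : V n → Set} → (∀ x → Dec (P x)) → ℕ
  # {n} P? = ∑ n (λ x → ind (P? x))

  #-mono : ∀ {n} {P Q : V n → Set} (P? : ∀ x → Dec (P x)) (Q? : ∀ x → Dec (Q x)) → (∀ x → P x → Q x) → # P? ≤ # Q?
  #-mono {n} P? Q? h = ∑-mono n λ x → ind-mono (P? x) (Q? x) (h x)

  #≤pⁿ : ∀ {n} {P : V n → Set} (P? : ∀ x → Dec (P x)) → # P? ≤ p ℕ.^ n
  #≤pⁿ {n} P? = ℕ.≤-trans (∑-mono n λ x → ind≤1 (P? x)) (ℕ.≤-reflexive (trans (∑-const n 1) (ℕ.*-identityʳ _)))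

  #-none : ∀ {n} {P : V n → Set} (P? : ∀ x → Dec (P x)) → (∀ x → ¬ P x) → # P? ≡ 0
  #-none {n} P? h = trans (∑-cong n λ x → ind-no (P? x) (h x)) (∑-ε n)

  ∑-term : ∀ {n} (f : V n → ℕ) x → f x ≤ ∑ n f
  ∑-term {zero}  f []      = ℕ.≤-refl
  ∑-term {suc n} f (a ∷ x) = ℕ.≤-trans (∑-term (λ x → f (a ∷ x)) x) (term (λ a → ∑ n λ x → f (a ∷ x)) a)
    where
    term : ∀ {k} (g : Fin k → ℕ) i → g i ≤ sum g
    term g Fin.zero    = ℕ.m≤m+n _ _
    term g (Fin.suc i) = ℕ.≤-trans (term (g ∘ Fin.suc) i) (ℕ.m≤n+m _ _)

  #>0 : ∀ {n} {P : V n → Set} (P? : ∀ x → Dec (P x)) {x} → P x → 1 ≤ # P?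
  #>0 P? {x} h = ℕ.≤-trans (ℕ.≤-reflexive (sym (ind-yes (P? x) h))) (∑-term (λ x → ind (P? x)) x)

  record Sub (n : ℕ) : Set₁ where
    field
      mem  : V n → Set
      mem? : ∀ x → Dec (mem x)
      mem0 : mem 𝟘
      mem⊕ : ∀ {x y} → mem x → mem y → mem (x ⊕ y)
      mem⊖ : ∀ {x y} → mem x → mem y → mem (x ⊖ y)
    size : ℕ
    size = # mem?
    mem· : ∀ a {x} → mem x → mem (a · x)
    mem· a {x} h = subst (λ a → mem (a · x)) (⟦⟧-toℕ a) (go (toℕ a))
      where
      go : ∀ k → mem (⟦ k ⟧ · x)
      go zero    = subst mem (sym (·-zeroˡ x)) mem0
      go (suc k) = subst mem
        (sym (trans (cong (_· x) (⟦⟧-+ 1 k)) (trans (·-distribʳ 1ᶠ ⟦ k ⟧ x) (cong (_⊕ ⟦ k ⟧ · x) (·-identityˡ x)))))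
        (mem⊕ h (go k))
    size>0 : 1 ≤ size
    size>0 = #>0 mem? mem0

  open Sub public using (size)

  infix 4 _∋_ _⊑_
  _∋_ : ∀ {n} → Sub n → V n → Set
  K ∋ x = Sub.mem K x

  _⊑_ : ∀ {n} → Sub n → Sub n → Set
  K ⊑ L = ∀ {x} → K ∋ x → L ∋ x

  full : ∀ {n} → Sub n
  full = record { mem = λ _ → ⊤ ; mem? = λ _ → yes tt ; mem0 = tt ; mem⊕ = λ _ _ → tt ; mem⊖ = λ _ _ → tt }

  size-full : ∀ {n} → size (full {n}) ≡ p ℕ.^ n
  size-full {n} = trans (∑-const n 1) (ℕ.*-identityʳ _)

  infixl 7 _⊓_
  _⊓_ : ∀ {n} → Sub n → Sub n → Sub n
  K ⊓ L = record
    { mem  = λ x → K ∋ x × L ∋ x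
    ; mem? = λ x → Sub.mem? K x ×-dec Sub.mem? L x
    ; mem0 = Sub.mem0 K , Sub.mem0 L
    ; mem⊕ = λ (a , b) (c , d) → Sub.mem⊕ K a c , Sub.mem⊕ L b d
    ; mem⊖ = λ (a , b) (c , d) → Sub.mem⊖ K a c , Sub.mem⊖ L b d }

  -- Both sides count pairs (u , g): the map (u , g) ↦ u + φ g into L has
  -- fibres which are translates of sets embedding in K ∩ φ⁻¹(U).
  restrict : ∀ {d n} (φ : V d → V n) → Additive φ → (K : Sub d) (U L : Sub n) →
             U ⊑ L → (∀ {g} → K ∋ g → L ∋ φ g) →
             size U ℕ.* size K ≤ # (λ g → Sub.mem? K g ×-dec Sub.mem? U (φ g)) ℕ.* size L
  restrict {d} {n} φ add K U L U⊑L φK⊑L = begin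
    size U ℕ.* size K                                    ≡⟨ sym (∑-*ˡ d (size U) _) ⟩
    ∑ d (λ g → size U ℕ.* k g)                           ≡⟨ ∑-cong d (λ g → trans (cong (ℕ._* k g) (∑-translate n u (⊝ φ g))) (sym (∑-*ʳ n _ (k g)))) ⟩
    ∑ d (λ g → ∑ n λ v → u (v ⊖ φ g) ℕ.* k g)            ≡⟨ ∑-swap d n _ ⟩
    ∑ n (λ v → ∑ d λ g → u (v ⊖ φ g) ℕ.* k g)            ≤⟨ ∑-mono n fibre ⟩
    ∑ n (λ v → c ℕ.* ind (Sub.mem? L v))                 ≡⟨ ∑-*ˡ n c _ ⟩
    c ℕ.* size L                                         ∎
    where
    open ℕ.≤-Reasoning
    u : V n → ℕ
    u x = ind (Sub.mem? U x)
    k : V d → ℕ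
    k g = ind (Sub.mem? K g)
    c : ℕ
    c = # (λ g → Sub.mem? K g ×-dec Sub.mem? U (φ g))
    rearranged : ∀ v g g₀ → (v ⊖ φ (g ⊕ g₀)) ⊕ φ g ≡ v ⊖ φ g₀
    rearranged v g g₀ = E.begin
      (v ⊖ φ (g ⊕ g₀)) ⊕ φ g                   E.≡⟨ cong (λ z → (v ⊖ z) ⊕ φ g) (trans (cong φ (⊕-comm g g₀)) (add g₀ g)) ⟩
      (v ⊖ (φ g₀ ⊕ φ g)) ⊕ φ g                 E.≡⟨ sym (⊕-⊖ _ (φ g₀)) ⟩
      ((v ⊖ (φ g₀ ⊕ φ g)) ⊕ φ g) ⊕ φ g₀ ⊖ φ g₀ E.≡⟨ cong (_⊖ φ g₀) (trans (⊕-assoc _ (φ g) (φ g₀)) (trans (cong ((v ⊖ (φ g₀ ⊕ φ g)) ⊕_) (⊕-comm (φ g) (φ g₀))) (⊖-⊕ v _))) ⟩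
      v ⊖ φ g₀                                 E.∎
      where module E = ≡-Reasoning
    fibre : ∀ v → ∑ d (λ g → u (v ⊖ φ g) ℕ.* k g) ≤ c ℕ.* ind (Sub.mem? L v)
    fibre v with ∃? {d} {λ g → U ∋ (v ⊖ φ g) × K ∋ g} (λ g → Sub.mem? U (v ⊖ φ g) ×-dec Sub.mem? K g)
    ... | no ¬h = ℕ.≤-trans (ℕ.≤-reflexive (trans (∑-cong d λ g → trans (sym (ind-× (Sub.mem? U _) (Sub.mem? K g))) (ind-no (Sub.mem? U (v ⊖ φ g) ×-dec Sub.mem? K g) λ h → ¬h (g , h))) (∑-ε d))) z≤n
    ... | yes (g₀ , u₀ , k₀) = begin
      ∑ d (λ g → u (v ⊖ φ g) ℕ.* k g)                       ≡⟨ ∑-translate d _ g₀ ⟩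
      ∑ d (λ g → u (v ⊖ φ (g ⊕ g₀)) ℕ.* k (g ⊕ g₀))         ≤⟨ ∑-mono d pointwise ⟩
      c                                                     ≡⟨ sym (ℕ.*-identityʳ c) ⟩
      c ℕ.* 1                                               ≡⟨ cong (c ℕ.*_) (sym (ind-yes (Sub.mem? L v) v∈L)) ⟩
      c ℕ.* ind (Sub.mem? L v)                              ∎
      where
      v∈L : L ∋ v
      v∈L = subst (L ∋_) (⊖-⊕ v (φ g₀)) (Sub.mem⊕ L (U⊑L u₀) (φK⊑L k₀))
      pointwise : ∀ g → u (v ⊖ φ (g ⊕ g₀)) ℕ.* k (g ⊕ g₀) ≤ ind (Sub.mem? K g ×-dec Sub.mem? U (φ g))
      pointwise g = ℕ.≤-trans (ℕ.≤-reflexive (sym (ind-× (Sub.mem? U _) (Sub.mem? K _))))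
        (ind-mono (Sub.mem? U (v ⊖ φ (g ⊕ g₀)) ×-dec Sub.mem? K (g ⊕ g₀)) (Sub.mem? K g ×-dec Sub.mem? U (φ g))
          λ (a , b) → subst (K ∋_) (⊕-⊖ g g₀) (Sub.mem⊖ K b k₀) ,
                      subst (U ∋_) (trans (cong (_⊖ (v ⊖ φ (g ⊕ g₀))) (trans (sym (rearranged v g g₀)) (⊕-comm _ (φ g)))) (⊕-⊖ (φ g) _))
                        (Sub.mem⊖ U u₀ a))

  ⊓-size : ∀ {n} (K U L : Sub n) → K ⊑ L → U ⊑ L → size U ℕ.* size K ≤ size (K ⊓ U) ℕ.* size L
  ⊓-size K U L K⊑L U⊑L = restrict id (λ _ _ → refl) K U L U⊑L K⊑L

module MultilinearForms (p : ℕ) .{{nz : NonZero p}} (prime : Prime p) where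
  open PrimeField p prime
  open Count p prime

  sum≤1 : ∀ {k} (g : Fin k → ℕ) → (∀ i → g i ≤ 1) → (∀ i j → 1 ≤ g i → 1 ≤ g j → i ≡ j) → sum g ≤ 1
  sum≤1 {zero}  g b u = z≤n
  sum≤1 {suc k} g b u with g Fin.zero in eq
  ... | zero  = sum≤1 (g ∘ Fin.suc) (b ∘ Fin.suc) λ i j hi hj → Fin.suc-injective (u (Fin.suc i) (Fin.suc j) hi hj)
  ... | suc m = begin
    suc m ℕ.+ sum (g ∘ Fin.suc)   ≡⟨ cong (suc m ℕ.+_) (trans (sum-cong-≗ zeros′) (trans (sum-const k 0) (ℕ.*-zeroʳ k))) ⟩
    suc m ℕ.+ 0                   ≡⟨ ℕ.+-identityʳ _ ⟩
    suc m                         ≡⟨ sym eq ⟩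
    g Fin.zero                    ≤⟨ b Fin.zero ⟩
    1                             ∎
    where
    open ℕ.≤-Reasoning
    zeros′ : ∀ i → g (Fin.suc i) ≡ 0
    zeros′ i with g (Fin.suc i) in eq′
    ... | zero  = refl
    ... | suc _ with () ← u Fin.zero (Fin.suc i) (subst (1 ≤_) (sym eq) (s≤s z≤n)) (subst (1 ≤_) (sym eq′) (s≤s z≤n))

  ind>0 : {P : Set} (P? : Dec P) → 1 ≤ ind P? → P
  ind>0 (yes h) _ = h

  #>0⁻ : ∀ {n} {P : V n → Set} (P? : ∀ x → Dec (P x)) → 1 ≤ # P? → ∃ P
  #>0⁻ P? h with ∃? P?
  ... | yes e = e
  ... | no ¬e = contradiction h (ℕ.<⇒≱ (s≤s (ℕ.≤-reflexive (#-none P? λ x hx → ¬e (x , hx)))))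

  #≤1 : ∀ {n} {P : V n → Set} (P? : ∀ x → Dec (P x)) → (∀ x y → P x → P y → x ≡ y) → # P? ≤ 1
  #≤1 {zero}  P? u = ind≤1 (P? [])
  #≤1 {suc n} P? u = sum≤1 _ (λ a → #≤1 (λ x → P? (a ∷ x)) λ x y hx hy → proj₂ (∷-inj (u (a ∷ x) (a ∷ y) hx hy)))
    λ a b ha hb → let (x , hx) = #>0⁻ (λ x → P? (a ∷ x)) ha
                      (y , hy) = #>0⁻ (λ x → P? (b ∷ x)) hb
                  in proj₁ (∷-inj (u (a ∷ x) (b ∷ y) hx hy))
    where
    ∷-inj : ∀ {a b : F} {x y : V n} → a ∷ x ≡ b ∷ y → a ≡ b × x ≡ y
    ∷-inj refl = refl , refl

  pⁿ>0 : ∀ n → 1 ≤ p ℕ.^ n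
  pⁿ>0 n = ℕ.m^n>0 p n

  cancelʳ : ∀ a b {c} → 1 ≤ c → a ℕ.* c ≤ b ℕ.* c → a ≤ b
  cancelʳ a b {suc c} _ h = ℕ.*-cancelʳ-≤ a b (suc c) h

  zeros : ∀ {n} {I : Set} (∀I? : {P : I → Set} → (∀ i → Dec (P i)) → Dec (∀ i → P i))
          (Q : I → Set) (Q? : ∀ i → Dec (Q i)) (ℓ : I → V n → F) → (∀ i → Functional (ℓ i)) → Sub n
  zeros ∀I? Q Q? ℓ add = record
    { mem  = λ x → ∀ i → Q i → ℓ i x ≡ 0ᶠ
    ; mem? = λ x → ∀I? λ i → Q? i →-dec (ℓ i x ≟ᶠ 0ᶠ)
    ; mem0 = λ i _ → functional-0 (ℓ i) (add i)
    ; mem⊕ = λ {x} {y} hx hy i qi → trans (add i x y) (trans (cong₂ _+ᶠ_ (hx i qi) (hy i qi)) (+ᶠ-identityˡ 0ᶠ))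
    ; mem⊖ = λ {x} {y} hx hy i qi → trans (functional-⊖ (ℓ i) (add i) x y) (trans (cong₂ _-ᶠ_ (hx i qi) (hy i qi)) (-ᶠ-self 0ᶠ)) }

  record Tri (n : ℕ) : Set where
    field
      form  : V n → V n → V n → F
      add   : ∀ x x′ y z → form (x ⊕ x′) y z ≡ form x y z +ᶠ form x′ y z
      sym₁₂ : ∀ x y z → form x y z ≡ form y x z
      sym₂₃ : ∀ x y z → form x y z ≡ form x z y
    add₂ : ∀ x y y′ z → form x (y ⊕ y′) z ≡ form x y z +ᶠ form x y′ z
    add₂ x y y′ z = trans (sym₁₂ _ _ _) (trans (add y y′ x z) (cong₂ _+ᶠ_ (sym₁₂ _ _ _) (sym₁₂ _ _ _)))
    add₃ : ∀ x y z z′ → form x y (z ⊕ z′) ≡ form x y z +ᶠ form x y z′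
    add₃ x y z z′ = trans (sym₂₃ _ _ _) (trans (add₂ x z z′ y) (cong₂ _+ᶠ_ (sym₂₃ _ _ _) (sym₂₃ _ _ _)))
    radical : V n → Sub n
    radical x = zeros ∀? (λ _ → ⊤) (λ _ → yes tt) (λ z y → form x y z) (λ z y y′ → add₂ x y y′ z)
    nulls : ℕ
    nulls = ∑ n λ x → size (radical x)
    Biased : ℕ → Set
    Biased q = p ℕ.^ n ℕ.* p ℕ.^ n ≤ q ℕ.* nulls

  record Quad (n : ℕ) : Set where
    field
      form  : V n → V n → V n → V n → F
      add   : ∀ x x′ y z w → form (x ⊕ x′) y z w ≡ form x y z w +ᶠ form x′ y z w
      sym₁₂ : ∀ x y z w → form x y z w ≡ form y x z w
      sym₂₃ : ∀ x y z w → form x y z w ≡ form x z y w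
      sym₃₄ : ∀ x y z w → form x y z w ≡ form x y w z
    slice : V n → Tri n
    slice x = record
      { form  = form x
      ; add   = λ y y′ z w → trans (sym₁₂ _ _ _ _) (trans (add y y′ x z w) (cong₂ _+ᶠ_ (sym₁₂ _ _ _ _) (sym₁₂ _ _ _ _)))
      ; sym₁₂ = sym₂₃ x
      ; sym₂₃ = sym₃₄ x }
    Biased : ℕ → Set
    Biased q = p ℕ.^ n ℕ.* (p ℕ.^ n ℕ.* p ℕ.^ n) ≤ q ℕ.* ∑ n λ x → Tri.nulls (slice x)

  restrict-weighted : ∀ {m d n} (φ : V d → V n) → Additive φ → (K : Sub d) (w : V m → ℕ) (U : V m → Sub n) →
    ∑ m (λ y → w y ℕ.* size (U y)) ℕ.* size K ≤
    ∑ m (λ y → w y ℕ.* # (λ g → Sub.mem? K g ×-dec Sub.mem? (U y) (φ g))) ℕ.* p ℕ.^ n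
  restrict-weighted {m} {d} {n} φ add K w U = begin
    ∑ m (λ y → w y ℕ.* size (U y)) ℕ.* size K     ≡⟨ sym (∑-*ʳ m _ (size K)) ⟩
    ∑ m (λ y → w y ℕ.* size (U y) ℕ.* size K)     ≤⟨ ∑-mono m (λ y → begin
      w y ℕ.* size (U y) ℕ.* size K                 ≡⟨ ℕ.*-assoc (w y) _ _ ⟩
      w y ℕ.* (size (U y) ℕ.* size K)               ≤⟨ ℕ.*-monoʳ-≤ (w y) (restrict φ add K (U y) full (λ _ → _) (λ _ → _)) ⟩
      w y ℕ.* (c y ℕ.* size (full {n}))             ≡⟨ cong (λ z → w y ℕ.* (c y ℕ.* z)) (size-full {n}) ⟩
      w y ℕ.* (c y ℕ.* p ℕ.^ n)                     ≡⟨ sym (ℕ.*-assoc (w y) _ _) ⟩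
      w y ℕ.* c y ℕ.* p ℕ.^ n                       ∎) ⟩
    ∑ m (λ y → w y ℕ.* c y ℕ.* p ℕ.^ n)           ≡⟨ ∑-*ʳ m _ _ ⟩
    ∑ m (λ y → w y ℕ.* c y) ℕ.* p ℕ.^ n           ∎
    where
    open ℕ.≤-Reasoning
    c : V m → ℕ
    c y = # (λ g → Sub.mem? K g ×-dec Sub.mem? (U y) (φ g))

  module _ {n : ℕ} (S : Tri n) where
    open Tri S

    radical-sym : ∀ {x y} → radical x ∋ y → radical y ∋ x
    radical-sym h z _ = trans (sym₁₂ _ _ z) (h z _)

    restrict-tri : ∀ {q} → Biased q → ∀ {d e} (φ : V d → V n) → Additive φ → (K : Sub d) (ψ : V e → V n) → Additive ψ → (L : Sub e) →
      size K ℕ.* size L ≤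
      q ℕ.* ∑ d λ a → ind (Sub.mem? K a) ℕ.* # (λ b → Sub.mem? L b ×-dec Sub.mem? (radical (φ a)) (ψ b))
    restrict-tri {q} bias {d} {e} φ addφ K ψ addψ L =
      cancelʳ _ _ (ℕ.*-mono-≤ (pⁿ>0 n) (pⁿ>0 n)) (begin
        size K ℕ.* size L ℕ.* (P ℕ.* P)         ≤⟨ ℕ.*-monoʳ-≤ (size K ℕ.* size L) bias ⟩
        size K ℕ.* size L ℕ.* (q ℕ.* nulls)     ≡⟨ solve 4 (λ k l q z → k :* l :* (q :* z) := q :* l :* (z :* k)) refl (size K) (size L) q nulls ⟩
        q ℕ.* size L ℕ.* (nulls ℕ.* size K)     ≤⟨ ℕ.*-monoʳ-≤ (q ℕ.* size L) first ⟩
        q ℕ.* size L ℕ.* (X ℕ.* P)              ≡⟨ solve 4 (λ q l x p → q :* l :* (x :* p) := q :* (x :* l) :* p) refl q (size L) X P ⟩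
        q ℕ.* (X ℕ.* size L) ℕ.* P              ≤⟨ ℕ.*-monoˡ-≤ P (ℕ.*-monoʳ-≤ q (restrict-weighted ψ addψ L (λ a → ind (Sub.mem? K a)) (radical ∘ φ))) ⟩
        q ℕ.* (Y ℕ.* P) ℕ.* P                   ≡⟨ solve 3 (λ q y p → q :* (y :* p) :* p := q :* y :* (p :* p)) refl q Y P ⟩
        q ℕ.* Y ℕ.* (P ℕ.* P)                   ∎)
      where
      open ℕ.≤-Reasoning
      open +-*-Solver
      P X Y : ℕ
      P = p ℕ.^ n
      X = ∑ d λ a → ind (Sub.mem? K a) ℕ.* size (radical (φ a))
      Y = ∑ d λ a → ind (Sub.mem? K a) ℕ.* # (λ b → Sub.mem? L b ×-dec Sub.mem? (radical (φ a)) (ψ b))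
      first : nulls ℕ.* size K ≤ X ℕ.* P
      first = begin
        nulls ℕ.* size K       ≡⟨ cong (ℕ._* size K) (∑-cong n λ x → sym (ℕ.*-identityˡ _)) ⟩
        ∑ n (λ x → 1 ℕ.* size (radical x)) ℕ.* size K   ≤⟨ restrict-weighted φ addφ K (λ _ → 1) radical ⟩
        ∑ n (λ x → 1 ℕ.* # (λ a → Sub.mem? K a ×-dec Sub.mem? (radical x) (φ a))) ℕ.* P
          ≡⟨ cong (ℕ._* P) (∑-cong n λ x → trans (ℕ.*-identityˡ _) (∑-cong d λ a → trans (ind-× (Sub.mem? K a) (Sub.mem? (radical x) (φ a)))
               (cong (ind (Sub.mem? K a) ℕ.*_) (ind-cong (Sub.mem? (radical x) (φ a)) (Sub.mem? (radical (φ a)) x) radical-sym radical-sym)))) ⟩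
        ∑ n (λ x → ∑ d λ a → ind (Sub.mem? K a) ℕ.* ind (Sub.mem? (radical (φ a)) x)) ℕ.* P   ≡⟨ cong (ℕ._* P) (∑-swap n d _) ⟩
        ∑ d (λ a → ∑ n λ x → ind (Sub.mem? K a) ℕ.* ind (Sub.mem? (radical (φ a)) x)) ℕ.* P   ≡⟨ cong (ℕ._* P) (∑-cong d λ a → ∑-*ˡ n (ind (Sub.mem? K a)) _) ⟩
        X ℕ.* P                ∎

  module _ {n : ℕ} (T : Quad n) where
    open Quad T

    biased-slice : ∀ {q} → Biased q → ∀ {d} (φ : V d → V n) → Additive φ → (K : Sub d) → 2 ℕ.* q ≤ size K →
      ∃[ g ] K ∋ g × g ≢ 𝟘 × Tri.Biased (slice (φ g)) (2 ℕ.* q)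
    biased-slice {q} bias {d} φ addφ K large
      with ∃? {d} {λ g → K ∋ g × g ≢ 𝟘 × Tri.Biased (slice (φ g)) (2 ℕ.* q)}
              (λ g → Sub.mem? K g ×-dec (¬? (g ≟ⱽ 𝟘) ×-dec (_ ℕ.≤? _)))
    ... | yes found = found
    ... | no ¬found = contradiction (Sub.size>0 K) (ℕ.<⇒≱ (s≤s (ℕ.+-cancelˡ-≤ (2 ℕ.* q ℕ.* X) _ _ (ℕ.≤-trans summed (ℕ.≤-reflexive (sym (ℕ.+-identityʳ _)))))))
      where
      open ℕ.≤-Reasoning
      open +-*-Solver
      P Q X : ℕ
      P = p ℕ.^ n
      Q = P ℕ.* P
      k z δ : V d → ℕ
      k g = ind (Sub.mem? K g)
      z g = Tri.nulls (slice (φ g))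
      δ g = ind (g ≟ⱽ 𝟘)
      X = ∑ d λ g → k g ℕ.* z g
      R : V n → V n → Sub n
      R y z = zeros ∀? (λ _ → ⊤) (λ _ → yes tt) (λ w x → form x y z w) (λ w x x′ → add x x′ y z w)
      R? : ∀ x y z → ind (Sub.mem? (Tri.radical (slice x) y) z) ≡ ind (Sub.mem? (R y z) x)
      R? x y z = ind-cong (Sub.mem? (Tri.radical (slice x) y) z) (Sub.mem? (R y z) x) id id
      nulls≡ : ∑ n (λ x → Tri.nulls (slice x)) ≡ ∑ n λ y → ∑ n λ z → 1 ℕ.* size (R y z)
      nulls≡ = trans (∑-swap n n λ x y → size (Tri.radical (slice x) y)) (∑-cong n λ y →
        trans (∑-swap n n λ x z → ind (Sub.mem? (Tri.radical (slice x) y) z)) (∑-cong n λ z →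
          trans (∑-cong n λ x → R? x y z) (sym (ℕ.*-identityˡ _))))
      swapped : ∑ n (λ y → ∑ n λ z → 1 ℕ.* # (λ g → Sub.mem? K g ×-dec Sub.mem? (R y z) (φ g))) ≡ X
      swapped = trans (∑-cong n λ y → trans (∑-cong n λ z → trans (ℕ.*-identityˡ _) (∑-cong d λ g →
          trans (ind-× (Sub.mem? K g) (Sub.mem? (R y z) (φ g))) (cong (k g ℕ.*_) (sym (R? (φ g) y z)))))
          (∑-swap n d λ z g → k g ℕ.* ind (Sub.mem? (Tri.radical (slice (φ g)) y) z)))
        (trans (∑-swap n d λ y g → ∑ n λ z → k g ℕ.* ind (Sub.mem? (Tri.radical (slice (φ g)) y) z))
          (∑-cong d λ g → trans (∑-cong n λ y → ∑-*ˡ n (k g) _) (∑-*ˡ n (k g) _)))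
      restricted : size K ℕ.* Q ≤ q ℕ.* X
      restricted = cancelʳ _ _ (pⁿ>0 n) (begin
        size K ℕ.* Q ℕ.* P                               ≡⟨ solve 2 (λ k p → k :* (p :* p) :* p := k :* (p :* (p :* p))) refl (size K) P ⟩
        size K ℕ.* (P ℕ.* Q)                             ≤⟨ ℕ.*-monoʳ-≤ (size K) bias ⟩
        size K ℕ.* (q ℕ.* ∑ n λ x → Tri.nulls (slice x)) ≡⟨ cong (λ m → size K ℕ.* (q ℕ.* m)) nulls≡ ⟩
        size K ℕ.* (q ℕ.* N)                             ≡⟨ solve 3 (λ k q m → k :* (q :* m) := q :* (m :* k)) refl (size K) q N ⟩
        q ℕ.* (N ℕ.* size K)                             ≡⟨ cong (q ℕ.*_) (sym (∑-*ʳ n _ (size K))) ⟩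
        q ℕ.* ∑ n (λ y → ∑ n (λ z → 1 ℕ.* size (R y z)) ℕ.* size K)
          ≤⟨ ℕ.*-monoʳ-≤ q (∑-mono n λ y → restrict-weighted φ addφ K (λ _ → 1) (R y)) ⟩
        q ℕ.* ∑ n (λ y → ∑ n (λ z → 1 ℕ.* # (λ g → Sub.mem? K g ×-dec Sub.mem? (R y z) (φ g))) ℕ.* P)
          ≡⟨ cong (q ℕ.*_) (trans (∑-*ʳ n _ P) (cong (ℕ._* P) swapped)) ⟩
        q ℕ.* (X ℕ.* P)                                  ≡⟨ sym (ℕ.*-assoc q X P) ⟩
        q ℕ.* X ℕ.* P                                    ∎)
        where
        N : ℕ
        N = ∑ n λ y → ∑ n λ z → 1 ℕ.* size (R y z)
      pointwise : ∀ g → 2 ℕ.* q ℕ.* (k g ℕ.* z g) ℕ.+ k g ≤ k g ℕ.* Q ℕ.+ δ g ℕ.* (2 ℕ.* q ℕ.* Q)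
      pointwise g with Sub.mem? K g | g ≟ⱽ 𝟘
      ... | no _  | _ = ℕ.≤-trans (ℕ.≤-reflexive (trans (ℕ.+-identityʳ _) (ℕ.*-zeroʳ (2 ℕ.* q)))) z≤n
      ... | yes _ | yes _ = begin
        2 ℕ.* q ℕ.* (1 ℕ.* z g) ℕ.+ 1         ≤⟨ ℕ.+-mono-≤ (ℕ.*-monoʳ-≤ (2 ℕ.* q) (ℕ.≤-trans (ℕ.≤-reflexive (ℕ.*-identityˡ _)) z≤Q)) 0<Q ⟩
        2 ℕ.* q ℕ.* Q ℕ.+ Q                   ≡⟨ solve 2 (λ q r → con 2 :* q :* r :+ r := con 1 :* r :+ con 1 :* (con 2 :* q :* r)) refl q Q ⟩
        1 ℕ.* Q ℕ.+ 1 ℕ.* (2 ℕ.* q ℕ.* Q)     ∎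
        where
        0<Q : 1 ≤ Q
        0<Q = ℕ.*-mono-≤ (pⁿ>0 n) (pⁿ>0 n)
        z≤Q : z g ≤ Q
        z≤Q = ℕ.≤-trans (∑-mono n λ x → #≤pⁿ (Sub.mem? (Tri.radical (slice (φ g)) x))) (ℕ.≤-reflexive (∑-const n P))
      ... | yes Kg | no g≢0 = begin
        2 ℕ.* q ℕ.* (1 ℕ.* z g) ℕ.+ 1         ≡⟨ cong (λ m → 2 ℕ.* q ℕ.* m ℕ.+ 1) (ℕ.*-identityˡ (z g)) ⟩
        2 ℕ.* q ℕ.* z g ℕ.+ 1                 ≡⟨ ℕ.+-comm _ 1 ⟩
        suc (2 ℕ.* q ℕ.* z g)                 ≤⟨ ℕ.≰⇒> (λ h → ¬found (g , Kg , g≢0 , h)) ⟩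
        Q                                     ≡⟨ sym (trans (ℕ.+-identityʳ _) (ℕ.*-identityˡ Q)) ⟩
        1 ℕ.* Q ℕ.+ 0                         ∎
      summed : 2 ℕ.* q ℕ.* X ℕ.+ size K ≤ 2 ℕ.* q ℕ.* X
      summed = begin
        2 ℕ.* q ℕ.* X ℕ.+ size K              ≡⟨ cong (ℕ._+ size K) (sym (∑-*ˡ d (2 ℕ.* q) _)) ⟩
        ∑ d (λ g → 2 ℕ.* q ℕ.* (k g ℕ.* z g)) ℕ.+ ∑ d k   ≡⟨ sym (∑-distrib d _ _) ⟩
        ∑ d (λ g → 2 ℕ.* q ℕ.* (k g ℕ.* z g) ℕ.+ k g)     ≤⟨ ∑-mono d pointwise ⟩
        ∑ d (λ g → k g ℕ.* Q ℕ.+ δ g ℕ.* (2 ℕ.* q ℕ.* Q)) ≡⟨ ∑-distrib d _ _ ⟩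
        ∑ d (λ g → k g ℕ.* Q) ℕ.+ ∑ d (λ g → δ g ℕ.* (2 ℕ.* q ℕ.* Q))
          ≡⟨ cong₂ ℕ._+_ (∑-*ʳ d k Q) (∑-*ʳ d δ _) ⟩
        size K ℕ.* Q ℕ.+ ∑ d δ ℕ.* (2 ℕ.* q ℕ.* Q)
          ≤⟨ ℕ.+-monoʳ-≤ (size K ℕ.* Q) (ℕ.*-monoˡ-≤ (2 ℕ.* q ℕ.* Q) (#≤1 {d} (_≟ⱽ 𝟘) λ x y hx hy → trans hx (sym hy))) ⟩
        size K ℕ.* Q ℕ.+ 1 ℕ.* (2 ℕ.* q ℕ.* Q)
          ≤⟨ ℕ.+-monoʳ-≤ (size K ℕ.* Q) (ℕ.≤-trans (ℕ.≤-reflexive (ℕ.*-identityˡ _)) (ℕ.*-monoˡ-≤ Q large)) ⟩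
        size K ℕ.* Q ℕ.+ size K ℕ.* Q         ≤⟨ ℕ.+-mono-≤ restricted restricted ⟩
        q ℕ.* X ℕ.+ q ℕ.* X                   ≡⟨ solve 2 (λ q x → q :* x :+ q :* x := con 2 :* q :* x) refl q X ⟩
        2 ℕ.* q ℕ.* X                         ∎

module TrilinearForms (p : ℕ) .{{nz : NonZero p}} (prime : Prime p) where
  open import Data.Vec.Relation.Unary.All as All using (All; []; _∷_)
  open PrimeField p prime
  open Count p prime
  open MultilinearForms p prime

  *ᶠ-cancelʳ : ∀ {a b} c → c ≢ 0ᶠ → a *ᶠ c ≡ b *ᶠ c → a ≡ b
  *ᶠ-cancelʳ {a} {b} c c≢0 e with d , dc≡1 ← inverse c c≢0 = trans (expand a) (trans (cong (_*ᶠ d) e) (sym (expand b)))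
    where
    expand : ∀ x → x ≡ (x *ᶠ c) *ᶠ d
    expand x = sym (trans (*ᶠ-assoc x c d) (trans (cong (x *ᶠ_) (trans (*ᶠ-comm c d) dc≡1)) (*ᶠ-identityʳ x)))

  module _ {n : ℕ} (S : Tri n) where
    open Tri S

    add·₁ : ∀ a x y z → form (a · x) y z ≡ a *ᶠ form x y z
    add·₁ a x y z = functional-· (λ x → form x y z) (λ x x′ → add x x′ y z) a x

    add·₂ : ∀ a x y z → form x (a · y) z ≡ a *ᶠ form x y z
    add·₂ a x y z = functional-· (λ y → form x y z) (λ y y′ → add₂ x y y′ z) a y

    -- A triangular system of vectors: form xᵢ uⱼ · = 0 and form xᵢ · vⱼ = 0
    -- whenever i < j, while form xᵢ uᵢ vᵢ ≠ 0.  The last vectors come first.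
    data Triangular (K : Sub n) : ∀ {t} → Sub n → Vec (V n) t → Vec (V n) t → Vec (V n) t → Set₁ where
      base : Triangular K K [] [] []
      extend  : ∀ {t N x u v} {xs us vs : Vec (V n) t} → Triangular K N xs us vs →
              N ∋ u → N ∋ v → form x u v ≢ 0ᶠ →
              Triangular K (N ⊓ (K ⊓ radical x)) (x ∷ xs) (u ∷ us) (v ∷ vs)

    triangular-⊑ : ∀ {K N t} {xs us vs : Vec (V n) t} → Triangular K N xs us vs → N ⊑ K
    triangular-⊑ base              h       = h
    triangular-⊑ (extend c _ _ _) (h , _) = triangular-⊑ c h

    triangular-null : ∀ {K N t} {xs us vs : Vec (V n) t} → Triangular K N xs us vs →
                      ∀ ε {y} → N ∋ y → ∀ z → form (combination ε xs) y z ≡ 0ᶠ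
    triangular-null base [] {y} _ z = functional-0 (λ x → form x y z) (λ x x′ → add x x′ y z)
    triangular-null (extend {x = x} {xs = xs} c _ _ _) (e ∷ ε) {y} (h , _ , h′) z = begin
      form (e · x ⊕ combination ε xs) y z               ≡⟨ add _ _ y z ⟩
      form (e · x) y z +ᶠ form (combination ε xs) y z   ≡⟨ cong₂ _+ᶠ_ (add·₁ e x y z) (triangular-null c ε h z) ⟩
      e *ᶠ form x y z +ᶠ 0ᶠ                             ≡⟨ cong (λ w → e *ᶠ w +ᶠ 0ᶠ) (h′ z _) ⟩
      e *ᶠ 0ᶠ +ᶠ 0ᶠ                                     ≡⟨ trans (+ᶠ-identityʳ _) (*ᶠ-zeroʳ e) ⟩
      0ᶠ                                                ∎
      where open ≡-Reasoning

    weight : ∀ {t} → Vec (V n) t → Vec (V n) t → Vec (V n) t → V t → ℕ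
    weight []       []       []       []      = 1
    weight (x ∷ xs) (u ∷ us) (v ∷ vs) (a ∷ as) =
      (1 ℕ.+ (p ℕ.∸ 1) ℕ.* ind (form x (combination (a ∷ as) (u ∷ us)) v ≟ᶠ 0ᶠ)) ℕ.* weight xs us vs as

    module _ {t} (xs vs : Vec (V n) t) where
      Solution : V n → (V n → F) → V t → Set
      Solution y τ ε = All (λ v → form (combination ε xs) y v ≡ τ v) vs
      solution? : ∀ y τ ε → Dec (Solution y τ ε)
      solution? y τ ε = All.all? (λ v → form (combination ε xs) y v ≟ᶠ τ v) vs

    roots≤ : ∀ c d → c ≢ 0ᶠ → ∀ τ → sum {p} (λ e → ind (e *ᶠ c +ᶠ d ≟ᶠ τ)) ≤ 1
    roots≤ c d c≢0 τ = sum≤1 _ (λ e → ind≤1 (e *ᶠ c +ᶠ d ≟ᶠ τ)) λ e e′ h h′ →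
      *ᶠ-cancelʳ c c≢0 (+ᶠ-cancelʳ d (trans (ind>0 (e *ᶠ c +ᶠ d ≟ᶠ τ) h) (sym (ind>0 (e′ *ᶠ c +ᶠ d ≟ᶠ τ) h′))))

    1+[p∸1]≡p : 1 ℕ.+ (p ℕ.∸ 1) ≡ p
    1+[p∸1]≡p = ℕ.m+[n∸m]≡n (ℕ.<⇒≤ 1<p)

    solutions≤weight : ∀ {K N t} {xs us vs : Vec (V n) t} → Triangular K N xs us vs →
                       ∀ (a : V t) (τ : V n → F) → # (solution? xs vs (combination a us) τ) ≤ weight xs us vs a
    solutions≤weight base [] τ = ℕ.≤-refl
    solutions≤weight {t = suc t} (extend {x = x} {u} {v} {xs} {us} {vs} tri u∈N v∈N s≢0) (a ∷ as) τ = begin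
      sum {p} (λ e → ∑ t λ ε → ind (solution? (x ∷ xs) (v ∷ vs) Y τ (e ∷ ε)))   ≤⟨ sum-mono {p} (λ e → ∑-mono t λ ε → split e ε) ⟩
      sum {p} (λ e → ∑ t λ ε → r e ℕ.* ind (solution? xs vs Y′ (τ′ e) ε))       ≡⟨ sum-cong-≗ {p} (λ e → ∑-*ˡ t (r e) _) ⟩
      sum {p} (λ e → r e ℕ.* # (solution? xs vs Y′ (τ′ e)))                     ≤⟨ sum-mono {p} (λ e → ℕ.*-monoʳ-≤ (r e) (solutions≤weight tri as (τ′ e))) ⟩
      sum {p} (λ e → r e ℕ.* W)                                                 ≡⟨ trans (sum-cong-≗ {p} λ e → ℕ.*-comm (r e) W) (trans (sum-*ˡ {p} W r) (ℕ.*-comm W _)) ⟩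
      sum {p} r ℕ.* W                                                           ≤⟨ ℕ.*-monoˡ-≤ W r≤ ⟩
      weight (x ∷ xs) (u ∷ us) (v ∷ vs) (a ∷ as)                                ∎
      where
      open ℕ.≤-Reasoning
      Y Y′ : V n
      Y = combination (a ∷ as) (u ∷ us)
      Y′ = combination as us
      W : ℕ
      W = weight xs us vs as
      τ′ : F → V n → F
      τ′ e w = τ w -ᶠ e *ᶠ form x Y w
      r : F → ℕ
      r e = ind (e *ᶠ form x Y v +ᶠ 0ᶠ ≟ᶠ τ v)
      r≤ : sum {p} r ≤ 1 ℕ.+ (p ℕ.∸ 1) ℕ.* ind (form x Y v ≟ᶠ 0ᶠ)
      r≤ with form x Y v ≟ᶠ 0ᶠ
      ... | yes _  = begin
        sum {p} r                  ≤⟨ sum-mono {p} (λ e → ind≤1 (e *ᶠ form x Y v +ᶠ 0ᶠ ≟ᶠ τ v)) ⟩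
        sum {p} (λ _ → 1)          ≡⟨ trans (sum-const p 1) (ℕ.*-identityʳ p) ⟩
        p                          ≡⟨ sym 1+[p∸1]≡p ⟩
        1 ℕ.+ (p ℕ.∸ 1)            ≡⟨ cong suc (sym (ℕ.*-identityʳ (p ℕ.∸ 1))) ⟩
        1 ℕ.+ (p ℕ.∸ 1) ℕ.* 1      ∎
      ... | no c≢0 = ℕ.≤-trans (roots≤ (form x Y v) 0ᶠ c≢0 (τ v)) (ℕ.m≤m+n 1 _)
      form-split : ∀ e ε w → form (combination (e ∷ ε) (x ∷ xs)) Y w ≡ e *ᶠ form x Y w +ᶠ form (combination ε xs) Y w
      form-split e ε w = trans (add _ _ Y w) (cong (_+ᶠ _) (add·₁ e x Y w))
      drop-u : ∀ ε w → form (combination ε xs) Y w ≡ form (combination ε xs) Y′ w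
      drop-u ε w = trans (add₂ X (a · u) Y′ w) (trans (cong (_+ᶠ form X Y′ w) (trans (add·₂ a X u w)
        (trans (cong (a *ᶠ_) (triangular-null tri ε u∈N w)) (*ᶠ-zeroʳ a)))) (+ᶠ-identityˡ _))
        where
        X : V n
        X = combination ε xs
      tail : ∀ e ε {k} (ws : Vec (V n) k) → All (λ w → form (combination (e ∷ ε) (x ∷ xs)) Y w ≡ τ w) ws →
             All (λ w → form (combination ε xs) Y′ w ≡ τ′ e w) ws
      tail e ε [] [] = []
      tail e ε (w ∷ ws) (h ∷ hs) = sym (-ᶠ-unique (trans (sym h) (trans (form-split e ε w)
        (trans (+ᶠ-comm (e *ᶠ form x Y w) _) (cong (_+ᶠ e *ᶠ form x Y w) (drop-u ε w)))))) ∷ tail e ε ws hs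
      split : ∀ e ε → ind (solution? (x ∷ xs) (v ∷ vs) Y τ (e ∷ ε)) ≤ r e ℕ.* ind (solution? xs vs Y′ (τ′ e) ε)
      split e ε = ℕ.≤-trans
        (ind-mono (solution? (x ∷ xs) (v ∷ vs) Y τ (e ∷ ε)) ((e *ᶠ form x Y v +ᶠ 0ᶠ ≟ᶠ τ v) ×-dec solution? xs vs Y′ (τ′ e) ε)
          λ { (h ∷ hs) → trans (cong (e *ᶠ form x Y v +ᶠ_) (sym (trans (sym₂₃ _ Y v) (triangular-null tri ε v∈N Y)))) (trans (sym (form-split e ε v)) h)
                       , tail e ε vs hs })
        (ℕ.≤-reflexive (ind-× (e *ᶠ form x Y v +ᶠ 0ᶠ ≟ᶠ τ v) (solution? xs vs Y′ (τ′ e) ε)))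

    weight-sum : ∀ {K N t} {xs us vs : Vec (V n) t} → Triangular K N xs us vs →
                 ∑ t (weight xs us vs) ≤ (p ℕ.+ (p ℕ.∸ 1)) ℕ.^ t
    weight-sum base = ℕ.≤-refl
    weight-sum {t = suc t} (extend {x = x} {u} {v} {xs} {us} {vs} tri _ _ s≢0) = begin
      sum {p} (λ a → ∑ t λ as → w a as ℕ.* weight xs us vs as)   ≡⟨ sum-∑-swap t (λ a as → w a as ℕ.* weight xs us vs as) ⟩
      ∑ t (λ as → sum {p} λ a → w a as ℕ.* weight xs us vs as)   ≡⟨ ∑-cong t (λ as → trans (sum-cong-≗ {p} λ a → ℕ.*-comm (w a as) _) (trans (sum-*ˡ {p} (weight xs us vs as) λ a → w a as) (ℕ.*-comm (weight xs us vs as) _))) ⟩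
      ∑ t (λ as → sum {p} (λ a → w a as) ℕ.* weight xs us vs as) ≤⟨ ∑-mono t (λ as → ℕ.*-monoˡ-≤ (weight xs us vs as) (w≤ as)) ⟩
      ∑ t (λ as → B ℕ.* weight xs us vs as)                      ≡⟨ ∑-*ˡ t B (weight xs us vs) ⟩
      B ℕ.* ∑ t (weight xs us vs)                                ≤⟨ ℕ.*-monoʳ-≤ B (weight-sum tri) ⟩
      B ℕ.* B ℕ.^ t                                              ∎
      where
      open ℕ.≤-Reasoning
      B : ℕ
      B = p ℕ.+ (p ℕ.∸ 1)
      w : F → V t → ℕ
      w a as = 1 ℕ.+ (p ℕ.∸ 1) ℕ.* ind (form x (combination (a ∷ as) (u ∷ us)) v ≟ᶠ 0ᶠ)
      w≤ : ∀ as → sum {p} (λ a → w a as) ≤ B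
      w≤ as = begin
        sum {p} (λ a → w a as)                    ≡⟨ +-split ⟩
        p ℕ.+ (p ℕ.∸ 1) ℕ.* sum {p} (λ a → i a)   ≤⟨ ℕ.+-monoʳ-≤ p (ℕ.*-monoʳ-≤ (p ℕ.∸ 1) (ℕ.≤-trans (sum-mono {p} λ a → ind-mono (form x (combination (a ∷ as) (u ∷ us)) v ≟ᶠ 0ᶠ) (a *ᶠ form x u v +ᶠ form x Y′ v ≟ᶠ 0ᶠ) (trans (sym (linear a)))) (roots≤ (form x u v) _ s≢0 0ᶠ))) ⟩
        p ℕ.+ (p ℕ.∸ 1) ℕ.* 1                     ≡⟨ cong (p ℕ.+_) (ℕ.*-identityʳ _) ⟩
        B                                         ∎
        where
        Y′ : V n
        Y′ = combination as us
        i : F → ℕ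
        i a = ind (form x (combination (a ∷ as) (u ∷ us)) v ≟ᶠ 0ᶠ)
        linear : ∀ a → form x (combination (a ∷ as) (u ∷ us)) v ≡ a *ᶠ form x u v +ᶠ form x Y′ v
        linear a = trans (add₂ x _ _ v) (cong (_+ᶠ form x Y′ v) (add·₂ a x u v))
        +-split : sum {p} (λ a → 1 ℕ.+ (p ℕ.∸ 1) ℕ.* i a) ≡ p ℕ.+ (p ℕ.∸ 1) ℕ.* sum {p} i
        +-split = trans (∑-distrib 1 (λ { (a ∷ []) → 1 }) (λ { (a ∷ []) → (p ℕ.∸ 1) ℕ.* i a }))
          (cong₂ ℕ._+_ (trans (sum-const p 1) (ℕ.*-identityʳ p)) (sum-*ˡ {p} (p ℕ.∸ 1) i))

    -- p² / (2p - 1) ≥ 4/3, so by Bernoulli's inequality the lower bound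
    -- p²ᵗ ≤ q (2p - 1)ᵗ on the number of solutions bounds t.
    triangular-length : ∀ {q K N t} {xs us vs : Vec (V n) t} → Biased q → Triangular K N xs us vs → 3 ℕ.+ t ≤ 3 ℕ.* q
    triangular-length {q} {t = t} {xs} {us} {vs} bias tri = cancelʳ _ _ (ℕ.m^n>0 3 t) (cancelʳ _ _ 0<Bᵗ (begin
      (3 ℕ.+ t) ℕ.* 3 ℕ.^ t ℕ.* B ℕ.^ t               ≤⟨ ℕ.*-monoˡ-≤ (B ℕ.^ t) (bernoulli t) ⟩
      3 ℕ.* 4 ℕ.^ t ℕ.* B ℕ.^ t                       ≡⟨ trans (ℕ.*-assoc 3 (4 ℕ.^ t) (B ℕ.^ t)) (cong (3 ℕ.*_) (sym (^-distribʳ-* 4 B t))) ⟩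
      3 ℕ.* (4 ℕ.* B) ℕ.^ t                           ≤⟨ ℕ.*-monoʳ-≤ 3 (ℕ.^-monoˡ-≤ t 4B≤3pp) ⟩
      3 ℕ.* (3 ℕ.* (p ℕ.* p)) ℕ.^ t                   ≡⟨ cong (3 ℕ.*_) (trans (^-distribʳ-* 3 (p ℕ.* p) t) (cong (3 ℕ.^ t ℕ.*_) (^-distribʳ-* p p t))) ⟩
      3 ℕ.* (3 ℕ.^ t ℕ.* (p ℕ.^ t ℕ.* p ℕ.^ t))       ≤⟨ ℕ.*-monoʳ-≤ 3 (ℕ.*-monoʳ-≤ (3 ℕ.^ t) counted) ⟩
      3 ℕ.* (3 ℕ.^ t ℕ.* (q ℕ.* B ℕ.^ t))             ≡⟨ solve 3 (λ a q b → con 3 :* (a :* (q :* b)) := con 3 :* q :* a :* b) refl (3 ℕ.^ t) q (B ℕ.^ t) ⟩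
      3 ℕ.* q ℕ.* 3 ℕ.^ t ℕ.* B ℕ.^ t                 ∎))
      where
      open ℕ.≤-Reasoning
      open +-*-Solver
      B : ℕ
      B = p ℕ.+ (p ℕ.∸ 1)
      ^-distribʳ-* : ∀ a b k → (a ℕ.* b) ℕ.^ k ≡ a ℕ.^ k ℕ.* b ℕ.^ k
      ^-distribʳ-* a b zero    = refl
      ^-distribʳ-* a b (suc k) = trans (cong (a ℕ.* b ℕ.*_) (^-distribʳ-* a b k))
        (solve 4 (λ a b c d → a :* b :* (c :* d) := a :* c :* (b :* d)) refl a b (a ℕ.^ k) (b ℕ.^ k))
      0<Bᵗ : 1 ≤ B ℕ.^ t
      0<Bᵗ = ℕ.≤-trans (pⁿ>0 t) (ℕ.^-monoˡ-≤ t (ℕ.m≤m+n p _))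
      bernoulli : ∀ k → (3 ℕ.+ k) ℕ.* 3 ℕ.^ k ≤ 3 ℕ.* 4 ℕ.^ k
      bernoulli zero    = ℕ.≤-refl
      bernoulli (suc k) = begin
        (4 ℕ.+ k) ℕ.* (3 ℕ.* 3 ℕ.^ k)                           ≤⟨ ℕ.m≤m+n _ (k ℕ.* 3 ℕ.^ k) ⟩
        (4 ℕ.+ k) ℕ.* (3 ℕ.* 3 ℕ.^ k) ℕ.+ k ℕ.* 3 ℕ.^ k         ≡⟨ solve 2 (λ k x → (con 4 :+ k) :* (con 3 :* x) :+ k :* x := con 4 :* ((con 3 :+ k) :* x)) refl k (3 ℕ.^ k) ⟩
        4 ℕ.* ((3 ℕ.+ k) ℕ.* 3 ℕ.^ k)                           ≤⟨ ℕ.*-monoʳ-≤ 4 (bernoulli k) ⟩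
        4 ℕ.* (3 ℕ.* 4 ℕ.^ k)                                   ≡⟨ solve 1 (λ x → con 4 :* (con 3 :* x) := con 3 :* (con 4 :* x)) refl (4 ℕ.^ k) ⟩
        3 ℕ.* 4 ℕ.^ suc k                                       ∎
      4B≤3pp : 4 ℕ.* B ≤ 3 ℕ.* (p ℕ.* p)
      4B≤3pp = subst (λ r → 4 ℕ.* (r ℕ.+ (r ℕ.∸ 1)) ≤ 3 ℕ.* (r ℕ.* r)) (ℕ.m+[n∸m]≡n 1<p)
        (ℕ.≤-trans (ℕ.m≤m+n _ (3 ℕ.* (s ℕ.* s) ℕ.+ 4 ℕ.* s)) (ℕ.≤-reflexive
          (solve 1 (λ s → con 4 :* ((con 2 :+ s) :+ (con 1 :+ s)) :+ (con 3 :* (s :* s) :+ con 4 :* s) := con 3 :* ((con 2 :+ s) :* (con 2 :+ s))) refl s)))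
        where
        s : ℕ
        s = p ℕ.∸ 2
      counted : p ℕ.^ t ℕ.* p ℕ.^ t ≤ q ℕ.* B ℕ.^ t
      counted = begin
        p ℕ.^ t ℕ.* p ℕ.^ t       ≡⟨ sym (cong₂ ℕ._*_ (size-full {t}) (size-full {t})) ⟩
        size (full {t}) ℕ.* size (full {t})   ≤⟨ restrict-tri S {q} bias (λ a → combination a us) (combination-additive us) full (λ ε → combination ε xs) (combination-additive xs) full ⟩
        q ℕ.* ∑ t (λ a → 1 ℕ.* # (λ ε → Sub.mem? (full {t}) ε ×-dec Sub.mem? (radical (combination a us)) (combination ε xs)))
          ≤⟨ ℕ.*-monoʳ-≤ q (∑-mono t λ a → ℕ.≤-trans (ℕ.≤-reflexive (ℕ.*-identityˡ _)) (ℕ.≤-trans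
               (#-mono (λ ε → Sub.mem? (full {t}) ε ×-dec Sub.mem? (radical (combination a us)) (combination ε xs))
                       (solution? xs vs (combination a us) (λ _ → 0ᶠ))
                       λ ε (_ , h) → All.universal (λ v → trans (sym₁₂ _ _ v) (h v _)) vs)
               (solutions≤weight tri a (λ _ → 0ᶠ)))) ⟩
        q ℕ.* ∑ t (weight xs us vs)   ≤⟨ ℕ.*-monoʳ-≤ q (weight-sum tri) ⟩
        q ℕ.* B ℕ.^ t                 ∎

    -- Markov's inequality turns the bias into a dense set of slices of
    -- small rank.
    dense : ∀ {q} → Biased q → ∀ {d} (φ : V d → V n) → Additive φ → (K : Sub d) (L : Sub n) →
      size K ≤ 2 ℕ.* q ℕ.* # (λ a → Sub.mem? K a ×-dec (size L ℕ.≤? 2 ℕ.* q ℕ.* size (L ⊓ radical (φ a))))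
    dense {q} bias {d} φ addφ K L = cancelʳ _ _ (Sub.size>0 L) (ℕ.+-cancelʳ-≤ (size K ℕ.* size L) _ _ (begin
      size K ℕ.* size L ℕ.+ size K ℕ.* size L            ≤⟨ ℕ.+-mono-≤ restricted restricted ⟩
      q ℕ.* X ℕ.+ q ℕ.* X                                ≡⟨ solve 2 (λ q x → q :* x :+ q :* x := con 2 :* q :* x) refl q X ⟩
      2 ℕ.* q ℕ.* X                                      ≡⟨ sym (∑-*ˡ d (2 ℕ.* q) _) ⟩
      ∑ d (λ a → 2 ℕ.* q ℕ.* (ind (Sub.mem? K a) ℕ.* r a))   ≤⟨ ∑-mono d (λ a → markov (Sub.mem? K a) (size L) (r a) (size L ℕ.≤? _)
                                                                     (#-mono (Sub.mem? (L ⊓ radical (φ a))) (Sub.mem? L) λ _ → proj₁)) ⟩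
      ∑ d (λ a → ind (B? a) ℕ.* (2 ℕ.* q ℕ.* size L) ℕ.+ ind (Sub.mem? K a) ℕ.* size L)   ≡⟨ ∑-distrib d _ _ ⟩
      ∑ d (λ a → ind (B? a) ℕ.* (2 ℕ.* q ℕ.* size L)) ℕ.+ ∑ d (λ a → ind (Sub.mem? K a) ℕ.* size L)   ≡⟨ cong₂ ℕ._+_ (∑-*ʳ d _ _) (∑-*ʳ d _ (size L)) ⟩
      # B? ℕ.* (2 ℕ.* q ℕ.* size L) ℕ.+ size K ℕ.* size L ≡⟨ cong (ℕ._+ size K ℕ.* size L) (solve 3 (λ b q k → b :* (con 2 :* q :* k) := con 2 :* q :* b :* k) refl (# B?) q (size L)) ⟩
      2 ℕ.* q ℕ.* # B? ℕ.* size L ℕ.+ size K ℕ.* size L  ∎))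
      where
      open ℕ.≤-Reasoning
      open +-*-Solver
      r : V d → ℕ
      r a = size (L ⊓ radical (φ a))
      B? : ∀ a → Dec (Sub.mem K a × size L ≤ 2 ℕ.* q ℕ.* r a)
      B? a = Sub.mem? K a ×-dec (size L ℕ.≤? 2 ℕ.* q ℕ.* r a)
      X : ℕ
      X = ∑ d λ a → ind (Sub.mem? K a) ℕ.* r a
      restricted : size K ℕ.* size L ≤ q ℕ.* X
      restricted = restrict-tri S {q} bias φ addφ K id (λ _ _ → refl) L
      markov : {P : Set} (P? : Dec P) (s c : ℕ) (B? : Dec (s ≤ 2 ℕ.* q ℕ.* c)) → c ≤ s →
        2 ℕ.* q ℕ.* (ind P? ℕ.* c) ≤ ind (P? ×-dec B?) ℕ.* (2 ℕ.* q ℕ.* s) ℕ.+ ind P? ℕ.* s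
      markov (no _)  s c _       _   = ℕ.≤-trans (ℕ.≤-reflexive (ℕ.*-zeroʳ (2 ℕ.* q))) z≤n
      markov (yes _) s c (yes _) c≤s = begin
        2 ℕ.* q ℕ.* (1 ℕ.* c)                 ≤⟨ ℕ.*-monoʳ-≤ (2 ℕ.* q) (ℕ.≤-trans (ℕ.≤-reflexive (ℕ.*-identityˡ c)) c≤s) ⟩
        2 ℕ.* q ℕ.* s                         ≡⟨ sym (ℕ.*-identityˡ _) ⟩
        1 ℕ.* (2 ℕ.* q ℕ.* s)                 ≤⟨ ℕ.m≤m+n _ _ ⟩
        1 ℕ.* (2 ℕ.* q ℕ.* s) ℕ.+ 1 ℕ.* s     ∎
      markov (yes _) s c (no h)  _   = ℕ.≤-trans (ℕ.≤-reflexive (cong (2 ℕ.* q ℕ.*_) (ℕ.*-identityˡ c)))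
        (ℕ.≤-trans (ℕ.<⇒≤ (ℕ.≰⇒> h)) (ℕ.≤-reflexive (sym (ℕ.*-identityˡ s))))

    vanishing : ∀ {q} → Biased q → (K : Sub n) →
      Σ (Sub n) λ K′ → K′ ⊑ K × (∀ {x y z} → K′ ∋ x → K′ ∋ y → K′ ∋ z → form x y z ≡ 0ᶠ) ×
                       size K ≤ (2 ℕ.* q) ℕ.^ (3 ℕ.* q ℕ.+ 1) ℕ.* size K′
    vanishing {q} bias K = loop (3 ℕ.* q) base refl
      where
      open ℕ.≤-Reasoning
      open +-*-Solver
      B : V n → Set
      B x = size K ≤ 2 ℕ.* q ℕ.* size (K ⊓ radical x)
      B? : ∀ x → Dec (K ∋ x × B x)
      B? x = Sub.mem? K x ×-dec (size K ℕ.≤? 2 ℕ.* q ℕ.* size (K ⊓ radical x))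
      B-dense : size K ≤ 2 ℕ.* q ℕ.* # B?
      B-dense = dense {q} bias id (λ _ _ → refl) K K
      Result : Sub n → ℕ → Set₁
      Result N k = Σ (Sub n) λ K′ → K′ ⊑ K × (∀ {x y z} → K′ ∋ x → K′ ∋ y → K′ ∋ z → form x y z ≡ 0ᶠ) ×
                   size N ≤ (2 ℕ.* q) ℕ.^ (k ℕ.+ 1) ℕ.* size K′
      loop : ∀ k {t N} {xs us vs : Vec (V n) t} → Triangular K N xs us vs → t ℕ.+ k ≡ 3 ℕ.* q → Result N k
      loop zero {t} tri e = contradiction (triangular-length {q} bias tri)
        (ℕ.<⇒≱ (ℕ.≤-trans (s≤s (ℕ.≤-reflexive (trans (sym e) (ℕ.+-identityʳ t)))) (ℕ.m≤n+m (suc t) 2)))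
      loop (suc k) {t} {N} tri e with ∃? (λ x → B? x ×-dec ∃? (λ u → ∃? λ v → Sub.mem? N u ×-dec (Sub.mem? N v ×-dec ¬? (form x u v ≟ᶠ 0ᶠ))))
      ... | yes (x , (Kx , Bx) , u , v , Nu , Nv , s≢0) =
        let (K′ , K′⊑K , null , bound) = loop k (extend tri Nu Nv s≢0) (trans (sym (ℕ.+-suc t k)) e)
        in K′ , K′⊑K , null , (begin
          size N                                           ≤⟨ shrink (size N) (size (N ⊓ (K ⊓ radical x))) (size (K ⊓ radical x)) Bx
                                                                (⊓-size N (K ⊓ radical x) K (triangular-⊑ tri) proj₁) ⟩
          2 ℕ.* q ℕ.* size (N ⊓ (K ⊓ radical x))           ≤⟨ ℕ.*-monoʳ-≤ (2 ℕ.* q) bound ⟩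
          2 ℕ.* q ℕ.* ((2 ℕ.* q) ℕ.^ (k ℕ.+ 1) ℕ.* size K′) ≡⟨ sym (ℕ.*-assoc (2 ℕ.* q) _ _) ⟩
          (2 ℕ.* q) ℕ.^ (suc k ℕ.+ 1) ℕ.* size K′          ∎)
        where
        shrink : ∀ a b c → size K ≤ 2 ℕ.* q ℕ.* c → c ℕ.* a ≤ b ℕ.* size K → a ≤ 2 ℕ.* q ℕ.* b
        shrink a b c h₁ h₂ = cancelʳ _ _ (Sub.size>0 K) (begin
          a ℕ.* size K              ≤⟨ ℕ.*-monoʳ-≤ a h₁ ⟩
          a ℕ.* (2 ℕ.* q ℕ.* c)     ≡⟨ solve 3 (λ a q c → a :* (con 2 :* q :* c) := con 2 :* q :* (c :* a)) refl a q c ⟩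
          2 ℕ.* q ℕ.* (c ℕ.* a)     ≤⟨ ℕ.*-monoʳ-≤ (2 ℕ.* q) h₂ ⟩
          2 ℕ.* q ℕ.* (b ℕ.* size K) ≡⟨ sym (ℕ.*-assoc (2 ℕ.* q) b _) ⟩
          2 ℕ.* q ℕ.* b ℕ.* size K  ∎)
      ... | no ¬found = N ⊓ U , (λ (h , _) → triangular-⊑ tri h) , (λ { {x} {y} {z} (_ , _ , hx) (hy , _) (hz , _) → hx (y , z) (hy , hz) }) , (begin
          size N                                      ≤⟨ cancelʳ _ _ (Sub.size>0 K) (begin
            size N ℕ.* size K                           ≤⟨ ℕ.*-monoʳ-≤ (size N) (ℕ.≤-trans B-dense (ℕ.*-monoʳ-≤ (2 ℕ.* q) (#-mono B? (Sub.mem? U) λ x (Kx , Bx) → Kx , λ (y , z) (hy , hz) →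
                                                             decidable-stable (form x y z ≟ᶠ 0ᶠ) λ s≢0 → ¬found (x , (Kx , Bx) , y , z , hy , hz , s≢0)))) ⟩
            size N ℕ.* (2 ℕ.* q ℕ.* size U)             ≡⟨ solve 3 (λ a q c → a :* (con 2 :* q :* c) := con 2 :* q :* (c :* a)) refl (size N) q (size U) ⟩
            2 ℕ.* q ℕ.* (size U ℕ.* size N)             ≤⟨ ℕ.*-monoʳ-≤ (2 ℕ.* q) (⊓-size N U K (triangular-⊑ tri) proj₁) ⟩
            2 ℕ.* q ℕ.* (size (N ⊓ U) ℕ.* size K)       ≡⟨ sym (ℕ.*-assoc (2 ℕ.* q) _ _) ⟩
            2 ℕ.* q ℕ.* size (N ⊓ U) ℕ.* size K         ∎) ⟩
          2 ℕ.* q ℕ.* size (N ⊓ U)                    ≡⟨ cong (ℕ._* size (N ⊓ U)) (sym (ℕ.*-identityʳ (2 ℕ.* q))) ⟩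
          (2 ℕ.* q) ℕ.^ 1 ℕ.* size (N ⊓ U)            ≤⟨ ℕ.*-monoˡ-≤ (size (N ⊓ U)) (ℕ.^-monoʳ-≤ (2 ℕ.* q) {{ℕ.>-nonZero 0<2q}} (ℕ.m≤n+m 1 (suc k))) ⟩
          (2 ℕ.* q) ℕ.^ (suc k ℕ.+ 1) ℕ.* size (N ⊓ U) ∎)
        where
        U : Sub n
        U = K ⊓ zeros (λ P? → map′ (λ h (y , z) → h y z) (λ h y z → h (y , z)) (∀? λ y → ∀? λ z → P? (y , z)))
                      (λ (y , z) → N ∋ y × N ∋ z) (λ (y , z) → Sub.mem? N y ×-dec Sub.mem? N z)
                      (λ (y , z) x → form x y z) (λ (y , z) x x′ → add x x′ y z)
        0<2q : 1 ≤ 2 ℕ.* q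
        0<2q = ℕ.n≢0⇒n>0 λ e₀ → contradiction (ℕ.≤-trans (Sub.size>0 K) B-dense) (ℕ.<⇒≱ (s≤s (ℕ.≤-reflexive (cong (ℕ._* # B?) e₀))))

module IsotropicSubspaces (p : ℕ) .{{nz : NonZero p}} (prime : Prime p) where
  open PrimeField p prime
  open Count p prime
  open MultilinearForms p prime
  open TrilinearForms p prime

  nonzero-coordinate : ∀ {n} {x : V n} → x ≢ 𝟘 → ∃[ i ] lookup x i ≢ 0ᶠ
  nonzero-coordinate {x = []}     h = contradiction refl h
  nonzero-coordinate {x = a ∷ x} h with a ≟ᶠ 0ᶠ
  ... | no a≢0 = Fin.zero , a≢0
  ... | yes refl with i , e ← nonzero-coordinate {x = x} (λ x≡0 → h (cong (0ᶠ ∷_) x≡0)) = Fin.suc i , e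

  kernel : ∀ {n} (ℓ : V n → F) → Functional ℓ → Sub n
  kernel ℓ add = zeros (λ P? → map′ (λ h _ → h) (λ h → h tt) (P? tt)) (λ _ → ⊤) (λ _ → yes tt) (λ _ → ℓ) (λ _ → add)
    where open import Relation.Nullary.Decidable using (map′)

  kernel-index : ∀ {n} (K : Sub n) (ℓ : V n → F) (add : Functional ℓ) → size K ≤ p ℕ.* size (K ⊓ kernel ℓ add)
  kernel-index {n} K ℓ add = begin
    size K                                      ≡⟨ sym (ℕ.*-identityˡ _) ⟩
    1 ℕ.* size K                                ≤⟨ ℕ.*-monoˡ-≤ (size K) (Sub.size>0 0-sub) ⟩
    size 0-sub ℕ.* size K                       ≤⟨ restrict (λ x → ℓ x ∷ []) (λ x y → cong (_∷ []) (add x y)) K 0-sub full (λ _ → tt) (λ _ → tt) ⟩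
    # (λ x → Sub.mem? K x ×-dec Sub.mem? 0-sub (ℓ x ∷ [])) ℕ.* size (full {1})
      ≤⟨ ℕ.*-monoˡ-≤ (size (full {1})) (#-mono (λ x → Sub.mem? K x ×-dec Sub.mem? 0-sub (ℓ x ∷ [])) (Sub.mem? (K ⊓ kernel ℓ add)) λ x (k , e) → k , λ _ _ → cong Vec.head e) ⟩
    size (K ⊓ kernel ℓ add) ℕ.* size (full {1}) ≡⟨ cong (size (K ⊓ kernel ℓ add) ℕ.*_) (trans (size-full {1}) (ℕ.*-identityʳ p)) ⟩
    size (K ⊓ kernel ℓ add) ℕ.* p               ≡⟨ ℕ.*-comm _ p ⟩
    p ℕ.* size (K ⊓ kernel ℓ add)               ∎
    where
    open ℕ.≤-Reasoning
    0-sub : Sub 1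
    0-sub = record { mem = _≡ 𝟘 ; mem? = _≟ⱽ 𝟘 ; mem0 = refl
                   ; mem⊕ = λ h h′ → trans (cong₂ _⊕_ h h′) (⊕-identityˡ 𝟘) ; mem⊖ = λ h h′ → trans (cong₂ _⊖_ h h′) (⊕-inverseʳ 𝟘) }

  ⊓-index : ∀ {n a b} (L R R′ : Sub n) → size L ≤ a ℕ.* size (L ⊓ R) → size L ≤ b ℕ.* size (L ⊓ R′) →
            size L ≤ a ℕ.* b ℕ.* size ((L ⊓ R) ⊓ (L ⊓ R′))
  ⊓-index {a = a} {b} L R R′ h h′ = cancelʳ _ _ (Sub.size>0 L) (begin
    size L ℕ.* size L                                    ≤⟨ ℕ.*-mono-≤ h h′ ⟩
    a ℕ.* size (L ⊓ R) ℕ.* (b ℕ.* size (L ⊓ R′))         ≡⟨ solve 4 (λ a x b y → a :* x :* (b :* y) := a :* b :* (y :* x)) refl a (size (L ⊓ R)) b (size (L ⊓ R′)) ⟩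
    a ℕ.* b ℕ.* (size (L ⊓ R′) ℕ.* size (L ⊓ R))         ≤⟨ ℕ.*-monoʳ-≤ (a ℕ.* b) (⊓-size (L ⊓ R) (L ⊓ R′) L proj₁ proj₁) ⟩
    a ℕ.* b ℕ.* (size ((L ⊓ R) ⊓ (L ⊓ R′)) ℕ.* size L)   ≡⟨ sym (ℕ.*-assoc (a ℕ.* b) _ _) ⟩
    a ℕ.* b ℕ.* size ((L ⊓ R) ⊓ (L ⊓ R′)) ℕ.* size L     ∎)
    where
    open ℕ.≤-Reasoning
    open +-*-Solver

  data Chain {ℓ : Level} {n : ℕ} {A : Set} (R : Sub n → A → Sub n → Set ℓ) : ∀ {k} → Sub n → Vec A k → Sub n → Set (lsuc 0ℓ ⊔ ℓ) where
    []  : ∀ {K} → Chain R K [] K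
    _∷_ : ∀ {k K K′ N a} {as : Vec A k} → R K a K′ → Chain R K′ as N → Chain R K (a ∷ as) N

  iterate : ∀ {ℓ : Level} {n A} {R : Sub n → A → Sub n → Set ℓ} {L I} →
    (∀ K → L ≤ size K → Σ A λ a → Σ (Sub n) λ K′ → R K a K′ × size K ≤ I ℕ.* size K′) → 1 ≤ I →
    ∀ k K → L ℕ.* I ℕ.^ k ≤ size K → Σ (Vec A k) λ as → Σ (Sub n) λ N → Chain R K as N × size K ≤ I ℕ.^ k ℕ.* size N
  iterate step 1≤I zero K h = [] , K , [] , ℕ.≤-reflexive (sym (ℕ.*-identityˡ _))
  iterate {L = L} {I} step 1≤I (suc k) K h =
    let (a , K′ , r , b) = step K (ℕ.≤-trans (ℕ.≤-trans (ℕ.≤-reflexive (sym (ℕ.*-identityʳ L))) (ℕ.*-monoʳ-≤ L (ℕ.m^n>0 I {{ℕ.>-nonZero 1≤I}} (suc k)))) h)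
        (as , N , c , b′) = iterate step 1≤I k K′ (cancelˡ (begin
          I ℕ.* (L ℕ.* I ℕ.^ k)   ≡⟨ solve 3 (λ i l x → i :* (l :* x) := l :* (i :* x)) refl I L (I ℕ.^ k) ⟩
          L ℕ.* I ℕ.^ suc k       ≤⟨ h ⟩
          size K                  ≤⟨ b ⟩
          I ℕ.* size K′           ∎))
    in a ∷ as , N , r ∷ c , ℕ.≤-trans b (ℕ.≤-trans (ℕ.*-monoʳ-≤ I b′) (ℕ.≤-reflexive (sym (ℕ.*-assoc I _ _))))
    where
    open ℕ.≤-Reasoning
    open +-*-Solver
    cancelˡ : ∀ {a b} → I ℕ.* a ≤ I ℕ.* b → a ≤ b
    cancelˡ {a} {b} h = cancelʳ a b 1≤I (subst₂ _≤_ (ℕ.*-comm I a) (ℕ.*-comm I b) h)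

  record Nested {n : ℕ} (K : Sub n) (x : V n) (K′ : Sub n) : Set where
    field
      member  : K ∋ x
      smaller : K′ ⊑ K
      pivot   : Fin n
      pivot≢0 : lookup x pivot ≢ 0ᶠ
      pivot≡0 : ∀ {y} → K′ ∋ y → lookup y pivot ≡ 0ᶠ

  Flag : ∀ {n} → (V n → Sub n → Set) → ∀ {k} → Sub n → Vec (V n) k → Sub n → Set₁
  Flag E = Chain (λ K x K′ → Nested K x K′ × E x K′)

  module _ {n : ℕ} {E : V n → Sub n → Set} where

    flag-⊑ : ∀ {k K N} {xs : Vec (V n) k} → Flag E K xs N → N ⊑ K
    flag-⊑ []            h = h
    flag-⊑ ((r , _) ∷ f) h = Nested.smaller r (flag-⊑ f h)

    flag-span : ∀ {k K N} {xs : Vec (V n) k} → Flag E K xs N → ∀ c → K ∋ combination c xs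
    flag-span {K = K} []            []      = Sub.mem0 K
    flag-span {K = K} ((r , _) ∷ f) (a ∷ c) = Sub.mem⊕ K (Sub.mem· K a (Nested.member r)) (Nested.smaller r (flag-span f c))

    pivot-coefficient : ∀ {k K K′ N x} {xs : Vec (V n) k} (r : Nested K x K′) → Flag E K′ xs N → ∀ a c →
      lookup (combination (a ∷ c) (x ∷ xs)) (Nested.pivot r) ≡ a *ᶠ lookup x (Nested.pivot r)
    pivot-coefficient {x = x} {xs} r f a c = begin
      lookup (a · x ⊕ combination c xs) π            ≡⟨ lookup-⊕ π (a · x) _ ⟩
      lookup (a · x) π +ᶠ lookup (combination c xs) π ≡⟨ cong₂ _+ᶠ_ (lookup-· π a x) (pivot≡0 (flag-span f c)) ⟩
      a *ᶠ lookup x π +ᶠ 0ᶠ                          ≡⟨ +ᶠ-identityʳ _ ⟩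
      a *ᶠ lookup x π                                ∎
      where
      open ≡-Reasoning
      open Nested r renaming (pivot to π)

    flag-pivot : ∀ {k K N} {xs : Vec (V n) k} → Flag E K xs N → ∀ c → c ≢ 𝟘 →
      ∃[ π ] lookup (combination c xs) π ≢ 0ᶠ × (∀ {y} → N ∋ y → lookup y π ≡ 0ᶠ)
    flag-pivot []            []      c≢0 = contradiction refl c≢0
    flag-pivot ((r , _) ∷ f) (a ∷ c) c≢0 with a ≟ᶠ 0ᶠ
    ... | no a≢0 = Nested.pivot r , subst (_≢ 0ᶠ) (sym (pivot-coefficient r f a c)) (*ᶠ-nonzero a≢0 (Nested.pivot≢0 r))
                 , λ h → Nested.pivot≡0 r (flag-⊑ f h)
    flag-pivot {xs = x ∷ xs} ((r , _) ∷ f) (a ∷ c) c≢0 | yes refl =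
      let (π , h , h′) = flag-pivot f c (λ e → c≢0 (cong (0ᶠ ∷_) e))
      in π , subst (λ y → lookup y π ≢ 0ᶠ) (sym (trans (cong (_⊕ combination c xs) (·-zeroˡ x)) (⊕-identityˡ _))) h , h′

    flag-nested : ∀ {k K N} {xs : Vec (V n) k} → Flag E K xs N → ∀ c → c ≢ 𝟘 → ∀ {N′} → N′ ⊑ N → Nested K (combination c xs) N′
    flag-nested f c c≢0 N′⊑N = let (π , h , h′) = flag-pivot f c c≢0 in record
      { member = flag-span f c ; smaller = λ h → flag-⊑ f (N′⊑N h) ; pivot = π ; pivot≢0 = h ; pivot≡0 = λ y → h′ (N′⊑N y) }

    coordinates : ∀ {k K N} {xs : Vec (V n) k} → Flag E K xs N →
      Σ (V n → V k) λ κ → Additive κ × (∀ a → κ (combination a xs) ≡ a)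
    coordinates [] = (λ _ → []) , (λ _ _ → refl) , λ { [] → refl }
    coordinates {k = suc k} {xs = x ∷ xs} ((r , _) ∷ f) = κ , κ-additive , κ-inverse
      where
      open ≡-Reasoning
      open Nested r renaming (pivot to π)
      κ′ : V n → V k
      κ′ = proj₁ (coordinates f)
      d : F
      d = proj₁ (inverse (lookup x π) pivot≢0)
      h : V n → F
      h y = lookup y π *ᶠ d
      κ : V n → V (suc k)
      κ y = h y ∷ κ′ (y ⊖ h y · x)
      h-add : ∀ y z → h (y ⊕ z) ≡ h y +ᶠ h z
      h-add y z = trans (cong (_*ᶠ d) (lookup-⊕ π y z)) (*ᶠ-distribʳ d (lookup y π) _)
      κ-additive : Additive κ
      κ-additive y z = cong₂ _∷_ (h-add y z) (begin
        κ′ ((y ⊕ z) ⊖ h (y ⊕ z) · x)               ≡⟨ cong (λ a → κ′ ((y ⊕ z) ⊖ a)) (trans (cong (_· x) (h-add y z)) (·-distribʳ (h y) (h z) x)) ⟩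
        κ′ ((y ⊕ z) ⊖ (h y · x ⊕ h z · x))         ≡⟨ cong κ′ (⊖-interchange y z _ _) ⟩
        κ′ ((y ⊖ h y · x) ⊕ (z ⊖ h z · x))         ≡⟨ proj₁ (proj₂ (coordinates f)) _ _ ⟩
        κ′ (y ⊖ h y · x) ⊕ κ′ (z ⊖ h z · x)        ∎)
      κ-inverse : ∀ a → κ (combination a (x ∷ xs)) ≡ a
      κ-inverse (a ∷ c) = cong₂ _∷_ ha (begin
        κ′ (w ⊖ h w · x)                  ≡⟨ cong (λ b → κ′ (w ⊖ b · x)) ha ⟩
        κ′ ((a · x ⊕ combination c xs) ⊖ a · x)   ≡⟨ cong κ′ (trans (cong (_⊖ a · x) (⊕-comm _ _)) (⊕-⊖ _ (a · x))) ⟩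
        κ′ (combination c xs)             ≡⟨ proj₂ (proj₂ (coordinates f)) c ⟩
        c                                 ∎)
        where
        w : V n
        w = combination (a ∷ c) (x ∷ xs)
        ha : h w ≡ a
        ha = begin
          lookup w π *ᶠ d            ≡⟨ cong (_*ᶠ d) (pivot-coefficient r f a c) ⟩
          (a *ᶠ lookup x π) *ᶠ d     ≡⟨ *ᶠ-assoc a _ d ⟩
          a *ᶠ (lookup x π *ᶠ d)     ≡⟨ cong (a *ᶠ_) (trans (*ᶠ-comm _ d) (proj₂ (inverse (lookup x π) pivot≢0))) ⟩
          a *ᶠ 1ᶠ                    ≡⟨ *ᶠ-identityʳ a ⟩
          a                          ∎

  flag-weaken : ∀ {n k K N} {E E′ : V n → Sub n → Set} {xs : Vec (V n) k} → (∀ {x K} → E x K → E′ x K) → Flag E K xs N → Flag E′ K xs N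
  flag-weaken g []            = []
  flag-weaken g ((r , e) ∷ f) = (r , g e) ∷ flag-weaken g f

  prefix : ∀ m → ℕ → V m
  prefix zero    _       = []
  prefix (suc m) zero    = 𝟘
  prefix (suc m) (suc j) = 1ᶠ ∷ prefix m j

  interval : ∀ m {i j} → i < j → j ≤ m → let e = prefix m j ⊖ prefix m i in e ≢ 𝟘 × zipWith _*ᶠ_ e e ≡ e
  interval zero    (s≤s _) ()
  interval (suc m) {suc i} {suc j} (s≤s i<j) (s≤s j≤m) =
    let (e≢0 , ee) = interval m i<j j≤m
    in (λ e≡0 → e≢0 (Vec.∷-injectiveʳ e≡0)) , cong₂ _∷_ (trans (cong₂ _*ᶠ_ (+ᶠ-inverseʳ 1ᶠ) (+ᶠ-inverseʳ 1ᶠ)) (trans (*ᶠ-zeroˡ 0ᶠ) (sym (+ᶠ-inverseʳ 1ᶠ)))) ee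
  interval (suc m) {zero} {suc j} _ (s≤s j≤m) = (λ e≡0 → 1≢0 (trans (sym h) (Vec.∷-injectiveˡ e≡0))) ,
    subst (λ e → zipWith _*ᶠ_ e e ≡ e) (sym (trans (cong (prefix (suc m) (suc j) ⊕_) neg𝟘) (⊕-identityʳ _))) (cong₂ _∷_ (*ᶠ-identityˡ 1ᶠ) (idem m j))
    where
    neg𝟘 : ∀ {k} → ⊝ 𝟘 {n = k} ≡ 𝟘
    neg𝟘 = trans (sym (⊕-identityˡ _)) (⊕-inverseʳ 𝟘)
    h : 1ᶠ +ᶠ neg 0ᶠ ≡ 1ᶠ
    h = trans (cong (1ᶠ +ᶠ_) (trans (sym (+ᶠ-identityˡ _)) (+ᶠ-inverseʳ 0ᶠ))) (+ᶠ-identityʳ 1ᶠ)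
    idem0 : ∀ k → zipWith _*ᶠ_ (𝟘 {n = k}) 𝟘 ≡ 𝟘
    idem0 zero    = refl
    idem0 (suc k) = cong₂ _∷_ (*ᶠ-zeroˡ 0ᶠ) (idem0 k)
    idem : ∀ k l → zipWith _*ᶠ_ (prefix k l) (prefix k l) ≡ prefix k l
    idem zero    l       = refl
    idem (suc k) zero    = idem0 (suc k)
    idem (suc k) (suc l) = cong₂ _∷_ (*ᶠ-identityˡ 1ᶠ) (idem k l)

  -- The translates of so dense a set by s₀ , … , sₖ cannot be disjoint.
  pigeonhole : ∀ {m k} {C : V m → Set} (C? : ∀ x → Dec (C x)) (s : Fin k → V m) → p ℕ.^ m < k ℕ.* # C? →
    ∃[ i ] ∃[ j ] (toℕ i < toℕ j × ∃[ c ] ∃[ c′ ] (C c × C c′ × c ⊖ c′ ≡ s j ⊖ s i))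
  pigeonhole {m} {k} {C} C? s dense
    with ∃? (λ x → Fin.any? λ i → Fin.any? λ j → (toℕ i ℕ.<? toℕ j) ×-dec (C? (x ⊖ s i) ×-dec C? (x ⊖ s j)))
  ... | yes (x , i , j , i<j , c , c′) = i , j , i<j , x ⊖ s i , x ⊖ s j , c , c′ , difference x (s i) (s j)
    where
    difference : ∀ x a b → (x ⊖ a) ⊖ (x ⊖ b) ≡ b ⊖ a
    difference x a b = begin
      (x ⊖ a) ⊖ (x ⊖ b)                            ≡⟨ cong (λ z → (z ⊖ a) ⊖ (x ⊖ b)) (sym (⊖-⊕ x b)) ⟩
      (((x ⊖ b) ⊕ b) ⊖ a) ⊖ (x ⊖ b)                ≡⟨ cong (_⊖ (x ⊖ b)) (trans (⊕-assoc _ b _) (⊕-comm _ _)) ⟩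
      ((b ⊖ a) ⊕ (x ⊖ b)) ⊖ (x ⊖ b)                ≡⟨ ⊕-⊖ _ _ ⟩
      b ⊖ a                                        ∎
      where open ≡-Reasoning
  ... | no ¬found = contradiction dense (ℕ.≤⇒≯ (begin
    k ℕ.* # C?                                        ≡⟨ sym (sum-const k _) ⟩
    sum {k} (λ _ → # C?)                              ≡⟨ sum-cong-≗ {k} (λ i → ∑-translate m _ (⊝ s i)) ⟩
    sum {k} (λ i → ∑ m λ x → ind (C? (x ⊖ s i)))      ≡⟨ sum-∑-swap m (λ i x → ind (C? (x ⊖ s i))) ⟩
    ∑ m (λ x → sum {k} λ i → ind (C? (x ⊖ s i)))      ≤⟨ ∑-mono m (λ x → sum≤1 _ (λ i → ind≤1 (C? (x ⊖ s i))) λ i j hi hj → unique x i j (ind>0 (C? (x ⊖ s i)) hi) (ind>0 (C? (x ⊖ s j)) hj)) ⟩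
    ∑ m (λ _ → 1)                                     ≡⟨ trans (∑-const m 1) (ℕ.*-identityʳ _) ⟩
    p ℕ.^ m                                           ∎))
    where
    open ℕ.≤-Reasoning
    open import Relation.Binary.Definitions using (tri<; tri≈; tri>)
    unique : ∀ x i j → C (x ⊖ s i) → C (x ⊖ s j) → i ≡ j
    unique x i j hi hj with ℕ.<-cmp (toℕ i) (toℕ j)
    ... | tri< i<j _ _ = contradiction (x , i , j , i<j , hi , hj) ¬found
    ... | tri≈ _ e _   = Fin.toℕ-injective e
    ... | tri> _ _ j<i = contradiction (x , j , i , j<i , hj , hi) ¬found

module QuarticSteps (p : ℕ) .{{nz : NonZero p}} (prime : Prime p) where
  open PrimeField p prime
  open Count p prime
  open MultilinearForms p prime
  open TrilinearForms p prime
  open IsotropicSubspaces p prime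

  module QuarticForm {n : ℕ} (T : Quad n) where
    open Quad T

    rotate : ∀ x y z w → form x y z w ≡ form y z w x
    rotate x y z w = trans (sym₁₂ x y z w) (trans (sym₂₃ y x z w) (sym₃₄ y z x w))

    linear : ∀ c x r y z w → form (c · x ⊕ r) y z w ≡ c *ᶠ form x y z w +ᶠ form r y z w
    linear c x r y z w = trans (add _ r y z w)
      (cong (_+ᶠ form r y z w) (functional-· (λ x → form x y z w) (λ x x′ → add x x′ y z w) c x))

    scaled-vanish : ∀ c {a} → a ≡ 0ᶠ → c *ᶠ a ≡ 0ᶠ
    scaled-vanish c e = trans (cong (c *ᶠ_) e) (*ᶠ-zeroʳ c)

    vanish : ∀ c {x r y z w} → form x y z w ≡ 0ᶠ → form r y z w ≡ 0ᶠ → form (c · x ⊕ r) y z w ≡ 0ᶠ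
    vanish c {x} {r} {y} {z} {w} h h′ = trans (linear c x r y z w) (trans (cong₂ _+ᶠ_ (scaled-vanish c h) h′) (+ᶠ-identityˡ 0ᶠ))

    vanish₂ : ∀ c {x r y z w} → form y x z w ≡ 0ᶠ → form y r z w ≡ 0ᶠ → form y (c · x ⊕ r) z w ≡ 0ᶠ
    vanish₂ c h h′ = trans (sym₁₂ _ _ _ _) (vanish c (trans (sym₁₂ _ _ _ _) h) (trans (sym₁₂ _ _ _ _) h′))

    vanish₃ : ∀ c {x r y z w} → form y z x w ≡ 0ᶠ → form y z r w ≡ 0ᶠ → form y z (c · x ⊕ r) w ≡ 0ᶠ
    vanish₃ c h h′ = trans (sym₂₃ _ _ _ _) (vanish₂ c (trans (sym₂₃ _ _ _ _) h) (trans (sym₂₃ _ _ _ _) h′))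

    vanish₄ : ∀ c {x r y z w} → form y z w x ≡ 0ᶠ → form y z w r ≡ 0ᶠ → form y z w (c · x ⊕ r) ≡ 0ᶠ
    vanish₄ c h h′ = trans (sym₃₄ _ _ _ _) (vanish₃ c (trans (sym₃₄ _ _ _ _) h) (trans (sym₃₄ _ _ _ _) h′))

    form-𝟘 : ∀ {y z w} → form 𝟘 y z w ≡ 0ᶠ
    form-𝟘 {y} {z} {w} = functional-0 (λ x → form x y z w) (λ x x′ → add x x′ y z w)

    E₁ E₂ E₃ : V n → Sub n → Set
    E₁ x K = ∀ {y z w} → K ∋ y → K ∋ z → K ∋ w → form x y z w ≡ 0ᶠ
    E₂ x K = E₁ x K × (∀ {y z} → K ∋ y → K ∋ z → form x x y z ≡ 0ᶠ) × (∀ {y} → K ∋ y → form x x x y ≡ 0ᶠ)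
    E₃ x K = E₂ x K × form x x x x ≡ 0ᶠ

    span₁ : ∀ {k K N} {xs : Vec (V n) k} → Flag E₁ K xs N → ∀ c → E₁ (combination c xs) N
    span₁ []            []      y z w = form-𝟘
    span₁ ((_ , e) ∷ f) (a ∷ c) y z w = vanish a (e (flag-⊑ f y) (flag-⊑ f z) (flag-⊑ f w)) (span₁ f c y z w)

    Span : V n → Sub n → V n → Set
    Span x K s = ∃[ a ] ∃[ r ] (K ∋ r × s ≡ a · x ⊕ r)

    ∋⇒Span : ∀ {x K r} → K ∋ r → Span x K r
    ∋⇒Span {x} {K} {r} h = 0ᶠ , r , h , sym (trans (cong (_⊕ r) (·-zeroˡ x)) (⊕-identityˡ r))

    module _ {x K} (e : E₂ x K) where
      private
        e₁ : E₁ x K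
        e₁ = proj₁ e
        e₂ : ∀ {y z} → K ∋ y → K ∋ z → form x x y z ≡ 0ᶠ
        e₂ = proj₁ (proj₂ e)
        e₃ : ∀ {y} → K ∋ y → form x x x y ≡ 0ᶠ
        e₃ = proj₂ (proj₂ e)

      expand₁ : ∀ {s y} → Span x K s → K ∋ y → form x x s y ≡ 0ᶠ
      expand₁ (a , r , r∈ , refl) y = vanish₃ a (e₃ y) (e₂ r∈ y)

      expand₂ : ∀ {s t y} → Span x K s → Span x K t → K ∋ y → form x s t y ≡ 0ᶠ
      expand₂ {t = t} {y} (a , r , r∈ , refl) (b , u , u∈ , refl) y∈ =
        vanish₂ a (expand₁ (b , u , u∈ , refl) y∈) (vanish₃ b (trans (sym₂₃ x r x y) (e₂ r∈ y∈)) (e₁ r∈ u∈ y∈))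

      expand₃ : form x x x x ≡ 0ᶠ → ∀ {s t u} → Span x K s → Span x K t → Span x K u → form x s t u ≡ 0ᶠ
      expand₃ e₄ {s} {t} (a , r , r∈ , refl) (b , u , u∈ , refl) (c , v , v∈ , refl) =
        vanish₄ c (trans (rotate x s t x) (trans (rotate s t x x) (trans (rotate t x x s) (three′ (a , r , r∈ , refl) (b , u , u∈ , refl)))))
                  (expand₂ (a , r , r∈ , refl) (b , u , u∈ , refl) v∈)
        where
        three′ : ∀ {s t} → Span x K s → Span x K t → form x x s t ≡ 0ᶠ
        three′ {s} σ (b , u , u∈ , refl) = vanish₄ b (trans (sym₃₄ x x s x) (trans (sym₂₃ x x x s) (four σ))) (expand₁ σ u∈)
          where
          four : ∀ {s} → Span x K s → form x x x s ≡ 0ᶠ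
          four (a , r , r∈ , refl) = vanish₄ a e₄ (e₃ r∈)

    span₂ : ∀ {k K N} {xs : Vec (V n) k} → Flag E₂ K xs N → ∀ c → E₂ (combination c xs) N
    span₂ {N = N} f c = span₁ (flag-weaken proj₁ f) c , two f c , three f c
      where
      two : ∀ {k K} {xs : Vec (V n) k} → Flag E₂ K xs N → ∀ c {y z} → N ∋ y → N ∋ z → form (combination c xs) (combination c xs) y z ≡ 0ᶠ
      two [] [] y z = form-𝟘
      two {xs = x ∷ xs} ((_ , e) ∷ f) (a ∷ c) {y} {z} y∈ z∈ =
        let y′ = flag-⊑ f y∈ ; z′ = flag-⊑ f z∈ ; r = flag-span f c
        in vanish a (vanish₂ a (proj₁ (proj₂ e) y′ z′) (proj₁ e r y′ z′))
                    (vanish₂ a (trans (sym₁₂ (combination c xs) x y z) (proj₁ e r y′ z′)) (two f c y∈ z∈))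
      three : ∀ {k K} {xs : Vec (V n) k} → Flag E₂ K xs N → ∀ c {y} → N ∋ y → form (combination c xs) (combination c xs) (combination c xs) y ≡ 0ᶠ
      three [] [] y = form-𝟘
      three {xs = x ∷ xs} (_∷_ {K′ = K′} (_ , e) f) (a ∷ c) {y} y∈ =
        vanish a (expand₂ {x} {K′} e sσ sσ y′) (trans (sym₁₂ r s s y) (trans (sym₂₃ s r s y)
          (vanish a (expand₂ {x} {K′} e sσ rσ y′) (trans (sym₁₂ r s r y)
            (vanish a (expand₂ {x} {K′} e rσ rσ y′) (three f c y∈))))))
        where
        r s : V n
        r = combination c xs
        s = a · x ⊕ r
        y′ : K′ ∋ y
        y′ = flag-⊑ f y∈
        rσ : Span x K′ r
        rσ = ∋⇒Span {x} {K′} (flag-span f c)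
        sσ : Span x K′ s
        sσ = a , r , flag-span f c , refl

    isotropic : ∀ {k K N} {xs : Vec (V n) k} → Flag E₃ K xs N → ∀ a b c d →
      form (combination a xs) (combination b xs) (combination c xs) (combination d xs) ≡ 0ᶠ
    isotropic [] [] [] [] [] = form-𝟘
    isotropic {xs = x ∷ xs} (_∷_ {K′ = K′} (_ , e , e₄) f) (a₀ ∷ a) (b₀ ∷ b) (c₀ ∷ c) (d₀ ∷ d) =
      trans (sym (rotate _ _ _ _)) (vanish d₀ (expand₃ {x} {K′} e e₄ (σ a₀ a) (σ b₀ b) (σ c₀ c))
        (trans (sym (rotate _ _ _ _)) (vanish c₀ (expand₃ {x} {K′} e e₄ (ρ d) (σ a₀ a) (σ b₀ b))
          (trans (sym (rotate _ _ _ _)) (vanish b₀ (expand₃ {x} {K′} e e₄ (ρ c) (ρ d) (σ a₀ a))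
            (trans (sym (rotate _ _ _ _)) (vanish a₀ (expand₃ {x} {K′} e e₄ (ρ b) (ρ c) (ρ d)) (isotropic f a b c d))))))))
      where
      ρ : ∀ a → Span x K′ (combination a xs)
      ρ a = ∋⇒Span {x} {K′} (flag-span f a)
      σ : ∀ a₀ a → Span x K′ (combination (a₀ ∷ a) (x ∷ xs))
      σ a₀ a = a₀ , combination a xs , flag-span f a , refl

    -- On vectors which are pairwise orthogonal relative to N, the form is
    -- diagonal, so it only depends on products of coefficients.
    diagonal : ∀ {k K N} {xs : Vec (V n) k} → Flag E₁ K xs N → ∀ e f e′ f′ → zipWith _*ᶠ_ e f ≡ zipWith _*ᶠ_ e′ f′ →
      ∀ {y z} → N ∋ y → N ∋ z →
      form (combination e xs) (combination f xs) y z ≡ form (combination e′ xs) (combination f′ xs) y z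
    diagonal [] [] [] [] [] _ y z = refl
    diagonal {xs = x ∷ xs} ((_ , E) ∷ fl) (e₀ ∷ e) (f₀ ∷ f) (e₀′ ∷ e′) (f₀′ ∷ f′) eq {y} {z} y∈ z∈ =
      trans (split e₀ e f₀ f) (trans (cong₂ (λ a b → a *ᶠ form x x y z +ᶠ b) (Vec.∷-injectiveˡ eq)
        (diagonal fl e f e′ f′ (Vec.∷-injectiveʳ eq) y∈ z∈)) (sym (split e₀′ e′ f₀′ f′)))
      where
      open ≡-Reasoning
      null : ∀ c → form x (combination c xs) y z ≡ 0ᶠ
      null c = E (flag-span fl c) (flag-⊑ fl y∈) (flag-⊑ fl z∈)
      split : ∀ e₀ e f₀ f → form (e₀ · x ⊕ combination e xs) (f₀ · x ⊕ combination f xs) y z ≡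
                            (e₀ *ᶠ f₀) *ᶠ form x x y z +ᶠ form (combination e xs) (combination f xs) y z
      split e₀ e f₀ f = begin
        form (e₀ · x ⊕ r) (f₀ · x ⊕ t) y z                             ≡⟨ linear e₀ x r _ y z ⟩
        e₀ *ᶠ form x (f₀ · x ⊕ t) y z +ᶠ form r (f₀ · x ⊕ t) y z       ≡⟨ cong₂ (λ a b → e₀ *ᶠ a +ᶠ b) (expand x) (expand r) ⟩
        e₀ *ᶠ (f₀ *ᶠ form x x y z +ᶠ form x t y z) +ᶠ (f₀ *ᶠ form x r y z +ᶠ form r t y z)
          ≡⟨ cong₂ (λ a b → e₀ *ᶠ a +ᶠ (b +ᶠ form r t y z)) (trans (cong (f₀ *ᶠ form x x y z +ᶠ_) (null f)) (+ᶠ-identityʳ _)) (scaled-vanish f₀ (null e)) ⟩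
        e₀ *ᶠ (f₀ *ᶠ form x x y z) +ᶠ (0ᶠ +ᶠ form r t y z)             ≡⟨ cong₂ _+ᶠ_ (sym (*ᶠ-assoc e₀ f₀ _)) (+ᶠ-identityˡ _) ⟩
        (e₀ *ᶠ f₀) *ᶠ form x x y z +ᶠ form r t y z                     ∎
        where
        r t : V n
        r = combination e xs
        t = combination f xs
        expand : ∀ w → form w (f₀ · x ⊕ t) y z ≡ f₀ *ᶠ form x w y z +ᶠ form w t y z
        expand w = trans (sym₁₂ w _ y z) (trans (linear f₀ x t w y z) (cong (f₀ *ᶠ form x w y z +ᶠ_) (sym₁₂ t w y z)))

    total : ∀ {m} → Vec (V n) m → V n
    total Y = combination (replicate _ 1ᶠ) Y

    find-block : ∀ {m h K N} {Ys : Vec (Vec (V n) m) h} → Chain (Flag E₁) K Ys N → ∀ a → a ≢ 𝟘 →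
      Σ (Vec (V n) m) λ Y → Σ (Sub n) λ K₀ → Σ (Sub n) λ N₀ → ∃[ b ] (Flag E₁ K₀ Y N₀ × K₀ ⊑ K × N ⊑ N₀ × b ≢ 0ᶠ ×
        (∀ e {y z} → N ∋ y → N ∋ z → form (combination a (Vec.map total Ys)) (combination e Y) y z ≡ b *ᶠ form (total Y) (combination e Y) y z))
    find-block [] [] a≢0 = contradiction refl a≢0
    find-block {m} {N = N} {Ys = Y ∷ Ys} (_∷_ {K = K} {K′ = K₁} f c) (b ∷ a) ab≢0 with b ≟ᶠ 0ᶠ
    ... | no b≢0 = Y , K , K₁ , b , f , id , chain-⊑ c , b≢0 , λ e {y} {z} y∈ z∈ →
      trans (linear b (total Y) X (combination e Y) y z) (trans (cong (b *ᶠ form (total Y) (combination e Y) y z +ᶠ_)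
        (trans (sym₁₂ X (combination e Y) y z) (span₁ f e (rest c a) (chain-⊑ c y∈) (chain-⊑ c z∈)))) (+ᶠ-identityʳ _))
      where
      X : V n
      X = combination a (Vec.map total Ys)
      chain-⊑ : ∀ {h K} {Ys : Vec (Vec (V n) m) h} → Chain (Flag E₁) K Ys N → N ⊑ K
      chain-⊑ []      h = h
      chain-⊑ (f ∷ c) h = flag-⊑ f (chain-⊑ c h)
      rest : ∀ {h K} {Ys : Vec (Vec (V n) m) h} → Chain (Flag E₁) K Ys N → ∀ a → K ∋ combination a (Vec.map total Ys)
      rest {K = K} []      []      = Sub.mem0 K
      rest {K = K} (f ∷ c) (b ∷ a) = Sub.mem⊕ K (Sub.mem· K b (flag-span f (replicate m 1ᶠ))) (flag-⊑ f (rest c a))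
    ... | yes refl =
      let (Y′ , K₀ , N₀ , b′ , f′ , K₀⊑ , N⊑ , b′≢0 , acts) = find-block c a (λ e → ab≢0 (cong (0ᶠ ∷_) e))
      in Y′ , K₀ , N₀ , b′ , f′ , (λ h → flag-⊑ f (K₀⊑ h)) , N⊑ , b′≢0 , λ e {y} {z} y∈ z∈ →
        trans (cong (λ X → form X (combination e Y′) y z) (trans (cong (_⊕ combination a (Vec.map total Ys)) (·-zeroˡ (total Y))) (⊕-identityˡ _))) (acts e y∈ z∈)

    Step : (V n → Sub n → Set) → ℕ → ℕ → Set₁
    Step E L I = ∀ K → L ≤ size K → Σ (V n) λ x → Σ (Sub n) λ K′ → (Nested K x K′ × E x K′) × size K ≤ I ℕ.* size K′

    step₁ : ∀ {q} → Biased q → Step E₁ (2 ℕ.* q) (p ℕ.* (2 ℕ.* (2 ℕ.* q)) ℕ.^ (3 ℕ.* (2 ℕ.* q) ℕ.+ 1))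
    step₁ {q} bias K large =
      let (x , x∈K , x≢0 , biased) = biased-slice T {q} bias id (λ _ _ → refl) K large
          (K₁ , K₁⊑K , null , bound) = vanishing (slice x) {2 ℕ.* q} biased K
          (π , xπ≢0) = nonzero-coordinate x≢0
          K′ = K₁ ⊓ kernel (λ y → lookup y π) (lookup-⊕ π)
      in x , K′ , (record { member = x∈K ; smaller = λ h → K₁⊑K (proj₁ h) ; pivot = π ; pivot≢0 = xπ≢0 ; pivot≡0 = λ h → proj₂ h tt tt }
                  , λ y z w → null (proj₁ y) (proj₁ z) (proj₁ w)) , (begin
        size K                                    ≤⟨ bound ⟩
        I ℕ.* size K₁                             ≤⟨ ℕ.*-monoʳ-≤ I (kernel-index K₁ (λ y → lookup y π) (lookup-⊕ π)) ⟩
        I ℕ.* (p ℕ.* size K′)                     ≡⟨ solve 3 (λ i p k → i :* (p :* k) := p :* i :* k) refl I p (size K′) ⟩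
        p ℕ.* I ℕ.* size K′                       ∎)
      where
      open ℕ.≤-Reasoning
      open +-*-Solver
      I : ℕ
      I = (2 ℕ.* (2 ℕ.* q)) ℕ.^ (3 ℕ.* (2 ℕ.* q) ℕ.+ 1)

    collision : ∀ {q m} (S : Tri n) → Tri.Biased S q → (φ : V m → V n) → Additive φ → (N : Sub n) → 2 ℕ.* q ≤ m →
      ∃[ e ] ∃[ c ] ∃[ c′ ] (c ⊖ c′ ≡ e × e ≢ 𝟘 × zipWith _*ᶠ_ e e ≡ e ×
        size N ≤ 2 ℕ.* q ℕ.* size (N ⊓ Tri.radical S (φ c)) × size N ≤ 2 ℕ.* q ℕ.* size (N ⊓ Tri.radical S (φ c′)))
    collision {q} {m} S bias φ addφ N 2q≤m =
      let (i , j , i<j , c , c′ , c∈ , c′∈ , eq) = pigeonhole C? (λ (i : Fin (suc m)) → prefix m (toℕ i)) (ℕ.≤-trans (s≤s C-dense) (ℕ.+-monoˡ-≤ _ #C>0))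
          (e≢0 , ee) = interval m i<j (ℕ.≤-pred (Fin.toℕ<n j))
      in _ , c , c′ , eq , e≢0 , ee , proj₂ c∈ , proj₂ c′∈
      where
      C? : ∀ e → Dec (⊤ × size N ≤ 2 ℕ.* q ℕ.* size (N ⊓ Tri.radical S (φ e)))
      C? e = Sub.mem? (full {m}) e ×-dec (size N ℕ.≤? 2 ℕ.* q ℕ.* size (N ⊓ Tri.radical S (φ e)))
      C-dense : p ℕ.^ m ≤ m ℕ.* # C?
      C-dense = ℕ.≤-trans (ℕ.≤-reflexive (sym (size-full {m}))) (ℕ.≤-trans (dense S {q} bias φ addφ full N) (ℕ.*-monoˡ-≤ (# C?) 2q≤m))
      #C>0 : 1 ≤ # C?
      #C>0 = ℕ.n≢0⇒n>0 λ e → ℕ.<⇒≱ (pⁿ>0 m) (ℕ.≤-trans C-dense (ℕ.≤-reflexive (trans (cong (m ℕ.*_) e) (ℕ.*-zeroʳ m))))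

    -- A vector X acting on a flag like its total b ∑ xᵢ turns a collision
    -- c - c′ = e for X into a null vector w = ∑ eᵢ xᵢ, as eᵢ² = eᵢ.
    module _ {m} {Y : Vec (V n) m} {K N K₀ N₀ : Sub n} (f : Flag E₁ K₀ Y N₀) (K₀⊑ : K₀ ⊑ K) (N⊑ : N ⊑ N₀)
             {X : V n} {b : F} (b≢0 : b ≢ 0ᶠ)
             (acts : ∀ e {y z} → N ∋ y → N ∋ z → form X (combination e Y) y z ≡ b *ᶠ form (total Y) (combination e Y) y z)
             {q : ℕ} {e c c′ : V m} (c⊖c′ : c ⊖ c′ ≡ e) (e≢0 : e ≢ 𝟘) (ee : zipWith _*ᶠ_ e e ≡ e)
             (index : size N ≤ q ℕ.* size (N ⊓ Tri.radical (slice X) (combination c Y)))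
             (index′ : size N ≤ q ℕ.* size (N ⊓ Tri.radical (slice X) (combination c′ Y))) where

      collision-null : Σ (Sub n) λ N′ → (Nested K (combination e Y) N′ × E₂ (combination e Y) N′) × size N ≤ q ℕ.* q ℕ.* p ℕ.* size N′
      collision-null = N′ , (nested , (λ y z v → span₁ f e (N⊑ (N′⊑N y)) (N⊑ (N′⊑N z)) (N⊑ (N′⊑N v))) , two , λ y → proj₂ y tt tt) , (begin
        size N                          ≤⟨ ⊓-index {a = q} {q} N (radical (combination c Y)) (radical (combination c′ Y)) index index′ ⟩
        q ℕ.* q ℕ.* size M              ≤⟨ ℕ.*-monoʳ-≤ (q ℕ.* q) (kernel-index M (form w w w) www) ⟩
        q ℕ.* q ℕ.* (p ℕ.* size N′)     ≡⟨ sym (ℕ.*-assoc (q ℕ.* q) p _) ⟩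
        q ℕ.* q ℕ.* p ℕ.* size N′       ∎)
        where
        open ℕ.≤-Reasoning
        open Tri (slice X) using (radical)
        w : V n
        w = combination e Y
        www : Functional (form w w w)
        www y y′ = Tri.add₃ (slice w) w w y y′
        M N′ : Sub n
        M = (N ⊓ radical (combination c Y)) ⊓ (N ⊓ radical (combination c′ Y))
        N′ = M ⊓ kernel (form w w w) www
        N′⊑N : N′ ⊑ N
        N′⊑N h = proj₁ (proj₁ (proj₁ h))
        r : Nested K₀ w N′
        r = flag-nested f e e≢0 {N′} (λ h → N⊑ (N′⊑N h))
        nested : Nested K w N′
        nested = record { member = K₀⊑ (Nested.member r) ; smaller = λ h → K₀⊑ (Nested.smaller r h)
                        ; pivot = Nested.pivot r ; pivot≢0 = Nested.pivot≢0 r ; pivot≡0 = Nested.pivot≡0 r }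
        ones : ∀ {m} (e : V m) → zipWith _*ᶠ_ (replicate m 1ᶠ) e ≡ e
        ones []      = refl
        ones (a ∷ e) = cong₂ _∷_ (*ᶠ-identityˡ a) (ones e)
        two : ∀ {y z} → N′ ∋ y → N′ ∋ z → form w w y z ≡ 0ᶠ
        two {y} {z} y∈ z∈ = decidable-stable (form w w y z ≟ᶠ 0ᶠ) λ ≢0 → *ᶠ-nonzero b≢0 ≢0 (E.begin
          b *ᶠ form w w y z                               E.≡⟨ cong (b *ᶠ_) (diagonal f e e (replicate m 1ᶠ) e (trans ee (sym (ones e))) (N⊑ (N′⊑N y∈)) (N⊑ (N′⊑N z∈))) ⟩
          b *ᶠ form (total Y) w y z                       E.≡⟨ sym (acts e (N′⊑N y∈) (N′⊑N z∈)) ⟩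
          form X w y z                                    E.≡⟨ cong (λ e → form X (combination e Y) y z) (sym c⊖c′) ⟩
          form X (combination (c ⊖ c′) Y) y z             E.≡⟨ functional-⊖ (λ e → form X (combination e Y) y z) (λ d d′ → trans (cong (λ v → form X v y z) (combination-additive Y d d′)) (Tri.add (slice X) _ _ y z)) c c′ ⟩
          form X (combination c Y) y z -ᶠ form X (combination c′ Y) y z     E.≡⟨ cong₂ _-ᶠ_ (proj₂ (proj₁ (proj₁ y∈)) z tt) (proj₂ (proj₂ (proj₁ y∈)) z tt) ⟩
          0ᶠ -ᶠ 0ᶠ                                        E.≡⟨ -ᶠ-self 0ᶠ ⟩
          0ᶠ                                              E.∎)
          where module E = ≡-Reasoning

    step₂ : ∀ {q L I m h} → Biased q → Step E₁ L I → 1 ≤ I → 2 ℕ.* (2 ℕ.* q) ≤ m → 2 ℕ.* q ≤ p ℕ.^ h →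
      Step E₂ (L ℕ.* I ℕ.^ m ℕ.* (I ℕ.^ m) ℕ.^ h) ((I ℕ.^ m) ℕ.^ h ℕ.* (2 ℕ.* (2 ℕ.* q) ℕ.* (2 ℕ.* (2 ℕ.* q)) ℕ.* p))
    step₂ {q} {L} {I} {m} {h} bias step I>0 m-large h-large K large =
      let (Ys , N , chain , bound) = iterate {A = Vec (V n) m} {L = L ℕ.* I ℕ.^ m} {I ℕ.^ m} (iterate {L = L} {I} step I>0 m) (ℕ.m^n>0 I {{ℕ.>-nonZero I>0}} m) h K large
          (a , _ , a≢0 , biased) = biased-slice T {q} bias (λ a → combination a (Vec.map total Ys)) (combination-additive (Vec.map total Ys)) full
            (ℕ.≤-trans h-large (ℕ.≤-reflexive (sym (size-full {h}))))
          X = combination a (Vec.map total Ys)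
          (Y , K₀ , N₀ , b , f , K₀⊑ , N⊑ , b≢0 , acts) = find-block chain a a≢0
          (e , c , c′ , c⊖c′ , e≢0 , ee , index , index′) = collision {2 ℕ.* q} (slice X) biased (λ e → combination e Y) (combination-additive Y) N m-large
          (N′ , good , bound′) = collision-null {K = K} {N = N} f K₀⊑ N⊑ {X = X} {b = b} b≢0 acts {q = 2 ℕ.* (2 ℕ.* q)} {e} {c} {c′} c⊖c′ e≢0 ee index index′
      in combination e Y , N′ , good , ℕ.≤-trans bound (ℕ.≤-trans (ℕ.*-monoʳ-≤ ((I ℕ.^ m) ℕ.^ h) bound′) (ℕ.≤-reflexive (sym (ℕ.*-assoc ((I ℕ.^ m) ℕ.^ h) _ _))))

    step₃ : (∀ (φ : V 5 → V n) → Additive φ → ∃[ c ] (c ≢ 𝟘 × form (φ c) (φ c) (φ c) (φ c) ≡ 0ᶠ)) →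
      ∀ {L I} → Step E₂ L I → 1 ≤ I → Step E₃ (L ℕ.* I ℕ.^ 5) (I ℕ.^ 5)
    step₃ quartic-zero {L} {I} step I>0 K large =
      let (ws , N , f , bound) = iterate {A = V n} {R = λ K x K′ → Nested K x K′ × E₂ x K′} {L = L} {I} step I>0 5 K large
          (c , c≢0 , null) = quartic-zero (λ c → combination c ws) (combination-additive ws)
      in combination c ws , N , (flag-nested {E = E₂} f c c≢0 {N} id , span₂ f c , null) , bound

module IsotropicSystems (p : ℕ) .{{nz : NonZero p}} (prime : Prime p) where
  open import Data.Vec.Base using (_++_)
  open PrimeField p prime
  open Count p prime
  open MultilinearForms p prime
  open TrilinearForms p prime
  open IsotropicSubspaces p prime
  open QuarticSteps p prime

  record IsotropicSystem {n : ℕ} (T : Quad n) : Set where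
    field
      {rank}       : ℕ
      vectors′     : Vec (V n) rank
      isotropy     : ∀ a b c d → Quad.form T (combination a vectors′) (combination b vectors′) (combination c vectors′) (combination d vectors′) ≡ 0ᶠ
      coords       : V n → V rank
      coords-add   : Additive coords
      coords-comb  : ∀ a → coords (combination a vectors′) ≡ a

  2^-double : ∀ x → 2 ℕ.^ x ℕ.+ 2 ℕ.^ x ≡ 2 ℕ.^ suc x
  2^-double x = cong (2 ℕ.^ x ℕ.+_) (sym (ℕ.+-identityʳ _))

  2^-mono : ∀ {x y} → x ≤ y → 2 ℕ.^ x ≤ 2 ℕ.^ y
  2^-mono = ℕ.^-monoʳ-≤ 2

  2^-+ : ∀ {a b} z {x y} → a ≤ 2 ℕ.^ x → b ≤ 2 ℕ.^ y → x ≤ z → y ≤ z → a ℕ.+ b ≤ 2 ℕ.^ suc z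
  2^-+ z h h′ x≤z y≤z = ℕ.≤-trans (ℕ.+-mono-≤ (ℕ.≤-trans h (2^-mono x≤z)) (ℕ.≤-trans h′ (2^-mono y≤z))) (ℕ.≤-reflexive (2^-double z))

  2^-* : ∀ {a b} x y → a ≤ 2 ℕ.^ x → b ≤ 2 ℕ.^ y → a ℕ.* b ≤ 2 ℕ.^ (x ℕ.+ y)
  2^-* x y h h′ = ℕ.≤-trans (ℕ.*-mono-≤ h h′) (ℕ.≤-reflexive (sym (ℕ.^-distribˡ-+-* 2 x y)))

  -- Powers of p with these exponents bound the indices of the successive
  -- steps, when the bias is at least 1/q.
  u X s : ℕ → ℕ
  u q = 1 ℕ.+ 2 ℕ.* (2 ℕ.* q) ℕ.* (3 ℕ.* (2 ℕ.* q) ℕ.+ 1)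
  X q = u q ℕ.* (2 ℕ.* (2 ℕ.* q)) ℕ.* (2 ℕ.* q)
  s q = (2 ℕ.* q ℕ.+ u q ℕ.* (2 ℕ.* (2 ℕ.* q)) ℕ.+ X q) ℕ.+ (X q ℕ.+ (2 ℕ.* (2 ℕ.* q) ℕ.+ 2 ℕ.* (2 ℕ.* q) ℕ.+ 1)) ℕ.* 5

  3s≤ : ∀ b → 3 ℕ.* s (2 ℕ.^ b) ≤ 2 ℕ.^ (17 ℕ.+ 4 ℕ.* b)
  3s≤ b = ℕ.≤-trans (2^-* 2 (15 ℕ.+ 4 ℕ.* b) (ℕ.n≤1+n 3) s≤) ℕ.≤-refl
    where
    2q≤ : 2 ℕ.* 2 ℕ.^ b ≤ 2 ℕ.^ (1 ℕ.+ b)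
    2q≤ = ℕ.≤-refl
    4q≤ : 2 ℕ.* (2 ℕ.* 2 ℕ.^ b) ≤ 2 ℕ.^ (2 ℕ.+ b)
    4q≤ = ℕ.≤-refl
    1≤ : 1 ≤ 2 ℕ.^ 0
    1≤ = ℕ.≤-refl
    u≤ : u (2 ℕ.^ b) ≤ 2 ℕ.^ (7 ℕ.+ (b ℕ.+ b))
    u≤ = 2^-+ (6 ℕ.+ (b ℕ.+ b)) 1≤
      (ℕ.≤-trans (2^-* (2 ℕ.+ b) (4 ℕ.+ b) 4q≤ (2^-+ (3 ℕ.+ b) (2^-* 2 (1 ℕ.+ b) (ℕ.n≤1+n 3) 2q≤) 1≤ ℕ.≤-refl z≤n))
        (ℕ.≤-reflexive (cong (2 ℕ.^_) (solve 1 (λ b → con 2 :+ b :+ (con 4 :+ b) := con 6 :+ (b :+ b)) refl b)))) z≤n ℕ.≤-refl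
      where open +-*-Solver
    u4q≤ : u (2 ℕ.^ b) ℕ.* (2 ℕ.* (2 ℕ.* 2 ℕ.^ b)) ≤ 2 ℕ.^ (9 ℕ.+ 3 ℕ.* b)
    u4q≤ = ℕ.≤-trans (2^-* (7 ℕ.+ (b ℕ.+ b)) (2 ℕ.+ b) u≤ 4q≤) (ℕ.≤-reflexive (cong (2 ℕ.^_) (solve 1 (λ b → con 7 :+ (b :+ b) :+ (con 2 :+ b) := con 9 :+ con 3 :* b) refl b)))
      where open +-*-Solver
    X≤ : X (2 ℕ.^ b) ≤ 2 ℕ.^ (10 ℕ.+ 4 ℕ.* b)
    X≤ = ℕ.≤-trans (2^-* (9 ℕ.+ 3 ℕ.* b) (1 ℕ.+ b) u4q≤ 2q≤) (ℕ.≤-reflexive (cong (2 ℕ.^_) (solve 1 (λ b → con 9 :+ con 3 :* b :+ (con 1 :+ b) := con 10 :+ con 4 :* b) refl b)))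
      where open +-*-Solver
    b≤ : ∀ k → b ≤ k ℕ.+ 4 ℕ.* b
    b≤ k = ℕ.≤-trans (ℕ.m≤m+n b _) (ℕ.m≤n+m _ k)
    s≤ : s (2 ℕ.^ b) ≤ 2 ℕ.^ (15 ℕ.+ 4 ℕ.* b)
    s≤ = 2^-+ (14 ℕ.+ 4 ℕ.* b) {12 ℕ.+ 4 ℕ.* b}
      (2^-+ (11 ℕ.+ 4 ℕ.* b) (2^-+ (10 ℕ.+ 4 ℕ.* b) 2q≤ u4q≤ (s≤s (b≤ 9)) (ℕ.+-mono-≤ (ℕ.n≤1+n 9) (ℕ.*-monoˡ-≤ b (ℕ.n≤1+n 3)))) X≤ ℕ.≤-refl (ℕ.n≤1+n _))
      (ℕ.≤-trans (2^-* (11 ℕ.+ 4 ℕ.* b) 3 (2^-+ (10 ℕ.+ 4 ℕ.* b) X≤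
          (2^-+ (3 ℕ.+ b) (2^-+ (2 ℕ.+ b) 4q≤ 4q≤ ℕ.≤-refl ℕ.≤-refl) 1≤ ℕ.≤-refl z≤n) ℕ.≤-refl (ℕ.+-mono-≤ (s≤s (s≤s (s≤s (s≤s (z≤n {6}))))) (b≤ 0)))
          (ℕ.m≤m+n 5 3)) (ℕ.≤-reflexive (cong (2 ℕ.^_) (ℕ.+-comm (11 ℕ.+ 4 ℕ.* b) 3))))
      (ℕ.≤-trans (ℕ.n≤1+n _) (ℕ.n≤1+n _)) ℕ.≤-refl

  module _ {n : ℕ} (T : Quad n) where
    open Quad T
    open QuarticForm T
    open IsotropicSystem

    flag-system : ∀ {k N} {ws : Vec (V n) k} → Flag E₃ full ws N → IsotropicSystem T
    flag-system {ws = ws} f = let (κ , κ-add , κ-comb) = coordinates f in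
      record { vectors′ = ws ; isotropy = isotropic f ; coords = κ ; coords-add = κ-add ; coords-comb = κ-comb }

    line-system : ∀ w → w ≢ 𝟘 → form w w w w ≡ 0ᶠ → IsotropicSystem T
    line-system w w≢0 wwww = let (κ , κ-add , κ-comb) = coordinates flag in
      record { vectors′ = w ∷ [] ; isotropy = null′ ; coords = κ ; coords-add = κ-add ; coords-comb = κ-comb }
      where
      π : ∃[ π ] lookup w π ≢ 0ᶠ
      π = nonzero-coordinate w≢0
      flag : Flag (λ _ _ → ⊤) full (w ∷ []) (kernel (λ y → lookup y (proj₁ π)) (lookup-⊕ (proj₁ π)))
      flag = (record { member = tt ; smaller = λ _ → tt ; pivot = proj₁ π ; pivot≢0 = proj₂ π ; pivot≡0 = λ h → h tt tt } , tt) ∷ []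
      peel : ∀ a {y z v} → form w y z v ≡ 0ᶠ → form (combination (a ∷ []) (w ∷ [])) y z v ≡ 0ᶠ
      peel a h = vanish a h form-𝟘
      null′ : ∀ a b c d → form (combination a (w ∷ [])) (combination b (w ∷ [])) (combination c (w ∷ [])) (combination d (w ∷ [])) ≡ 0ᶠ
      null′ (a ∷ []) (b ∷ []) (c ∷ []) (d ∷ []) =
        peel a (trans (rotate _ _ _ _) (peel b (trans (rotate _ _ _ _) (peel c (trans (rotate _ _ _ _) (peel d (trans (rotate _ _ _ _) wwww)))))))

    powers : ∀ {a b} x y → a ≤ p ℕ.^ x → b ≤ p ℕ.^ y → a ℕ.* b ≤ p ℕ.^ (x ℕ.+ y)
    powers x y h h′ = ℕ.≤-trans (ℕ.*-mono-≤ h h′) (ℕ.≤-reflexive (sym (ℕ.^-distribˡ-+-* p x y)))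

    power-^ : ∀ {a} x k → a ≤ p ℕ.^ x → a ℕ.^ k ≤ p ℕ.^ (x ℕ.* k)
    power-^ x k h = ℕ.≤-trans (ℕ.^-monoˡ-≤ k h) (ℕ.≤-reflexive (ℕ.^-*-assoc p x k))

    p-power : ∀ {x y} → x ≤ y → p ℕ.^ x ≤ p ℕ.^ y
    p-power h = ℕ.^-monoʳ-≤ p h

    module _ (quartic-zero : ∀ (φ : V 5 → V n) → Additive φ → ∃[ c ] (c ≢ 𝟘 × form (φ c) (φ c) (φ c) (φ c) ≡ 0ᶠ)) where

      small-system : ∀ {C} → n ≤ C → Σ (IsotropicSystem T) λ W → 5 ≤ n → n ≤ C ℕ.* rank W
      small-system {C} n≤C with 5 ℕ.≤? n
      ... | no n<5 = flag-system [] , λ h → contradiction h n<5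
      ... | yes 5≤n = let (c , c≢0 , e) = quartic-zero pad pad-add in
        line-system (pad c) (λ h → c≢0 (pad-inj c h)) e , λ _ → ℕ.≤-trans n≤C (ℕ.≤-reflexive (sym (ℕ.*-identityʳ C)))
        where
        n≡ : 5 ℕ.+ (n ℕ.∸ 5) ≡ n
        n≡ = ℕ.m+[n∸m]≡n 5≤n
        pad : V 5 → V n
        pad c = Vec.cast n≡ (c ++ 𝟘)
        cast-⊕ : ∀ {m k} .(e : m ≡ k) (x y : V m) → Vec.cast e (x ⊕ y) ≡ Vec.cast e x ⊕ Vec.cast e y
        cast-⊕ {k = zero}  e []      []      = refl
        cast-⊕ {k = suc k} e (a ∷ x) (b ∷ y) = cong (_ ∷_) (cast-⊕ (ℕ.suc-injective e) x y)
        ++-⊕ : ∀ {m k} (x y : V m) → (x ⊕ y) ++ 𝟘 {n = k} ≡ (x ++ 𝟘) ⊕ (y ++ 𝟘)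
        ++-⊕ []      []      = sym (⊕-identityˡ 𝟘)
        ++-⊕ (a ∷ x) (b ∷ y) = cong (_ ∷_) (++-⊕ x y)
        pad-add : Additive pad
        pad-add x y = trans (cong (Vec.cast n≡) (++-⊕ x y)) (cast-⊕ n≡ _ _)
        cast-inj : ∀ {m k} .(e : m ≡ k) (x : V m) → Vec.cast e x ≡ 𝟘 → x ≡ 𝟘
        cast-inj {k = zero}  e []      h = refl
        cast-inj {k = suc k} e (a ∷ x) h = cong₂ _∷_ (Vec.∷-injectiveˡ h) (cast-inj (ℕ.suc-injective e) x (Vec.∷-injectiveʳ h))
        ++-inj : ∀ {m k} (x : V m) → x ++ 𝟘 {n = k} ≡ 𝟘 → x ≡ 𝟘
        ++-inj []      h = refl
        ++-inj (a ∷ x) h = cong₂ _∷_ (Vec.∷-injectiveˡ h) (++-inj x (Vec.∷-injectiveʳ h))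
        pad-inj : ∀ c → pad c ≡ 𝟘 → c ≡ 𝟘
        pad-inj c h = ++-inj c (cast-inj n≡ _ h)

      k≤pᵏ : ∀ k → k ≤ p ℕ.^ k
      k≤pᵏ k = ℕ.≤-trans (ℕ.<⇒≤ (k<2ᵏ k)) (ℕ.^-monoˡ-≤ k 1<p)
        where
        k<2ᵏ : ∀ k → k < 2 ℕ.^ k
        k<2ᵏ zero    = s≤s z≤n
        k<2ᵏ (suc k) = ℕ.≤-trans (ℕ.+-mono-≤ (ℕ.m^n>0 2 k) (k<2ᵏ k)) (ℕ.≤-reflexive (2^-double k))

      greedy : ∀ {q} → Biased q → 1 ≤ q → Σ ℕ λ L → Σ ℕ λ I → Step E₃ L I × 1 ≤ I × L ≤ p ℕ.^ s q × I ≤ p ℕ.^ s q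
      greedy {q} bias q>0 = L₃ , I₃ , step₃ quartic-zero (step₂ {q} {2 ℕ.* q} {I₁} {4q} {2 ℕ.* q} bias (step₁ {q} bias) I₁>0 ℕ.≤-refl (k≤pᵏ (2 ℕ.* q))) I₂>0
        , ^>0 5 I₂>0 , powers (2 ℕ.* q ℕ.+ u q ℕ.* 4q ℕ.+ X q) _ L₂≤ I₃≤ , ℕ.≤-trans I₃≤ (p-power (ℕ.m≤n+m _ (2 ℕ.* q ℕ.+ u q ℕ.* 4q ℕ.+ X q)))
        where
        4q I₁ L₂ I₂ L₃ I₃ : ℕ
        4q = 2 ℕ.* (2 ℕ.* q)
        I₁ = p ℕ.* 4q ℕ.^ (3 ℕ.* (2 ℕ.* q) ℕ.+ 1)
        L₂ = 2 ℕ.* q ℕ.* I₁ ℕ.^ 4q ℕ.* (I₁ ℕ.^ 4q) ℕ.^ (2 ℕ.* q)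
        I₂ = (I₁ ℕ.^ 4q) ℕ.^ (2 ℕ.* q) ℕ.* (4q ℕ.* 4q ℕ.* p)
        L₃ = L₂ ℕ.* I₂ ℕ.^ 5
        I₃ = I₂ ℕ.^ 5
        ^>0 : ∀ {a} k → 1 ≤ a → 1 ≤ a ℕ.^ k
        ^>0 {a} k h = ℕ.m^n>0 a {{ℕ.>-nonZero h}} k
        4q>0 : 1 ≤ 4q
        4q>0 = ℕ.*-mono-≤ (s≤s (z≤n {1})) (ℕ.*-mono-≤ (s≤s (z≤n {1})) q>0)
        I₁>0 : 1 ≤ I₁
        I₁>0 = ℕ.*-mono-≤ (ℕ.<⇒≤ 1<p) (^>0 (3 ℕ.* (2 ℕ.* q) ℕ.+ 1) 4q>0)
        I₂>0 : 1 ≤ I₂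
        I₂>0 = ℕ.*-mono-≤ (^>0 (2 ℕ.* q) (^>0 4q I₁>0)) (ℕ.*-mono-≤ (ℕ.*-mono-≤ 4q>0 4q>0) (ℕ.<⇒≤ 1<p))
        p≤p¹ : p ≤ p ℕ.^ 1
        p≤p¹ = ℕ.≤-reflexive (sym (ℕ.*-identityʳ p))
        I₁≤ : I₁ ≤ p ℕ.^ u q
        I₁≤ = powers 1 (4q ℕ.* (3 ℕ.* (2 ℕ.* q) ℕ.+ 1)) p≤p¹ (power-^ 4q (3 ℕ.* (2 ℕ.* q) ℕ.+ 1) (k≤pᵏ 4q))
        Iᵐ≤ : I₁ ℕ.^ 4q ≤ p ℕ.^ (u q ℕ.* 4q)
        Iᵐ≤ = power-^ (u q) 4q I₁≤
        L₂≤ : L₂ ≤ p ℕ.^ (2 ℕ.* q ℕ.+ u q ℕ.* 4q ℕ.+ X q)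
        L₂≤ = powers (2 ℕ.* q ℕ.+ u q ℕ.* 4q) (X q) (powers (2 ℕ.* q) (u q ℕ.* 4q) (k≤pᵏ (2 ℕ.* q)) Iᵐ≤) (power-^ (u q ℕ.* 4q) (2 ℕ.* q) Iᵐ≤)
        I₂≤ : I₂ ≤ p ℕ.^ (X q ℕ.+ (4q ℕ.+ 4q ℕ.+ 1))
        I₂≤ = powers (X q) (4q ℕ.+ 4q ℕ.+ 1) (power-^ (u q ℕ.* 4q) (2 ℕ.* q) Iᵐ≤) (powers (4q ℕ.+ 4q) 1 (powers 4q 4q (k≤pᵏ 4q) (k≤pᵏ 4q)) p≤p¹)
        I₃≤ : I₃ ≤ p ℕ.^ ((X q ℕ.+ (4q ℕ.+ 4q ℕ.+ 1)) ℕ.* 5)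
        I₃≤ = power-^ (X q ℕ.+ (4q ℕ.+ 4q ℕ.+ 1)) 5 I₂≤

      greedy-system : ∀ {L I} s → Step E₃ L I → 1 ≤ I → L ≤ p ℕ.^ s → I ≤ p ℕ.^ s → 1 ≤ s →
        Σ (IsotropicSystem T) λ W → 5 ≤ n → n ≤ 3 ℕ.* s ℕ.* rank W
      greedy-system {L} {I} s@(suc _) step I>0 L≤ I≤ _ = cases (n ℕ./ s) (m≡m%n+[m/n]*n n s)
        where
        open ℕ.≤-Reasoning
        open +-*-Solver
        cases : ∀ d → n ≡ n % s ℕ.+ d ℕ.* s → Σ (IsotropicSystem T) λ W → 5 ≤ n → n ≤ 3 ℕ.* s ℕ.* rank W
        cases 0 e = small-system (begin
          n                    ≡⟨ e ⟩
          n % s ℕ.+ 0          ≤⟨ ℕ.+-mono-≤ (ℕ.<⇒≤ (m%n<n n s)) z≤n ⟩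
          s ℕ.+ (s ℕ.+ (s ℕ.+ 0)) ∎)
        cases 1 e = small-system (begin
          n                    ≡⟨ e ⟩
          n % s ℕ.+ (s ℕ.+ 0)  ≤⟨ ℕ.+-mono-≤ (ℕ.<⇒≤ (m%n<n n s)) (ℕ.+-monoʳ-≤ s z≤n) ⟩
          s ℕ.+ (s ℕ.+ (s ℕ.+ 0)) ∎)
        cases (suc d@(suc d′)) e =
          let (ws , N , f , _) = iterate {L = L} {I} step I>0 d full (begin
                L ℕ.* I ℕ.^ d                      ≤⟨ powers s (s ℕ.* d) L≤ (power-^ s d I≤) ⟩
                p ℕ.^ (s ℕ.+ s ℕ.* d)              ≤⟨ p-power (ℕ.≤-trans (ℕ.≤-reflexive (trans (cong (s ℕ.+_) (ℕ.*-comm s d)) refl)) (ℕ.≤-trans (ℕ.m≤n+m _ (n % s)) (ℕ.≤-reflexive (sym e)))) ⟩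
                p ℕ.^ n                            ≡⟨ sym (size-full {n}) ⟩
                size (full {n})                    ∎)
          in flag-system f , λ _ → (begin
            n                              ≡⟨ e ⟩
            n % s ℕ.+ suc d ℕ.* s          ≤⟨ ℕ.+-monoˡ-≤ (suc d ℕ.* s) (ℕ.<⇒≤ (m%n<n n s)) ⟩
            s ℕ.+ suc d ℕ.* s              ≤⟨ ℕ.m≤m+n _ (2 ℕ.* d′ ℕ.* s) ⟩
            s ℕ.+ suc d ℕ.* s ℕ.+ 2 ℕ.* d′ ℕ.* s   ≡⟨ solve 2 (λ s d → s :+ (con 2 :+ d) :* s :+ con 2 :* d :* s := con 3 :* s :* (con 1 :+ d)) refl s d′ ⟩
            3 ℕ.* s ℕ.* d                  ∎)

      isotropic-system : ∀ {b} → Biased (2 ℕ.^ b) → Σ (IsotropicSystem T) λ W → 5 ≤ n → n ≤ 2 ℕ.^ (17 ℕ.+ 4 ℕ.* b) ℕ.* rank W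
      isotropic-system {b} bias =
        let (L , I , step , I>0 , L≤ , I≤) = greedy {2 ℕ.^ b} bias (ℕ.m^n>0 2 b)
            (W , large) = greedy-system (s (2 ℕ.^ b)) step I>0 L≤ I≤ s>0
        in W , λ h → ℕ.≤-trans (large h) (ℕ.*-monoˡ-≤ (rank W) (3s≤ b))
        where
        s>0 : 1 ≤ s (2 ℕ.^ b)
        s>0 = ℕ.≤-trans (ℕ.≤-trans (ℕ.m≤n+m 1 _) (ℕ.≤-trans (ℕ.m≤n+m _ (X (2 ℕ.^ b))) (ℕ.m≤m*n _ 5))) (ℕ.m≤n+m _ (2 ℕ.* 2 ℕ.^ b ℕ.+ u (2 ℕ.^ b) ℕ.* (2 ℕ.* (2 ℕ.* 2 ℕ.^ b)) ℕ.+ X (2 ℕ.^ b)))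

module DifferenceDegree (p : ℕ) .{{nz : NonZero p}} (prime : Prime p) where
  open PrimeField p prime
  open Count p prime using (∃?; module SumV)
  open MultilinearForms p prime using (Quad)
  private
    module F = CommutativeRing 𝔽-ring
    module FS = NatSolver F.commutativeSemiring
    module Σᶠ = SumV F.+-commutativeMonoid
    module Fsum = MonoidSum F.+-commutativeMonoid

  -- Deg d f: every d-fold difference of f vanishes (so f has degree < d).
  data Deg {n : ℕ} : ℕ → (V n → F) → Set where
    null : ∀ {f} → (∀ x → f x ≡ 0ᶠ) → Deg zero f
    next : ∀ {d f} → (∀ y → Deg d (Δ y f)) → Deg (suc d) f

  deg-null : ∀ {n} {f : V n → F} → Deg zero f → ∀ x → f x ≡ 0ᶠ
  deg-null (null h) = h

  deg-next : ∀ {n d} {f : V n → F} → Deg (suc d) f → ∀ y → Deg d (Δ y f)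
  deg-next (next h) = h

  deg-cong : ∀ {n} d {f g : V n → F} → (∀ x → f x ≡ g x) → Deg d f → Deg d g
  deg-cong zero    f≗g (null h) = null λ x → trans (sym (f≗g x)) (h x)
  deg-cong (suc d) f≗g (next h) = next λ y → deg-cong d (λ x → cong₂ _-ᶠ_ (f≗g (x ⊕ y)) (f≗g x)) (h y)

  deg-zero : ∀ {n} d {f : V n → F} → (∀ x → f x ≡ 0ᶠ) → Deg d f
  deg-zero zero    h = null h
  deg-zero (suc d) h = next λ y → deg-zero d λ x → trans (cong₂ _-ᶠ_ (h (x ⊕ y)) (h x)) (-ᶠ-self 0ᶠ)

  deg-≤ : ∀ {n d e} {f : V n → F} → d ≤ e → Deg d f → Deg e f
  deg-≤ z≤n       (null h) = deg-zero _ h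
  deg-≤ (s≤s d≤e) (next h) = next λ y → deg-≤ d≤e (h y)

  deg-+ : ∀ {n} d {f g : V n → F} → Deg d f → Deg d g → Deg d (λ x → f x +ᶠ g x)
  deg-+ zero    (null h) (null k) = null λ x → trans (cong₂ _+ᶠ_ (h x) (k x)) (+ᶠ-identityˡ 0ᶠ)
  deg-+ (suc d) {f} {g} (next h) (next k) = next λ y → deg-cong d (λ x → sym (-ᶠ-unique (begin
      f (x ⊕ y) +ᶠ g (x ⊕ y)                                   ≡⟨ cong₂ _+ᶠ_ (sym (-ᶠ-cancel _ (f x))) (sym (-ᶠ-cancel _ (g x))) ⟩
      (Δ y f x +ᶠ f x) +ᶠ (Δ y g x +ᶠ g x)                     ≡⟨ solve 4 (λ a b c d → (a :+ b) :+ (c :+ d) := (a :+ c) :+ (b :+ d)) refl (Δ y f x) (f x) (Δ y g x) (g x) ⟩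
      (Δ y f x +ᶠ Δ y g x) +ᶠ (f x +ᶠ g x)                     ∎))) (deg-+ d (h y) (k y))
    where
    open ≡-Reasoning
    open FS using (solve; _:+_; _:*_; _:=_)

  deg-scale : ∀ {n} d c {f : V n → F} → Deg d f → Deg d (λ x → c *ᶠ f x)
  deg-scale zero    c (null h) = null λ x → trans (cong (c *ᶠ_) (h x)) (*ᶠ-zeroʳ c)
  deg-scale (suc d) c {f} (next h) = next λ y → deg-cong d (λ x → sym (-ᶠ-unique (trans (cong (c *ᶠ_) (sym (-ᶠ-cancel _ (f x)))) (*ᶠ-distribˡ c _ (f x)))))
    (deg-scale d c (h y))

  deg-affine : ∀ {m n} d {f : V n → F} (φ : V m → V n) → Additive φ → ∀ a → Deg d f → Deg d (λ x → f (a ⊕ φ x))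
  deg-affine zero    φ add a (null h) = null λ x → h (a ⊕ φ x)
  deg-affine (suc d) {f} φ add a (next h) = next λ y → deg-cong d (λ x → cong (λ z → f z -ᶠ f (a ⊕ φ x)) (trans (⊕-assoc a _ _) (cong (a ⊕_) (sym (add x y)))))
    (deg-affine d φ add a (h (φ y)))

  deg-additive : ∀ {m n} d {f : V n → F} (φ : V m → V n) → Additive φ → Deg d f → Deg d (f ∘ φ)
  deg-additive d {f} φ add h = deg-cong d (λ x → cong f (⊕-identityˡ (φ x))) (deg-affine d φ add 𝟘 h)

  deg-shift : ∀ {n} d {f : V n → F} y → Deg d f → Deg d (λ x → f (x ⊕ y))
  deg-shift d {f} y h = deg-cong d (λ x → cong f (⊕-comm y x)) (deg-affine d id (λ _ _ → refl) y h)

  deg-const : ∀ {n} c → Deg {n} 1 (λ _ → c)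
  deg-const c = next λ y → null λ x → -ᶠ-self c

  deg-functional : ∀ {n} {ℓ : V n → F} → Functional ℓ → Deg 2 ℓ
  deg-functional {ℓ = ℓ} add = next λ y → deg-cong 1 (λ x → sym (-ᶠ-unique (trans (add x y) (+ᶠ-comm (ℓ x) (ℓ y))))) (deg-const (ℓ y))

  deg-* : ∀ {n} d e {f g : V n → F} → Deg (suc d) f → Deg (suc e) g → Deg (suc (d ℕ.+ e)) (λ x → f x *ᶠ g x)
  deg-* d e {f} {g} h k = next λ y → deg-cong (d ℕ.+ e) (λ x → sym (-ᶠ-unique (begin
      f (x ⊕ y) *ᶠ g (x ⊕ y)                                          ≡⟨ cong (f (x ⊕ y) *ᶠ_) (sym (-ᶠ-cancel _ (g x))) ⟩
      f (x ⊕ y) *ᶠ (Δ y g x +ᶠ g x)                                   ≡⟨ *ᶠ-distribˡ (f (x ⊕ y)) _ _ ⟩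
      f (x ⊕ y) *ᶠ Δ y g x +ᶠ f (x ⊕ y) *ᶠ g x                        ≡⟨ cong (λ a → f (x ⊕ y) *ᶠ Δ y g x +ᶠ a *ᶠ g x) (sym (-ᶠ-cancel _ (f x))) ⟩
      f (x ⊕ y) *ᶠ Δ y g x +ᶠ (Δ y f x +ᶠ f x) *ᶠ g x
        ≡⟨ solve 4 (λ a b c d → a :+ (b :+ c) :* d := (b :* d :+ a) :+ c :* d) refl (f (x ⊕ y) *ᶠ Δ y g x) (Δ y f x) (f x) (g x) ⟩
      (Δ y f x *ᶠ g x +ᶠ f (x ⊕ y) *ᶠ Δ y g x) +ᶠ f x *ᶠ g x          ∎)))
    (deg-+ (d ℕ.+ e) (left d h y) (right e k y))
    where
    open ≡-Reasoning
    open FS using (solve; _:+_; _:*_; _:=_)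
    left : ∀ d {f} → Deg (suc d) f → ∀ y → Deg (d ℕ.+ e) (λ x → Δ y f x *ᶠ g x)
    left zero    h y = deg-zero e λ x → trans (cong (_*ᶠ g x) (deg-null (deg-next h y) x)) (*ᶠ-zeroˡ (g x))
    left (suc d) h y = deg-* d e (deg-next h y) k
    right : ∀ e {g} → Deg (suc e) g → ∀ y → Deg (d ℕ.+ e) (λ x → f (x ⊕ y) *ᶠ Δ y g x)
    right zero    {g} k y = deg-zero (d ℕ.+ 0) λ x → trans (cong (f (x ⊕ y) *ᶠ_) (deg-null (deg-next k y) x)) (*ᶠ-zeroʳ (f (x ⊕ y)))
    right (suc e) {g} k y = subst (λ m → Deg m (λ x → f (x ⊕ y) *ᶠ Δ y g x)) (sym (ℕ.+-suc d e)) (deg-* d e (deg-shift (suc d) y h) (deg-next k y))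

  deg-diagonal : ∀ {n} d (Φ : V n → V n → F) → (∀ v w x → Φ (v ⊕ w) x ≡ Φ v x +ᶠ Φ w x) →
                 (∀ v → Deg (suc d) (Φ v)) → Deg (suc (suc d)) (λ x → Φ x x)
  deg-diagonal d Φ add h = next λ y → deg-cong (suc d) (λ x → sym (-ᶠ-unique (begin
      Φ (x ⊕ y) (x ⊕ y)                         ≡⟨ add x y (x ⊕ y) ⟩
      Φ x (x ⊕ y) +ᶠ Φ y (x ⊕ y)                ≡⟨ cong (_+ᶠ Φ y (x ⊕ y)) (sym (-ᶠ-cancel _ (Φ x x))) ⟩
      (Δ y (Φ x) x +ᶠ Φ x x) +ᶠ Φ y (x ⊕ y)     ≡⟨ solve 3 (λ a b c → (a :+ b) :+ c := (a :+ c) :+ b) refl (Δ y (Φ x) x) (Φ x x) (Φ y (x ⊕ y)) ⟩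
      (Δ y (Φ x) x +ᶠ Φ y (x ⊕ y)) +ᶠ Φ x x     ∎)))
    (deg-+ (suc d) (first d h y) (deg-shift (suc d) y (h y)))
    where
    open ≡-Reasoning
    open FS using (solve; _:+_; _:*_; _:=_)
    add′ : ∀ y v w x → Δ y (Φ (v ⊕ w)) x ≡ Δ y (Φ v) x +ᶠ Δ y (Φ w) x
    add′ y v w x = -ᶠ-unique (begin
      Φ (v ⊕ w) (x ⊕ y)                                   ≡⟨ add v w (x ⊕ y) ⟩
      Φ v (x ⊕ y) +ᶠ Φ w (x ⊕ y)                          ≡⟨ cong₂ _+ᶠ_ (sym (-ᶠ-cancel _ (Φ v x))) (sym (-ᶠ-cancel _ (Φ w x))) ⟩
      (Δ y (Φ v) x +ᶠ Φ v x) +ᶠ (Δ y (Φ w) x +ᶠ Φ w x)    ≡⟨ solve 4 (λ a b c d → (a :+ b) :+ (c :+ d) := (a :+ c) :+ (b :+ d)) refl (Δ y (Φ v) x) (Φ v x) (Δ y (Φ w) x) (Φ w x) ⟩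
      (Δ y (Φ v) x +ᶠ Δ y (Φ w) x) +ᶠ (Φ v x +ᶠ Φ w x)    ≡⟨ cong ((Δ y (Φ v) x +ᶠ Δ y (Φ w) x) +ᶠ_) (sym (add v w x)) ⟩
      (Δ y (Φ v) x +ᶠ Δ y (Φ w) x) +ᶠ Φ (v ⊕ w) x         ∎)
    first : ∀ d → (∀ v → Deg (suc d) (Φ v)) → ∀ y → Deg (suc d) (λ x → Δ y (Φ x) x)
    first zero    h y = deg-zero 1 λ x → deg-null (deg-next (h x) y) x
    first (suc d) h y = deg-diagonal d (λ v → Δ y (Φ v)) (add′ y) (λ v → deg-next (h v) y)

  -- Newton's forward difference formula

  Σ< : ℕ → (ℕ → F) → F
  Σ< zero    h = 0ᶠ
  Σ< (suc m) h = h 0 +ᶠ Σ< m (h ∘ suc)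

  Σ<-cong : ∀ m {h k : ℕ → F} → (∀ j → j < m → h j ≡ k j) → Σ< m h ≡ Σ< m k
  Σ<-cong zero    e = refl
  Σ<-cong (suc m) e = cong₂ _+ᶠ_ (e 0 (s≤s z≤n)) (Σ<-cong m λ j j<m → e (suc j) (s≤s j<m))

  Σ<-zero : ∀ m {h : ℕ → F} → (∀ j → j < m → h j ≡ 0ᶠ) → Σ< m h ≡ 0ᶠ
  Σ<-zero zero    e = refl
  Σ<-zero (suc m) e = trans (cong₂ _+ᶠ_ (e 0 (s≤s z≤n)) (Σ<-zero m λ j j<m → e (suc j) (s≤s j<m))) (+ᶠ-identityˡ 0ᶠ)

  Σ<-+ : ∀ m (h k : ℕ → F) → Σ< m (λ j → h j +ᶠ k j) ≡ Σ< m h +ᶠ Σ< m k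
  Σ<-+ zero    h k = sym (+ᶠ-identityˡ 0ᶠ)
  Σ<-+ (suc m) h k = trans (cong ((h 0 +ᶠ k 0) +ᶠ_) (Σ<-+ m (h ∘ suc) (k ∘ suc)))
    (solve 4 (λ a b c d → (a :+ b) :+ (c :+ d) := (a :+ c) :+ (b :+ d)) refl (h 0) (k 0) (Σ< m (h ∘ suc)) (Σ< m (k ∘ suc)))
    where open FS using (solve; _:+_; _:*_; _:=_)

  Σ<-last : ∀ m (h : ℕ → F) → Σ< (suc m) h ≡ Σ< m h +ᶠ h m
  Σ<-last zero    h = +ᶠ-comm (h 0) 0ᶠ
  Σ<-last (suc m) h = trans (cong (h 0 +ᶠ_) (Σ<-last m (h ∘ suc))) (sym (+ᶠ-assoc (h 0) (Σ< m (h ∘ suc)) (h (suc m))))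

  Σ<-sum : ∀ m (h : ℕ → F) → Σ< m h ≡ Fsum.sum {m} (λ i → h (toℕ i))
  Σ<-sum zero    h = refl
  Σ<-sum (suc m) h = cong (h 0 +ᶠ_) (Σ<-sum m (h ∘ suc))

  binom : ℕ → ℕ → ℕ
  binom n       zero    = 1
  binom zero    (suc k) = 0
  binom (suc n) (suc k) = binom n k ℕ.+ binom n (suc k)

  binom-absorb : ∀ n k → suc k ℕ.* binom n (suc k) ℕ.+ k ℕ.* binom n k ≡ n ℕ.* binom n k
  binom-absorb zero    zero    = refl
  binom-absorb zero    (suc k) = cong₂ ℕ._+_ (ℕ.*-zeroʳ (suc (suc k))) (ℕ.*-zeroʳ (suc k))
  binom-absorb (suc n) zero    = begin
    1 ℕ.* (1 ℕ.+ binom n 1) ℕ.+ 0 ℕ.* 1    ≡⟨ solve 1 (λ b → con 1 :* (con 1 :+ b) :+ con 0 :* con 1 := con 1 :+ (con 1 :* b :+ con 0 :* con 1)) refl (binom n 1) ⟩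
    1 ℕ.+ (1 ℕ.* binom n 1 ℕ.+ 0 ℕ.* 1)    ≡⟨ cong suc (binom-absorb n 0) ⟩
    1 ℕ.+ n ℕ.* 1                          ∎
    where
    open ≡-Reasoning
    open +-*-Solver
  binom-absorb (suc n) (suc k) = begin
    suc (suc k) ℕ.* (b₁ ℕ.+ b₂) ℕ.+ suc k ℕ.* (b₀ ℕ.+ b₁)
      ≡⟨ solve 4 (λ k a b c → (con 2 :+ k) :* (b :+ c) :+ (con 1 :+ k) :* (a :+ b) := ((con 2 :+ k) :* c :+ (con 1 :+ k) :* b) :+ b :+ (((con 1 :+ k) :* b :+ k :* a) :+ a)) refl k b₀ b₁ b₂ ⟩
    (suc (suc k) ℕ.* b₂ ℕ.+ suc k ℕ.* b₁) ℕ.+ b₁ ℕ.+ ((suc k ℕ.* b₁ ℕ.+ k ℕ.* b₀) ℕ.+ b₀)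
      ≡⟨ cong₂ (λ x y → x ℕ.+ b₁ ℕ.+ (y ℕ.+ b₀)) (binom-absorb n (suc k)) (binom-absorb n k) ⟩
    n ℕ.* b₁ ℕ.+ b₁ ℕ.+ (n ℕ.* b₀ ℕ.+ b₀)
      ≡⟨ solve 3 (λ n a b → n :* b :+ b :+ (n :* a :+ a) := (con 1 :+ n) :* (a :+ b)) refl n b₀ b₁ ⟩
    suc n ℕ.* (b₀ ℕ.+ b₁)    ∎
    where
    open ≡-Reasoning
    open +-*-Solver
    b₀ b₁ b₂ : ℕ
    b₀ = binom n k
    b₁ = binom n (suc k)
    b₂ = binom n (suc (suc k))

  binom-prime : ∀ {k} → suc k < p → ⟦ binom p (suc k) ⟧ ≡ 0ᶠ
  binom-prime {k} k<p with euclidsLemma (suc k) (binom p (suc k)) prime p∣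
    where
    p∣ : p ∣ suc k ℕ.* binom p (suc k)
    p∣ = subst (λ m → m ∣ suc k ℕ.* binom m (suc k)) (ℕ.m+[n∸m]≡n {1} {p} (ℕ.<⇒≤ 1<p)) (divides (binom (p ℕ.∸ 1) k) (begin
      suc k ℕ.* (binom m k ℕ.+ binom m (suc k))                          ≡⟨ solve 3 (λ k a b → (con 1 :+ k) :* (a :+ b) := a :+ ((con 1 :+ k) :* b :+ k :* a)) refl k (binom m k) (binom m (suc k)) ⟩
      binom m k ℕ.+ (suc k ℕ.* binom m (suc k) ℕ.+ k ℕ.* binom m k)      ≡⟨ cong (binom m k ℕ.+_) (binom-absorb m k) ⟩
      binom m k ℕ.+ m ℕ.* binom m k                                      ≡⟨ ℕ.*-comm (suc m) (binom m k) ⟩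
      binom m k ℕ.* suc m                                                ∎))
      where
      open ≡-Reasoning
      open +-*-Solver
      m : ℕ
      m = p ℕ.∸ 1
  ... | inj₁ p∣k = contradiction (∣⇒≤ p∣k) (ℕ.<⇒≱ k<p)
  ... | inj₂ p∣b = ∣⇒⟦⟧≡0 p∣b

  Δ^ : ∀ {n} → ℕ → V n → (V n → F) → (V n → F)
  Δ^ zero    y f = f
  Δ^ (suc j) y f = Δ^ j y (Δ y f)

  newton : ∀ {n} (y : V n) N m → N < m → ∀ (f : V n → F) x → f (x ⊕ ⟦ N ⟧ · y) ≡ Σ< m (λ j → ⟦ binom N j ⟧ *ᶠ Δ^ j y f x)
  newton y zero (suc m) _ f x = begin
    f (x ⊕ 0ᶠ · y)          ≡⟨ cong f (trans (cong (x ⊕_) (·-zeroˡ y)) (⊕-identityʳ x)) ⟩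
    f x                     ≡⟨ sym (trans (cong₂ _+ᶠ_ (*ᶠ-identityˡ (f x)) (Σ<-zero m λ j _ → *ᶠ-zeroˡ _)) (+ᶠ-identityʳ (f x))) ⟩
    1ᶠ *ᶠ f x +ᶠ Σ< m (λ j → 0ᶠ *ᶠ Δ^ j y (Δ y f) x)   ∎
    where open ≡-Reasoning
  newton y (suc N) (suc m) (s≤s N<m) f x = begin
    f (x ⊕ ⟦ suc N ⟧ · y)                                                       ≡⟨ cong f step ⟩
    f (z ⊕ y)                                                                   ≡⟨ sym (-ᶠ-cancel _ (f z)) ⟩
    Δ y f z +ᶠ f z                                                              ≡⟨ cong₂ _+ᶠ_ (newton y N m N<m (Δ y f) x) (newton y N (suc m) (ℕ.m<n⇒m<1+n N<m) f x) ⟩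
    Σ< m a +ᶠ (1ᶠ *ᶠ f x +ᶠ Σ< m b)                                             ≡⟨ solve 3 (λ a c b → a :+ (c :+ b) := c :+ (a :+ b)) refl (Σ< m a) (1ᶠ *ᶠ f x) (Σ< m b) ⟩
    1ᶠ *ᶠ f x +ᶠ (Σ< m a +ᶠ Σ< m b)                                             ≡⟨ cong (1ᶠ *ᶠ f x +ᶠ_) (sym (Σ<-+ m a b)) ⟩
    1ᶠ *ᶠ f x +ᶠ Σ< m (λ j → a j +ᶠ b j)                                        ≡⟨ cong (1ᶠ *ᶠ f x +ᶠ_) (Σ<-cong m λ j _ → trans (sym (*ᶠ-distribʳ (c j) ⟦ binom N j ⟧ ⟦ binom N (suc j) ⟧)) (cong (_*ᶠ c j) (sym (⟦⟧-+ (binom N j) (binom N (suc j)))))) ⟩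
    1ᶠ *ᶠ f x +ᶠ Σ< m (λ j → ⟦ binom (suc N) (suc j) ⟧ *ᶠ Δ^ j y (Δ y f) x)     ∎
    where
    open ≡-Reasoning
    open FS using (solve; _:+_; _:*_; _:=_)
    z : V _
    z = x ⊕ ⟦ N ⟧ · y
    a b c : ℕ → F
    c j = Δ^ j y (Δ y f) x
    a j = ⟦ binom N j ⟧ *ᶠ c j
    b j = ⟦ binom N (suc j) ⟧ *ᶠ c j
    step : x ⊕ ⟦ suc N ⟧ · y ≡ z ⊕ y
    step = trans (cong (x ⊕_) (trans (cong (_· y) (trans (⟦⟧-+ 1 N) (+ᶠ-comm 1ᶠ ⟦ N ⟧))) (trans (·-distribʳ ⟦ N ⟧ 1ᶠ y) (cong (⟦ N ⟧ · y ⊕_) (·-identityˡ y))))) (sym (⊕-assoc x _ y))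

  newton-sum : ∀ {n} (y : V n) N m → N ≤ m → ∀ (f : V n → F) x →
    Σ< N (λ i → f (x ⊕ ⟦ i ⟧ · y)) ≡ Σ< m (λ j → ⟦ binom N (suc j) ⟧ *ᶠ Δ^ j y f x)
  newton-sum y zero    m _   f x = sym (Σ<-zero m λ j _ → *ᶠ-zeroˡ _)
  newton-sum y (suc N) m N<m f x = begin
    Σ< (suc N) (λ i → f (x ⊕ ⟦ i ⟧ · y))                        ≡⟨ Σ<-last N _ ⟩
    Σ< N (λ i → f (x ⊕ ⟦ i ⟧ · y)) +ᶠ f (x ⊕ ⟦ N ⟧ · y)         ≡⟨ cong₂ _+ᶠ_ (newton-sum y N m (ℕ.<⇒≤ N<m) f x) (newton y N m N<m f x) ⟩
    Σ< m a +ᶠ Σ< m b                                            ≡⟨ sym (Σ<-+ m a b) ⟩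
    Σ< m (λ j → a j +ᶠ b j)                                     ≡⟨ Σ<-cong m (λ j _ → trans (+ᶠ-comm (a j) (b j)) (trans (sym (*ᶠ-distribʳ (Δ^ j y f x) ⟦ binom N j ⟧ ⟦ binom N (suc j) ⟧)) (cong (_*ᶠ Δ^ j y f x) (sym (⟦⟧-+ (binom N j) (binom N (suc j))))))) ⟩
    Σ< m (λ j → ⟦ binom (suc N) (suc j) ⟧ *ᶠ Δ^ j y f x)        ∎
    where
    open ≡-Reasoning
    a b : ℕ → F
    a j = ⟦ binom N (suc j) ⟧ *ᶠ Δ^ j y f x
    b j = ⟦ binom N j ⟧ *ᶠ Δ^ j y f x

  deg-Δ^ : ∀ {n} j d {f : V n → F} y → Deg (j ℕ.+ d) f → Deg d (Δ^ j y f)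
  deg-Δ^ zero    d y h = h
  deg-Δ^ (suc j) d y (next h) = deg-Δ^ j d y (h y)

  axis : ∀ {n} → V (suc n)
  axis = 1ᶠ ∷ 𝟘

  on-axis : ∀ {n} a (x : V n) → (0ᶠ ∷ x) ⊕ a · axis ≡ a ∷ x
  on-axis a x = cong₂ _∷_ (trans (+ᶠ-identityˡ _) (*ᶠ-identityʳ a)) (trans (cong (x ⊕_) (·-zeroʳ a)) (⊕-identityʳ x))

  fibre-sum : ∀ {n} d (f : V (suc n) → F) → Deg (d ℕ.+ (p ℕ.∸ 1)) f → Deg d (λ x → Fsum.sum {p} λ a → f (a ∷ x))
  fibre-sum zero f h = null λ x → begin
    Fsum.sum {p} (λ a → f (a ∷ x))                               ≡⟨ Fsum.sum-cong-≗ {p} (λ a → cong f (trans (sym (on-axis a x)) (cong (λ b → (0ᶠ ∷ x) ⊕ b · axis) (sym (⟦⟧-toℕ a))))) ⟩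
    Fsum.sum {p} (λ a → f ((0ᶠ ∷ x) ⊕ ⟦ toℕ a ⟧ · axis))         ≡⟨ sym (Σ<-sum p (λ i → f ((0ᶠ ∷ x) ⊕ ⟦ i ⟧ · axis))) ⟩
    Σ< p (λ i → f ((0ᶠ ∷ x) ⊕ ⟦ i ⟧ · axis))                     ≡⟨ newton-sum axis p p ℕ.≤-refl f (0ᶠ ∷ x) ⟩
    Σ< p (λ j → ⟦ binom p (suc j) ⟧ *ᶠ Δ^ j axis f (0ᶠ ∷ x))     ≡⟨ Σ<-zero p (vanishes x) ⟩
    0ᶠ                                                           ∎
    where
    open ≡-Reasoning
    vanishes : ∀ x j → j < p → ⟦ binom p (suc j) ⟧ *ᶠ Δ^ j axis f (0ᶠ ∷ x) ≡ 0ᶠ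
    vanishes x j j<p with suc j ℕ.<? p
    ... | yes j+1<p = trans (cong (_*ᶠ Δ^ j axis f (0ᶠ ∷ x)) (binom-prime j+1<p)) (*ᶠ-zeroˡ _)
    ... | no j+1≮p = trans (cong (⟦ binom p (suc j) ⟧ *ᶠ_) (deg-null (deg-Δ^ j 0 axis (subst (λ k → Deg k f) (sym (trans (ℕ.+-identityʳ j) j≡)) h)) (0ᶠ ∷ x))) (*ᶠ-zeroʳ ⟦ binom p (suc j) ⟧)
      where
      j≡ : j ≡ p ℕ.∸ 1
      j≡ = cong ℕ.pred (ℕ.≤-antisym j<p (ℕ.≮⇒≥ j+1≮p))
  fibre-sum (suc d) f (next h) = next λ y → deg-cong d (λ x → sym (-ᶠ-unique (begin
      Fsum.sum {p} (λ a → f (a ∷ (x ⊕ y)))                                  ≡⟨ Fsum.sum-cong-≗ {p} (λ a → sym (-ᶠ-cancel _ (f (a ∷ x)))) ⟩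
      Fsum.sum {p} (λ a → (f (a ∷ (x ⊕ y)) -ᶠ f (a ∷ x)) +ᶠ f (a ∷ x))      ≡⟨ Fsum.∑-distrib-+ {p} _ _ ⟩
      Fsum.sum {p} (λ a → f (a ∷ (x ⊕ y)) -ᶠ f (a ∷ x)) +ᶠ Fsum.sum {p} (λ a → f (a ∷ x))
        ≡⟨ cong (_+ᶠ Fsum.sum {p} (λ a → f (a ∷ x))) (Fsum.sum-cong-≗ {p} λ a → cong (λ b → f (b ∷ (x ⊕ y)) -ᶠ f (a ∷ x)) (sym (+ᶠ-identityʳ a))) ⟩
      Fsum.sum {p} (λ a → Δ (0ᶠ ∷ y) f (a ∷ x)) +ᶠ Fsum.sum {p} (λ a → f (a ∷ x))   ∎)))
    (fibre-sum d (Δ (0ᶠ ∷ y) f) (h (0ᶠ ∷ y)))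
    where open ≡-Reasoning

  total-sum : ∀ n (f : V n → F) → Deg (n ℕ.* (p ℕ.∸ 1)) f → Σᶠ.∑ n f ≡ 0ᶠ
  total-sum zero    f (null h) = h []
  total-sum (suc n) f h = trans (Σᶠ.sum-∑-swap n (λ a x → f (a ∷ x)))
    (total-sum n _ (fibre-sum (n ℕ.* (p ℕ.∸ 1)) f (subst (λ k → Deg k f) (ℕ.+-comm (p ℕ.∸ 1) _) h)))

  sum-single : ∀ {k} (f : Fin k → F) i → (∀ j → j ≢ i → f j ≡ 0ᶠ) → Fsum.sum f ≡ f i
  sum-single {suc k} f Fin.zero    h = trans (cong (f Fin.zero +ᶠ_) (trans (Fsum.sum-cong-≗ λ j → h (Fin.suc j) λ ()) (Fsum.sum-replicate-zero k))) (+ᶠ-identityʳ _)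
  sum-single {suc k} f (Fin.suc i) h = trans (cong₂ _+ᶠ_ (h Fin.zero λ ()) (sum-single (f ∘ Fin.suc) i λ j j≢i → h (Fin.suc j) (j≢i ∘ Fin.suc-injective))) (+ᶠ-identityˡ _)

  ∑-single : ∀ n (f : V n → F) y → (∀ x → x ≢ y → f x ≡ 0ᶠ) → Σᶠ.∑ n f ≡ f y
  ∑-single zero    f []      h = refl
  ∑-single (suc n) f (b ∷ y) h = trans
    (sum-single {p} (λ a → Σᶠ.∑ n λ x → f (a ∷ x)) b λ a a≢b → trans (Σᶠ.∑-cong n λ x → h (a ∷ x) λ { refl → a≢b refl }) (Σᶠ.∑-ε n))
    (∑-single n (λ x → f (b ∷ x)) y λ x x≢y → h (b ∷ x) λ { refl → x≢y refl })

  -- A polynomial without nontrivial zeros would make ∏_{b ≠ 0} (g - b)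
  -- a nonzero multiple of the indicator function of the origin.
  chevalley-warning : ∀ d n (g : V n → F) → Deg (suc d) g → d < n → g 𝟘 ≡ 0ᶠ → ∃[ x ] (x ≢ 𝟘 × g x ≡ 0ᶠ)
  chevalley-warning d n g deg d<n g𝟘 with ∃? (λ x → ¬? (x ≟ⱽ 𝟘) ×-dec (g x ≟ᶠ 0ᶠ))
  ... | yes found = found
  ... | no ¬found = contradiction (trans (sym (∑-single n (λ x → h (p ℕ.∸ 1) x) 𝟘 h-zero)) (total-sum n (h (p ℕ.∸ 1)) h-deg′)) h𝟘≢0
    where
    h : ℕ → V n → F
    h zero    x = 1ᶠ
    h (suc m) x = (g x -ᶠ ⟦ suc m ⟧) *ᶠ h m x
    h-deg : ∀ m → Deg (suc (m ℕ.* d)) (h m)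
    h-deg zero    = deg-const 1ᶠ
    h-deg (suc m) = deg-* d (m ℕ.* d) (deg-cong (suc d) (λ x → sym (-ᶠ-def (g x) ⟦ suc m ⟧)) (deg-+ (suc d) deg (deg-≤ (s≤s z≤n) (deg-const (neg ⟦ suc m ⟧))))) (h-deg m)
    h-deg′ : Deg (n ℕ.* (p ℕ.∸ 1)) (h (p ℕ.∸ 1))
    h-deg′ = deg-≤ (ℕ.≤-trans (ℕ.+-monoˡ-≤ ((p ℕ.∸ 1) ℕ.* d) (ℕ.∸-monoˡ-≤ 1 1<p)) (ℕ.≤-trans (ℕ.≤-reflexive (trans (sym (ℕ.*-suc (p ℕ.∸ 1) d)) (ℕ.*-comm (p ℕ.∸ 1) (suc d)))) (ℕ.*-monoˡ-≤ (p ℕ.∸ 1) d<n))) (h-deg (p ℕ.∸ 1))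
    h-root : ∀ m x {i} → g x ≡ ⟦ suc i ⟧ → i < m → h m x ≡ 0ᶠ
    h-root (suc m) x {i} e i<m with i ℕ.≟ m
    ... | yes refl = trans (cong (_*ᶠ h m x) (trans (cong (_-ᶠ ⟦ suc m ⟧) e) (-ᶠ-self ⟦ suc m ⟧))) (*ᶠ-zeroˡ (h m x))
    ... | no i≢m   = trans (cong ((g x -ᶠ ⟦ suc m ⟧) *ᶠ_) (h-root m x e (ℕ.≤∧≢⇒< (ℕ.≤-pred i<m) i≢m))) (*ᶠ-zeroʳ (g x -ᶠ ⟦ suc m ⟧))
    h-zero : ∀ x → x ≢ 𝟘 → h (p ℕ.∸ 1) x ≡ 0ᶠ
    h-zero x x≢𝟘 = positive (toℕ (g x)) refl
      where
      positive : ∀ k → toℕ (g x) ≡ k → h (p ℕ.∸ 1) x ≡ 0ᶠ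
      positive zero    e = contradiction (x , x≢𝟘 , trans (sym (⟦⟧-toℕ (g x))) (cong ⟦_⟧ e)) ¬found
      positive (suc i) e = h-root (p ℕ.∸ 1) x (trans (sym (⟦⟧-toℕ (g x))) (cong ⟦_⟧ e)) (ℕ.∸-monoˡ-≤ 1 (subst (_< p) e (Fin.toℕ<n (g x))))
    h𝟘≢0 : h (p ℕ.∸ 1) 𝟘 ≢ 0ᶠ
    h𝟘≢0 = go (p ℕ.∸ 1) (ℕ.≤-reflexive (ℕ.m+[n∸m]≡n (ℕ.<⇒≤ 1<p)))
      where
      go : ∀ m → m < p → h m 𝟘 ≢ 0ᶠ
      go zero    _   = 1≢0
      go (suc m) m<p = *ᶠ-nonzero (λ e → ⟦⟧≢0 (s≤s z≤n) m<p (trans (sym (-ᶠ≡0 e)) g𝟘)) (go m (ℕ.<⇒≤ m<p))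

  quartic-zero : ∀ {n} (T : Quad n) (φ : V 5 → V n) → Additive φ → ∃[ c ] (c ≢ 𝟘 × Quad.form T (φ c) (φ c) (φ c) (φ c) ≡ 0ᶠ)
  quartic-zero {n} T φ addφ = chevalley-warning 4 5 (λ c → form (φ c) (φ c) (φ c) (φ c)) (deg-additive 5 φ addφ diag) ℕ.≤-refl
    (trans (cong (λ x → form x x x x) (additive-0 φ addφ)) (functional-0 (λ x → form x 𝟘 𝟘 𝟘) (λ x y → add x y 𝟘 𝟘 𝟘)))
    where
    open Quad T
    add₄ : ∀ a b c x y → form a b c (x ⊕ y) ≡ form a b c x +ᶠ form a b c y
    add₄ a b c x y = Tri.add₃ (slice a) b c x y
      where open MultilinearForms p prime using (module Tri)
    add₃ : ∀ a b x y c → form a b (x ⊕ y) c ≡ form a b x c +ᶠ form a b y c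
    add₃ a b x y c = Tri.add₂ (slice a) b x y c
      where open MultilinearForms p prime using (module Tri)
    add₂ : ∀ a x y b c → form a (x ⊕ y) b c ≡ form a x b c +ᶠ form a y b c
    add₂ a x y b c = Tri.add (slice a) x y b c
      where open MultilinearForms p prime using (module Tri)
    diag : Deg 5 (λ x → form x x x x)
    diag = deg-diagonal 3 (λ a x → form a x x x) (λ a a′ x → add a a′ x x x) λ a →
           deg-diagonal 2 (λ b x → form a b x x) (λ b b′ x → add₂ a b b′ x x) λ b →
           deg-diagonal 1 (λ c x → form a b c x) (λ c c′ x → add₃ a b c c′ x) λ c → deg-functional (add₄ a b c)

module ListSum (M : CommutativeMonoid 0ℓ 0ℓ) where
  open import Data.List.Base using (_++_)
  open CommutativeMonoid M using (Carrier; _≈_; _∙_; ε; assoc; identityˡ; setoid) renaming (refl to ≈refl; sym to ≈sym; trans to ≈trans; ∙-cong to ∙cong; ∙-congˡ to ∙congˡ)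
  open MonoidSum M using (sum)

  listSum : {A : Set} → (A → Carrier) → List A → Carrier
  listSum f xs = List.foldr _∙_ ε (List.map f xs)

  listSum-++ : {A : Set} (f : A → Carrier) (xs ys : List A) → listSum f (xs ++ ys) ≈ listSum f xs ∙ listSum f ys
  listSum-++ f []       ys = ≈sym (identityˡ _)
  listSum-++ f (x ∷ xs) ys = ≈trans (∙congˡ (listSum-++ f xs ys)) (≈sym (assoc _ _ _))

  listSum-map : {A B : Set} (f : B → Carrier) (g : A → B) (xs : List A) → listSum f (List.map g xs) ≡ listSum (f ∘ g) xs
  listSum-map f g xs = cong (List.foldr _∙_ ε) (sym (List.map-∘ xs))

  listSum-cong : {A : Set} {f g : A → Carrier} → (∀ x → f x ≈ g x) → ∀ xs → listSum f xs ≈ listSum g xs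
  listSum-cong h []       = ≈refl
  listSum-cong h (x ∷ xs) = ∙cong (h x) (listSum-cong h xs)

  listSum-product : {A B C : Set} (f : C → Carrier) (g : A → B → C) (xs : List A) (ys : List B) →
    listSum f (cartesianProductWith g xs ys) ≈ listSum (λ x → listSum (λ y → f (g x y)) ys) xs
  listSum-product f g []       ys = ≈refl
  listSum-product f g (x ∷ xs) ys = ≈trans (listSum-++ f (List.map (g x) ys) _)
    (∙cong (CommutativeMonoid.reflexive M (listSum-map f (g x) ys)) (listSum-product f g xs ys))

  listSum-tabulate : ∀ {k} {A : Set} (f : A → Carrier) (g : Fin k → A) → listSum f (tabulate g) ≡ sum (f ∘ g)
  listSum-tabulate {zero}  f g = refl
  listSum-tabulate {suc k} f g = cong (f (g Fin.zero) ∙_) (listSum-tabulate f (g ∘ Fin.suc))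

module PolynomialFunctions (p : ℕ) .{{nz : NonZero p}} (prime : Prime p) where
  import Data.Nat.ListAction as ℕ
  open PrimeField p prime
  open Count p prime using (module SumV)
  open DifferenceDegree p prime
  private
    module F = CommutativeRing 𝔽-ring
    module FS = NatSolver F.commutativeSemiring
    module Σᶠ = SumV F.+-commutativeMonoid
    module Fsum = MonoidSum F.+-commutativeMonoid
    module FL = ListSum F.+-commutativeMonoid

  module PointSum (M : CommutativeMonoid 0ℓ 0ℓ) where
    open ListSum M
    open SumV M
    open CommutativeMonoid M using (Carrier; _≈_; identityʳ) renaming (refl to ≈refl; trans to ≈trans; reflexive to ≈reflexive)
    open MonoidSum M using (sum; sum-cong-≋)

    listSum-points : ∀ n (f : V n → Carrier) → listSum f (points p n) ≈ ∑ n f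
    listSum-points zero    f = identityʳ (f [])
    listSum-points (suc n) f = ≈trans (listSum-product f _∷_ (allFin p) (points p n))
      (≈trans (≈reflexive (listSum-tabulate (λ a → listSum (λ x → f (a ∷ x)) (points p n)) id))
        (sum-cong-≋ {p} {λ a → listSum (λ x → f (a ∷ x)) (points p n)} {λ a → ∑ n λ x → f (a ∷ x)} λ a → listSum-points n λ x → f (a ∷ x)))

  open PointSum F.+-commutativeMonoid

  pow : F → ℕ → F
  pow a k = ⟦ toℕ a ℕ.^ k ⟧

  pow-suc : ∀ a k → pow a (suc k) ≡ a *ᶠ pow a k
  pow-suc a k = trans (⟦⟧-* (toℕ a) (toℕ a ℕ.^ k)) (cong (_*ᶠ pow a k) (⟦⟧-toℕ a))

  mono : ∀ {n} → Vec (Fin p) n → V n → F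
  mono e x = ⟦ monomial e x ⟧

  mono-∷ : ∀ {n} k (e : Vec (Fin p) n) a x → mono (k ∷ e) (a ∷ x) ≡ pow a (toℕ k) *ᶠ mono e x
  mono-∷ k e a x = ⟦⟧-* (toℕ a ℕ.^ toℕ k) (monomial e x)

  eval-∑ : ∀ {n} (f : Poly {p} n) x → eval f x ≡ Σᶠ.∑ n (λ e → f e *ᶠ mono e x)
  eval-∑ {n} f x = trans (homomorphic (points p n)) (trans
    (FL.listSum-cong (λ e → trans (⟦⟧-* (toℕ (f e)) (monomial e x)) (cong (_*ᶠ mono e x) (⟦⟧-toℕ (f e)))) (points p n))
    (listSum-points n (λ e → f e *ᶠ mono e x)))
    where
    homomorphic : ∀ es → ⟦ ℕ.sum (List.map (λ e → toℕ (f e) ℕ.* monomial e x) es) ⟧ ≡ FL.listSum (λ e → ⟦ toℕ (f e) ℕ.* monomial e x ⟧) es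
    homomorphic []       = refl
    homomorphic (e ∷ es) = trans (⟦⟧-+ _ _) (cong (⟦ toℕ (f e) ℕ.* monomial e x ⟧ +ᶠ_) (homomorphic es))

  deg-sum : ∀ {k m} d (g : Fin k → V m → F) → (∀ i → Deg d (g i)) → Deg d (λ x → Fsum.sum λ i → g i x)
  deg-sum {zero}  d g h = deg-zero d λ _ → refl
  deg-sum {suc k} d g h = deg-+ d (h Fin.zero) (deg-sum d (g ∘ Fin.suc) (h ∘ Fin.suc))

  deg-∑ : ∀ n {m} d (g : V n → V m → F) → (∀ e → Deg d (g e)) → Deg d (λ x → Σᶠ.∑ n λ e → g e x)
  deg-∑ zero    d g h = h []
  deg-∑ (suc n) d g h = deg-sum d _ λ a → deg-∑ n d (λ e → g (a ∷ e)) λ e → h (a ∷ e)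

  deg-pow : ∀ {n} k → Deg {suc n} (suc k) (λ x → pow (Vec.head x) k)
  deg-pow zero    = deg-const 1ᶠ
  deg-pow (suc k) = deg-cong (suc (suc k)) (λ x → sym (pow-suc (Vec.head x) k)) (deg-* 1 k (deg-functional {ℓ = Vec.head} head-add) (deg-pow k))
    where
    head-add : ∀ {n} (x y : V (suc n)) → Vec.head (x ⊕ y) ≡ Vec.head x +ᶠ Vec.head y
    head-add (a ∷ x) (b ∷ y) = refl

  deg-monomial : ∀ {n} (e : Vec (Fin p) n) → Deg (suc (totalDegree e)) (mono e)
  deg-monomial []      = deg-cong 1 (λ { [] → refl }) (deg-const 1ᶠ)
  deg-monomial (k ∷ e) = deg-cong _ (λ { (a ∷ x) → sym (mono-∷ k e a x) })
    (deg-* (toℕ k) (totalDegree e) (deg-pow (toℕ k)) (deg-additive _ Vec.tail tail-add (deg-monomial e)))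
    where
    tail-add : ∀ {n} (x y : V (suc n)) → Vec.tail (x ⊕ y) ≡ Vec.tail x ⊕ Vec.tail y
    tail-add (a ∷ x) (b ∷ y) = refl

  deg-eval : ∀ {n} d (f : Poly {p} n) → DegreeAtMost d f → Deg (suc d) (eval f)
  deg-eval {n} d f h = deg-cong (suc d) (λ x → sym (eval-∑ f x)) (deg-∑ n (suc d) (λ e x → f e *ᶠ mono e x) term)
    where
    term : ∀ e → Deg (suc d) (λ x → f e *ᶠ mono e x)
    term e with f e ≟ᶠ 0ᶠ
    ... | yes e≡0 = deg-zero (suc d) λ x → trans (cong (_*ᶠ mono e x) e≡0) (*ᶠ-zeroˡ (mono e x))
    ... | no e≢0  = deg-scale (suc d) (f e) (deg-≤ (s≤s (h e e≢0)) (deg-monomial e))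

  recip : F → F
  recip a with a ≟ᶠ 0ᶠ
  ... | yes _  = 0ᶠ
  ... | no a≢0 = proj₁ (inverse a a≢0)

  recip-* : ∀ {a} → a ≢ 0ᶠ → recip a *ᶠ a ≡ 1ᶠ
  recip-* {a} h with a ≟ᶠ 0ᶠ
  ... | yes a≡0 = contradiction a≡0 h
  ... | no a≢0  = proj₂ (inverse a a≢0)

  -- binom x j = (x - j + 1) / j · binom x (j - 1) as polynomials in x.
  coef : ℕ → ℕ → F
  coef zero    zero    = 1ᶠ
  coef zero    (suc k) = 0ᶠ
  coef (suc j) zero    = recip ⟦ suc j ⟧ *ᶠ neg (⟦ j ⟧ *ᶠ coef j zero)
  coef (suc j) (suc k) = recip ⟦ suc j ⟧ *ᶠ (coef j k +ᶠ neg (⟦ j ⟧ *ᶠ coef j (suc k)))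

  neg-0 : ∀ {a} → a ≡ 0ᶠ → neg a ≡ 0ᶠ
  neg-0 refl = -ᶠ-self 0ᶠ

  coef-large : ∀ j k → j < k → coef j k ≡ 0ᶠ
  coef-large zero    (suc k) _         = refl
  coef-large (suc j) (suc k) (s≤s j<k) = trans (cong (recip ⟦ suc j ⟧ *ᶠ_) (trans
    (cong₂ _+ᶠ_ (coef-large j k j<k) (neg-0 (trans (cong (⟦ j ⟧ *ᶠ_) (coef-large j (suc k) (ℕ.m<n⇒m<1+n j<k))) (*ᶠ-zeroʳ ⟦ j ⟧)))) (+ᶠ-identityˡ 0ᶠ))) (*ᶠ-zeroʳ (recip ⟦ suc j ⟧))

  Σ<-*ˡ : ∀ m c (h : ℕ → F) → Σ< m (λ j → c *ᶠ h j) ≡ c *ᶠ Σ< m h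
  Σ<-*ˡ zero    c h = sym (*ᶠ-zeroʳ c)
  Σ<-*ˡ (suc m) c h = trans (cong (c *ᶠ h 0 +ᶠ_) (Σ<-*ˡ m c (h ∘ suc))) (sym (*ᶠ-distribˡ c (h 0) (Σ< m (h ∘ suc))))

  binom-polynomial : ∀ j a m → j < m → j < p → Σ< m (λ k → coef j k *ᶠ pow a k) ≡ ⟦ binom (toℕ a) j ⟧
  binom-polynomial zero a (suc m) _ _ = trans (cong₂ _+ᶠ_ (*ᶠ-identityˡ 1ᶠ) (Σ<-zero m λ k _ → *ᶠ-zeroˡ _)) (+ᶠ-identityʳ 1ᶠ)
  binom-polynomial (suc j) a (suc m) (s≤s j<m) j+1<p = begin
    (r *ᶠ neg (b *ᶠ c 0)) *ᶠ pow a 0 +ᶠ Σ< m (λ k → (r *ᶠ (c k +ᶠ neg (b *ᶠ c (suc k)))) *ᶠ pow a (suc k))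
      ≡⟨ cong₂ _+ᶠ_ (trans (*ᶠ-assoc r _ (pow a 0)) (cong (r *ᶠ_) (neg-c 0)))
           (trans (Σ<-cong m λ k _ → trans (*ᶠ-assoc r _ (pow a (suc k))) (cong (r *ᶠ_) (split k))) (trans (Σ<-*ˡ m r (λ k → a *ᶠ t k +ᶠ neg b *ᶠ t (suc k))) (cong (r *ᶠ_) (Σ<-+ m (λ k → a *ᶠ t k) (λ k → neg b *ᶠ t (suc k)))))) ⟩
    r *ᶠ (neg b *ᶠ t 0) +ᶠ r *ᶠ (Σ< m (λ k → a *ᶠ t k) +ᶠ Σ< m (λ k → neg b *ᶠ t (suc k)))
      ≡⟨ cong₂ (λ x y → r *ᶠ (neg b *ᶠ t 0) +ᶠ r *ᶠ (x +ᶠ y)) (Σ<-*ˡ m a t) (Σ<-*ˡ m (neg b) (t ∘ suc)) ⟩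
    r *ᶠ (neg b *ᶠ t 0) +ᶠ r *ᶠ (a *ᶠ Σ< m t +ᶠ neg b *ᶠ Σ< m (t ∘ suc))
      ≡⟨ solve 6 (λ r n x a y z → r :* (n :* x) :+ r :* (a :* y :+ n :* z) := r :* (a :* y :+ n :* (x :+ z))) refl r (neg b) (t 0) a (Σ< m t) (Σ< m (t ∘ suc)) ⟩
    r *ᶠ (a *ᶠ Σ< m t +ᶠ neg b *ᶠ Σ< (suc m) t)
      ≡⟨ cong₂ (λ x y → r *ᶠ (a *ᶠ x +ᶠ neg b *ᶠ y)) (binom-polynomial j a m j<m j<p) (binom-polynomial j a (suc m) (ℕ.m<n⇒m<1+n j<m) j<p) ⟩
    r *ᶠ (a *ᶠ B +ᶠ neg b *ᶠ B)
      ≡⟨ cong (r *ᶠ_) (trans (cong (a *ᶠ B +ᶠ_) (neg-*ˡ b B)) (trans (sym (-ᶠ-def (a *ᶠ B) (b *ᶠ B))) (-ᶠ-unique absorb))) ⟩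
    r *ᶠ (⟦ suc j ⟧ *ᶠ B′)       ≡⟨ sym (*ᶠ-assoc r ⟦ suc j ⟧ B′) ⟩
    (r *ᶠ ⟦ suc j ⟧) *ᶠ B′       ≡⟨ cong (_*ᶠ B′) (recip-* (⟦⟧≢0 (s≤s z≤n) j+1<p)) ⟩
    1ᶠ *ᶠ B′                     ≡⟨ *ᶠ-identityˡ B′ ⟩
    B′                           ∎
    where
    open ≡-Reasoning
    open FS using (solve; _:+_; _:*_; _:=_)
    j<p : j < p
    j<p = ℕ.<⇒≤ j+1<p
    r b B B′ : F
    r = recip ⟦ suc j ⟧
    b = ⟦ j ⟧
    B = ⟦ binom (toℕ a) j ⟧
    B′ = ⟦ binom (toℕ a) (suc j) ⟧
    c t : ℕ → F
    c = coef j
    t k = c k *ᶠ pow a k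
    neg-c : ∀ k → neg (b *ᶠ c k) *ᶠ pow a k ≡ neg b *ᶠ t k
    neg-c k = trans (cong (_*ᶠ pow a k) (sym (neg-*ˡ b (c k)))) (*ᶠ-assoc (neg b) (c k) (pow a k))
    split : ∀ k → (c k +ᶠ neg (b *ᶠ c (suc k))) *ᶠ pow a (suc k) ≡ a *ᶠ t k +ᶠ neg b *ᶠ t (suc k)
    split k = trans (*ᶠ-distribʳ (pow a (suc k)) (c k) _) (cong₂ _+ᶠ_
      (trans (cong (c k *ᶠ_) (pow-suc a k)) (solve 3 (λ c a q → c :* (a :* q) := a :* (c :* q)) refl (c k) a (pow a k))) (neg-c (suc k)))
    absorb : a *ᶠ B ≡ ⟦ suc j ⟧ *ᶠ B′ +ᶠ b *ᶠ B
    absorb = begin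
      a *ᶠ B                                                          ≡⟨ cong (_*ᶠ B) (sym (⟦⟧-toℕ a)) ⟩
      ⟦ toℕ a ⟧ *ᶠ B                                                  ≡⟨ sym (⟦⟧-* (toℕ a) _) ⟩
      ⟦ toℕ a ℕ.* binom (toℕ a) j ⟧                                   ≡⟨ cong ⟦_⟧ (sym (binom-absorb (toℕ a) j)) ⟩
      ⟦ suc j ℕ.* binom (toℕ a) (suc j) ℕ.+ j ℕ.* binom (toℕ a) j ⟧   ≡⟨ ⟦⟧-+ (suc j ℕ.* binom (toℕ a) (suc j)) _ ⟩
      ⟦ suc j ℕ.* binom (toℕ a) (suc j) ⟧ +ᶠ ⟦ j ℕ.* binom (toℕ a) j ⟧ ≡⟨ cong₂ _+ᶠ_ (⟦⟧-* (suc j) _) (⟦⟧-* j _) ⟩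
      ⟦ suc j ⟧ *ᶠ B′ +ᶠ b *ᶠ B                                       ∎

  fsum-*ˡ : ∀ {k} c (f : Fin k → F) → Fsum.sum (λ i → c *ᶠ f i) ≡ c *ᶠ Fsum.sum f
  fsum-*ˡ {zero}  c f = sym (*ᶠ-zeroʳ c)
  fsum-*ˡ {suc k} c f = trans (cong (c *ᶠ f Fin.zero +ᶠ_) (fsum-*ˡ c (f ∘ Fin.suc))) (sym (*ᶠ-distribˡ c (f Fin.zero) (Fsum.sum (f ∘ Fin.suc))))

  ∑ᶠ-*ˡ : ∀ n c (f : V n → F) → Σᶠ.∑ n (λ x → c *ᶠ f x) ≡ c *ᶠ Σᶠ.∑ n f
  ∑ᶠ-*ˡ zero    c f = refl
  ∑ᶠ-*ˡ (suc n) c f = trans (Fsum.sum-cong-≗ {p} λ a → ∑ᶠ-*ˡ n c (λ x → f (a ∷ x))) (fsum-*ˡ {p} c (λ a → Σᶠ.∑ n λ x → f (a ∷ x)))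

  interpolation : ∀ n d (G : V n → F) → Deg d G →
    Σ (Poly {p} n) λ g → (∀ e → g e ≢ 0ᶠ → totalDegree e < d) × (∀ x → eval g x ≡ G x)
  interpolation zero d G h = (λ _ → G []) , (λ { [] g≢0 → small d h g≢0 }) ,
    λ { [] → trans (eval-∑ (λ _ → G []) []) (*ᶠ-identityʳ (G [])) }
    where
    small : ∀ d → Deg d G → G [] ≢ 0ᶠ → 0 < d
    small zero    h G≢0 = contradiction (deg-null h []) G≢0
    small (suc d) _ _   = s≤s z≤n
  interpolation (suc n) d G h = g , g-degree , g-eval
    where
    open ≡-Reasoning
    open FS using (solve; _:+_; _:*_; _:=_)
    Gⱼ : ℕ → V n → F
    Gⱼ j x = Δ^ j axis G (0ᶠ ∷ x)
    Gⱼ-deg : ∀ j → Deg (d ℕ.∸ j) (Gⱼ j)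
    Gⱼ-deg j = deg-additive (d ℕ.∸ j) (0ᶠ ∷_) (λ x y → cong (_∷ (x ⊕ y)) (sym (+ᶠ-identityˡ 0ᶠ)))
      (deg-Δ^ j (d ℕ.∸ j) axis (deg-≤ (ℕ.m≤n+m∸n d j) h))
    IH : ∀ j → Σ (Poly {p} n) λ g → (∀ e → g e ≢ 0ᶠ → totalDegree e < d ℕ.∸ j) × (∀ x → eval g x ≡ Gⱼ j x)
    IH j = interpolation n (d ℕ.∸ j) (Gⱼ j) (Gⱼ-deg j)
    B : Fin p → V n → F
    B j = proj₁ (IH (toℕ j))
    A : Fin p → Fin p → F
    A j k = coef (toℕ j) (toℕ k)
    g : Poly {p} (suc n)
    g (k ∷ e) = Fsum.sum {p} λ j → A j k *ᶠ B j e
    g-degree : ∀ e → g e ≢ 0ᶠ → totalDegree e < d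
    g-degree (k ∷ e) g≢0 with Fin.any? {n = p} (λ j → ¬? (A j k *ᶠ B j e ≟ᶠ 0ᶠ))
    ... | no ¬any = contradiction (trans (Fsum.sum-cong-≗ {p} λ j → decidable-stable (A j k *ᶠ B j e ≟ᶠ 0ᶠ) λ ≢0 → ¬any (j , ≢0)) (Fsum.sum-replicate-zero p)) g≢0
    ... | yes (j , ≢0) = ℕ.≤-trans (s≤s (ℕ.+-monoˡ-≤ (totalDegree e) k≤j)) j+e<d
      where
      k≤j : toℕ k ≤ toℕ j
      k≤j = ℕ.≮⇒≥ λ j<k → ≢0 (trans (cong (_*ᶠ B j e) (coef-large (toℕ j) (toℕ k) j<k)) (*ᶠ-zeroˡ (B j e)))
      e<d∸j : totalDegree e < d ℕ.∸ toℕ j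
      e<d∸j = proj₁ (proj₂ (IH (toℕ j))) e λ B≡0 → ≢0 (trans (cong (A j k *ᶠ_) B≡0) (*ᶠ-zeroʳ (A j k)))
      j+e<d : toℕ j ℕ.+ totalDegree e < d
      j+e<d = ℕ.≤-trans (ℕ.≤-reflexive (sym (ℕ.+-suc (toℕ j) _))) (ℕ.≤-trans (ℕ.+-monoʳ-≤ (toℕ j) e<d∸j)
        (ℕ.≤-reflexive (ℕ.m+[n∸m]≡n {toℕ j} {d} (ℕ.<⇒≤ (ℕ.≰⇒> λ d≤j → ℕ.<⇒≱ e<d∸j (subst (_≤ totalDegree e) (sym (ℕ.m≤n⇒m∸n≡0 d≤j)) z≤n))))))
    g-eval : ∀ x → eval g x ≡ G x
    g-eval (a ∷ x) = begin
      eval g (a ∷ x)                                                                    ≡⟨ eval-∑ g (a ∷ x) ⟩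
      Fsum.sum {p} (λ k → Σᶠ.∑ n λ e → g (k ∷ e) *ᶠ mono (k ∷ e) (a ∷ x))               ≡⟨ Fsum.sum-cong-≗ {p} (λ k → trans (Σᶠ.∑-cong n (expand k)) (sym (Σᶠ.sum-∑-swap {p} n (λ j e → Q j k *ᶠ R j e)))) ⟩
      Fsum.sum {p} (λ k → Fsum.sum {p} λ j → Σᶠ.∑ n λ e → Q j k *ᶠ R j e)               ≡⟨ Fsum.∑-comm {p} {p} (λ k j → Σᶠ.∑ n λ e → Q j k *ᶠ R j e) ⟩
      Fsum.sum {p} (λ j → Fsum.sum {p} λ k → Σᶠ.∑ n λ e → Q j k *ᶠ R j e)               ≡⟨ Fsum.sum-cong-≗ {p} (λ j → trans (Fsum.sum-cong-≗ {p} λ k → trans (∑ᶠ-*ˡ n (Q j k) (R j)) (*ᶠ-comm (Q j k) _)) (trans (fsum-*ˡ {p} (Σᶠ.∑ n (R j)) (Q j)) (*ᶠ-comm _ (Fsum.sum {p} (Q j))))) ⟩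
      Fsum.sum {p} (λ j → Fsum.sum {p} (Q j) *ᶠ Σᶠ.∑ n (R j))                           ≡⟨ Fsum.sum-cong-≗ {p} (λ j → cong₂ _*ᶠ_ (trans (sym (Σ<-sum p (λ k → coef (toℕ j) k *ᶠ pow a k))) (binom-polynomial (toℕ j) a p (Fin.toℕ<n j) (Fin.toℕ<n j)))
                                                                                             (trans (sym (eval-∑ (B j) x)) (proj₂ (proj₂ (IH (toℕ j))) x))) ⟩
      Fsum.sum {p} (λ j → ⟦ binom (toℕ a) (toℕ j) ⟧ *ᶠ Gⱼ (toℕ j) x)                    ≡⟨ sym (Σ<-sum p (λ j → ⟦ binom (toℕ a) j ⟧ *ᶠ Gⱼ j x)) ⟩
      Σ< p (λ j → ⟦ binom (toℕ a) j ⟧ *ᶠ Gⱼ j x)                                        ≡⟨ sym (newton axis (toℕ a) p (Fin.toℕ<n a) G (0ᶠ ∷ x)) ⟩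
      G ((0ᶠ ∷ x) ⊕ ⟦ toℕ a ⟧ · axis)                                                   ≡⟨ cong G (trans (cong (λ b → (0ᶠ ∷ x) ⊕ b · axis) (⟦⟧-toℕ a)) (on-axis a x)) ⟩
      G (a ∷ x)                                                                         ∎
      where
      Q : Fin p → Fin p → F
      Q j k = A j k *ᶠ pow a (toℕ k)
      R : Fin p → V n → F
      R j e = B j e *ᶠ mono e x
      expand : ∀ k e → g (k ∷ e) *ᶠ mono (k ∷ e) (a ∷ x) ≡ Fsum.sum {p} λ j → Q j k *ᶠ R j e
      expand k e = begin
        g (k ∷ e) *ᶠ mono (k ∷ e) (a ∷ x)                            ≡⟨ *ᶠ-comm (g (k ∷ e)) _ ⟩
        mono (k ∷ e) (a ∷ x) *ᶠ g (k ∷ e)                            ≡⟨ sym (fsum-*ˡ {p} (mono (k ∷ e) (a ∷ x)) (λ j → A j k *ᶠ B j e)) ⟩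
        Fsum.sum {p} (λ j → mono (k ∷ e) (a ∷ x) *ᶠ (A j k *ᶠ B j e)) ≡⟨ Fsum.sum-cong-≗ {p} (λ j → trans (cong (_*ᶠ (A j k *ᶠ B j e)) (mono-∷ k e a x))
            (solve 4 (λ w m a b → (w :* m) :* (a :* b) := (a :* w) :* (b :* m)) refl (pow a (toℕ k)) (mono e x) (A j k) (B j e))) ⟩
        Fsum.sum {p} (λ j → Q j k *ᶠ R j e)                          ∎

module CosetPartition (p : ℕ) .{{nz : NonZero p}} (prime : Prime p) where
  open import Data.List.Membership.Propositional using () renaming (_∈_ to _∈ₗ_)
  open import Data.List.Membership.Propositional.Properties using (∈-cartesianProductWith⁺; ∈-filter⁺; ∈-filter⁻; ∈-lookup; ∈-allFin)
  import Data.List.Relation.Unary.All as ListAll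
  open import Data.List.Relation.Unary.AllPairs using ([]; _∷_)
  open import Data.List.Relation.Unary.Any using (here; index)
  open import Data.List.Relation.Unary.Any.Properties using (lookup-index)
  open import Data.List.Relation.Unary.Unique.Propositional using (Unique)
  open import Data.List.Relation.Unary.Unique.Propositional.Properties using (cartesianProductWith⁺; allFin⁺; filter⁺)
  open PrimeField p prime
  open MultilinearForms p prime using (Quad)
  open IsotropicSystems p prime using (IsotropicSystem)
  open DifferenceDegree p prime
  open PolynomialFunctions p prime using (deg-eval; interpolation)

  Δ*-cong : ∀ {n k} (ys : Vec (V n) k) {f g : V n → F} → (∀ x → f x ≡ g x) → ∀ x → Δ* ys f x ≡ Δ* ys g x
  Δ*-cong []       h = h
  Δ*-cong (y ∷ ys) h = Δ*-cong ys λ x → cong₂ _-ᶠ_ (h (x ⊕ y)) (h x)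

  Δ-+ : ∀ {n} y (f g : V n → F) x → Δ y (λ x → f x +ᶠ g x) x ≡ Δ y f x +ᶠ Δ y g x
  Δ-+ y f g x = -ᶠ-unique (begin
    f (x ⊕ y) +ᶠ g (x ⊕ y)                      ≡⟨ cong₂ _+ᶠ_ (sym (-ᶠ-cancel _ (f x))) (sym (-ᶠ-cancel _ (g x))) ⟩
    (a +ᶠ f x) +ᶠ (b +ᶠ g x)                    ≡⟨ +ᶠ-assoc a (f x) _ ⟩
    a +ᶠ (f x +ᶠ (b +ᶠ g x))                    ≡⟨ cong (a +ᶠ_) (trans (sym (+ᶠ-assoc (f x) b _)) (trans (cong (_+ᶠ g x) (+ᶠ-comm (f x) b)) (+ᶠ-assoc b (f x) _))) ⟩
    a +ᶠ (b +ᶠ (f x +ᶠ g x))                    ≡⟨ sym (+ᶠ-assoc a b _) ⟩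
    (a +ᶠ b) +ᶠ (f x +ᶠ g x)                    ∎)
    where
    open ≡-Reasoning
    a b : F
    a = Δ y f x
    b = Δ y g x

  Δ*-+ : ∀ {n k} (ys : Vec (V n) k) (f g : V n → F) x → Δ* ys (λ x → f x +ᶠ g x) x ≡ Δ* ys f x +ᶠ Δ* ys g x
  Δ*-+ []       f g x = refl
  Δ*-+ (y ∷ ys) f g x = trans (Δ*-cong ys (Δ-+ y f g) x) (Δ*-+ ys (Δ y f) (Δ y g) x)

  Δ*-affine : ∀ {m n k} (φ : V m → V n) → Additive φ → ∀ o (f : V n → F) (ys : Vec (V m) k) x →
    Δ* ys (λ x → f (o ⊕ φ x)) x ≡ Δ* (Vec.map φ ys) f (o ⊕ φ x)
  Δ*-affine φ add o f []       x = refl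
  Δ*-affine φ add o f (y ∷ ys) x = trans
    (Δ*-cong ys (λ x → cong (λ z → f z -ᶠ f (o ⊕ φ x)) (trans (cong (o ⊕_) (add x y)) (sym (⊕-assoc o _ _)))) x)
    (Δ*-affine φ add o (Δ (φ y) f) ys x)

  Δ*-shift : ∀ {n k} (ys : Vec (V n) k) (f : V n → F) a x → Δ* ys (λ x → f (x ⊕ a)) x ≡ Δ* ys f (x ⊕ a)
  Δ*-shift ys f a x = trans (Δ*-cong ys (λ x → cong f (⊕-comm x a)) x)
    (trans (Δ*-affine id (λ _ _ → refl) a f ys x) (cong₂ (λ ys x → Δ* ys f x) (Vec.map-id ys) (⊕-comm a x)))

  Δ-comm : ∀ {n} y z (f : V n → F) x → Δ y (Δ z f) x ≡ Δ z (Δ y f) x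
  Δ-comm y z f x = -ᶠ-unique (-ᶠ-unique (begin
    f ((x ⊕ y) ⊕ z)                                     ≡⟨ cong f (trans (⊕-assoc x y z) (trans (cong (x ⊕_) (⊕-comm y z)) (sym (⊕-assoc x z y)))) ⟩
    f ((x ⊕ z) ⊕ y)                                     ≡⟨ sym (-ᶠ-cancel _ (f (x ⊕ z))) ⟩
    Δ y f (x ⊕ z) +ᶠ f (x ⊕ z)                          ≡⟨ cong₂ _+ᶠ_ (sym (-ᶠ-cancel _ (Δ y f x))) (sym (-ᶠ-cancel _ (f x))) ⟩
    (a +ᶠ b) +ᶠ (c +ᶠ f x)                              ≡⟨ +ᶠ-assoc a b _ ⟩
    a +ᶠ (b +ᶠ (c +ᶠ f x))                              ≡⟨ cong (a +ᶠ_) (trans (sym (+ᶠ-assoc b c _)) (trans (cong (_+ᶠ f x) (+ᶠ-comm b c)) (+ᶠ-assoc c b _))) ⟩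
    a +ᶠ (c +ᶠ (b +ᶠ f x))                              ≡⟨ cong (λ w → a +ᶠ (c +ᶠ w)) (-ᶠ-cancel _ (f x)) ⟩
    a +ᶠ (c +ᶠ f (x ⊕ y))                               ≡⟨ sym (+ᶠ-assoc a c _) ⟩
    (a +ᶠ c) +ᶠ f (x ⊕ y)                               ∎))
    where
    open ≡-Reasoning
    a b c : F
    a = Δ z (Δ y f) x
    b = Δ y f x
    c = Δ z f x

  Δ-⊕ : ∀ {n} y y′ (f : V n → F) x → Δ (y ⊕ y′) f x ≡ Δ y f (x ⊕ y′) +ᶠ Δ y′ f x
  Δ-⊕ y y′ f x = -ᶠ-unique (begin
    f (x ⊕ (y ⊕ y′))                                    ≡⟨ cong f (trans (cong (x ⊕_) (⊕-comm y y′)) (sym (⊕-assoc x y′ y))) ⟩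
    f ((x ⊕ y′) ⊕ y)                                    ≡⟨ sym (-ᶠ-cancel _ (f (x ⊕ y′))) ⟩
    Δ y f (x ⊕ y′) +ᶠ f (x ⊕ y′)                        ≡⟨ cong (Δ y f (x ⊕ y′) +ᶠ_) (sym (-ᶠ-cancel _ (f x))) ⟩
    Δ y f (x ⊕ y′) +ᶠ (Δ y′ f x +ᶠ f x)                 ≡⟨ sym (+ᶠ-assoc (Δ y f (x ⊕ y′)) _ _) ⟩
    (Δ y f (x ⊕ y′) +ᶠ Δ y′ f x) +ᶠ f x                 ∎)
    where open ≡-Reasoning

  deg-Δ* : ∀ {n k} d {f : V n → F} (ys : Vec (V n) k) → Deg (k ℕ.+ d) f → Deg d (Δ* ys f)
  deg-Δ* d []       h        = h
  deg-Δ* d (y ∷ ys) (next h) = deg-Δ* d ys (h y)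

  Δ*-null⇒deg : ∀ {n} k {f : V n → F} → (∀ (ys : Vec (V n) k) x → Δ* ys f x ≡ 0ᶠ) → Deg k f
  Δ*-null⇒deg zero    h = null (h [])
  Δ*-null⇒deg (suc k) h = next λ y → Δ*-null⇒deg k λ ys → h (y ∷ ys)

  constant : ∀ {n} {f : V n → F} → Deg 1 f → ∀ x → f x ≡ f 𝟘
  constant {f = f} h x = trans (cong f (sym (⊕-identityˡ x))) (-ᶠ≡0 (deg-null (deg-next h x) 𝟘))

  module _ {n : ℕ} (f : V n → F) (deg : Deg 5 f) where

    fourth-constant : ∀ (ys : Vec (V n) 4) x → Δ* ys f x ≡ Δ* ys f 𝟘
    fourth-constant ys = constant (deg-Δ* 1 ys deg)

    fourth-derivative : Quad n
    fourth-derivative = record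
      { form  = λ a b c d → Δ* (a ∷ b ∷ c ∷ d ∷ []) f 𝟘
      ; add   = λ a a′ b c d → let ys = b ∷ c ∷ d ∷ [] in
          trans (Δ*-cong ys (Δ-⊕ a a′ f) 𝟘)
          (trans (Δ*-+ ys (λ x → Δ a f (x ⊕ a′)) (Δ a′ f) 𝟘)
          (cong (_+ᶠ Δ* ys (Δ a′ f) 𝟘) (trans (Δ*-shift ys (Δ a f) a′ 𝟘) (fourth-constant (a ∷ ys) (𝟘 ⊕ a′)))))
      ; sym₁₂ = λ a b c d → Δ*-cong (c ∷ d ∷ []) (λ x → Δ-comm b a f x) 𝟘
      ; sym₂₃ = λ a b c d → Δ*-cong (d ∷ []) (λ x → Δ-comm c b (Δ a f) x) 𝟘
      ; sym₃₄ = λ a b c d → Δ-comm d c (Δ b (Δ a f)) 𝟘 }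

  units : ∀ n → Vec (V n) n
  units zero    = []
  units (suc n) = (1ᶠ ∷ 𝟘) ∷ Vec.map (0ᶠ ∷_) (units n)

  combination-0∷ : ∀ {n d} (a : V d) (vs : Vec (V n) d) → combination a (Vec.map (0ᶠ ∷_) vs) ≡ 0ᶠ ∷ combination a vs
  combination-0∷ []      []       = refl
  combination-0∷ (a ∷ c) (v ∷ vs) = trans (cong (a · (0ᶠ ∷ v) ⊕_) (combination-0∷ c vs))
    (cong (_∷ (a · v ⊕ combination c vs)) (trans (cong (_+ᶠ 0ᶠ) (*ᶠ-zeroʳ a)) (+ᶠ-identityˡ 0ᶠ)))

  combination-units : ∀ {n} (a : V n) → combination a (units n) ≡ a
  combination-units []      = refl
  combination-units (a ∷ c) = trans (cong (a · (1ᶠ ∷ 𝟘) ⊕_) (trans (combination-0∷ c (units _)) (cong (0ᶠ ∷_) (combination-units c))))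
    (cong₂ _∷_ (trans (+ᶠ-identityʳ _) (*ᶠ-identityʳ a)) (trans (cong (_⊕ c) (·-zeroʳ a)) (⊕-identityˡ c)))

  whole : ∀ n → Subspace {p} n
  whole n = record { dim = n ; basis = units n ; independent = λ a h → trans (sym (combination-units a)) h }

  points-complete : ∀ {n} (x : V n) → x ∈ₗ points p n
  points-complete []      = here refl
  points-complete (a ∷ x) = ∈-cartesianProductWith⁺ _∷_ (∈-allFin a) (points-complete x)

  points-unique : ∀ n → Unique (points p n)
  points-unique zero    = ListAll.[] ∷ []
  points-unique (suc n) = cartesianProductWith⁺ _∷_ Vec.∷-injective (allFin⁺ p) (points-unique n)

  lookup-injective : ∀ {A : Set} {xs : List A} → Unique xs → ∀ i j → List.lookup xs i ≡ List.lookup xs j → i ≡ j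
  lookup-injective (h ∷ u) Fin.zero    Fin.zero    e = refl
  lookup-injective (h ∷ u) Fin.zero    (Fin.suc j) e = contradiction e (ListAll.lookup h (∈-lookup j))
  lookup-injective (h ∷ u) (Fin.suc i) Fin.zero    e = contradiction (sym e) (ListAll.lookup h (∈-lookup i))
  lookup-injective (h ∷ u) (Fin.suc i) (Fin.suc j) e = cong Fin.suc (lookup-injective u i j e)

  module _ {n : ℕ} (f : Poly {p} n) (deg≤4 : DegreeAtMost 4 f) where

    fourth : Quad n
    fourth = fourth-derivative (eval f) (deg-eval 4 f deg≤4)

    module _ (W : IsotropicSystem fourth) where
      open IsotropicSystem W

      φ : V rank → V n
      φ a = combination a vectors′

      φ-add : Additive φ
      φ-add = combination-additive vectors′

      direction : Subspace {p} n
      direction = record { dim = rank ; basis = vectors′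
                         ; independent = λ a h → trans (sym (coords-comb a)) (trans (cong coords h) (additive-0 coords coords-add)) }

      representatives : List (V n)
      representatives = filter (λ x → coords x ≟ⱽ 𝟘) (points p n)

      coset : Fin (List.length representatives) → AffineSubspace {p} n
      coset i = record { origin = List.lookup representatives i ; direction = direction }

      residue : V n → V n
      residue x = x ⊖ φ (coords x)

      residue-coords : ∀ x → coords (residue x) ≡ 𝟘
      residue-coords x = trans (additive-⊖ coords coords-add x _) (trans (cong (coords x ⊖_) (coords-comb (coords x))) (⊕-inverseʳ (coords x)))

      residue∈ : ∀ x → residue x ∈ₗ representatives
      residue∈ x = ∈-filter⁺ (λ x → coords x ≟ⱽ 𝟘) (points-complete (residue x)) (residue-coords x)

      partition : IsPartition (whole n) coset
      partition = (λ _ x _ → x , sym (combination-units x)) , λ x _ → index (residue∈ x) ,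
        (φ (coords x) , (coords x , refl) , trans (sym (⊖-⊕ x (φ (coords x)))) (cong (_⊕ φ (coords x)) (lookup-index (residue∈ x)))) ,
        λ {j} (v , (a , v≡) , x≡) → lookup-injective (filter⁺ (λ x → coords x ≟ⱽ 𝟘) (points-unique n)) _ _
          (trans (sym (lookup-index (residue∈ x))) (origin-residue j a (trans x≡ (cong (List.lookup representatives j ⊕_) v≡))))
        where
        origin-residue : ∀ {x} j a → x ≡ List.lookup representatives j ⊕ φ a → residue x ≡ List.lookup representatives j
        origin-residue {x} j a x≡ = trans (cong (λ b → x ⊖ φ b) coords≡) (trans (cong (_⊖ φ a) x≡) (⊕-⊖ _ (φ a)))
          where
          coords≡ : coords x ≡ a
          coords≡ = trans (cong coords x≡) (trans (coords-add _ (φ a)) (trans (cong₂ _⊕_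
            (proj₂ (∈-filter⁻ (λ x → coords x ≟ⱽ 𝟘) {xs = points p n} (∈-lookup j))) (coords-comb a)) (⊕-identityˡ a)))

      cubic : ∀ A → AffineSubspace.direction A ≡ direction → CubicOn A f
      cubic A refl = let (g , g-deg , g-eval) = interpolation n 4 (λ x → h (coords (x ⊖ o))) G-deg in
        g , (λ e g≢0 → ℕ.≤-pred (g-deg e g≢0)) , λ { x (v , (a , refl) , refl) → trans (cong (λ b → eval f (o ⊕ φ b)) (sym (coords≡ a))) (sym (g-eval _)) }
        where
        o : V n
        o = AffineSubspace.origin A
        h : V rank → F
        h a = eval f (o ⊕ φ a)
        h-null : ∀ (ys : Vec (V rank) 4) a → Δ* ys h a ≡ 0ᶠ
        h-null ys@(b ∷ c ∷ d ∷ e ∷ []) a = trans (Δ*-affine φ φ-add o (eval f) ys a)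
          (trans (fourth-constant (eval f) (deg-eval 4 f deg≤4) (Vec.map φ ys) (o ⊕ φ a)) (isotropy b c d e))
        coords≡ : ∀ a → coords ((o ⊕ φ a) ⊖ o) ≡ a
        coords≡ a = trans (cong coords (trans (cong (_⊖ o) (⊕-comm o (φ a))) (⊕-⊖ (φ a) o))) (coords-comb a)
        G-deg : Deg 4 (λ x → h (coords (x ⊖ o)))
        G-deg = deg-cong 4 (λ x → cong h (trans (⊕-comm (coords (⊝ o)) (coords x)) (sym (coords-add x (⊝ o)))))
          (deg-affine 4 {h} coords coords-add (coords (⊝ o)) (Δ*-null⇒deg 4 h-null))

module Rationals where

  <⇒≱ : ∀ {a b} → a ℚ.< b → ¬ b ℚ.≤ a
  <⇒≱ a<b b≤a = ℚ.<-irrefl refl (ℚ.<-≤-trans a<b b≤a)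

  toℚᵘ-fromℕ : ∀ m → toℚᵘ (fromℕ m) ℚᵘ.≃ mkℚᵘ (+ m) 0
  toℚᵘ-fromℕ m = ℚ.toℚᵘ-fromℚᵘ (mkℚᵘ (+ m) 0)

  fromℕ-+ : ∀ m n → fromℕ (m ℕ.+ n) ≡ fromℕ m ℚ.+ fromℕ n
  fromℕ-+ m n = ℚ.toℚᵘ-injective (begin
    toℚᵘ (fromℕ (m ℕ.+ n))                  ≈⟨ toℚᵘ-fromℕ (m ℕ.+ n) ⟩
    mkℚᵘ (+ (m ℕ.+ n)) 0                    ≈⟨ *≡* (cong (ℤ._* + 1) (trans (ℤ.pos-+ m n) (cong₂ ℤ._+_ (sym (ℤ.*-identityʳ (+ m))) (sym (ℤ.*-identityʳ (+ n)))))) ⟩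
    mkℚᵘ (+ m) 0 ℚᵘ.+ mkℚᵘ (+ n) 0          ≈⟨ ℚᵘ.+-cong (ℚᵘ.≃-sym (toℚᵘ-fromℕ m)) (ℚᵘ.≃-sym (toℚᵘ-fromℕ n)) ⟩
    toℚᵘ (fromℕ m) ℚᵘ.+ toℚᵘ (fromℕ n)      ≈⟨ ℚᵘ.≃-sym (ℚ.toℚᵘ-homo-+ (fromℕ m) (fromℕ n)) ⟩
    toℚᵘ (fromℕ m ℚ.+ fromℕ n)              ∎)
    where open ℚᵘ.≃-Reasoning

  fromℕ-* : ∀ m n → fromℕ (m ℕ.* n) ≡ fromℕ m ℚ.* fromℕ n
  fromℕ-* m n = ℚ.toℚᵘ-injective (begin
    toℚᵘ (fromℕ (m ℕ.* n))                  ≈⟨ toℚᵘ-fromℕ (m ℕ.* n) ⟩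
    mkℚᵘ (+ (m ℕ.* n)) 0                    ≈⟨ *≡* (cong (ℤ._* + 1) (ℤ.pos-* m n)) ⟩
    mkℚᵘ (+ m) 0 ℚᵘ.* mkℚᵘ (+ n) 0          ≈⟨ ℚᵘ.*-cong (ℚᵘ.≃-sym (toℚᵘ-fromℕ m)) (ℚᵘ.≃-sym (toℚᵘ-fromℕ n)) ⟩
    toℚᵘ (fromℕ m) ℚᵘ.* toℚᵘ (fromℕ n)      ≈⟨ ℚᵘ.≃-sym (ℚ.toℚᵘ-homo-* (fromℕ m) (fromℕ n)) ⟩
    toℚᵘ (fromℕ m ℚ.* fromℕ n)              ∎)
    where open ℚᵘ.≃-Reasoning

  fromℕ-suc : ∀ n → fromℕ (suc n) ≡ 1ℚ ℚ.+ fromℕ n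
  fromℕ-suc n = fromℕ-+ 1 n

  fromℕ-mono : ∀ m n → m ℕ.≤ n → fromℕ m ℚ.≤ fromℕ n
  fromℕ-mono m n h = ℚ.toℚᵘ-cancel-≤ (ℚᵘ.≤-respˡ-≃ (ℚᵘ.≃-sym (toℚᵘ-fromℕ m)) (ℚᵘ.≤-respʳ-≃ (ℚᵘ.≃-sym (toℚᵘ-fromℕ n))
    (*≤* (ℤ.*-monoʳ-≤-nonNeg (+ 1) (ℤ.+≤+ h)))))

  fromℕ-cancel : ∀ m n → fromℕ m ℚ.≤ fromℕ n → m ℕ.≤ n
  fromℕ-cancel m n h with m ℕ.≤? n
  ... | yes m≤n = m≤n
  ... | no m≰n = contradiction (ℚ.≤-trans (ℚ.≤-reflexive (sym (fromℕ-suc n))) (ℚ.≤-trans (fromℕ-mono (suc n) m (ℕ.≰⇒> m≰n)) h))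
                   (<⇒≱ (subst (ℚ._< 1ℚ ℚ.+ fromℕ n) (ℚ.+-identityˡ (fromℕ n)) (ℚ.+-monoˡ-< (fromℕ n) (ℚ.positive⁻¹ 1ℚ))))

  0≤fromℕ : ∀ n → 0ℚ ℚ.≤ fromℕ n
  0≤fromℕ n = fromℕ-mono 0 n ℕ.z≤n

  reciprocal : ∀ m .{{_ : NonZero m}} → fromℕ m ℚ.* (+ 1 / m) ≡ 1ℚ
  reciprocal m@(suc k) = ℚ.toℚᵘ-injective (begin
    toℚᵘ (fromℕ m ℚ.* (+ 1 / m))            ≈⟨ ℚ.toℚᵘ-homo-* (fromℕ m) (+ 1 / m) ⟩
    toℚᵘ (fromℕ m) ℚᵘ.* toℚᵘ (+ 1 / m)      ≈⟨ ℚᵘ.*-cong (toℚᵘ-fromℕ m) (ℚ.toℚᵘ-fromℚᵘ (mkℚᵘ (+ 1) k)) ⟩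
    mkℚᵘ (+ m) 0 ℚᵘ.* mkℚᵘ (+ 1) k          ≈⟨ *≡* (trans (ℤ.*-identityʳ _) (trans (ℤ.*-identityʳ (+ m)) (trans (cong +_ (sym (ℕ.+-identityʳ m))) (sym (ℤ.*-identityˡ _))))) ⟩
    toℚᵘ 1ℚ                                 ∎)
    where open ℚᵘ.≃-Reasoning

  0≤⇒* : ∀ {a b} → 0ℚ ℚ.≤ a → 0ℚ ℚ.≤ b → 0ℚ ℚ.≤ a ℚ.* b
  0≤⇒* {a} {b} ha hb = ℚ.≤-trans (ℚ.≤-reflexive (sym (ℚ.*-zeroʳ a))) (ℚ.*-monoˡ-≤-nonNeg a {{ℚ.nonNegative ha}} hb)

  0≤⇒+ : ∀ {a b} → 0ℚ ℚ.≤ a → 0ℚ ℚ.≤ b → 0ℚ ℚ.≤ a ℚ.+ b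
  0≤⇒+ ha hb = ℚ.≤-trans (ℚ.≤-reflexive (sym (ℚ.+-identityˡ 0ℚ))) (ℚ.+-mono-≤ ha hb)

  *-monoˡ : ∀ {a b c} → 0ℚ ℚ.≤ a → b ℚ.≤ c → a ℚ.* b ℚ.≤ a ℚ.* c
  *-monoˡ {a} ha = ℚ.*-monoˡ-≤-nonNeg a {{ℚ.nonNegative ha}}

  *-monoʳ : ∀ {a b c} → 0ℚ ℚ.≤ a → b ℚ.≤ c → b ℚ.* a ℚ.≤ c ℚ.* a
  *-monoʳ {a} ha = ℚ.*-monoʳ-≤-nonNeg a {{ℚ.nonNegative ha}}

  *-mono : ∀ {a b c d} → 0ℚ ℚ.≤ a → 0ℚ ℚ.≤ c → a ℚ.≤ b → c ℚ.≤ d → a ℚ.* c ℚ.≤ b ℚ.* d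
  *-mono ha hc a≤b c≤d = ℚ.≤-trans (*-monoˡ ha c≤d) (*-monoʳ (ℚ.≤-trans hc c≤d) a≤b)

  ≤-+ʳ : ∀ {a b} → 0ℚ ℚ.≤ b → a ℚ.≤ a ℚ.+ b
  ≤-+ʳ {a} hb = ℚ.≤-trans (ℚ.≤-reflexive (sym (ℚ.+-identityʳ a))) (ℚ.+-monoʳ-≤ a hb)

  a≤∣a∣ : ∀ a → a ℚ.≤ ℚ.∣ a ∣
  a≤∣a∣ a with ℚ.≤-total 0ℚ a
  ... | inj₁ h = ℚ.≤-reflexive (sym (ℚ.0≤p⇒∣p∣≡p h))
  ... | inj₂ h = ℚ.≤-trans h (ℚ.0≤∣p∣ a)

  square≥0 : ∀ a → 0ℚ ℚ.≤ a ℚ.* a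
  square≥0 a with ℚ.≤-total 0ℚ a
  ... | inj₁ h = 0≤⇒* h h
  ... | inj₂ h = subst (0ℚ ℚ.≤_) (solve 1 (λ a → (:- a) :* (:- a) := a :* a) refl a) (0≤⇒* (ℚ.neg-antimono-≤ h) (ℚ.neg-antimono-≤ h))
    where
    open ℚ-Solver.+-*-Solver using (solve; _:*_; :-_; _:=_)

  inverse-factorial : ℕ → ℚ
  inverse-factorial j = _/_ (+ 1) (j !) {{j ℕ.!≢0}}

  inverse-factorial-suc : ∀ j → fromℕ (suc j) ℚ.* inverse-factorial (suc j) ≡ inverse-factorial j
  inverse-factorial-suc j = begin
    s ℚ.* f₁                               ≡⟨ sym (ℚ.*-identityˡ _) ⟩
    1ℚ ℚ.* (s ℚ.* f₁)                      ≡⟨ cong (ℚ._* (s ℚ.* f₁)) (sym (reciprocal (j !) {{j ℕ.!≢0}})) ⟩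
    (m ℚ.* f₀) ℚ.* (s ℚ.* f₁)              ≡⟨ solve 4 (λ m f s g → (m :* f) :* (s :* g) := f :* ((s :* m) :* g)) refl m f₀ s f₁ ⟩
    f₀ ℚ.* ((s ℚ.* m) ℚ.* f₁)              ≡⟨ cong (λ x → f₀ ℚ.* (x ℚ.* f₁)) (sym (fromℕ-* (suc j) (j !))) ⟩
    f₀ ℚ.* (fromℕ ((suc j) !) ℚ.* f₁)      ≡⟨ cong (f₀ ℚ.*_) (reciprocal ((suc j) !) {{(suc j) ℕ.!≢0}}) ⟩
    f₀ ℚ.* 1ℚ                              ≡⟨ ℚ.*-identityʳ f₀ ⟩
    f₀                                     ∎
    where
    open ≡-Reasoning
    open ℚ-Solver.+-*-Solver using (solve; _:*_; _:=_)
    s m f₀ f₁ : ℚ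
    s = fromℕ (suc j)
    m = fromℕ (j !)
    f₀ = inverse-factorial j
    f₁ = inverse-factorial (suc j)

  above : ∀ a → ∃[ n ] a ℚ.≤ fromℕ n
  above a@(ℚ.mkℚ n d c) = ℤ.∣ n ∣ , ℚ.toℚᵘ-cancel-≤ (ℚᵘ.≤-respʳ-≃ (ℚᵘ.≃-sym (toℚᵘ-fromℕ ℤ.∣ n ∣))
    (*≤* (ℤ.≤-trans (ℤ.≤-reflexive (ℤ.*-identityʳ n)) (ℤ.≤-trans (n≤∣n∣ n) (ℤ.≤-trans (ℤ.≤-reflexive (sym (ℤ.*-identityʳ (+ ℤ.∣ n ∣)))) (ℤ.*-monoˡ-≤-nonNeg (+ ℤ.∣ n ∣) (ℤ.+≤+ (ℕ.s≤s (ℕ.z≤n {d})))))))))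
    where
    n≤∣n∣ : ∀ n → n ℤ.≤ + ℤ.∣ n ∣
    n≤∣n∣ (+ n)      = ℤ.≤-refl
    n≤∣n∣ ℤ.-[1+ n ] = ℤ.-≤+

  archimedes : ∀ {ε} → 0ℚ ℚ.< ε → ∃[ n ] 1ℚ ℚ.≤ fromℕ n ℚ.* ε
  archimedes {ε} 0<ε = let (n , h) = above 1/ε in n , ℚ.≤-trans (ℚ.≤-reflexive (sym (ℚ.*-inverseˡ ε {{nz}}))) (*-monoʳ (ℚ.<⇒≤ 0<ε) h)
    where
    nz : ℚ.NonZero ε
    nz = ℚ.pos⇒nonZero ε {{ℚ.positive 0<ε}}
    1/ε : ℚ
    1/ε = (ℚ.1/ ε) {{nz}}

open Rationals

module PartialExponentials {A : Set} {add mul : A → A → A} {neg : A → A} {0# 1# : A}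
  (isRing : IsCommutativeRing _≡_ add mul neg 0# 1#)
  (ι : ℕ → A) (ι-0 : ι 0 ≡ 0#) (ι-suc : ∀ n → ι (suc n) ≡ add 1# (ι n))
  (f : ℕ → A) (f-0 : f 0 ≡ 1#) (f-suc : ∀ j → mul (ι (suc j)) (f (suc j)) ≡ f j)
  (g : ℕ → A) (g-inverse : ∀ j → mul (g j) (ι (suc j)) ≡ 1#) where

  private
    R : CommutativeRing 0ℓ 0ℓ
    R = record { isCommutativeRing = isRing }
    module R = CommutativeRing R
    module S = NatSolver R.commutativeSemiring
    open S using (solve; _:+_; _:*_; _:=_; con)
    infixl 6 _⊹_
    infixl 7 _⊛_
    _⊹_ _⊛_ : A → A → A
    _⊹_ = add
    _⊛_ = mul

  infixr 8 _↑_
  _↑_ : A → ℕ → A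
  z ↑ zero  = 1#
  z ↑ suc k = z ⊛ (z ↑ k)

  e : ℕ → A → A
  e j z = f j ⊛ (z ↑ j)

  E : ℕ → A → A
  E zero    z = e zero z
  E (suc k) z = E k z ⊹ e (suc k) z

  e-0 : ∀ z → e 0 z ≡ 1#
  e-0 z = trans (R.*-identityʳ (f 0)) f-0

  e-suc : ∀ j z → ι (suc j) ⊛ e (suc j) z ≡ z ⊛ e j z
  e-suc j z = begin
    ι (suc j) ⊛ (f (suc j) ⊛ (z ⊛ (z ↑ j)))   ≡⟨ solve 4 (λ a b c d → a :* (b :* (c :* d)) := c :* ((a :* b) :* d)) refl (ι (suc j)) (f (suc j)) z (z ↑ j) ⟩
    z ⊛ ((ι (suc j) ⊛ f (suc j)) ⊛ (z ↑ j))   ≡⟨ cong (λ x → z ⊛ (x ⊛ (z ↑ j))) (f-suc j) ⟩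
    z ⊛ e j z                                 ∎
    where open ≡-Reasoning

  ι-+ : ∀ m n → ι (m ℕ.+ n) ≡ ι m ⊹ ι n
  ι-+ zero    n = trans (sym (R.+-identityˡ (ι n))) (cong (_⊹ ι n) (sym ι-0))
  ι-+ (suc m) n = trans (ι-suc (m ℕ.+ n)) (trans (cong (1# ⊹_) (ι-+ m n)) (trans (sym (R.+-assoc 1# (ι m) (ι n))) (cong (_⊹ ι n) (sym (ι-suc m)))))

  cancel : ∀ j {x y} → ι (suc j) ⊛ x ≡ ι (suc j) ⊛ y → x ≡ y
  cancel j {x} {y} h = trans (expand x) (trans (cong (g j ⊛_) h) (sym (expand y)))
    where
    expand : ∀ x → x ≡ g j ⊛ (ι (suc j) ⊛ x)
    expand x = trans (sym (R.*-identityˡ x)) (trans (cong (_⊛ x) (sym (g-inverse j))) (R.*-assoc (g j) (ι (suc j)) x))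

  module _ (z w : A) where

    -- conv i j = ∑ e a z ⊛ e b w over a ⊹ b = i ⊹ j with a ≥ i
    conv conv-left conv-right : ℕ → ℕ → A
    conv i zero    = e i z ⊛ e 0 w
    conv i (suc j) = e i z ⊛ e (suc j) w ⊹ conv (suc i) j

    conv-left i zero    = ι i ⊛ (e i z ⊛ e 0 w)
    conv-left i (suc j) = ι i ⊛ (e i z ⊛ e (suc j) w) ⊹ conv-left (suc i) j

    conv-right i zero    = ι 0 ⊛ (e i z ⊛ e 0 w)
    conv-right i (suc j) = ι (suc j) ⊛ (e i z ⊛ e (suc j) w) ⊹ conv-right (suc i) j

    ι-conv : ∀ i j → ι (i ℕ.+ j) ⊛ conv i j ≡ conv-left i j ⊹ conv-right i j
    ι-conv i zero    = trans (cong (_⊛ conv i 0) (ι-+ i 0)) (R.distribʳ (conv i 0) (ι i) (ι 0))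
    ι-conv i (suc j) = begin
      ι (i ℕ.+ suc j) ⊛ (x ⊹ c)                                          ≡⟨ R.distribˡ (ι (i ℕ.+ suc j)) x c ⟩
      ι (i ℕ.+ suc j) ⊛ x ⊹ ι (i ℕ.+ suc j) ⊛ c                          ≡⟨ cong₂ (λ a b → a ⊛ x ⊹ ι b ⊛ c) (ι-+ i (suc j)) (ℕ.+-suc i j) ⟩
      (ι i ⊹ ι (suc j)) ⊛ x ⊹ ι (suc i ℕ.+ j) ⊛ c                        ≡⟨ cong ((ι i ⊹ ι (suc j)) ⊛ x ⊹_) (ι-conv (suc i) j) ⟩
      (ι i ⊹ ι (suc j)) ⊛ x ⊹ (conv-left (suc i) j ⊹ conv-right (suc i) j)
        ≡⟨ solve 5 (λ a b x l r → (a :+ b) :* x :+ (l :+ r) := (a :* x :+ l) :+ (b :* x :+ r)) refl (ι i) (ι (suc j)) x (conv-left (suc i) j) (conv-right (suc i) j) ⟩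
      conv-left i (suc j) ⊹ conv-right i (suc j)                         ∎
      where
      open ≡-Reasoning
      x c : A
      x = e i z ⊛ e (suc j) w
      c = conv (suc i) j

    lower : ∀ i y → ι (suc i) ⊛ (e (suc i) z ⊛ y) ≡ z ⊛ (e i z ⊛ y)
    lower i y = trans (sym (R.*-assoc (ι (suc i)) (e (suc i) z) y)) (trans (cong (_⊛ y) (e-suc i z)) (R.*-assoc z (e i z) y))

    conv-left-suc : ∀ i j → conv-left (suc i) j ≡ z ⊛ conv i j
    conv-left-suc i zero    = lower i (e 0 w)
    conv-left-suc i (suc j) = trans (cong₂ _⊹_ (lower i (e (suc j) w)) (conv-left-suc (suc i) j)) (sym (R.distribˡ z _ _))

    conv-right-suc : ∀ i j → conv-right i (suc j) ≡ w ⊛ conv i j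
    conv-right-suc i j = trans (cong (_⊹ conv-right (suc i) j) (begin
      ι (suc j) ⊛ (e i z ⊛ e (suc j) w)     ≡⟨ solve 3 (λ a b c → a :* (b :* c) := b :* (a :* c)) refl (ι (suc j)) (e i z) (e (suc j) w) ⟩
      e i z ⊛ (ι (suc j) ⊛ e (suc j) w)     ≡⟨ cong (e i z ⊛_) (e-suc j w) ⟩
      e i z ⊛ (w ⊛ e j w)                   ≡⟨ solve 3 (λ a b c → a :* (b :* c) := b :* (a :* c)) refl (e i z) w (e j w) ⟩
      w ⊛ (e i z ⊛ e j w)                   ∎)) (rest j)
      where
      open ≡-Reasoning
      rest : ∀ j → w ⊛ (e i z ⊛ e j w) ⊹ conv-right (suc i) j ≡ w ⊛ conv i j
      rest zero    = trans (cong (w ⊛ (e i z ⊛ e 0 w) ⊹_) (trans (cong (_⊛ (e (suc i) z ⊛ e 0 w)) ι-0) (R.zeroˡ _))) (R.+-identityʳ _)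
      rest (suc j) = trans (cong (w ⊛ (e i z ⊛ e (suc j) w) ⊹_) (conv-right-suc (suc i) j)) (sym (R.distribˡ w _ _))

    e-+ : ∀ m → e m (z ⊹ w) ≡ conv 0 m
    e-+ zero    = trans (e-0 (z ⊹ w)) (sym (trans (cong₂ _⊛_ (e-0 z) (e-0 w)) (R.*-identityˡ 1#)))
    e-+ (suc m) = cancel m (begin
      ι (suc m) ⊛ e (suc m) (z ⊹ w)                          ≡⟨ e-suc m (z ⊹ w) ⟩
      (z ⊹ w) ⊛ e m (z ⊹ w)                                  ≡⟨ cong ((z ⊹ w) ⊛_) (e-+ m) ⟩
      (z ⊹ w) ⊛ conv 0 m                                     ≡⟨ R.distribʳ (conv 0 m) z w ⟩
      z ⊛ conv 0 m ⊹ w ⊛ conv 0 m                            ≡⟨ cong₂ _⊹_ (sym left) (sym (conv-right-suc 0 m)) ⟩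
      conv-left 0 (suc m) ⊹ conv-right 0 (suc m)             ≡⟨ sym (ι-conv 0 (suc m)) ⟩
      ι (suc m) ⊛ conv 0 (suc m)                             ∎)
      where
      open ≡-Reasoning
      left : conv-left 0 (suc m) ≡ z ⊛ conv 0 m
      left = trans (cong₂ _⊹_ (trans (cong (_⊛ (e 0 z ⊛ e (suc m) w)) ι-0) (R.zeroˡ _)) (conv-left-suc 0 m)) (R.+-identityˡ _)

    -- staircase i j = ∑ e a z ⊛ e b w over a ⊹ b ≤ i ⊹ j with a ≥ i
    staircase : ℕ → ℕ → A
    staircase i zero    = e i z ⊛ E 0 w
    staircase i (suc j) = e i z ⊛ E (suc j) w ⊹ staircase (suc i) j

    staircase-suc : ∀ i j → staircase i (suc j) ≡ staircase i j ⊹ conv i (suc j)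
    staircase-suc i zero    = solve 5 (λ a b c d x → a :* (b :+ c) :+ d :* b := a :* b :+ (a :* c :+ d :* b)) refl (e i z) (E 0 w) (e 1 w) (e (suc i) z) 0#
    staircase-suc i (suc j) = trans (cong (e i z ⊛ E (suc (suc j)) w ⊹_) (staircase-suc (suc i) j))
      (solve 5 (λ a b c s t → a :* (b :+ c) :+ (s :+ t) := (a :* b :+ s) :+ (a :* c :+ t)) refl (e i z) (E (suc j) w) (e (suc (suc j)) w) (staircase (suc i) j) (conv (suc i) (suc j)))

    E-+ : ∀ k → E k (z ⊹ w) ≡ staircase 0 k
    E-+ zero    = e-+ 0
    E-+ (suc k) = trans (cong₂ _⊹_ (E-+ k) (e-+ (suc k))) (sym (staircase-suc 0 k))

  segment : ℕ → ℕ → A → A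
  segment i zero    z = e i z
  segment i (suc j) z = e i z ⊹ segment (suc i) j z

  segment-E : ∀ k z → segment 0 k z ≡ E k z
  segment-E k z = go k
    where
    snoc : ∀ i j → segment i (suc j) z ≡ segment i j z ⊹ e (suc (i ℕ.+ j)) z
    snoc i zero    = cong (λ m → e i z ⊹ e (suc m) z) (sym (ℕ.+-identityʳ i))
    snoc i (suc j) = trans (cong (e i z ⊹_) (snoc (suc i) j)) (trans (sym (R.+-assoc _ _ _)) (cong (λ m → (e i z ⊹ segment (suc i) j z) ⊹ e (suc m) z) (sym (ℕ.+-suc i j))))
    go : ∀ k → segment 0 k z ≡ E k z
    go zero    = refl
    go (suc k) = trans (snoc 0 k) (cong (_⊹ e (suc k) z) (go k))

  tail : ℕ → ℕ → A → A
  tail l zero    z = 0#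
  tail l (suc d) z = tail l d z ⊹ e (suc (l ℕ.+ d)) z

  E-tail : ∀ l d z → E (l ℕ.+ d) z ≡ E l z ⊹ tail l d z
  E-tail l zero    z = trans (cong (λ m → E m z) (ℕ.+-identityʳ l)) (sym (R.+-identityʳ _))
  E-tail l (suc d) z = trans (cong (λ m → E m z) (ℕ.+-suc l d)) (trans (cong (_⊹ e (suc (l ℕ.+ d)) z) (E-tail l d z)) (R.+-assoc _ _ _))

  -- The terms e a z * e b w with i ≤ a ≤ i + j, b ≤ j + d and a + b > i + j
  defect : ℕ → ℕ → ℕ → A → A → A
  defect i zero    d z w = e i z ⊛ tail 0 d w
  defect i (suc j) d z w = e i z ⊛ tail (suc j) d w ⊹ defect (suc i) j (suc d) z w

  defect-staircase : ∀ i j d z w → staircase z w i j ⊹ defect i j d z w ≡ segment i j z ⊛ E (j ℕ.+ d) w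
  defect-staircase i zero    d z w = trans (sym (R.distribˡ (e i z) _ _)) (cong (e i z ⊛_) (sym (E-tail 0 d w)))
  defect-staircase i (suc j) d z w = begin
    (a ⊛ E (suc j) w ⊹ s) ⊹ (a ⊛ tail (suc j) d w ⊹ t)   ≡⟨ solve 5 (λ a b c s t → (a :* b :+ s) :+ (a :* c :+ t) := a :* (b :+ c) :+ (s :+ t)) refl a (E (suc j) w) (tail (suc j) d w) s t ⟩
    a ⊛ (E (suc j) w ⊹ tail (suc j) d w) ⊹ (s ⊹ t)       ≡⟨ cong₂ (λ x y → a ⊛ x ⊹ y) (sym (E-tail (suc j) d w)) (trans (defect-staircase (suc i) j (suc d) z w) (cong (λ m → segment (suc i) j z ⊛ E m w) (ℕ.+-suc j d))) ⟩
    a ⊛ E (suc j ℕ.+ d) w ⊹ segment (suc i) j z ⊛ E (suc j ℕ.+ d) w   ≡⟨ sym (R.distribʳ (E (suc j ℕ.+ d) w) a (segment (suc i) j z)) ⟩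
    segment i (suc j) z ⊛ E (suc j ℕ.+ d) w              ∎
    where
    open ≡-Reasoning
    a s t : A
    a = e i z
    s = staircase z w (suc i) j
    t = defect (suc i) j (suc d) z w

  E-* : ∀ k z w → E k (z ⊹ w) ⊹ defect 0 k 0 z w ≡ E k z ⊛ E k w
  E-* k z w = trans (cong (_⊹ defect 0 k 0 z w) (E-+ z w k)) (trans (defect-staircase 0 k 0 z w)
    (cong₂ (λ a m → a ⊛ E m w) (segment-E k z) (ℕ.+-identityʳ k)))

module ComplexNumbers where
  open ℚ-Solver.+-*-Solver using (solve; _:+_; _:*_; _:-_; :-_; _:=_; con)

  negᶜ : ℚ[i] → ℚ[i]
  negᶜ (a +i b) = (ℚ.- a) +i (ℚ.- b)

  ℚ[i]-isCommutativeRing : IsCommutativeRing _≡_ _+ᶜ_ _*ᶜ_ negᶜ 0ᶜ 1ᶜ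
  ℚ[i]-isCommutativeRing = record
    { isRing = record
      { +-isAbelianGroup = record
        { isGroup = record
          { isMonoid = record
            { isSemigroup = record
              { isMagma = record { isEquivalence = isEquivalence ; ∙-cong = cong₂ _+ᶜ_ }
              ; assoc = λ (a +i b) (c +i d) (e +i f) → cong₂ _+i_ (ℚ.+-assoc a c e) (ℚ.+-assoc b d f) }
            ; identity = (λ (a +i b) → cong₂ _+i_ (ℚ.+-identityˡ a) (ℚ.+-identityˡ b)) , λ (a +i b) → cong₂ _+i_ (ℚ.+-identityʳ a) (ℚ.+-identityʳ b) }
          ; inverse = (λ (a +i b) → cong₂ _+i_ (ℚ.+-inverseˡ a) (ℚ.+-inverseˡ b)) , λ (a +i b) → cong₂ _+i_ (ℚ.+-inverseʳ a) (ℚ.+-inverseʳ b)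
          ; ⁻¹-cong = cong negᶜ }
        ; comm = λ (a +i b) (c +i d) → cong₂ _+i_ (ℚ.+-comm a c) (ℚ.+-comm b d) }
      ; *-cong = cong₂ _*ᶜ_
      ; *-assoc = λ (a +i b) (c +i d) (e +i f) → cong₂ _+i_
          (solve 6 (λ a b c d e f → (a :* c :- b :* d) :* e :- (a :* d :+ b :* c) :* f := a :* (c :* e :- d :* f) :- b :* (c :* f :+ d :* e)) refl a b c d e f)
          (solve 6 (λ a b c d e f → (a :* c :- b :* d) :* f :+ (a :* d :+ b :* c) :* e := a :* (c :* f :+ d :* e) :+ b :* (c :* e :- d :* f)) refl a b c d e f)
      ; *-identity = (λ (a +i b) → cong₂ _+i_ (solve 2 (λ a b → con 1ℚ :* a :- con 0ℚ :* b := a) refl a b) (solve 2 (λ a b → con 1ℚ :* b :+ con 0ℚ :* a := b) refl a b))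
                   , (λ (a +i b) → cong₂ _+i_ (solve 2 (λ a b → a :* con 1ℚ :- b :* con 0ℚ := a) refl a b) (solve 2 (λ a b → a :* con 0ℚ :+ b :* con 1ℚ := b) refl a b))
      ; distrib = (λ (a +i b) (c +i d) (e +i f) → cong₂ _+i_
            (solve 6 (λ a b c d e f → a :* (c :+ e) :- b :* (d :+ f) := (a :* c :- b :* d) :+ (a :* e :- b :* f)) refl a b c d e f)
            (solve 6 (λ a b c d e f → a :* (d :+ f) :+ b :* (c :+ e) := (a :* d :+ b :* c) :+ (a :* f :+ b :* e)) refl a b c d e f))
        , λ (a +i b) (c +i d) (e +i f) → cong₂ _+i_
            (solve 6 (λ a b c d e f → (c :+ e) :* a :- (d :+ f) :* b := (c :* a :- d :* b) :+ (e :* a :- f :* b)) refl a b c d e f)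
            (solve 6 (λ a b c d e f → (c :+ e) :* b :+ (d :+ f) :* a := (c :* b :+ d :* a) :+ (e :* b :+ f :* a)) refl a b c d e f) }
    ; *-comm = λ (a +i b) (c +i d) → cong₂ _+i_
        (solve 4 (λ a b c d → a :* c :- b :* d := c :* a :- d :* b) refl a b c d) (solve 4 (λ a b c d → a :* d :+ b :* c := c :* b :+ d :* a) refl a b c d) }

  real : ℚ → ℚ[i]
  real a = a +i 0ℚ

  real-* : ∀ a b → real a *ᶜ real b ≡ real (a ℚ.* b)
  real-* a b = cong₂ _+i_ (solve 2 (λ a b → a :* b :- con 0ℚ :* con 0ℚ := a :* b) refl a b) (solve 2 (λ a b → a :* con 0ℚ :+ con 0ℚ :* b := con 0ℚ) refl a b)

  ·ᶜ-real : ∀ q z → q ·ᶜ z ≡ real q *ᶜ z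
  ·ᶜ-real q (a +i b) = cong₂ _+i_ (solve 3 (λ q a b → q :* a := q :* a :- con 0ℚ :* b) refl q a b) (solve 3 (λ q a b → q :* b := q :* b :+ con 0ℚ :* a) refl q a b)

  recip : ℕ → ℚ
  recip j = + 1 / suc j

  recip-inverse : ∀ j → recip j ℚ.* fromℕ (suc j) ≡ 1ℚ
  recip-inverse j = trans (ℚ.*-comm (recip j) _) (reciprocal (suc j))

  open PartialExponentials ℚ.+-*-isCommutativeRing fromℕ refl fromℕ-suc inverse-factorial refl inverse-factorial-suc recip recip-inverse public
    using () renaming (e to r; E to R; e-suc to r-suc; E-+ to R-+; E-* to R-*; tail to tailᴿ; E-tail to R-tail; defect to defectᴿ; staircase to staircaseᴿ; segment to segmentᴿ; segment-E to segmentᴿ-R; _↑_ to _↑ᴿ_)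

  open PartialExponentials ℚ[i]-isCommutativeRing (real ∘ fromℕ) refl (λ n → cong real (fromℕ-suc n)) (real ∘ inverse-factorial) refl
    (λ j → trans (real-* (fromℕ (suc j)) (inverse-factorial (suc j))) (cong real (inverse-factorial-suc j))) (real ∘ recip) (λ j → trans (real-* (recip j) (fromℕ (suc j))) (cong real (recip-inverse j))) public
    using () renaming (e to c; E to C; E-* to C-*; tail to tailᶜ; E-tail to C-tail; defect to defectᶜ; _↑_ to _↑ᶜ_)

  ^ᶜ≡↑ᶜ : ∀ z k → z ^ᶜ k ≡ z ↑ᶜ k
  ^ᶜ≡↑ᶜ z zero    = refl
  ^ᶜ≡↑ᶜ z (suc k) = cong (z *ᶜ_) (^ᶜ≡↑ᶜ z k)

  expᶜ≡C : ∀ k z → expᶜ k z ≡ C k z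
  expᶜ≡C k z = trans (go id (suc k)) (partial-sum k)
    where
    open IsCommutativeRing ℚ[i]-isCommutativeRing using () renaming (+-assoc to assoc; +-identityʳ to identityʳ; +-identityˡ to identityˡ)
    term : ℕ → ℚ[i]
    term j = _/_ (+ 1) (j !) {{j ℕ.!≢0}} ·ᶜ z ^ᶜ j
    term≡ : ∀ j → term j ≡ c j z
    term≡ j = trans (·ᶜ-real (inverse-factorial j) (z ^ᶜ j)) (cong (real (inverse-factorial j) *ᶜ_) (^ᶜ≡↑ᶜ z j))
    partial : (ℕ → ℕ) → ℕ → ℚ[i]
    partial h zero    = 0ᶜ
    partial h (suc m) = partial h m +ᶜ term (h m)
    shift : ∀ h m → partial h (suc m) ≡ term (h 0) +ᶜ partial (h ∘ suc) m
    shift h zero    = trans (identityˡ (term (h 0))) (sym (identityʳ (term (h 0))))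
    shift h (suc m) = trans (cong (_+ᶜ term (h (suc m))) (shift h m)) (assoc (term (h 0)) _ _)
    go : ∀ h m → sumᶜ (List.map term (applyUpTo h m)) ≡ partial h m
    go h zero    = refl
    go h (suc m) = trans (cong (term (h 0) +ᶜ_) (go (h ∘ suc) m)) (sym (shift h m))
    partial-sum : ∀ k → partial id (suc k) ≡ C k z
    partial-sum zero    = trans (identityˡ (term 0)) (term≡ 0)
    partial-sum (suc k) = cong₂ _+ᶜ_ (partial-sum k) (term≡ (suc k))

  C-real : ∀ k x → C k (real x) ≡ real (R k x)
  C-real k x = go k
    where
    power : ∀ j → real x ↑ᶜ j ≡ real (x ↑ᴿ j)
    power zero    = refl
    power (suc j) = trans (cong (real x *ᶜ_) (power j)) (real-* x (x ↑ᴿ j))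
    term : ∀ j → c j (real x) ≡ real (r j x)
    term j = trans (cong (real (inverse-factorial j) *ᶜ_) (power j)) (real-* (inverse-factorial j) (x ↑ᴿ j))
    go : ∀ k → C k (real x) ≡ real (R k x)
    go zero    = term 0
    go (suc k) = cong₂ _+ᶜ_ (go k) (term (suc k))

  exp≡R : ∀ x k → exp x k ≡ R k (x k)
  exp≡R x k = cong re (trans (expᶜ≡C k (real (x k))) (C-real k (x k)))

  0≤inverse-factorial : ∀ j → 0ℚ ℚ.≤ inverse-factorial j
  0≤inverse-factorial j = ℚ.nonNegative⁻¹ (inverse-factorial j) {{ℚ.normalize-nonNeg 1 (j !) {{j ℕ.!≢0}}}}

  0≤↑ : ∀ {x} j → 0ℚ ℚ.≤ x → 0ℚ ℚ.≤ x ↑ᴿ j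
  0≤↑ zero    h = ℚ.nonNegative⁻¹ 1ℚ
  0≤↑ (suc j) h = 0≤⇒* h (0≤↑ j h)

  ↑-mono : ∀ {x y} j → 0ℚ ℚ.≤ x → x ℚ.≤ y → x ↑ᴿ j ℚ.≤ y ↑ᴿ j
  ↑-mono zero    h x≤y = ℚ.≤-refl
  ↑-mono (suc j) h x≤y = *-mono h (0≤↑ j h) x≤y (↑-mono j h x≤y)

  0≤r : ∀ {x} j → 0ℚ ℚ.≤ x → 0ℚ ℚ.≤ r j x
  0≤r j h = 0≤⇒* (0≤inverse-factorial j) (0≤↑ j h)

  r-mono : ∀ {x y} j → 0ℚ ℚ.≤ x → x ℚ.≤ y → r j x ℚ.≤ r j y
  r-mono j h x≤y = *-monoˡ (0≤inverse-factorial j) (↑-mono j h x≤y)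

  1≤R : ∀ {x} k → 0ℚ ℚ.≤ x → 1ℚ ℚ.≤ R k x
  1≤R zero    h = ℚ.≤-refl
  1≤R (suc k) h = ℚ.≤-trans (1≤R k h) (≤-+ʳ (0≤r (suc k) h))

  0≤R : ∀ {x} k → 0ℚ ℚ.≤ x → 0ℚ ℚ.≤ R k x
  0≤R k h = ℚ.≤-trans (ℚ.nonNegative⁻¹ 1ℚ) (1≤R k h)

  R-mono : ∀ {x y} k → 0ℚ ℚ.≤ x → x ℚ.≤ y → R k x ℚ.≤ R k y
  R-mono zero    h x≤y = r-mono 0 h x≤y
  R-mono (suc k) h x≤y = ℚ.+-mono-≤ (R-mono k h x≤y) (r-mono (suc k) h x≤y)

  0≤tail : ∀ {x} l d → 0ℚ ℚ.≤ x → 0ℚ ℚ.≤ tailᴿ l d x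
  0≤tail l zero    h = ℚ.≤-refl
  0≤tail l (suc d) h = 0≤⇒+ (0≤tail l d h) (0≤r (suc (l ℕ.+ d)) h)

  tail-mono : ∀ {x y} l d → 0ℚ ℚ.≤ x → x ℚ.≤ y → tailᴿ l d x ℚ.≤ tailᴿ l d y
  tail-mono l zero    h x≤y = ℚ.≤-refl
  tail-mono l (suc d) h x≤y = ℚ.+-mono-≤ (tail-mono l d h x≤y) (r-mono (suc (l ℕ.+ d)) h x≤y)

  R-more : ∀ {x} k l → 0ℚ ℚ.≤ x → R k x ℚ.≤ R (k ℕ.+ l) x
  R-more {x} k l h = ℚ.≤-trans (≤-+ʳ (0≤tail k l h)) (ℚ.≤-reflexive (sym (R-tail k l x)))

  R-more′ : ∀ {x k m} → k ℕ.≤ m → 0ℚ ℚ.≤ x → R k x ℚ.≤ R m x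
  R-more′ {x} {k} {m} k≤m h = subst (λ m → R k x ℚ.≤ R m x) (ℕ.m+[n∸m]≡n k≤m) (R-more k (m ℕ.∸ k) h)

  0≤staircase : ∀ {x y} i j → 0ℚ ℚ.≤ x → 0ℚ ℚ.≤ y → 0ℚ ℚ.≤ staircaseᴿ x y i j
  0≤staircase i zero    hx hy = 0≤⇒* (0≤r i hx) (0≤R 0 hy)
  0≤staircase i (suc j) hx hy = 0≤⇒+ (0≤⇒* (0≤r i hx) (0≤R (suc j) hy)) (0≤staircase (suc i) j hx hy)

  staircase≥ : ∀ {x y} i j l → 0ℚ ℚ.≤ x → 0ℚ ℚ.≤ y → segmentᴿ i j x ℚ.* R l y ℚ.≤ staircaseᴿ x y i (j ℕ.+ l)
  staircase≥ i zero    zero    hx hy = ℚ.≤-refl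
  staircase≥ i zero    (suc l) hx hy = ≤-+ʳ (0≤staircase (suc i) l hx hy)
  staircase≥ {x} {y} i (suc j) l hx hy = ℚ.≤-trans (ℚ.≤-reflexive (ℚ.*-distribʳ-+ (R l y) (r i x) (segmentᴿ (suc i) j x)))
    (ℚ.+-mono-≤ (*-monoˡ (0≤r i hx) (R-more′ (ℕ.m≤n+m l (suc j)) hy)) (staircase≥ (suc i) j l hx hy))

  R-supermultiplicative : ∀ {x y} k l → 0ℚ ℚ.≤ x → 0ℚ ℚ.≤ y → R k x ℚ.* R l y ℚ.≤ R (k ℕ.+ l) (x ℚ.+ y)
  R-supermultiplicative {x} {y} k l hx hy = ℚ.≤-trans (ℚ.≤-reflexive (cong (ℚ._* R l y) (sym (segmentᴿ-R k x))))
    (ℚ.≤-trans (staircase≥ 0 k l hx hy) (ℚ.≤-reflexive (sym (R-+ x y (k ℕ.+ l)))))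

  0≤defect : ∀ {x y} i j d → 0ℚ ℚ.≤ x → 0ℚ ℚ.≤ y → 0ℚ ℚ.≤ defectᴿ i j d x y
  0≤defect i zero    d hx hy = 0≤⇒* (0≤r i hx) (0≤tail 0 d hy)
  0≤defect i (suc j) d hx hy = 0≤⇒+ (0≤⇒* (0≤r i hx) (0≤tail (suc j) d hy)) (0≤defect (suc i) j (suc d) hx hy)

  R-submultiplicative : ∀ {x y} k → 0ℚ ℚ.≤ x → 0ℚ ℚ.≤ y → R k (x ℚ.+ y) ℚ.≤ R k x ℚ.* R k y
  R-submultiplicative {x} {y} k hx hy = ℚ.≤-trans (≤-+ʳ (0≤defect 0 k 0 hx hy)) (ℚ.≤-reflexive (R-* k x y))

  +-cancelˡ-≤ : ∀ a {b c} → a ℚ.+ b ℚ.≤ a ℚ.+ c → b ℚ.≤ c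
  +-cancelˡ-≤ a {b} {c} h = subst₂ ℚ._≤_ (lemma b) (lemma c) (ℚ.+-monoʳ-≤ (ℚ.- a) h)
    where
    lemma : ∀ b → ℚ.- a ℚ.+ (a ℚ.+ b) ≡ b
    lemma b = solve 2 (λ a b → :- a :+ (a :+ b) := b) refl a b

  defect≤tail : ∀ {x y} k → 0ℚ ℚ.≤ x → 0ℚ ℚ.≤ y → defectᴿ 0 k 0 x y ℚ.≤ tailᴿ k k (x ℚ.+ y)
  defect≤tail {x} {y} k hx hy = +-cancelˡ-≤ (R k (x ℚ.+ y)) (ℚ.≤-trans (ℚ.≤-reflexive (R-* k x y))
    (ℚ.≤-trans (R-supermultiplicative k k hx hy) (ℚ.≤-reflexive (R-tail k k (x ℚ.+ y)))))

  half : ∀ {a b} → a ℚ.+ a ℚ.≤ b ℚ.+ b → a ℚ.≤ b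
  half {a} {b} h with ℚ.≤-total a b
  ... | inj₁ a≤b = a≤b
  ... | inj₂ b≤a = +-cancelˡ-≤ a (ℚ.≤-trans h (ℚ.+-monoˡ-≤ b b≤a))

  r-halving : ∀ {x} j → 0ℚ ℚ.≤ x → x ℚ.+ x ℚ.≤ fromℕ (suc j) → r (suc j) x ℚ.+ r (suc j) x ℚ.≤ r j x
  r-halving {x} j h 2x≤j = ℚ.*-cancelˡ-≤-pos (fromℕ (suc j)) {{pos}} (begin
    s ℚ.* (r (suc j) x ℚ.+ r (suc j) x)       ≡⟨ solve 2 (λ s a → s :* (a :+ a) := s :* a :+ s :* a) refl s (r (suc j) x) ⟩
    s ℚ.* r (suc j) x ℚ.+ s ℚ.* r (suc j) x   ≡⟨ cong₂ ℚ._+_ (r-suc j x) (r-suc j x) ⟩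
    x ℚ.* r j x ℚ.+ x ℚ.* r j x               ≡⟨ sym (ℚ.*-distribʳ-+ (r j x) x x) ⟩
    (x ℚ.+ x) ℚ.* r j x                       ≤⟨ *-monoʳ (0≤r j h) 2x≤j ⟩
    s ℚ.* r j x                               ∎)
    where
    open ℚ.≤-Reasoning
    s : ℚ
    s = fromℕ (suc j)
    pos : ℚ.Positive s
    pos = ℚ.normalize-pos (suc j) 1

  tail≤r : ∀ {x} k d → 0ℚ ℚ.≤ x → x ℚ.+ x ℚ.≤ fromℕ (suc k) → tailᴿ k d x ℚ.≤ r k x
  tail≤r {x} k d h 2x≤ = ℚ.≤-trans (≤-+ʳ (0≤r (k ℕ.+ d) h)) (go d)
    where
    go : ∀ d → tailᴿ k d x ℚ.+ r (k ℕ.+ d) x ℚ.≤ r k x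
    go zero    = ℚ.≤-reflexive (trans (ℚ.+-identityˡ _) (cong (λ m → r m x) (ℕ.+-identityʳ k)))
    go (suc d) = ℚ.≤-trans (ℚ.≤-reflexive (trans (cong (λ m → (tailᴿ k d x ℚ.+ r (suc (k ℕ.+ d)) x) ℚ.+ r m x) (ℕ.+-suc k d)) (ℚ.+-assoc (tailᴿ k d x) _ _)))
      (ℚ.≤-trans (ℚ.+-monoʳ-≤ (tailᴿ k d x) (r-halving (k ℕ.+ d) h (ℚ.≤-trans 2x≤ (fromℕ-mono (suc k) (suc (k ℕ.+ d)) (s≤s (ℕ.m≤m+n k d)))))) (go d))

  Small : (ℕ → ℚ) → Set
  Small x = ∀ ε → 0ℚ ℚ.< ε → ∃[ N ] (∀ k → N ℕ.≤ k → x k ℚ.≤ ε)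

  r-small : ∀ B → Small (λ k → r k (fromℕ B))
  r-small B ε 0<ε = let
      (M , r≤M) = above (r K x)
      (n , 1≤nε) = archimedes 0<ε
    in K ℕ.+ M ℕ.* n , λ k N≤k → ℚ.*-cancelˡ-≤-pos (fromℕ (suc (M ℕ.* n))) {{ℚ.normalize-pos (suc (M ℕ.* n)) 1}} (begin
        fromℕ (suc (M ℕ.* n)) ℚ.* r k x                 ≡⟨ cong (λ m → fromℕ (suc (M ℕ.* n)) ℚ.* r m x) (sym (trans (sym (ℕ.+-assoc K (M ℕ.* n) _)) (ℕ.m+[n∸m]≡n N≤k))) ⟩
        fromℕ (suc (M ℕ.* n)) ℚ.* r (K ℕ.+ (M ℕ.* n ℕ.+ (k ℕ.∸ (K ℕ.+ M ℕ.* n)))) x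
          ≤⟨ *-monoʳ (0≤r (K ℕ.+ (M ℕ.* n ℕ.+ (k ℕ.∸ (K ℕ.+ M ℕ.* n)))) 0≤x) (fromℕ-mono (suc (M ℕ.* n)) (suc (M ℕ.* n ℕ.+ (k ℕ.∸ (K ℕ.+ M ℕ.* n)))) (s≤s (ℕ.m≤m+n (M ℕ.* n) _))) ⟩
        fromℕ (suc (M ℕ.* n ℕ.+ (k ℕ.∸ (K ℕ.+ M ℕ.* n)))) ℚ.* r (K ℕ.+ (M ℕ.* n ℕ.+ (k ℕ.∸ (K ℕ.+ M ℕ.* n)))) x  ≤⟨ decay (M ℕ.* n ℕ.+ (k ℕ.∸ (K ℕ.+ M ℕ.* n))) ⟩
        r K x                                           ≤⟨ r≤M ⟩
        fromℕ M                                         ≡⟨ sym (ℚ.*-identityʳ (fromℕ M)) ⟩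
        fromℕ M ℚ.* 1ℚ                                  ≤⟨ *-monoˡ (0≤fromℕ M) 1≤nε ⟩
        fromℕ M ℚ.* (fromℕ n ℚ.* ε)                     ≡⟨ trans (sym (ℚ.*-assoc (fromℕ M) (fromℕ n) ε)) (cong (ℚ._* ε) (sym (fromℕ-* M n))) ⟩
        fromℕ (M ℕ.* n) ℚ.* ε                           ≤⟨ *-monoʳ (ℚ.<⇒≤ 0<ε) (fromℕ-mono (M ℕ.* n) (suc (M ℕ.* n)) (ℕ.n≤1+n _)) ⟩
        fromℕ (suc (M ℕ.* n)) ℚ.* ε                     ∎)
    where
    open ℚ.≤-Reasoning
    x : ℚ
    x = fromℕ B
    K : ℕ
    K = B ℕ.+ B
    0≤x : 0ℚ ℚ.≤ x
    0≤x = 0≤fromℕ B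
    decay : ∀ l → fromℕ (suc l) ℚ.* r (K ℕ.+ l) x ℚ.≤ r K x
    decay zero    = ℚ.≤-reflexive (trans (ℚ.*-identityˡ _) (cong (λ m → r m x) (ℕ.+-identityʳ K)))
    decay (suc l) = half (begin
      a ℚ.* r (K ℕ.+ suc l) x ℚ.+ a ℚ.* r (K ℕ.+ suc l) x     ≡⟨ trans (sym (ℚ.*-distribˡ-+ a _ _)) (cong (λ m → a ℚ.* (r m x ℚ.+ r m x)) (ℕ.+-suc K l)) ⟩
      a ℚ.* (r (suc (K ℕ.+ l)) x ℚ.+ r (suc (K ℕ.+ l)) x)     ≤⟨ *-monoˡ (0≤fromℕ (suc (suc l))) (r-halving (K ℕ.+ l) 0≤x (ℚ.≤-trans (ℚ.≤-reflexive (sym (fromℕ-+ B B))) (fromℕ-mono (B ℕ.+ B) (suc (K ℕ.+ l)) (ℕ.m≤n⇒m≤1+n (ℕ.m≤m+n K l))))) ⟩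
      a ℚ.* r (K ℕ.+ l) x                                     ≤⟨ *-monoʳ (0≤r (K ℕ.+ l) 0≤x) (fromℕ-mono (suc (suc l)) (suc l ℕ.+ suc l) (s≤s (ℕ.m≤n+m (suc l) l))) ⟩
      fromℕ (suc l ℕ.+ suc l) ℚ.* r (K ℕ.+ l) x               ≡⟨ trans (cong (ℚ._* r (K ℕ.+ l) x) (fromℕ-+ (suc l) (suc l))) (ℚ.*-distribʳ-+ (r (K ℕ.+ l) x) (fromℕ (suc l)) (fromℕ (suc l))) ⟩
      fromℕ (suc l) ℚ.* r (K ℕ.+ l) x ℚ.+ fromℕ (suc l) ℚ.* r (K ℕ.+ l) x   ≤⟨ ℚ.+-mono-≤ (decay l) (decay l) ⟩
      r K x ℚ.+ r K x                                         ∎)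
      where
      a : ℚ
      a = fromℕ (suc (suc l))

  tail-small : ∀ B → Small (λ k → tailᴿ k k (fromℕ B))
  tail-small B ε 0<ε = let (N , h) = r-small B ε 0<ε in N ℕ.+ (B ℕ.+ B) , λ k N≤k →
    ℚ.≤-trans (tail≤r k k (0≤fromℕ B) (ℚ.≤-trans (ℚ.≤-reflexive (sym (fromℕ-+ B B))) (fromℕ-mono (B ℕ.+ B) (suc k) (ℕ.m≤n⇒m≤1+n (ℕ.≤-trans (ℕ.m≤n+m _ N) N≤k)))))
      (h k (ℕ.≤-trans (ℕ.m≤m+n N _) N≤k))

open ComplexNumbers

module ComplexLimits where

  module ℚS = ℚ-Solver.+-*-Solver

  ℚ[i]-ring : CommutativeRing 0ℓ 0ℓ
  ℚ[i]-ring = record { isCommutativeRing = ℚ[i]-isCommutativeRing }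

  module ℂ = CommutativeRing ℚ[i]-ring
  module ℂS = NatSolver ℂ.commutativeSemiring

  ‖_‖ : ℚ[i] → ℚ
  ‖ a +i b ‖ = ∣ a ∣ ℚ.+ ∣ b ∣

  0≤‖_‖ : ∀ z → 0ℚ ℚ.≤ ‖ z ‖
  0≤‖ a +i b ‖ = 0≤⇒+ (ℚ.0≤∣p∣ a) (ℚ.0≤∣p∣ b)

  ‖+‖ : ∀ z w → ‖ z +ᶜ w ‖ ℚ.≤ ‖ z ‖ ℚ.+ ‖ w ‖
  ‖+‖ (a +i b) (c +i d) = ℚ.≤-trans (ℚ.+-mono-≤ (ℚ.∣p+q∣≤∣p∣+∣q∣ a c) (ℚ.∣p+q∣≤∣p∣+∣q∣ b d))
    (ℚ.≤-reflexive (solve 4 (λ a b c d → (a :+ c) :+ (b :+ d) := (a :+ b) :+ (c :+ d)) refl (∣ a ∣) (∣ b ∣) (∣ c ∣) (∣ d ∣)))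
    where open ℚS using (solve; _:+_; _:=_)

  ‖neg‖ : ∀ z → ‖ negᶜ z ‖ ≡ ‖ z ‖
  ‖neg‖ (a +i b) = cong₂ ℚ._+_ (ℚ.∣-p∣≡∣p∣ a) (ℚ.∣-p∣≡∣p∣ b)

  ‖*‖ : ∀ z w → ‖ z *ᶜ w ‖ ℚ.≤ ‖ z ‖ ℚ.* ‖ w ‖
  ‖*‖ (a +i b) (c +i d) = ℚ.≤-trans (ℚ.+-mono-≤ (ℚ.∣p-q∣≤∣p∣+∣q∣ (a ℚ.* c) (b ℚ.* d)) (ℚ.∣p+q∣≤∣p∣+∣q∣ (a ℚ.* d) (b ℚ.* c)))
    (ℚ.≤-reflexive (trans (cong₂ ℚ._+_ (cong₂ ℚ._+_ (ℚ.∣p*q∣≡∣p∣*∣q∣ a c) (ℚ.∣p*q∣≡∣p∣*∣q∣ b d)) (cong₂ ℚ._+_ (ℚ.∣p*q∣≡∣p∣*∣q∣ a d) (ℚ.∣p*q∣≡∣p∣*∣q∣ b c)))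
      (solve 4 (λ a b c d → (a :* c :+ b :* d) :+ (a :* d :+ b :* c) := (a :+ b) :* (c :+ d)) refl (∣ a ∣) (∣ b ∣) (∣ c ∣) (∣ d ∣))))
    where open ℚS using (solve; _:+_; _:*_; _:=_)

  ‖*‖-≤ : ∀ z w {a b} → ‖ z ‖ ℚ.≤ a → ‖ w ‖ ℚ.≤ b → ‖ z *ᶜ w ‖ ℚ.≤ a ℚ.* b
  ‖*‖-≤ z w h k = ℚ.≤-trans (‖*‖ z w) (*-mono 0≤‖ z ‖ 0≤‖ w ‖ h k)

  ‖+‖-≤ : ∀ z w {a b} → ‖ z ‖ ℚ.≤ a → ‖ w ‖ ℚ.≤ b → ‖ z +ᶜ w ‖ ℚ.≤ a ℚ.+ b
  ‖+‖-≤ z w h k = ℚ.≤-trans (‖+‖ z w) (ℚ.+-mono-≤ h k)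

  ∣re∣≤ : ∀ z → ∣ re z ∣ ℚ.≤ ‖ z ‖
  ∣re∣≤ (a +i b) = ≤-+ʳ (ℚ.0≤∣p∣ b)

  ‖real‖ : ∀ {a} → 0ℚ ℚ.≤ a → ‖ real a ‖ ≡ a
  ‖real‖ h = trans (ℚ.+-identityʳ _) (ℚ.0≤p⇒∣p∣≡p h)

  ∣∣²-* : ∀ z w → ∣ z *ᶜ w ∣² ≡ ∣ z ∣² ℚ.* ∣ w ∣²
  ∣∣²-* (a +i b) (c +i d) = solve 4 (λ a b c d → (a :* c :- b :* d) :* (a :* c :- b :* d) :+ (a :* d :+ b :* c) :* (a :* d :+ b :* c) := (a :* a :+ b :* b) :* (c :* c :+ d :* d)) refl a b c d
    where open ℚS using (solve; _:+_; _:*_; _:-_; _:=_)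

  0≤∣∣² : ∀ z → 0ℚ ℚ.≤ ∣ z ∣²
  0≤∣∣² (a +i b) = 0≤⇒+ (square≥0 a) (square≥0 b)

  square-∣∣ : ∀ a → a ℚ.* a ≡ ∣ a ∣ ℚ.* ∣ a ∣
  square-∣∣ a = trans (sym (ℚ.0≤p⇒∣p∣≡p (square≥0 a))) (ℚ.∣p*q∣≡∣p∣*∣q∣ a a)

  ∣∣²≤ : ∀ z → ∣ z ∣² ℚ.≤ ‖ z ‖ ℚ.* ‖ z ‖
  ∣∣²≤ (a +i b) = ℚ.≤-trans (ℚ.≤-reflexive (cong₂ ℚ._+_ (square-∣∣ a) (square-∣∣ b)))
    (ℚ.≤-trans (≤-+ʳ (0≤⇒+ (0≤⇒* (ℚ.0≤∣p∣ a) (ℚ.0≤∣p∣ b)) (0≤⇒* (ℚ.0≤∣p∣ a) (ℚ.0≤∣p∣ b))))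
      (ℚ.≤-reflexive (solve 2 (λ a b → (a :* a :+ b :* b) :+ (a :* b :+ a :* b) := (a :+ b) :* (a :+ b)) refl (∣ a ∣) (∣ b ∣))))
    where open ℚS using (solve; _:+_; _:*_; _:=_)

  ∣∣²-+ : ∀ z w → ∣ z +ᶜ w ∣² ℚ.≤ (∣ z ∣² ℚ.+ ∣ z ∣²) ℚ.+ (∣ w ∣² ℚ.+ ∣ w ∣²)
  ∣∣²-+ (a +i b) (c +i d) = ℚ.≤-trans (≤-+ʳ (0≤⇒+ (square≥0 (a ℚ.- c)) (square≥0 (b ℚ.- d))))
    (ℚ.≤-reflexive (solve 4 (λ a b c d → ((a :+ c) :* (a :+ c) :+ (b :+ d) :* (b :+ d)) :+ ((a :- c) :* (a :- c) :+ (b :- d) :* (b :- d))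
      := ((a :* a :+ b :* b) :+ (a :* a :+ b :* b)) :+ ((c :* c :+ d :* d) :+ (c :* c :+ d :* d))) refl a b c d))
    where open ℚS using (solve; _:+_; _:*_; _:-_; _:=_)

  ‖c‖ : ∀ j z → ‖ c j z ‖ ℚ.≤ r j ‖ z ‖
  ‖c‖ j z = ‖*‖-≤ (real (inverse-factorial j)) (z ↑ᶜ j) (ℚ.≤-reflexive (‖real‖ (0≤inverse-factorial j))) (power j)
    where
    power : ∀ j → ‖ z ↑ᶜ j ‖ ℚ.≤ ‖ z ‖ ↑ᴿ j
    power zero    = ℚ.≤-refl
    power (suc j) = ‖*‖-≤ z (z ↑ᶜ j) ℚ.≤-refl (power j)

  ‖C‖ : ∀ k z → ‖ C k z ‖ ℚ.≤ R k ‖ z ‖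
  ‖C‖ zero    z = ‖c‖ 0 z
  ‖C‖ (suc k) z = ‖+‖-≤ (C k z) (c (suc k) z) (‖C‖ k z) (‖c‖ (suc k) z)

  ‖tail‖ : ∀ l d z → ‖ tailᶜ l d z ‖ ℚ.≤ tailᴿ l d ‖ z ‖
  ‖tail‖ l zero    z = ℚ.≤-refl
  ‖tail‖ l (suc d) z = ‖+‖-≤ (tailᶜ l d z) (c (suc (l ℕ.+ d)) z) (‖tail‖ l d z) (‖c‖ (suc (l ℕ.+ d)) z)

  ‖defect‖ : ∀ i j d z w → ‖ defectᶜ i j d z w ‖ ℚ.≤ defectᴿ i j d ‖ z ‖ ‖ w ‖
  ‖defect‖ i zero    d z w = ‖*‖-≤ (c i z) (tailᶜ 0 d w) (‖c‖ i z) (‖tail‖ 0 d w)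
  ‖defect‖ i (suc j) d z w = ‖+‖-≤ (c i z *ᶜ tailᶜ (suc j) d w) (defectᶜ (suc i) j (suc d) z w) (‖*‖-≤ (c i z) (tailᶜ (suc j) d w) (‖c‖ i z) (‖tail‖ (suc j) d w)) (‖defect‖ (suc i) j (suc d) z w)

  infixl 6 _-ᶜ_
  _-ᶜ_ : ℚ[i] → ℚ[i] → ℚ[i]
  z -ᶜ w = z +ᶜ negᶜ w

  multiplication-error : ∀ {b} k z w → ‖ z ‖ ℚ.+ ‖ w ‖ ℚ.≤ b → ‖ C k z *ᶜ C k w -ᶜ C k (z +ᶜ w) ‖ ℚ.≤ tailᴿ k k b
  multiplication-error {b} k z w h = begin
    ‖ C k z *ᶜ C k w -ᶜ C k (z +ᶜ w) ‖   ≡⟨ cong ‖_‖ (trans (cong (_-ᶜ C k (z +ᶜ w)) (trans (sym (C-* k z w)) (ℂ.+-comm (C k (z +ᶜ w)) (defectᶜ 0 k 0 z w)))) (trans (ℂ.+-assoc (defectᶜ 0 k 0 z w) (C k (z +ᶜ w)) _) (trans (cong (defectᶜ 0 k 0 z w +ᶜ_) (ℂ.-‿inverseʳ (C k (z +ᶜ w)))) (ℂ.+-identityʳ (defectᶜ 0 k 0 z w))))) ⟩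
    ‖ defectᶜ 0 k 0 z w ‖                ≤⟨ ‖defect‖ 0 k 0 z w ⟩
    defectᴿ 0 k 0 ‖ z ‖ ‖ w ‖            ≤⟨ defect≤tail k 0≤‖ z ‖ 0≤‖ w ‖ ⟩
    tailᴿ k k (‖ z ‖ ℚ.+ ‖ w ‖)          ≤⟨ tail-mono k k (0≤⇒+ 0≤‖ z ‖ 0≤‖ w ‖) h ⟩
    tailᴿ k k b                          ∎
    where open ℚ.≤-Reasoning

  small-≤ : ∀ {x y} N₀ → (∀ k → N₀ ℕ.≤ k → x k ℚ.≤ y k) → Small y → Small x
  small-≤ N₀ h s ε 0<ε = let (N , b) = s ε 0<ε in N₀ ℕ.+ N , λ k N≤k →
    ℚ.≤-trans (h k (ℕ.≤-trans (ℕ.m≤m+n N₀ N) N≤k)) (b k (ℕ.≤-trans (ℕ.m≤n+m N N₀) N≤k))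

  0<recip : ∀ j → 0ℚ ℚ.< recip j
  0<recip j = ℚ.positive⁻¹ (recip j) {{ℚ.normalize-pos 1 (suc j)}}

  0<* : ∀ {a b} → 0ℚ ℚ.< a → 0ℚ ℚ.< b → 0ℚ ℚ.< a ℚ.* b
  0<* {a} {b} ha hb = ℚ.positive⁻¹ (a ℚ.* b) {{ℚ.pos*pos⇒pos a {{ℚ.positive ha}} b {{ℚ.positive hb}}}}

  small-+ : ∀ {x y} → Small x → Small y → Small (λ k → x k ℚ.+ y k)
  small-+ {x} {y} sx sy ε 0<ε =
    let ε/2 = recip 1 ℚ.* ε
        (N , b) = sx ε/2 (0<* (0<recip 1) 0<ε)
        (M , b′) = sy ε/2 (0<* (0<recip 1) 0<ε)
    in N ℕ.+ M , λ k h → ℚ.≤-trans (ℚ.+-mono-≤ (b k (ℕ.≤-trans (ℕ.m≤m+n N M) h)) (b′ k (ℕ.≤-trans (ℕ.m≤n+m M N) h)))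
         (ℚ.≤-reflexive (trans (sym (ℚ.*-distribʳ-+ ε (recip 1) (recip 1))) (ℚ.*-identityˡ ε)))

  small-scale : ∀ B {x} → Small x → Small (λ k → fromℕ B ℚ.* x k)
  small-scale B {x} s ε 0<ε = let (N , b) = s (recip B ℚ.* ε) 0<ε′ in N , λ k h → begin
    fromℕ B ℚ.* x k                           ≤⟨ *-monoˡ (0≤fromℕ B) (b k h) ⟩
    fromℕ B ℚ.* (recip B ℚ.* ε)               ≤⟨ *-monoʳ (ℚ.<⇒≤ 0<ε′) (fromℕ-mono B (suc B) (ℕ.n≤1+n B)) ⟩
    fromℕ (suc B) ℚ.* (recip B ℚ.* ε)         ≡⟨ trans (sym (ℚ.*-assoc (fromℕ (suc B)) (recip B) ε)) (trans (cong (ℚ._* ε) (reciprocal (suc B))) (ℚ.*-identityˡ ε)) ⟩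
    ε                                         ∎
    where
    open ℚ.≤-Reasoning
    0<ε′ : 0ℚ ℚ.< recip B ℚ.* ε
    0<ε′ = 0<* (0<recip B) 0<ε

  Bounded : (ℕ → ℚ[i]) → Set
  Bounded z = ∃[ B ] ∃[ N ] (∀ k → N ℕ.≤ k → ‖ z k ‖ ℚ.≤ fromℕ B)

  Close : (ℕ → ℚ[i]) → (ℕ → ℚ[i]) → Set
  Close z w = Small (λ k → ‖ z k -ᶜ w k ‖)

  close-≡ : ∀ {z w} → (∀ k → z k ≡ w k) → Close z w
  close-≡ {z} {w} h ε 0<ε = 0 , λ k _ → ℚ.≤-trans (ℚ.≤-reflexive (cong ‖_‖ (trans (cong (_-ᶜ w k) (h k)) (ℂ.-‿inverseʳ (w k))))) (ℚ.<⇒≤ 0<ε)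

  close-trans : ∀ {z w v} → Close z w → Close w v → Close z v
  close-trans {z} {w} {v} h k = small-≤ 0 (λ j _ → ℚ.≤-trans (ℚ.≤-reflexive (cong ‖_‖ (split (z j) (w j) (v j)))) (‖+‖ (z j -ᶜ w j) (w j -ᶜ v j))) (small-+ h k)
    where
    split : ∀ z w v → z -ᶜ v ≡ (z -ᶜ w) +ᶜ (w -ᶜ v)
    split (a +i b) (c +i d) (e +i f) = cong₂ _+i_ (solve 3 (λ a c e → a :- e := (a :- c) :+ (c :- e)) refl a c e) (solve 3 (λ a c e → a :- e := (a :- c) :+ (c :- e)) refl b d f)
      where open ℚS using (solve; _:+_; _:-_; _:=_)

  close-sym : ∀ {z w} → Close z w → Close w z
  close-sym {z} {w} = small-≤ 0 (λ k _ → ℚ.≤-reflexive (trans (cong ‖_‖ (swap (w k) (z k))) (‖neg‖ (z k -ᶜ w k))))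
    where
    swap : ∀ z w → z -ᶜ w ≡ negᶜ (w -ᶜ z)
    swap (a +i b) (c +i d) = cong₂ _+i_ (solve 2 (λ a c → a :- c := :- (c :- a)) refl a c) (solve 2 (λ a c → a :- c := :- (c :- a)) refl b d)
      where open ℚS using (solve; :-_; _:-_; _:=_)

  close-+ : ∀ {z w z′ w′} → Close z z′ → Close w w′ → Close (λ k → z k +ᶜ w k) (λ k → z′ k +ᶜ w′ k)
  close-+ {z} {w} {z′} {w′} h k = small-≤ 0 (λ j _ → ℚ.≤-trans (ℚ.≤-reflexive (cong ‖_‖ (split (z j) (w j) (z′ j) (w′ j)))) (‖+‖ (z j -ᶜ z′ j) (w j -ᶜ w′ j))) (small-+ h k)
    where
    split : ∀ z w z′ w′ → (z +ᶜ w) -ᶜ (z′ +ᶜ w′) ≡ (z -ᶜ z′) +ᶜ (w -ᶜ w′)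
    split (a +i b) (c +i d) (e +i f) (g +i h) = cong₂ _+i_ (lemma a c e g) (lemma b d f h)
      where
      open ℚS using (solve; _:+_; _:-_; _:=_)
      lemma : ∀ a c e g → (a ℚ.+ c) ℚ.- (e ℚ.+ g) ≡ (a ℚ.- e) ℚ.+ (c ℚ.- g)
      lemma = solve 4 (λ a c e g → (a :+ c) :- (e :+ g) := (a :- e) :+ (c :- g)) refl

  close-* : ∀ {z w z′ w′} → Bounded z → Bounded w′ → Close z z′ → Close w w′ → Close (λ k → z k *ᶜ w k) (λ k → z′ k *ᶜ w′ k)
  close-* {z} {w} {z′} {w′} (B , N , zB) (B′ , N′ , wB) h h′ = small-≤ (N ℕ.+ N′) (λ j N≤j → ℚ.≤-trans (ℚ.≤-reflexive (cong ‖_‖ (split (z j) (w j) (z′ j) (w′ j))))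
      (‖+‖-≤ (z j *ᶜ (w j -ᶜ w′ j)) (w′ j *ᶜ (z j -ᶜ z′ j)) (‖*‖-≤ (z j) (w j -ᶜ w′ j) (zB j (ℕ.≤-trans (ℕ.m≤m+n N N′) N≤j)) ℚ.≤-refl) (‖*‖-≤ (w′ j) (z j -ᶜ z′ j) (wB j (ℕ.≤-trans (ℕ.m≤n+m N′ N) N≤j)) ℚ.≤-refl)))
    (small-+ (small-scale B h′) (small-scale B′ h))
    where
    split : ∀ z w z′ w′ → (z *ᶜ w) -ᶜ (z′ *ᶜ w′) ≡ (z *ᶜ (w -ᶜ w′)) +ᶜ (w′ *ᶜ (z -ᶜ z′))
    split z w z′ w′ = begin
      z *ᶜ w +ᶜ negᶜ (z′ *ᶜ w′)                                    ≡⟨ cong (z *ᶜ w +ᶜ_) (-‿distribˡ-* z′ w′) ⟩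
      z *ᶜ w +ᶜ negᶜ z′ *ᶜ w′                                      ≡⟨ sym (ℂ.+-identityʳ _) ⟩
      z *ᶜ w +ᶜ negᶜ z′ *ᶜ w′ +ᶜ 0ᶜ                                ≡⟨ cong (z *ᶜ w +ᶜ negᶜ z′ *ᶜ w′ +ᶜ_) (sym (trans (cong (z *ᶜ_) (ℂ.-‿inverseˡ w′)) (ℂ.zeroʳ z))) ⟩
      z *ᶜ w +ᶜ negᶜ z′ *ᶜ w′ +ᶜ z *ᶜ (negᶜ w′ +ᶜ w′)
        ≡⟨ solve 5 (λ z w w′ m n → z :* w :+ m :* w′ :+ z :* (n :+ w′) := z :* (w :+ n) :+ w′ :* (z :+ m)) refl z w w′ (negᶜ z′) (negᶜ w′) ⟩
      (z *ᶜ (w -ᶜ w′)) +ᶜ (w′ *ᶜ (z -ᶜ z′))                        ∎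
      where
      open ≡-Reasoning
      open ℂS using (solve; _:+_; _:*_; _:=_)
      open import Algebra.Properties.Ring ℂ.ring using (-‿distribˡ-*)

  bounded-const : ∀ z → Bounded (λ _ → z)
  bounded-const z = let (B , h) = above ‖ z ‖ in B , 0 , λ _ _ → h

  bounded-+ : ∀ {z w} → Bounded z → Bounded w → Bounded (λ k → z k +ᶜ w k)
  bounded-+ {z} {w} (B , N , zB) (B′ , N′ , wB) = B ℕ.+ B′ , N ℕ.+ N′ , λ k h →
    ℚ.≤-trans (‖+‖-≤ (z k) (w k) (zB k (ℕ.≤-trans (ℕ.m≤m+n N N′) h)) (wB k (ℕ.≤-trans (ℕ.m≤n+m N′ N) h))) (ℚ.≤-reflexive (sym (fromℕ-+ B B′)))

  bounded-* : ∀ {z w} → Bounded z → Bounded w → Bounded (λ k → z k *ᶜ w k)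
  bounded-* {z} {w} (B , N , zB) (B′ , N′ , wB) = B ℕ.* B′ , N ℕ.+ N′ , λ k h →
    ℚ.≤-trans (‖*‖-≤ (z k) (w k) (zB k (ℕ.≤-trans (ℕ.m≤m+n N N′) h)) (wB k (ℕ.≤-trans (ℕ.m≤n+m N′ N) h))) (ℚ.≤-reflexive (sym (fromℕ-* B B′)))

  bounded-^ : ∀ {z} j → Bounded z → Bounded (λ k → z k ^ᶜ j)
  bounded-^ zero    h = bounded-const 1ᶜ
  bounded-^ {z} (suc j) h = bounded-* {z} {λ k → z k ^ᶜ j} h (bounded-^ {z} j h)

  R-bounded : ∀ B → ∃[ M ] (∀ k → R k (fromℕ B) ℚ.≤ fromℕ M)
  R-bounded B = let (M , h) = above (R K x ℚ.+ r K x) in M , λ k → ℚ.≤-trans (R-more′ (ℕ.m≤n+m k K) (0≤fromℕ B))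
      (ℚ.≤-trans (ℚ.≤-reflexive (R-tail K k x)) (ℚ.≤-trans (ℚ.+-monoʳ-≤ (R K x) (tail≤r K k (0≤fromℕ B) (ℚ.≤-trans (ℚ.≤-reflexive (sym (fromℕ-+ B B))) (fromℕ-mono K (suc K) (ℕ.n≤1+n K))))) h))
    where
    x : ℚ
    x = fromℕ B
    K : ℕ
    K = B ℕ.+ B

  bounded-C : ∀ {z} → Bounded z → Bounded (λ k → C k (z k))
  bounded-C {z} (B , N , zB) = let (M , h) = R-bounded B in M , N , λ k N≤k → ℚ.≤-trans (‖C‖ k (z k)) (ℚ.≤-trans (R-mono k 0≤‖ z k ‖ (zB k N≤k)) (h k))

  C-multiplicative : ∀ {z w} → Bounded z → Bounded w → Close (λ k → C k (z k) *ᶜ C k (w k)) (λ k → C k (z k +ᶜ w k))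
  C-multiplicative {z} {w} (B , N , zB) (B′ , N′ , wB) = small-≤ {λ k → ‖ C k (z k) *ᶜ C k (w k) -ᶜ C k (z k +ᶜ w k) ‖} {λ k → tailᴿ k k b} (N ℕ.+ N′) error (tail-small (B ℕ.+ B′))
    where
    b : ℚ
    b = fromℕ (B ℕ.+ B′)
    error : ∀ k → N ℕ.+ N′ ℕ.≤ k → ‖ C k (z k) *ᶜ C k (w k) -ᶜ C k (z k +ᶜ w k) ‖ ℚ.≤ tailᴿ k k b
    error k h = multiplication-error {b} k (z k) (w k)
      (ℚ.≤-trans (ℚ.+-mono-≤ (zB k (ℕ.≤-trans (ℕ.m≤m+n N N′) h)) (wB k (ℕ.≤-trans (ℕ.m≤n+m N′ N) h))) (ℚ.≤-reflexive (sym (fromℕ-+ B B′))))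

  multiple : ℕ → ℚ[i] → ℚ[i]
  multiple zero    z = 0ᶜ
  multiple (suc j) z = z +ᶜ multiple j z

  bounded-multiple : ∀ {z} j → Bounded z → Bounded (λ k → multiple j (z k))
  bounded-multiple zero    h = bounded-const 0ᶜ
  bounded-multiple {z} (suc j) h = bounded-+ {z} {λ k → multiple j (z k)} h (bounded-multiple {z} j h)

  R-0 : ∀ k → R k 0ℚ ≡ 1ℚ
  R-0 zero    = refl
  R-0 (suc k) = trans (cong₂ ℚ._+_ (R-0 k) (trans (cong (inverse-factorial (suc k) ℚ.*_) (ℚ.*-zeroˡ (0ℚ ↑ᴿ k))) (ℚ.*-zeroʳ (inverse-factorial (suc k))))) (ℚ.+-identityʳ 1ℚ)

  C-power : ∀ {z} j → Bounded z → Close (λ k → C k (z k) ^ᶜ j) (λ k → C k (multiple j (z k)))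
  C-power {z} zero    h = close-≡ {λ k → C k (z k) ^ᶜ 0} {λ k → C k (multiple 0 (z k))} λ k → sym (trans (C-real k 0ℚ) (cong real (R-0 k)))
  C-power {z} (suc j) h = close-trans {λ k → C k (z k) ^ᶜ suc j} {λ k → C k (z k) *ᶜ C k (multiple j (z k))} {λ k → C k (multiple (suc j) (z k))}
    (close-* {λ k → C k (z k)} {λ k → C k (z k) ^ᶜ j} {λ k → C k (z k)} {λ k → C k (multiple j (z k))}
      (bounded-C {z} h) (bounded-C {λ k → multiple j (z k)} (bounded-multiple {z} j h)) (close-≡ {λ k → C k (z k)} λ k → refl) (C-power {z} j h))
    (C-multiplicative {z} {λ k → multiple j (z k)} h (bounded-multiple {z} j h))

  close-^ : ∀ {z w} j → Bounded z → Bounded w → Close z w → Close (λ k → z k ^ᶜ j) (λ k → w k ^ᶜ j)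
  close-^ {z} {w} zero    bz bw h = close-≡ {λ _ → 1ᶜ} λ k → refl
  close-^ {z} {w} (suc j) bz bw h = close-* {z} {λ k → z k ^ᶜ j} {w} {λ k → w k ^ᶜ j} bz (bounded-^ {w} j bw) h (close-^ {z} {w} j bz bw h)

  geo : ℕ → ℚ[i] → ℚ[i]
  geo zero    z = 0ᶜ
  geo (suc m) z = geo m z +ᶜ z ^ᶜ m

  geo-identity : ∀ m z → z *ᶜ geo m z +ᶜ 1ᶜ ≡ geo m z +ᶜ z ^ᶜ m
  geo-identity zero    z = cong (_+ᶜ 1ᶜ) (ℂ.zeroʳ z)
  geo-identity (suc m) z = begin
    z *ᶜ (geo m z +ᶜ z ^ᶜ m) +ᶜ 1ᶜ            ≡⟨ solve 4 (λ z g y o → z :* (g :+ y) :+ o := (z :* g :+ o) :+ z :* y) refl z (geo m z) (z ^ᶜ m) 1ᶜ ⟩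
    (z *ᶜ geo m z +ᶜ 1ᶜ) +ᶜ z *ᶜ z ^ᶜ m       ≡⟨ cong (_+ᶜ z *ᶜ z ^ᶜ m) (geo-identity m z) ⟩
    geo (suc m) z +ᶜ z ^ᶜ suc m               ∎
    where
    open ≡-Reasoning
    open ℂS using (solve; _:+_; _:*_; _:=_)

  geo-factor : ∀ m z → (z -ᶜ 1ᶜ) *ᶜ geo m z ≡ z ^ᶜ m -ᶜ 1ᶜ
  geo-factor m z = difference z (geo m z) (z ^ᶜ m) (geo-identity m z)
    where
    difference : ∀ z g y → z *ᶜ g +ᶜ 1ᶜ ≡ g +ᶜ y → (z -ᶜ 1ᶜ) *ᶜ g ≡ y -ᶜ 1ᶜ
    difference z g y e = begin
      (z -ᶜ 1ᶜ) *ᶜ g                              ≡⟨ sym (ℂ.+-identityʳ _) ⟩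
      (z -ᶜ 1ᶜ) *ᶜ g +ᶜ 0ᶜ                        ≡⟨ cong ((z -ᶜ 1ᶜ) *ᶜ g +ᶜ_) (sym (ℂ.-‿inverseʳ (g +ᶜ 1ᶜ))) ⟩
      (z -ᶜ 1ᶜ) *ᶜ g +ᶜ ((g +ᶜ 1ᶜ) -ᶜ (g +ᶜ 1ᶜ))  ≡⟨ sym (ℂ.+-assoc ((z -ᶜ 1ᶜ) *ᶜ g) (g +ᶜ 1ᶜ) _) ⟩
      ((z -ᶜ 1ᶜ) *ᶜ g +ᶜ (g +ᶜ 1ᶜ)) -ᶜ (g +ᶜ 1ᶜ)  ≡⟨ cong (_-ᶜ (g +ᶜ 1ᶜ)) (trans (lemma z g) (trans e (ℂ.+-comm g y))) ⟩
      (y +ᶜ g) -ᶜ (g +ᶜ 1ᶜ)                       ≡⟨ lemma′ y g ⟩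
      y -ᶜ 1ᶜ                                     ∎
      where
      open ≡-Reasoning
      open ℚS using (solve; _:+_; _:*_; _:-_; _:=_; con)
      lemma : ∀ z g → (z -ᶜ 1ᶜ) *ᶜ g +ᶜ (g +ᶜ 1ᶜ) ≡ z *ᶜ g +ᶜ 1ᶜ
      lemma (a +i b) (c +i d) = cong₂ _+i_
        (solve 4 (λ a b c d → ((a :- con 1ℚ) :* c :- (b :- con 0ℚ) :* d) :+ (c :+ con 1ℚ) := (a :* c :- b :* d) :+ con 1ℚ) refl a b c d)
        (solve 4 (λ a b c d → ((a :- con 1ℚ) :* d :+ (b :- con 0ℚ) :* c) :+ (d :+ con 0ℚ) := (a :* d :+ b :* c) :+ con 0ℚ) refl a b c d)
      lemma′ : ∀ y g → (y +ᶜ g) -ᶜ (g +ᶜ 1ᶜ) ≡ y -ᶜ 1ᶜ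
      lemma′ (a +i b) (c +i d) = cong₂ _+i_ (solve 2 (λ a c → (a :+ c) :- (c :+ con 1ℚ) := a :- con 1ℚ) refl a c) (solve 2 (λ a c → (a :+ c) :- (c :+ con 0ℚ) := a :- con 0ℚ) refl b d)

  bounded-geo : ∀ {z} m → Bounded z → Bounded (λ k → geo m (z k))
  bounded-geo {z} zero    h = bounded-const 0ᶜ
  bounded-geo {z} (suc m) h = bounded-+ {λ k → geo m (z k)} {λ k → z k ^ᶜ m} (bounded-geo {z} m h) (bounded-^ {z} m h)

  close-geo : ∀ {z w} m → Bounded z → Bounded w → Close z w → Close (λ k → geo m (z k)) (λ k → geo m (w k))
  close-geo {z} {w} zero    bz bw h = close-≡ {λ _ → 0ᶜ} λ k → refl
  close-geo {z} {w} (suc m) bz bw h = close-+ {λ k → geo m (z k)} {λ k → z k ^ᶜ m} {λ k → geo m (w k)} {λ k → w k ^ᶜ m}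
    (close-geo {z} {w} m bz bw h) (close-^ {z} {w} m bz bw h)

open ComplexLimits

module RootsOfUnity where

  ∣∣≤ : ∀ {a b} → a ℚ.≤ b → ℚ.- a ℚ.≤ b → ∣ a ∣ ℚ.≤ b
  ∣∣≤ {a} h h′ with ℚ.∣p∣≡p∨∣p∣≡-p a
  ... | inj₁ e = ℚ.≤-trans (ℚ.≤-reflexive e) h
  ... | inj₂ e = ℚ.≤-trans (ℚ.≤-reflexive e) h′

  ≲⇒-≤ : ∀ {a b c} → a ℚ.≤ b ℚ.+ c → a ℚ.- b ℚ.≤ c
  ≲⇒-≤ {a} {b} {c} h = ℚ.≤-trans (ℚ.+-monoˡ-≤ (ℚ.- b) h) (ℚ.≤-reflexive (solve 2 (λ b c → (b :+ c) :- b := c) refl b c))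
    where open ℚS using (solve; _:+_; _:-_; _:=_)

  ≃⇒small : ∀ {x y} → x ≃ y → Small (λ k → ∣ x k ℚ.- y k ∣)
  ≃⇒small {x} {y} (h , h′) ε 0<ε = let (N , b) = h ε 0<ε ; (N′ , b′) = h′ ε 0<ε in N ℕ.+ N′ , λ k N≤k →
    ∣∣≤ (≲⇒-≤ {x k} {y k} (b k (ℕ.≤-trans (ℕ.m≤m+n N N′) N≤k)))
        (ℚ.≤-trans (ℚ.≤-reflexive (solve 2 (λ x y → :- (x :- y) := y :- x) refl (x k) (y k))) (≲⇒-≤ {y k} {x k} (b′ k (ℕ.≤-trans (ℕ.m≤n+m N′ N) N≤k))))
    where open ℚS using (solve; :-_; _:-_; _:=_)

  division : ∀ m p .{{_ : NonZero p}} → + m / p ≡ fromℕ m ℚ.* (+ 1 / p)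
  division m p@(suc k) = begin
    + m / p                                    ≡⟨ sym (ℚ.*-identityʳ _) ⟩
    (+ m / p) ℚ.* 1ℚ                           ≡⟨ cong ((+ m / p) ℚ.*_) (sym (reciprocal p)) ⟩
    (+ m / p) ℚ.* (fromℕ p ℚ.* (+ 1 / p))      ≡⟨ solve 3 (λ a b c → a :* (b :* c) := (b :* a) :* c) refl (+ m / p) (fromℕ p) (+ 1 / p) ⟩
    (fromℕ p ℚ.* (+ m / p)) ℚ.* (+ 1 / p)      ≡⟨ cong (ℚ._* (+ 1 / p)) multiply ⟩
    fromℕ m ℚ.* (+ 1 / p)                      ∎
    where
    open ≡-Reasoning
    open ℚS using (solve; _:*_; _:=_)
    multiply : fromℕ p ℚ.* (+ m / p) ≡ fromℕ m
    multiply = ℚ.toℚᵘ-injective (ℚᵘ.≃-trans (ℚ.toℚᵘ-homo-* (fromℕ p) (+ m / p)) (ℚᵘ.≃-trans (ℚᵘ.*-cong (toℚᵘ-fromℕ p) (ℚ.toℚᵘ-fromℚᵘ (mkℚᵘ (+ m) k)))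
      (ℚᵘ.≃-trans (*≡* (trans (ℤ.*-identityʳ _) (trans (ℤ.*-comm (+ p) (+ m)) (cong (+ m ℤ.*_) (sym (ℤ.*-identityˡ (+ p))))))) (ℚᵘ.≃-sym (toℚᵘ-fromℕ m)))))

  0≤1/ : ∀ p .{{_ : NonZero p}} → 0ℚ ℚ.≤ + 1 / p
  0≤1/ p = ℚ.nonNegative⁻¹ (+ 1 / p) {{ℚ.normalize-nonNeg 1 p}}

  1/-antimono : ∀ m p .{{_ : NonZero m}} .{{_ : NonZero p}} → m ℕ.≤ p → + 1 / p ℚ.≤ + 1 / m
  1/-antimono m p m≤p = begin
    + 1 / p                                    ≡⟨ sym (trans (cong ((+ 1 / p) ℚ.*_) (reciprocal m)) (ℚ.*-identityʳ _)) ⟩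
    (+ 1 / p) ℚ.* (fromℕ m ℚ.* (+ 1 / m))      ≤⟨ *-monoˡ (0≤1/ p) (*-monoʳ (0≤1/ m) (fromℕ-mono m p m≤p)) ⟩
    (+ 1 / p) ℚ.* (fromℕ p ℚ.* (+ 1 / m))      ≡⟨ solve 3 (λ a b c → a :* (b :* c) := (b :* a) :* c) refl (+ 1 / p) (fromℕ p) (+ 1 / m) ⟩
    (fromℕ p ℚ.* (+ 1 / p)) ℚ.* (+ 1 / m)      ≡⟨ trans (cong (ℚ._* (+ 1 / m)) (reciprocal p)) (ℚ.*-identityˡ _) ⟩
    + 1 / m                                    ∎
    where
    open ℚ.≤-Reasoning
    open ℚS using (solve; _:*_; _:=_)

  R-quadratic : ∀ {x} k → 0ℚ ℚ.≤ x → x ℚ.+ x ℚ.≤ fromℕ 3 → R k x ℚ.≤ (1ℚ ℚ.+ x) ℚ.+ x ℚ.* x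
  R-quadratic {x} k h 2x≤3 = ℚ.≤-trans (R-more′ (ℕ.m≤n+m k 2) h) (ℚ.≤-trans (≤-+ʳ (0≤r (2 ℕ.+ k) h)) (go k))
    where
    go : ∀ k → R (2 ℕ.+ k) x ℚ.+ r (2 ℕ.+ k) x ℚ.≤ (1ℚ ℚ.+ x) ℚ.+ x ℚ.* x
    go zero    = ℚ.≤-reflexive (solve 1 (λ x → ((con 1ℚ :* con 1ℚ :+ con 1ℚ :* (x :* con 1ℚ)) :+ con ½ :* (x :* (x :* con 1ℚ))) :+ con ½ :* (x :* (x :* con 1ℚ)) := (con 1ℚ :+ x) :+ x :* x) refl x)
      where open ℚS using (solve; _:+_; _:*_; _:=_; con)
    go (suc k) = ℚ.≤-trans (ℚ.≤-reflexive (ℚ.+-assoc (R (2 ℕ.+ k) x) (r (3 ℕ.+ k) x) (r (3 ℕ.+ k) x)))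
      (ℚ.≤-trans (ℚ.+-monoʳ-≤ (R (2 ℕ.+ k) x) (r-halving (2 ℕ.+ k) h (ℚ.≤-trans 2x≤3 (fromℕ-mono 3 (3 ℕ.+ k) (ℕ.m≤m+n 3 k))))) (go k))

  small-∣∣² : ∀ {z : ℕ → ℚ[i]} → Small (λ k → ‖ z k ‖) → Small (λ k → ∣ z k ∣²)
  small-∣∣² {z} h = let (N , b) = h 1ℚ (ℚ.positive⁻¹ 1ℚ) in
    small-≤ {λ k → ∣ z k ∣²} {λ k → ‖ z k ‖} N (λ k N≤k → ℚ.≤-trans (∣∣²≤ (z k)) (ℚ.≤-trans (*-monoʳ 0≤‖ z k ‖ (b k N≤k)) (ℚ.≤-reflexive (ℚ.*-identityˡ ‖ z k ‖)))) h

  -1ᶜ : ℚ[i]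
  -1ᶜ = (ℚ.- 1ℚ) +i 0ℚ

  difference-of-squares : ∀ z → z *ᶜ z -ᶜ 1ᶜ ≡ (z -ᶜ 1ᶜ) *ᶜ (z -ᶜ -1ᶜ)
  difference-of-squares (a +i b) = cong₂ _+i_
    (solve 2 (λ a b → (a :* a :- b :* b) :- con 1ℚ := (a :- con 1ℚ) :* (a :- (:- con 1ℚ)) :- (b :- con 0ℚ) :* (b :- con 0ℚ)) refl a b)
    (solve 2 (λ a b → (a :* b :+ b :* a) :- con 0ℚ := (a :- con 1ℚ) :* (b :- con 0ℚ) :+ (b :- con 0ℚ) :* (a :- (:- con 1ℚ))) refl a b)
    where open ℚS using (solve; _:+_; _:*_; _:-_; :-_; _:=_; con)

  square-^ : ∀ z j → (z *ᶜ z) ^ᶜ j ≡ z ^ᶜ j *ᶜ z ^ᶜ j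
  square-^ z zero    = refl
  square-^ z (suc j) = trans (cong ((z *ᶜ z) *ᶜ_) (square-^ z j)) (solve 2 (λ z y → (z :* z) :* (y :* y) := (z :* y) :* (z :* y)) refl z (z ^ᶜ j))
    where open ℂS using (solve; _:*_; _:=_)

  -- For u = ζᵖ, P = ∑ ζʲ and S = ∑ ζ²ʲ we have (ζ - 1) P = u - 1 and
  -- (ζ² - 1) S = u² - 1, whence |ζ + 1|² |S|² = |P|² |u + 1|².
  double-sum : ∀ p ζ → let u = ζ ^ᶜ p in 1ℚ ℚ.≤ ∣ u -ᶜ 1ᶜ ∣² →
    ∣ ζ -ᶜ -1ᶜ ∣² ℚ.* ∣ geo p (ζ *ᶜ ζ) ∣² ≡ ∣ geo p ζ ∣² ℚ.* ∣ u -ᶜ -1ᶜ ∣²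
  double-sum p ζ 1≤U = ℚ.≤-antisym (cancel (ℚ.≤-reflexive eq)) (cancel (ℚ.≤-reflexive (sym eq)))
    where
    u : ℚ[i]
    u = ζ ^ᶜ p
    A P D X Y : ℚ
    A = ∣ ζ -ᶜ 1ᶜ ∣²
    P = ∣ geo p ζ ∣²
    D = ∣ ζ -ᶜ -1ᶜ ∣²
    X = ∣ geo p (ζ *ᶜ ζ) ∣²
    Y = ∣ u -ᶜ -1ᶜ ∣²
    AP : A ℚ.* P ≡ ∣ u -ᶜ 1ᶜ ∣²
    AP = trans (sym (∣∣²-* (ζ -ᶜ 1ᶜ) (geo p ζ))) (cong ∣_∣² (geo-factor p ζ))
    ADX : (A ℚ.* D) ℚ.* X ≡ ∣ u -ᶜ 1ᶜ ∣² ℚ.* Y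
    ADX = begin
      (A ℚ.* D) ℚ.* X                                    ≡⟨ cong (ℚ._* X) (trans (sym (∣∣²-* (ζ -ᶜ 1ᶜ) (ζ -ᶜ -1ᶜ))) (cong ∣_∣² (sym (difference-of-squares ζ)))) ⟩
      ∣ ζ *ᶜ ζ -ᶜ 1ᶜ ∣² ℚ.* X                            ≡⟨ sym (∣∣²-* (ζ *ᶜ ζ -ᶜ 1ᶜ) (geo p (ζ *ᶜ ζ))) ⟩
      ∣ (ζ *ᶜ ζ -ᶜ 1ᶜ) *ᶜ geo p (ζ *ᶜ ζ) ∣²              ≡⟨ cong ∣_∣² (trans (geo-factor p (ζ *ᶜ ζ)) (trans (cong (_-ᶜ 1ᶜ) (square-^ ζ p)) (difference-of-squares u))) ⟩
      ∣ (u -ᶜ 1ᶜ) *ᶜ (u -ᶜ -1ᶜ) ∣²                       ≡⟨ ∣∣²-* (u -ᶜ 1ᶜ) (u -ᶜ -1ᶜ) ⟩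
      ∣ u -ᶜ 1ᶜ ∣² ℚ.* Y                                 ∎
      where open ≡-Reasoning
    A>0 : 0ℚ ℚ.< A
    A>0 = ℚ.≰⇒> λ A≤0 → <⇒≱ (ℚ.positive⁻¹ 1ℚ) (ℚ.≤-trans 1≤U (ℚ.≤-trans (ℚ.≤-reflexive (sym AP)) (ℚ.≤-trans (*-monoʳ (0≤∣∣² (geo p ζ)) A≤0) (ℚ.≤-reflexive (ℚ.*-zeroˡ P)))))
    cancel : ∀ {a b} → A ℚ.* a ℚ.≤ A ℚ.* b → a ℚ.≤ b
    cancel = ℚ.*-cancelˡ-≤-pos A {{ℚ.positive A>0}}
    eq : A ℚ.* (D ℚ.* X) ≡ A ℚ.* (P ℚ.* Y)
    eq = trans (sym (ℚ.*-assoc A D X)) (trans ADX (trans (cong (ℚ._* Y) (sym AP)) (ℚ.*-assoc A P Y)))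

  module _ (p : ℕ) .{{_ : NonZero p}} (t : ℕ → ℚ) (isPi : IsPi t) where

    z : ℕ → ℚ[i]
    z k = 0ℚ +i (+ 1 / p) ℚ.* t k

    ζ : ℕ → ℚ[i]
    ζ k = C k (z k)

    root≡ : ∀ k → root p t k ≡ C k (z k +ᶜ z k)
    root≡ k = trans (expᶜ≡C k _) (cong (λ y → C k (0ℚ +i y)) (trans (cong (ℚ._* t k) (division 2 p)) (solve 2 (λ a t → (con (fromℕ 2) :* a) :* t := a :* t :+ a :* t) refl (+ 1 / p) (t k))))
      where open ℚS using (solve; _:+_; _:*_; _:=_; con)

    multiple-z : ∀ k → multiple p (z k) ≡ 0ℚ +i t k
    multiple-z k = trans (go p) (cong (0ℚ +i_) (trans (sym (ℚ.*-assoc (fromℕ p) (+ 1 / p) (t k))) (trans (cong (ℚ._* t k) (reciprocal p)) (ℚ.*-identityˡ (t k)))))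
      where
      y : ℚ
      y = (+ 1 / p) ℚ.* t k
      go : ∀ j → multiple j (z k) ≡ 0ℚ +i (fromℕ j ℚ.* y)
      go zero    = cong (0ℚ +i_) (sym (ℚ.*-zeroˡ y))
      go (suc j) = trans (cong (z k +ᶜ_) (go j)) (cong (0ℚ +i_) (trans (cong (ℚ._+ fromℕ j ℚ.* y) (sym (ℚ.*-identityˡ y)))
        (trans (sym (ℚ.*-distribʳ-+ y 1ℚ (fromℕ j))) (cong (ℚ._* y) (sym (fromℕ-suc j))))))

    t-bound : ∃[ N ] (∀ k → N ℕ.≤ k → ∣ t k ∣ ℚ.≤ + 33 / 8)
    t-bound = let (N , b) = proj₁ isPi (+ 1 / 8) (ℚ.positive⁻¹ (+ 1 / 8)) ; (N′ , b′) = proj₁ (proj₂ isPi) (+ 1 / 8) (ℚ.positive⁻¹ (+ 1 / 8)) in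
      N ℕ.+ N′ , λ k h → ∣∣≤ (ℚ.≤-trans (b′ k (ℕ.≤-trans (ℕ.m≤n+m N′ N) h)) (toWitness {a? = fromℕ 4 ℚ.+ (+ 1 / 8) ℚ.≤? + 33 / 8} _))
        (ℚ.≤-trans (negate (t k) (b k (ℕ.≤-trans (ℕ.m≤m+n N N′) h))) (toWitness {a? = + 1 / 8 ℚ.≤? + 33 / 8} _))
      where
      negate : ∀ a → 0ℚ ℚ.≤ a ℚ.+ (+ 1 / 8) → ℚ.- a ℚ.≤ + 1 / 8
      negate a h = ℚ.≤-trans (ℚ.≤-reflexive (sym (ℚ.+-identityˡ (ℚ.- a)))) (≲⇒-≤ {0ℚ} {a} h)

    ‖z‖≤ : ∀ m .{{_ : NonZero m}} → m ℕ.≤ p → ∃[ N ] (∀ k → N ℕ.≤ k → ‖ z k ‖ ℚ.≤ (+ 1 / m) ℚ.* (+ 33 / 8))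
    ‖z‖≤ m m≤p = let (N , b) = t-bound in N , λ k h → ℚ.≤-trans (ℚ.≤-reflexive (trans (ℚ.+-identityˡ _) (trans (ℚ.∣p*q∣≡∣p∣*∣q∣ (+ 1 / p) (t k)) (cong (ℚ._* ∣ t k ∣) (ℚ.0≤p⇒∣p∣≡p (0≤1/ p))))))
      (*-mono (0≤1/ p) (ℚ.0≤∣p∣ (t k)) (1/-antimono m p m≤p) (b k h))

    z-bounded : 1 ℕ.≤ p → Bounded z
    z-bounded 1≤p = let (N , b) = ‖z‖≤ 1 1≤p in 5 , N , λ k h → ℚ.≤-trans (b k h) (toWitness {a? = (+ 1 / 1) ℚ.* (+ 33 / 8) ℚ.≤? fromℕ 5} _)

    exp-π : Close (λ k → C k (0ℚ +i t k)) (λ _ → -1ᶜ)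
    exp-π = small-+ {λ k → ∣ re (E k) ℚ.- (ℚ.- 1ℚ) ∣} {λ k → ∣ im (E k) ℚ.- 0ℚ ∣} (transfer re (proj₁ (proj₂ (proj₂ isPi)))) (transfer im (proj₂ (proj₂ (proj₂ isPi))))
      where
      E : ℕ → ℚ[i]
      E k = C k (0ℚ +i t k)
      transfer : ∀ (part : ℚ[i] → ℚ) {c} → (λ k → part (expᶜ k (0ℚ +i t k))) ≃ (λ _ → c) → Small (λ k → ∣ part (E k) ℚ.- c ∣)
      transfer part {c} h = small-≤ {λ k → ∣ part (E k) ℚ.- c ∣} {λ k → ∣ part (expᶜ k (0ℚ +i t k)) ℚ.- c ∣} 0
        (λ k _ → ℚ.≤-reflexive (cong (λ w → ∣ part w ℚ.- c ∣) (sym (expᶜ≡C k (0ℚ +i t k))))) (≃⇒small {λ k → part (expᶜ k (0ℚ +i t k))} {λ _ → c} h)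

    ζ^p : 1 ℕ.≤ p → Close (λ k → ζ k ^ᶜ p) (λ _ → -1ᶜ)
    ζ^p 1≤p = close-trans {λ k → ζ k ^ᶜ p} {λ k → C k (0ℚ +i t k)} {λ _ → -1ᶜ}
      (close-trans {λ k → ζ k ^ᶜ p} {λ k → C k (multiple p (z k))} {λ k → C k (0ℚ +i t k)} (C-power {z} p (z-bounded 1≤p))
        (close-≡ {λ k → C k (multiple p (z k))} {λ k → C k (0ℚ +i t k)} λ k → cong (C k) (multiple-z k))) exp-π

    -- |e^{iθ} + 1| is bounded below since θ = π / p ≤ 11/8.
    ζ+1 : 3 ℕ.≤ p → ∃[ N ] (∀ k → N ℕ.≤ k → 1ℚ ℚ.≤ fromℕ 100 ℚ.* ∣ ζ k -ᶜ -1ᶜ ∣²)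
    ζ+1 3≤p = let (N , b) = ‖z‖≤ 3 3≤p in suc N , λ { (suc k) (s≤s h) → bound k (ℚ.≤-trans (b (suc k) (ℕ.m≤n⇒m≤1+n h)) (toWitness {a? = (+ 1 / 3) ℚ.* (+ 33 / 8) ℚ.≤? + 11 / 8} _)) }
      where
      open ℚ.≤-Reasoning
      bound : ∀ k → ‖ z (suc k) ‖ ℚ.≤ + 11 / 8 → 1ℚ ℚ.≤ fromℕ 100 ℚ.* ∣ ζ (suc k) -ᶜ -1ᶜ ∣²
      bound k x≤ = begin
        1ℚ                                    ≡⟨⟩
        fromℕ 100 ℚ.* ((+ 1 / 10) ℚ.* (+ 1 / 10))   ≤⟨ *-monoˡ (0≤fromℕ 100) (*-mono (0≤1/ 10) (0≤1/ 10) re-large re-large) ⟩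
        fromℕ 100 ℚ.* (re ξ ℚ.* re ξ)         ≤⟨ *-monoˡ (0≤fromℕ 100) (≤-+ʳ {re ξ ℚ.* re ξ} {im ξ ℚ.* im ξ} (square≥0 (im ξ))) ⟩
        fromℕ 100 ℚ.* ∣ ξ ∣²                  ∎
        where
        w ξ τ : ℚ[i]
        w = z (suc k)
        ξ = ζ (suc k) -ᶜ -1ᶜ
        τ = tailᶜ 1 k w
        x : ℚ
        x = ‖ w ‖
        C-split : C (suc k) w ≡ (1ᶜ +ᶜ w) +ᶜ τ
        C-split = trans (C-tail 1 k w) (cong (_+ᶜ τ) (C₁ w))
          where
          C₁ : ∀ w → C 1 w ≡ 1ᶜ +ᶜ w
          C₁ (a +i b) = cong₂ _+i_
            (solve 2 (λ a b → con 1ℚ :+ (con 1ℚ :* (a :* con 1ℚ :- b :* con 0ℚ) :- con 0ℚ :* (a :* con 0ℚ :+ b :* con 1ℚ)) := con 1ℚ :+ a) refl a b)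
            (solve 2 (λ a b → con 0ℚ :+ (con 1ℚ :* (a :* con 0ℚ :+ b :* con 1ℚ) :+ con 0ℚ :* (a :* con 1ℚ :- b :* con 0ℚ)) := con 0ℚ :+ b) refl a b)
            where open ℚS using (solve; _:+_; _:*_; _:-_; _:=_; con)
        re-ξ : re ξ ≡ fromℕ 2 ℚ.+ re τ
        re-ξ = trans (cong (λ v → re v ℚ.- (ℚ.- 1ℚ)) C-split) (solve 1 (λ τ → ((con 1ℚ :+ con 0ℚ) :+ τ) :- (:- con 1ℚ) := con (fromℕ 2) :+ τ) refl (re τ))
          where open ℚS using (solve; _:+_; _:-_; :-_; _:=_; con)
        R₁ : R 1 x ≡ 1ℚ ℚ.+ x
        R₁ = solve 1 (λ x → con 1ℚ :* con 1ℚ :+ con 1ℚ :* (x :* con 1ℚ) := con 1ℚ :+ x) refl x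
          where open ℚS using (solve; _:+_; _:*_; _:=_; con)
        τ≤ : ∣ re τ ∣ ℚ.≤ (+ 11 / 8) ℚ.* (+ 11 / 8)
        τ≤ = begin
          ∣ re τ ∣             ≤⟨ ∣re∣≤ τ ⟩
          ‖ τ ‖                ≤⟨ ‖tail‖ 1 k w ⟩
          tailᴿ 1 k x          ≤⟨ +-cancelˡ-≤ (1ℚ ℚ.+ x) (ℚ.≤-trans (ℚ.≤-reflexive (trans (cong (ℚ._+ tailᴿ 1 k x) (sym R₁)) (sym (R-tail 1 k x))))
                                    (R-quadratic (1 ℕ.+ k) 0≤‖ w ‖ (ℚ.≤-trans (ℚ.+-mono-≤ x≤ x≤) (toWitness {a? = (+ 11 / 8) ℚ.+ (+ 11 / 8) ℚ.≤? fromℕ 3} _)))) ⟩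
          x ℚ.* x              ≤⟨ *-mono 0≤‖ w ‖ 0≤‖ w ‖ x≤ x≤ ⟩
          (+ 11 / 8) ℚ.* (+ 11 / 8) ∎
        re-large : + 1 / 10 ℚ.≤ re ξ
        re-large = begin
          + 1 / 10                                         ≤⟨ toWitness {a? = + 1 / 10 ℚ.≤? fromℕ 2 ℚ.- ((+ 11 / 8) ℚ.* (+ 11 / 8))} _ ⟩
          fromℕ 2 ℚ.- ((+ 11 / 8) ℚ.* (+ 11 / 8))          ≤⟨ ℚ.+-monoʳ-≤ (fromℕ 2) (ℚ.neg-antimono-≤ τ≤) ⟩
          fromℕ 2 ℚ.- ∣ re τ ∣                             ≤⟨ ℚ.+-monoʳ-≤ (fromℕ 2) (ℚ.≤-trans (ℚ.neg-antimono-≤ (ℚ.≤-trans (a≤∣a∣ (ℚ.- re τ)) (ℚ.≤-reflexive (ℚ.∣-p∣≡∣p∣ (re τ))))) (ℚ.≤-reflexive (solve 1 (λ a → :- (:- a) := a) refl (re τ)))) ⟩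
          fromℕ 2 ℚ.+ re τ                                 ≡⟨ sym re-ξ ⟩
          re ξ                                             ∎
          where open ℚS using (solve; :-_; _:=_)

    u-1 : 1 ℕ.≤ p → ∃[ N ] (∀ k → N ℕ.≤ k → 1ℚ ℚ.≤ ∣ ζ k ^ᶜ p -ᶜ 1ᶜ ∣²)
    u-1 1≤p = let (N , b) = ζ^p 1≤p 1ℚ (ℚ.positive⁻¹ 1ℚ) in N , λ k h → large (ζ k ^ᶜ p) (b k h)
      where
      large : ∀ u → ‖ u -ᶜ -1ᶜ ‖ ℚ.≤ 1ℚ → 1ℚ ℚ.≤ ∣ u -ᶜ 1ᶜ ∣²
      large (a +i b) h = ℚ.≤-trans (ℚ.≤-trans (*-mono (ℚ.nonNegative⁻¹ 1ℚ) (ℚ.nonNegative⁻¹ 1ℚ) 1≤ 1≤) (ℚ.≤-reflexive (solve 1 (λ a → (con 1ℚ :- a) :* (con 1ℚ :- a) := (a :- con 1ℚ) :* (a :- con 1ℚ)) refl a)))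
        (≤-+ʳ (square≥0 (b ℚ.- 0ℚ)))
        where
        open ℚS using (solve; _:+_; _:*_; _:-_; :-_; _:=_; con)
        a+1≤1 : a ℚ.- (ℚ.- 1ℚ) ℚ.≤ 1ℚ
        a+1≤1 = ℚ.≤-trans (a≤∣a∣ _) (ℚ.≤-trans (∣re∣≤ ((a +i b) -ᶜ -1ᶜ)) h)
        1≤ : 1ℚ ℚ.≤ 1ℚ ℚ.- a
        1≤ = ℚ.≤-trans (ℚ.≤-reflexive (solve 1 (λ a → con 1ℚ := (con 1ℚ :- a) :+ ((a :- (:- con 1ℚ)) :- con 1ℚ)) refl a))
          (ℚ.≤-trans (ℚ.+-monoʳ-≤ (1ℚ ℚ.- a) (ℚ.+-monoˡ-≤ (ℚ.- 1ℚ) a+1≤1)) (ℚ.≤-reflexive (ℚ.+-identityʳ _)))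

    close-root : 1 ℕ.≤ p → Close (root p t) (λ k → ζ k *ᶜ ζ k)
    close-root 1≤p = close-trans {root p t} {λ k → C k (z k +ᶜ z k)} {λ k → ζ k *ᶜ ζ k} (close-≡ {root p t} {λ k → C k (z k +ᶜ z k)} root≡)
      (close-sym {λ k → ζ k *ᶜ ζ k} {λ k → C k (z k +ᶜ z k)} (C-multiplicative {z} {z} (z-bounded 1≤p) (z-bounded 1≤p)))

    bounded-root : 1 ℕ.≤ p → Bounded (root p t)
    bounded-root 1≤p = let (B , N , h) = bounded-C {λ k → z k +ᶜ z k} (bounded-+ {z} {z} (z-bounded 1≤p) (z-bounded 1≤p)) in
      B , N , λ k N≤k → ℚ.≤-trans (ℚ.≤-reflexive (cong ‖_‖ (root≡ k))) (h k N≤k)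

    odd-root-sum : 3 ℕ.≤ p → Small (λ k → ∣ geo p (root p t k) ∣²)
    odd-root-sum 3≤p = small-≤ {λ k → ∣ geo p (root p t k) ∣²} {λ k → (X k ℚ.+ X k) ℚ.+ (E k ℚ.+ E k)} 0 (λ k _ → bound k)
        (small-+ {λ k → X k ℚ.+ X k} {λ k → E k ℚ.+ E k} (small-+ {X} {X} X-small X-small) (small-+ {E} {E} E-small E-small))
      where
      1≤p : 1 ℕ.≤ p
      1≤p = ℕ.≤-trans (s≤s z≤n) 3≤p
      ζ-bounded : Bounded ζ
      ζ-bounded = bounded-C {z} (z-bounded 1≤p)
      S S′ : ℕ → ℚ[i]
      S k = geo p (root p t k)
      S′ k = geo p (ζ k *ᶜ ζ k)
      X Y E : ℕ → ℚ
      X k = ∣ S′ k ∣²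
      Y k = ∣ ζ k ^ᶜ p -ᶜ -1ᶜ ∣²
      E k = ∣ S k -ᶜ S′ k ∣²
      E-small : Small E
      E-small = small-∣∣² {λ k → S k -ᶜ S′ k} (close-geo {root p t} {λ k → ζ k *ᶜ ζ k} p (bounded-root 1≤p) (bounded-* {ζ} {ζ} ζ-bounded ζ-bounded) (close-root 1≤p))
      Y-small : Small Y
      Y-small = small-∣∣² {λ k → ζ k ^ᶜ p -ᶜ -1ᶜ} (ζ^p 1≤p)
      bound : ∀ k → ∣ S k ∣² ℚ.≤ (X k ℚ.+ X k) ℚ.+ (E k ℚ.+ E k)
      bound k = ℚ.≤-trans (ℚ.≤-reflexive (cong ∣_∣² (split (S k) (S′ k)))) (∣∣²-+ (S′ k) (S k -ᶜ S′ k))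
        where
        split : ∀ a b → a ≡ b +ᶜ (a -ᶜ b)
        split (a +i b) (c +i d) = cong₂ _+i_ (solve 2 (λ a c → a := c :+ (a :- c)) refl a c) (solve 2 (λ a c → a := c :+ (a :- c)) refl b d)
          where open ℚS using (solve; _:+_; _:-_; _:=_)
      X-small : Small X
      X-small = let
          (B , N , P≤) = bounded-geo {ζ} p ζ-bounded
          (N₁ , D≥) = ζ+1 3≤p
          (N₂ , U≥) = u-1 1≤p
        in small-≤ {X} {λ k → fromℕ 100 ℚ.* (fromℕ (B ℕ.* B) ℚ.* Y k)} (N ℕ.+ (N₁ ℕ.+ N₂)) (λ k h → begin
          X k                                                          ≡⟨ sym (ℚ.*-identityˡ (X k)) ⟩
          1ℚ ℚ.* X k                                                   ≤⟨ *-monoʳ (0≤∣∣² (S′ k)) (D≥ k (ℕ.≤-trans (ℕ.≤-trans (ℕ.m≤m+n N₁ N₂) (ℕ.m≤n+m _ N)) h)) ⟩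
          (fromℕ 100 ℚ.* ∣ ζ k -ᶜ -1ᶜ ∣²) ℚ.* X k                      ≡⟨ ℚ.*-assoc (fromℕ 100) ∣ ζ k -ᶜ -1ᶜ ∣² (X k) ⟩
          fromℕ 100 ℚ.* (∣ ζ k -ᶜ -1ᶜ ∣² ℚ.* X k)                      ≡⟨ cong (fromℕ 100 ℚ.*_) (double-sum p (ζ k) (U≥ k (ℕ.≤-trans (ℕ.≤-trans (ℕ.m≤n+m N₂ N₁) (ℕ.m≤n+m _ N)) h))) ⟩
          fromℕ 100 ℚ.* (∣ geo p (ζ k) ∣² ℚ.* Y k)                     ≤⟨ *-monoˡ (0≤fromℕ 100) (*-monoʳ (0≤∣∣² (ζ k ^ᶜ p -ᶜ -1ᶜ)) (ℚ.≤-trans (∣∣²≤ (geo p (ζ k)))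
                                                                            (ℚ.≤-trans (*-mono 0≤‖ geo p (ζ k) ‖ 0≤‖ geo p (ζ k) ‖ (P≤ k (ℕ.≤-trans (ℕ.m≤m+n N _) h)) (P≤ k (ℕ.≤-trans (ℕ.m≤m+n N _) h))) (ℚ.≤-reflexive (sym (fromℕ-* B B)))))) ⟩
          fromℕ 100 ℚ.* (fromℕ (B ℕ.* B) ℚ.* Y k)                      ∎)
          (small-scale 100 {λ k → fromℕ (B ℕ.* B) ℚ.* Y k} (small-scale (B ℕ.* B) {Y} Y-small))
        where open ℚ.≤-Reasoning

  root-sum-small : ∀ p .{{_ : NonZero p}} t → 2 ℕ.≤ p → IsPi t → Small (λ k → ∣ geo p (root p t k) ∣²)
  root-sum-small p t 2≤p isPi with 3 ℕ.≤? p
  ... | yes 3≤p = odd-root-sum p t isPi 3≤p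
  ... | no p<3 = even p (ℕ.≤-antisym (ℕ.≤-pred (ℕ.≰⇒> p<3)) 2≤p)
    where
    even : ∀ p .{{_ : NonZero p}} → p ≡ 2 → Small (λ k → ∣ geo p (root p t k) ∣²)
    even .2 refl = small-≤ {λ k → ∣ geo 2 (root 2 t k) ∣²} {λ k → ∣ C k (0ℚ +i t k) -ᶜ -1ᶜ ∣²} 0 (λ k _ → ℚ.≤-reflexive (cong ∣_∣² (two k)))
      (small-∣∣² {λ k → C k (0ℚ +i t k) -ᶜ -1ᶜ} (exp-π 2 t isPi))
      where
      two : ∀ k → geo 2 (root 2 t k) ≡ C k (0ℚ +i t k) -ᶜ -1ᶜ
      two k = trans (geo₂ (root 2 t k)) (cong (_-ᶜ -1ᶜ) (trans (expᶜ≡C k _) (cong (λ y → C k (0ℚ +i y)) (ℚ.*-identityˡ (t k)))))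
        where
        geo₂ : ∀ w → geo 2 w ≡ w -ᶜ -1ᶜ
        geo₂ (a +i b) = cong₂ _+i_
          (solve 2 (λ a b → (con 0ℚ :+ con 1ℚ) :+ (a :* con 1ℚ :- b :* con 0ℚ) := a :- (:- con 1ℚ)) refl a b)
          (solve 2 (λ a b → (con 0ℚ :+ con 0ℚ) :+ (a :* con 0ℚ :+ b :* con 1ℚ) := b :- con 0ℚ) refl a b)
          where open ℚS using (solve; _:+_; _:*_; _:-_; :-_; _:=_; con)

open RootsOfUnity

module GowersMeans (p : ℕ) .{{nz : NonZero p}} (prime : Prime p) where
  open PrimeField p prime
  open Count p prime using (module SumV; ind; Sub; size; _∋_; ∃?; ∑-const; ∑-distrib; ∑-mono; ind≤1) renaming (∑ to ∑ᴺ; ∑-cong to ∑ᴺ-cong; sum to sumᴺ)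
  open MultilinearForms p prime
  open PolynomialFunctions p prime using (module PointSum)

  private
    ℂ+ : CommutativeMonoid _ _
    ℂ+ = ℂ.+-commutativeMonoid
    module L = ListSum ℂ+
    module Σᶜ = SumV ℂ+
    module Csum = MonoidSum ℂ+
    open PointSum ℂ+ using (listSum-points)
    ∑ : ∀ n → (V n → ℚ[i]) → ℚ[i]
    ∑ = Σᶜ.∑

  fsum-geo : ∀ m w → Csum.sum {m} (λ i → w ^ᶜ toℕ i) ≡ geo m w
  fsum-geo m w = go m (λ i → w ^ᶜ i) refl
    where
    back : ℕ → (ℕ → ℚ[i]) → ℚ[i]
    back zero    h = 0ᶜ
    back (suc m) h = back m h +ᶜ h m
    front : ∀ m h → back (suc m) h ≡ h 0 +ᶜ back m (h ∘ suc)
    front zero    h = trans (ℂ.+-identityˡ (h 0)) (sym (ℂ.+-identityʳ (h 0)))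
    front (suc m) h = trans (cong (_+ᶜ h (suc m)) (front m h)) (ℂ.+-assoc (h 0) (back m (h ∘ suc)) (h (suc m)))
    sum-back : ∀ m h → Csum.sum {m} (λ i → h (toℕ i)) ≡ back m h
    sum-back zero    h = refl
    sum-back (suc m) h = trans (cong (h 0 +ᶜ_) (sum-back m (h ∘ suc))) (sym (front m h))
    geo-back : ∀ m → back m (λ i → w ^ᶜ i) ≡ geo m w
    geo-back zero    = refl
    geo-back (suc m) = cong (_+ᶜ w ^ᶜ m) (geo-back m)
    go : ∀ m h → h ≡ (λ i → w ^ᶜ i) → Csum.sum {m} (λ i → w ^ᶜ toℕ i) ≡ geo m w
    go m h _ = trans (sum-back m (λ i → w ^ᶜ i)) (geo-back m)

  real-+ : ∀ a b → real (a ℚ.+ b) ≡ real a +ᶜ real b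
  real-+ a b = cong ((a ℚ.+ b) +i_) (sym (ℚ.+-identityʳ 0ℚ))

  sum-*ˡ : ∀ {k} z (h : Fin k → ℚ[i]) → Csum.sum (λ i → z *ᶜ h i) ≡ z *ᶜ Csum.sum h
  sum-*ˡ {zero}  z h = sym (ℂ.zeroʳ z)
  sum-*ˡ {suc k} z h = trans (cong (z *ᶜ h Fin.zero +ᶜ_) (sum-*ˡ z (h ∘ Fin.suc))) (sym (ℂ.distribˡ z (h Fin.zero) (Csum.sum (h ∘ Fin.suc))))

  ∑-*ˡ : ∀ n z (h : V n → ℚ[i]) → ∑ n (λ x → z *ᶜ h x) ≡ z *ᶜ ∑ n h
  ∑-*ˡ zero    z h = refl
  ∑-*ˡ (suc n) z h = trans (Csum.sum-cong-≗ {p} λ a → ∑-*ˡ n z (λ x → h (a ∷ x))) (sum-*ˡ {p} z (λ a → ∑ n λ x → h (a ∷ x)))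

  sum-real : ∀ {k} (h : Fin k → ℕ) → Csum.sum (λ i → real (fromℕ (h i))) ≡ real (fromℕ (sumᴺ h))
  sum-real {zero}  h = refl
  sum-real {suc k} h = trans (cong (real (fromℕ (h Fin.zero)) +ᶜ_) (sum-real (h ∘ Fin.suc)))
    (trans (sym (real-+ (fromℕ (h Fin.zero)) (fromℕ (sumᴺ (h ∘ Fin.suc))))) (cong real (sym (fromℕ-+ (h Fin.zero) (sumᴺ (h ∘ Fin.suc))))))

  ∑-real : ∀ n (h : V n → ℕ) → ∑ n (λ x → real (fromℕ (h x))) ≡ real (fromℕ (∑ᴺ n h))
  ∑-real zero    h = refl
  ∑-real (suc n) h = trans (Csum.sum-cong-≗ {p} λ a → ∑-real n (λ x → h (a ∷ x))) (sum-real {p} (λ a → ∑ᴺ n λ x → h (a ∷ x)))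

  sum-constant : ∀ k z → Csum.sum {k} (λ _ → z) ≡ real (fromℕ k) *ᶜ z
  sum-constant zero    z = sym (ℂ.zeroˡ z)
  sum-constant (suc k) z = trans (cong (z +ᶜ_) (sum-constant k z)) (trans (cong (_+ᶜ real (fromℕ k) *ᶜ z) (sym (ℂ.*-identityˡ z)))
    (trans (sym (ℂ.distribʳ z 1ᶜ (real (fromℕ k)))) (cong (_*ᶜ z) (trans (sym (real-+ 1ℚ (fromℕ k))) (cong real (sym (fromℕ-suc k)))))))

  ∑-constant : ∀ n z → ∑ n (λ _ → z) ≡ real (fromℕ (p ℕ.^ n)) *ᶜ z
  ∑-constant n z = begin
    ∑ n (λ _ → z)                               ≡⟨ Σᶜ.∑-cong n {λ _ → z} {λ _ → z *ᶜ real (fromℕ 1)} (λ _ → sym (ℂ.*-identityʳ z)) ⟩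
    ∑ n (λ _ → z *ᶜ real (fromℕ 1))             ≡⟨ ∑-*ˡ n z (λ _ → real (fromℕ 1)) ⟩
    z *ᶜ ∑ n (λ _ → real (fromℕ 1))             ≡⟨ cong (z *ᶜ_) (∑-real n (λ _ → 1)) ⟩
    z *ᶜ real (fromℕ (∑ᴺ n (λ _ → 1)))          ≡⟨ cong (λ m → z *ᶜ real (fromℕ m)) (trans (∑-const n 1) (ℕ.*-identityʳ (p ℕ.^ n))) ⟩
    z *ᶜ real (fromℕ (p ℕ.^ n))                 ≡⟨ ℂ.*-comm z (real (fromℕ (p ℕ.^ n))) ⟩
    real (fromℕ (p ℕ.^ n)) *ᶜ z                 ∎
    where open ≡-Reasoning

  -- Sum over the translates by e · d₁ for all scalars e, where ℓ d₁ = 1.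
  equidistribution : ∀ {n} (ℓ : V n → F) → Functional ℓ → ∀ d → ℓ d ≢ 0ᶠ → ∀ (g : F → ℚ[i]) →
    real (fromℕ p) *ᶜ ∑ n (g ∘ ℓ) ≡ real (fromℕ (p ℕ.^ n)) *ᶜ Csum.sum {p} g
  equidistribution {n} ℓ add d ℓd≢0 g = begin
    real (fromℕ p) *ᶜ ∑ n (g ∘ ℓ)                              ≡⟨ sym (sum-constant p (∑ n (g ∘ ℓ))) ⟩
    Csum.sum {p} (λ e → ∑ n (g ∘ ℓ))                           ≡⟨ Csum.sum-cong-≗ {p} (λ e → trans (Σᶜ.∑-translate n (g ∘ ℓ) (e · d₁)) (Σᶜ.∑-cong n λ x → cong g (shifted e x))) ⟩
    Csum.sum {p} (λ e → ∑ n λ x → g (e +ᶠ ℓ x))                ≡⟨ Σᶜ.sum-∑-swap {p} n (λ e x → g (e +ᶠ ℓ x)) ⟩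
    ∑ n (λ x → Csum.sum {p} λ e → g (e +ᶠ ℓ x))                ≡⟨ Σᶜ.∑-cong n (λ x → sym (Csum.∑-permute {p} g (Σᶜ.shift (ℓ x)))) ⟩
    ∑ n (λ x → Csum.sum {p} g)                                 ≡⟨ ∑-constant n (Csum.sum {p} g) ⟩
    real (fromℕ (p ℕ.^ n)) *ᶜ Csum.sum {p} g                   ∎
    where
    open ≡-Reasoning
    d₁ : V n
    d₁ = proj₁ (inverse (ℓ d) ℓd≢0) · d
    ℓd₁ : ℓ d₁ ≡ 1ᶠ
    ℓd₁ = trans (functional-· ℓ add (proj₁ (inverse (ℓ d) ℓd≢0)) d) (proj₂ (inverse (ℓ d) ℓd≢0))
    shifted : ∀ e x → ℓ (x ⊕ e · d₁) ≡ e +ᶠ ℓ x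
    shifted e x = trans (add x (e · d₁)) (trans (cong (ℓ x +ᶠ_) (trans (functional-· ℓ add e d₁) (trans (cong (e *ᶠ_) ℓd₁) (*ᶠ-identityʳ e)))) (+ᶠ-comm (ℓ x) e))

  module _ {n : ℕ} (T : Quad n) where
    open Quad T

    null? : ∀ a b c → Dec (Tri.radical (slice a) b ∋ c)
    null? a b c = Sub.mem? (Tri.radical (slice a) b) c

    u u′ : V n → V n → V n → ℕ
    u a b c = ind (null? a b c)
    u′ a b c = 1 ℕ.∸ u a b c

    ∑³ : (V n → V n → V n → ℕ) → ℕ
    ∑³ h = ∑ᴺ n λ a → ∑ᴺ n λ b → ∑ᴺ n λ c → h a b c

    Z Z′ : ℕ
    Z = ∑³ u
    Z′ = ∑³ u′

    Z+Z′ : Z ℕ.+ Z′ ≡ p ℕ.^ n ℕ.* (p ℕ.^ n ℕ.* p ℕ.^ n)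
    Z+Z′ = trans (sym (∑-distrib n _ _)) (trans (∑ᴺ-cong n λ a → trans (sym (∑-distrib n _ _)) (trans (∑ᴺ-cong n λ b → trans (sym (∑-distrib n (u a b) (u′ a b)))
      (trans (∑ᴺ-cong n λ c → ℕ.m+[n∸m]≡n (ind≤1 (null? a b c))) (trans (∑-const n 1) (ℕ.*-identityʳ _)))) (∑-const n (p ℕ.^ n)))) (∑-const n _))

  module _ {n : ℕ} (T : Quad n) (ω : ℚ[i]) where
    open Quad T

    private
      P γ : ℚ
      P = fromℕ (p ℕ.^ n)
      γ = + 1 / p
      S : ℚ[i]
      S = geo p ω

    character-sum′ : ∀ a b c (N? : Dec (Tri.radical (slice a) b ∋ c)) →
      ∑ n (λ d → ω ^ᶜ toℕ (form a b c d)) ≡ real P *ᶜ (real (fromℕ (ind N?)) +ᶜ (real γ *ᶜ S) *ᶜ real (fromℕ (1 ℕ.∸ ind N?)))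
    character-sum′ a b c (yes h) = begin
      ∑ n (λ d → ω ^ᶜ toℕ (form a b c d))       ≡⟨ Σᶜ.∑-cong n (λ d → cong (ω ^ᶜ_) (trans (cong toℕ (h d _)) (trans (toℕ-⟦⟧ 0) (m<n⇒m%n≡m (ℕ.<-trans ℕ.z<s 1<p))))) ⟩
      ∑ n (λ d → 1ᶜ)                            ≡⟨ ∑-constant n 1ᶜ ⟩
      real P *ᶜ 1ᶜ                              ≡⟨ cong (real P *ᶜ_) (sym (trans (cong (1ᶜ +ᶜ_) (ℂ.zeroʳ (real γ *ᶜ S))) (ℂ.+-identityʳ 1ᶜ))) ⟩
      real P *ᶜ (1ᶜ +ᶜ (real γ *ᶜ S) *ᶜ 0ᶜ)     ∎
      where open ≡-Reasoning
    character-sum′ a b c (no ¬h) = nonzero (∃? (λ d → ¬? (form a b c d ≟ᶠ 0ᶠ)))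
      where
      open ≡-Reasoning
      I : ℚ[i]
      I = ∑ n λ d → ω ^ᶜ toℕ (form a b c d)
      γp : real γ *ᶜ real (fromℕ p) ≡ 1ᶜ
      γp = trans (real-* γ (fromℕ p)) (cong real (trans (ℚ.*-comm γ (fromℕ p)) (reciprocal p)))
      nonzero : Dec (∃[ d ] form a b c d ≢ 0ᶠ) → I ≡ real P *ᶜ (0ᶜ +ᶜ (real γ *ᶜ S) *ᶜ 1ᶜ)
      nonzero (no ¬e) = contradiction (λ d _ → decidable-stable (form a b c d ≟ᶠ 0ᶠ) λ ≢0 → ¬e (d , ≢0)) ¬h
      nonzero (yes (d , ≢0)) = begin
        I                                         ≡⟨ sym (ℂ.*-identityˡ I) ⟩
        1ᶜ *ᶜ I                                   ≡⟨ cong (_*ᶜ I) (sym γp) ⟩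
        (real γ *ᶜ real (fromℕ p)) *ᶜ I           ≡⟨ ℂ.*-assoc (real γ) (real (fromℕ p)) I ⟩
        real γ *ᶜ (real (fromℕ p) *ᶜ I)           ≡⟨ cong (real γ *ᶜ_) (trans (equidistribution (form a b c) (Tri.add₃ (slice a) b c) d ≢0 (λ e → ω ^ᶜ toℕ e)) (cong (real P *ᶜ_) (fsum-geo p ω))) ⟩
        real γ *ᶜ (real P *ᶜ S)                   ≡⟨ trans (sym (ℂ.*-assoc (real γ) (real P) S)) (trans (cong (_*ᶜ S) (ℂ.*-comm (real γ) (real P))) (ℂ.*-assoc (real P) (real γ) S)) ⟩
        real P *ᶜ (real γ *ᶜ S)                   ≡⟨ cong (real P *ᶜ_) (sym (trans (ℂ.+-identityˡ ((real γ *ᶜ S) *ᶜ 1ᶜ)) (ℂ.*-identityʳ (real γ *ᶜ S)))) ⟩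
        real P *ᶜ (0ᶜ +ᶜ (real γ *ᶜ S) *ᶜ 1ᶜ)     ∎

    character-sum : ∀ a b c → ∑ n (λ d → ω ^ᶜ toℕ (form a b c d)) ≡ real P *ᶜ (real (fromℕ (u T a b c)) +ᶜ (real γ *ᶜ S) *ᶜ real (fromℕ (u′ T a b c)))
    character-sum a b c = character-sum′ a b c (null? T a b c)

    ∑-linear : ∀ {m} z w v (h h′ : V m → ℕ) (F : V m → ℚ[i]) → (∀ x → F x ≡ z *ᶜ (w *ᶜ real (fromℕ (h x)) +ᶜ v *ᶜ real (fromℕ (h′ x)))) →
      ∑ m F ≡ z *ᶜ (w *ᶜ real (fromℕ (∑ᴺ m h)) +ᶜ v *ᶜ real (fromℕ (∑ᴺ m h′)))
    ∑-linear {m} z w v h h′ F e = begin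
      ∑ m F                                                               ≡⟨ Σᶜ.∑-cong m e ⟩
      ∑ m (λ x → z *ᶜ (w *ᶜ H x +ᶜ v *ᶜ H′ x))                            ≡⟨ ∑-*ˡ m z (λ x → w *ᶜ H x +ᶜ v *ᶜ H′ x) ⟩
      z *ᶜ ∑ m (λ x → w *ᶜ H x +ᶜ v *ᶜ H′ x)                              ≡⟨ cong (z *ᶜ_) (Σᶜ.∑-distrib m (λ x → w *ᶜ H x) (λ x → v *ᶜ H′ x)) ⟩
      z *ᶜ (∑ m (λ x → w *ᶜ H x) +ᶜ ∑ m (λ x → v *ᶜ H′ x))                ≡⟨ cong (z *ᶜ_) (cong₂ _+ᶜ_ (∑-*ˡ m w H) (∑-*ˡ m v H′)) ⟩
      z *ᶜ (w *ᶜ ∑ m H +ᶜ v *ᶜ ∑ m H′)                                    ≡⟨ cong₂ (λ a b → z *ᶜ (w *ᶜ a +ᶜ v *ᶜ b)) (∑-real m h) (∑-real m h′) ⟩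
      z *ᶜ (w *ᶜ real (fromℕ (∑ᴺ m h)) +ᶜ v *ᶜ real (fromℕ (∑ᴺ m h′)))    ∎
      where
      open ≡-Reasoning
      H H′ : V m → ℚ[i]
      H x = real (fromℕ (h x))
      H′ x = real (fromℕ (h′ x))

    B : ℚ[i]
    B = 1ᶜ *ᶜ real (fromℕ (Z T)) +ᶜ (real γ *ᶜ S) *ᶜ real (fromℕ (Z′ T))

    full-sum : ∑ n (λ a → ∑ n λ b → ∑ n λ c → ∑ n λ d → ω ^ᶜ toℕ (form a b c d)) ≡ real P *ᶜ B
    full-sum = ∑-linear (real P) 1ᶜ (real γ *ᶜ S) (λ a → ∑ᴺ n λ b → ∑ᴺ n (u T a b)) (λ a → ∑ᴺ n λ b → ∑ᴺ n (u′ T a b)) _ λ a →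
               ∑-linear (real P) 1ᶜ (real γ *ᶜ S) (λ b → ∑ᴺ n (u T a b)) (λ b → ∑ᴺ n (u′ T a b)) _ λ b →
               ∑-linear (real P) 1ᶜ (real γ *ᶜ S) (u T a b) (u′ T a b) _ λ c →
               trans (character-sum a b c) (cong (λ w → real P *ᶜ (w +ᶜ (real γ *ᶜ S) *ᶜ real (fromℕ (u′ T a b c)))) (sym (ℂ.*-identityˡ (real (fromℕ (u T a b c))))))

  κ : ℕ → ℚ
  κ n = _/_ (+ 1) (p ℕ.^ (n ℕ.* 5)) {{ℕ.m^n≢0 p (n ℕ.* 5)}}

  gowersMean-∑ : ∀ {n} (f : V n → F) (T : Quad n) ω → (∀ a b c d x → Δ* (a ∷ b ∷ c ∷ d ∷ []) f x ≡ Quad.form T a b c d) →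
    gowersMean 4 f ω ≡ real (κ n) *ᶜ (real (fromℕ (p ℕ.^ n)) *ᶜ (real (fromℕ (p ℕ.^ n)) *ᶜ B T ω))
  gowersMean-∑ {n} f T ω Δ≡ = trans (·ᶜ-real (κ n) total) (cong (real (κ n) *ᶜ_) (begin
    total
      ≡⟨ L.listSum-product (λ (x , ys) → ω ^ᶜ toℕ (Δ* ys f x)) _,_ (points p n) (vectors (points p n) 4) ⟩
    L.listSum (λ x → L.listSum (λ ys → ω ^ᶜ toℕ (Δ* ys f x)) (vectors (points p n) 4)) (points p n)
      ≡⟨ L.listSum-cong (λ x → inner x) (points p n) ⟩
    L.listSum (λ x → real (fromℕ (p ℕ.^ n)) *ᶜ B T ω) (points p n)
      ≡⟨ listSum-points n (λ x → real (fromℕ (p ℕ.^ n)) *ᶜ B T ω) ⟩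
    ∑ n (λ x → real (fromℕ (p ℕ.^ n)) *ᶜ B T ω)
      ≡⟨ ∑-constant n (real (fromℕ (p ℕ.^ n)) *ᶜ B T ω) ⟩
    real (fromℕ (p ℕ.^ n)) *ᶜ (real (fromℕ (p ℕ.^ n)) *ᶜ B T ω)   ∎))
    where
    open ≡-Reasoning
    total : ℚ[i]
    total = L.listSum (λ (x , ys) → ω ^ᶜ toℕ (Δ* ys f x)) (cartesianProduct (points p n) (vectors (points p n) 4))
    vectors-∑ : ∀ d (h : Vec (V n) (suc d) → ℚ[i]) → L.listSum h (vectors (points p n) (suc d)) ≡ ∑ n λ a → L.listSum (λ ys → h (a ∷ ys)) (vectors (points p n) d)
    vectors-∑ d h = trans (L.listSum-product h _∷_ (points p n) (vectors (points p n) d)) (listSum-points n (λ a → L.listSum (λ ys → h (a ∷ ys)) (vectors (points p n) d)))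
    inner : ∀ x → L.listSum (λ ys → ω ^ᶜ toℕ (Δ* ys f x)) (vectors (points p n) 4) ≡ real (fromℕ (p ℕ.^ n)) *ᶜ B T ω
    inner x = trans (vectors-∑ 3 (λ ys → ω ^ᶜ toℕ (Δ* ys f x))) (trans
      (Σᶜ.∑-cong n λ a → trans (vectors-∑ 2 (λ ys → ω ^ᶜ toℕ (Δ* (a ∷ ys) f x))) (Σᶜ.∑-cong n λ b → trans (vectors-∑ 1 (λ ys → ω ^ᶜ toℕ (Δ* (a ∷ b ∷ ys) f x))) (Σᶜ.∑-cong n λ c →
        trans (vectors-∑ 0 (λ ys → ω ^ᶜ toℕ (Δ* (a ∷ b ∷ c ∷ ys) f x))) (Σᶜ.∑-cong n λ d →
          trans (ℂ.+-identityʳ (ω ^ᶜ toℕ (Δ* (a ∷ b ∷ c ∷ d ∷ []) f x))) (cong (λ e → ω ^ᶜ toℕ e) (Δ≡ a b c d x)))))) (full-sum T ω))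

  mean-bound : ∀ {n} (f : V n → F) (T : Quad n) → (∀ a b c d x → Δ* (a ∷ b ∷ c ∷ d ∷ []) f x ≡ Quad.form T a b c d) →
    ∀ m → m ℕ.* Z T ℕ.≤ p ℕ.^ n ℕ.* (p ℕ.^ n ℕ.* p ℕ.^ n) →
    ∃[ β ] (0ℚ ℚ.≤ β × fromℕ m ℚ.* β ℚ.≤ 1ℚ × ∀ ω → ∣ gowersMean 4 f ω ∣² ℚ.≤ (β ℚ.* β ℚ.+ β ℚ.* β) ℚ.+ (∣ geo p ω ∣² ℚ.+ ∣ geo p ω ∣²))
  mean-bound {n} f T Δ≡ m mZ≤ = β , 0≤⇒* 0≤μ (0≤fromℕ (Z T)) , mβ≤1 , λ ω → begin
    ∣ gowersMean 4 f ω ∣²                                       ≡⟨ cong ∣_∣² (trans (gowersMean-∑ f T ω Δ≡) (rearranged ω)) ⟩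
    ∣ real β +ᶜ real σ *ᶜ S ω ∣²                                  ≤⟨ ∣∣²-+ (real β) (real σ *ᶜ S ω) ⟩
    (∣ real β ∣² ℚ.+ ∣ real β ∣²) ℚ.+ (∣ real σ *ᶜ S ω ∣² ℚ.+ ∣ real σ *ᶜ S ω ∣²)
      ≤⟨ ℚ.+-mono-≤ (ℚ.≤-reflexive (cong₂ ℚ._+_ (∣real∣² β) (∣real∣² β))) (ℚ.+-mono-≤ (σS ω) (σS ω)) ⟩
    (β ℚ.* β ℚ.+ β ℚ.* β) ℚ.+ (∣ S ω ∣² ℚ.+ ∣ S ω ∣²)               ∎
    where
    open ℚ.≤-Reasoning
    P P³ γ μ β σ : ℚ
    P = fromℕ (p ℕ.^ n)
    P³ = fromℕ (p ℕ.^ n ℕ.* (p ℕ.^ n ℕ.* p ℕ.^ n))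
    γ = + 1 / p
    μ = κ n ℚ.* (P ℚ.* P)
    β = μ ℚ.* fromℕ (Z T)
    σ = γ ℚ.* (μ ℚ.* fromℕ (Z′ T))
    S : ℚ[i] → ℚ[i]
    S ω = geo p ω
    ∣real∣² : ∀ a → ∣ real a ∣² ≡ a ℚ.* a
    ∣real∣² a = ℚ.+-identityʳ (a ℚ.* a)
    μP³ : μ ℚ.* P³ ≡ 1ℚ
    μP³ = trans (cong (μ ℚ.*_) (trans (fromℕ-* (p ℕ.^ n) (p ℕ.^ n ℕ.* p ℕ.^ n)) (cong (P ℚ.*_) (fromℕ-* (p ℕ.^ n) (p ℕ.^ n)))))
      (trans (solve 2 (λ k P → (k :* (P :* P)) :* (P :* (P :* P)) := (P :* (P :* (P :* (P :* P)))) :* k) refl (κ n) P)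
      (trans (cong (ℚ._* κ n) (sym fifth)) (reciprocal (p ℕ.^ (n ℕ.* 5)) {{ℕ.m^n≢0 p (n ℕ.* 5)}})))
      where
      open ℚS using (solve; _:*_; _:=_)
      Q : ℕ
      Q = p ℕ.^ n
      fifth : fromℕ (p ℕ.^ (n ℕ.* 5)) ≡ P ℚ.* (P ℚ.* (P ℚ.* (P ℚ.* P)))
      fifth = trans (cong fromℕ (trans (sym (ℕ.^-*-assoc p n 5)) (cong (λ x → Q ℕ.* (Q ℕ.* (Q ℕ.* (Q ℕ.* x)))) (ℕ.*-identityʳ Q))))
        (trans (fromℕ-* Q (Q ℕ.* (Q ℕ.* (Q ℕ.* Q)))) (cong (P ℚ.*_) (trans (fromℕ-* Q (Q ℕ.* (Q ℕ.* Q))) (cong (P ℚ.*_) (trans (fromℕ-* Q (Q ℕ.* Q)) (cong (P ℚ.*_) (fromℕ-* Q Q)))))))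
    0≤μ : 0ℚ ℚ.≤ μ
    0≤μ = 0≤⇒* (0≤1/ (p ℕ.^ (n ℕ.* 5)) {{ℕ.m^n≢0 p (n ℕ.* 5)}}) (0≤⇒* (0≤fromℕ (p ℕ.^ n)) (0≤fromℕ (p ℕ.^ n)))
    mβ≤1 : fromℕ m ℚ.* β ℚ.≤ 1ℚ
    mβ≤1 = begin
      fromℕ m ℚ.* (μ ℚ.* fromℕ (Z T))        ≡⟨ solve 3 (λ a b c → a :* (b :* c) := b :* (a :* c)) refl (fromℕ m) μ (fromℕ (Z T)) ⟩
      μ ℚ.* (fromℕ m ℚ.* fromℕ (Z T))        ≡⟨ cong (μ ℚ.*_) (sym (fromℕ-* m (Z T))) ⟩
      μ ℚ.* fromℕ (m ℕ.* Z T)                ≤⟨ *-monoˡ 0≤μ (fromℕ-mono (m ℕ.* Z T) (p ℕ.^ n ℕ.* (p ℕ.^ n ℕ.* p ℕ.^ n)) mZ≤) ⟩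
      μ ℚ.* P³                                 ≡⟨ μP³ ⟩
      1ℚ                                       ∎
      where open ℚS using (solve; _:*_; _:=_)
    μZ′≤1 : μ ℚ.* fromℕ (Z′ T) ℚ.≤ 1ℚ
    μZ′≤1 = ℚ.≤-trans (*-monoˡ 0≤μ (fromℕ-mono (Z′ T) (p ℕ.^ n ℕ.* (p ℕ.^ n ℕ.* p ℕ.^ n)) (ℕ.≤-trans (ℕ.m≤n+m (Z′ T) (Z T)) (ℕ.≤-reflexive (Z+Z′ T))))) (ℚ.≤-reflexive μP³)
    0≤σ : 0ℚ ℚ.≤ σ
    0≤σ = 0≤⇒* (0≤1/ p) (0≤⇒* 0≤μ (0≤fromℕ (Z′ T)))
    σ≤1 : σ ℚ.≤ 1ℚ
    σ≤1 = *-mono (0≤1/ p) (0≤⇒* 0≤μ (0≤fromℕ (Z′ T))) (1/-antimono 1 p (ℕ.<⇒≤ 1<p)) μZ′≤1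
    σS : ∀ ω → ∣ real σ *ᶜ S ω ∣² ℚ.≤ ∣ S ω ∣²
    σS ω = ℚ.≤-trans (ℚ.≤-reflexive (trans (∣∣²-* (real σ) (S ω)) (cong (ℚ._* ∣ S ω ∣²) (∣real∣² σ))))
      (ℚ.≤-trans (*-monoʳ (0≤∣∣² (S ω)) (*-mono 0≤σ 0≤σ σ≤1 σ≤1)) (ℚ.≤-reflexive (ℚ.*-identityˡ ∣ S ω ∣²)))
    rearranged : ∀ ω → real (κ n) *ᶜ (real P *ᶜ (real P *ᶜ B T ω)) ≡ real β +ᶜ real σ *ᶜ S ω
    rearranged ω = trans (solve 6 (λ k P o z g z′ → k :* (P :* (P :* (o :* z :+ g :* z′))) := o :* ((k :* (P :* P)) :* z) :+ (g :* ((k :* (P :* P)) :* z′))) refl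
        (real (κ n)) (real P) 1ᶜ (real (fromℕ (Z T))) (real γ *ᶜ S ω) (real (fromℕ (Z′ T))))
      (cong₂ _+ᶜ_ (trans (ℂ.*-identityˡ _) (collect (Z T)))
        (trans (cong ((real γ *ᶜ S ω) *ᶜ_) (collect (Z′ T))) (trans (solve 3 (λ g s x → (g :* s) :* x := (g :* x) :* s) refl (real γ) (S ω) (real (μ ℚ.* fromℕ (Z′ T)))) (cong (_*ᶜ S ω) (real-* γ (μ ℚ.* fromℕ (Z′ T)))))))
      where
      open ℂS using (solve; _:+_; _:*_; _:=_)
      collect : ∀ z → (real (κ n) *ᶜ (real P *ᶜ real P)) *ᶜ real (fromℕ z) ≡ real (μ ℚ.* fromℕ z)
      collect z = trans (cong (_*ᶜ real (fromℕ z)) (trans (cong (real (κ n) *ᶜ_) (real-* P P)) (real-* (κ n) (P ℚ.* P)))) (real-* μ (fromℕ z))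

module RealEstimates where

  real-bounded : (x : ℝ) → Bounded (λ k → real (approx x k))
  real-bounded x = let
      (N , h) = cauchy x 1ℚ (ℚ.positive⁻¹ 1ℚ)
      (B , b) = above (∣ approx x N ∣ ℚ.+ 1ℚ)
    in B , N , λ k N≤k → ℚ.≤-trans (ℚ.≤-reflexive (ℚ.+-identityʳ (∣ approx x k ∣))) (ℚ.≤-trans (ℚ.≤-reflexive (cong ∣_∣ (split (approx x k) (approx x N))))
        (ℚ.≤-trans (ℚ.∣p+q∣≤∣p∣+∣q∣ (approx x N) (approx x k ℚ.- approx x N)) (ℚ.≤-trans (ℚ.+-monoʳ-≤ (∣ approx x N ∣) (h k N N≤k ℕ.≤-refl)) b)))
    where
    split : ∀ a b → a ≡ b ℚ.+ (a ℚ.- b)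
    split = solve 2 (λ a b → a := b :+ (a :- b)) refl
      where open ℚS using (solve; _:+_; _:-_; _:=_)

  R-reciprocal : (x : ℝ) → ∃[ N ] (∀ k → N ℕ.≤ k → R k (approx x k) ℚ.* R k (ℚ.- approx x k) ℚ.≤ + 3 / 2)
  R-reciprocal x = let
      z = λ k → real (approx x k)
      w = λ k → real (ℚ.- approx x k)
      (B , N₀ , b) = real-bounded x
      (N , h) = C-multiplicative {z} {w} (real-bounded x) (B , N₀ , λ k N≤k → ℚ.≤-trans (ℚ.≤-reflexive (cong (ℚ._+ 0ℚ) (ℚ.∣-p∣≡∣p∣ (approx x k)))) (b k N≤k)) ½ (ℚ.positive⁻¹ ½)
    in N , λ k N≤k → bound k (approx x k) (h k N≤k)
    where
    bound : ∀ k y → ‖ C k (real y) *ᶜ C k (real (ℚ.- y)) -ᶜ C k (real y +ᶜ real (ℚ.- y)) ‖ ℚ.≤ ½ → R k y ℚ.* R k (ℚ.- y) ℚ.≤ + 3 / 2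
    bound k y h = ℚ.≤-trans (ℚ.≤-reflexive (solve 1 (λ a → a := (a :- con 1ℚ) :+ con 1ℚ) refl (R k y ℚ.* R k (ℚ.- y))))
      (ℚ.+-monoˡ-≤ 1ℚ (ℚ.≤-trans (a≤∣a∣ D) (ℚ.≤-trans (ℚ.≤-trans (ℚ.≤-reflexive (sym (ℚ.+-identityʳ (∣ D ∣)))) (ℚ.≤-reflexive (cong ‖_‖ (sym product)))) h)))
      where
      open ℚS using (solve; _:+_; _:-_; _:=_; con)
      D : ℚ
      D = R k y ℚ.* R k (ℚ.- y) ℚ.- 1ℚ
      product : C k (real y) *ᶜ C k (real (ℚ.- y)) -ᶜ C k (real y +ᶜ real (ℚ.- y)) ≡ real (R k y ℚ.* R k (ℚ.- y) ℚ.- 1ℚ)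
      product = cong₂ _-ᶜ_ (trans (cong₂ _*ᶜ_ (C-real k y) (C-real k (ℚ.- y))) (real-* (R k y) (R k (ℚ.- y))))
        (trans (cong (λ a → C k (a +i (0ℚ ℚ.+ 0ℚ))) (ℚ.+-inverseʳ y)) (trans (C-real k 0ℚ) (cong real (R-0 k))))

  -- For f = exp, a negative y would give f y ≤ f y * f (- y), about 1.
  lower-bound : ∀ (A B D H : ℚ) (f : ℚ → ℚ) y → 0ℚ ℚ.≤ A → (∀ {z} → 0ℚ ℚ.≤ z → z ℚ.≤ H → f z ℚ.≤ B) → (∀ {z} → 0ℚ ℚ.≤ z → 1ℚ ℚ.≤ f z) →
    A ℚ.≤ f y → f y ℚ.* f (ℚ.- y) ℚ.≤ D → D ℚ.≤ B → B ℚ.< A → H ℚ.≤ y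
  lower-bound A B D H f y 0≤A small 1≤f large product D≤B B<A with ℚ.≤-total H y
  ... | inj₁ h = h
  ... | inj₂ y≤H with ℚ.≤-total 0ℚ y
  ...   | inj₁ 0≤y = contradiction (ℚ.≤-trans large (small 0≤y y≤H)) (<⇒≱ B<A)
  ...   | inj₂ y≤0 = contradiction (begin
            A                   ≡⟨ sym (ℚ.*-identityʳ A) ⟩
            A ℚ.* 1ℚ            ≤⟨ *-mono {A} {f y} {1ℚ} {f (ℚ.- y)} 0≤A (ℚ.nonNegative⁻¹ 1ℚ) large (1≤f (ℚ.neg-antimono-≤ y≤0)) ⟩
            f y ℚ.* f (ℚ.- y)   ≤⟨ product ⟩
            D                   ≤⟨ D≤B ⟩
            B                   ∎) (<⇒≱ B<A)
    where open ℚ.≤-Reasoning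

  R≤7/4 : ∀ k {x} → 0ℚ ℚ.≤ x → x ℚ.≤ ½ → R k x ℚ.≤ + 7 / 4
  R≤7/4 k {x} 0≤x x≤½ = ℚ.≤-trans (R-mono {x} {½} k 0≤x x≤½) (R-quadratic {½} k (ℚ.nonNegative⁻¹ ½) (toWitness {a? = ½ ℚ.+ ½ ℚ.≤? fromℕ 3} _))

  2-1/10 : ∀ p → 2 ℕ.≤ p → ∀ {x} → fromℕ p ℚ.≤ x ℚ.+ (+ 1 / 10) → + 19 / 10 ℚ.≤ x
  2-1/10 p 2≤p {x} h = ℚ.≤-trans {+ 19 / 10} {fromℕ p ℚ.- (+ 1 / 10)} {x}
    (ℚ.+-monoˡ-≤ (ℚ.- (+ 1 / 10)) {fromℕ 2} {fromℕ p} (fromℕ-mono 2 p 2≤p))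
    (≲⇒-≤ {fromℕ p} {+ 1 / 10} {x} (subst (fromℕ p ℚ.≤_) (ℚ.+-comm x (+ 1 / 10)) h))

  log≥½ : ∀ p (x : ℝ) → 2 ℕ.≤ p → IsLog (λ _ → fromℕ p) (approx x) → ∃[ N ] (∀ k → N ℕ.≤ k → ½ ℚ.≤ approx x k)
  log≥½ p x 2≤p (_ , h) = let
      (N , b) = h (+ 1 / 10) (ℚ.positive⁻¹ (+ 1 / 10))
      (N′ , b′) = R-reciprocal x
    in N ℕ.+ N′ , λ k le → lower-bound (+ 19 / 10) (+ 7 / 4) (+ 3 / 2) ½ (R k) (approx x k) (ℚ.nonNegative⁻¹ (+ 19 / 10)) (R≤7/4 k) (λ {z} → 1≤R {z} k)
      (2-1/10 p 2≤p (subst (λ y → fromℕ p ℚ.≤ y ℚ.+ (+ 1 / 10)) (exp≡R (approx x) k) (b k (ℕ.≤-trans (ℕ.m≤m+n N N′) le))))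
      (b′ k (ℕ.≤-trans (ℕ.m≤n+m N′ N) le))
      (toWitness {a? = + 3 / 2 ℚ.≤? + 7 / 4} _) (toWitness {a? = + 7 / 4 ℚ.<? + 19 / 10} _)

  2^≤R : ∀ N → fromℕ (2 ℕ.^ N) ℚ.≤ R N (fromℕ N)
  2^≤R zero    = ℚ.≤-refl
  2^≤R (suc N) = ℚ.≤-trans (ℚ.≤-reflexive (fromℕ-* 2 (2 ℕ.^ N))) (ℚ.≤-trans (*-monoˡ (0≤fromℕ 2) (2^≤R N))
    (ℚ.≤-trans (R-supermultiplicative 1 N (ℚ.nonNegative⁻¹ 1ℚ) (0≤fromℕ N)) (ℚ.≤-reflexive (cong (R (suc N)) (sym (fromℕ-suc N))))))

  R≤4^ : ∀ k M → R k (fromℕ M) ℚ.≤ fromℕ (4 ℕ.^ M)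
  R≤4^ k zero    = ℚ.≤-reflexive (R-0 k)
  R≤4^ k (suc M) = ℚ.≤-trans (ℚ.≤-reflexive (cong (R k) (fromℕ-suc M))) (ℚ.≤-trans (R-submultiplicative k (ℚ.nonNegative⁻¹ 1ℚ) (0≤fromℕ M))
    (ℚ.≤-trans (*-mono (0≤R k (ℚ.nonNegative⁻¹ 1ℚ)) (0≤R k (0≤fromℕ M)) R₁ (R≤4^ k M)) (ℚ.≤-reflexive (sym (fromℕ-* 4 (4 ℕ.^ M))))))
    where
    R₁ : R k 1ℚ ℚ.≤ fromℕ 4
    R₁ = ℚ.≤-trans (R-quadratic k (ℚ.nonNegative⁻¹ 1ℚ) (toWitness {a? = 1ℚ ℚ.+ 1ℚ ℚ.≤? fromℕ 3} _)) (toWitness {a? = (1ℚ ℚ.+ 1ℚ) ℚ.+ 1ℚ ℚ.* 1ℚ ℚ.≤? fromℕ 4} _)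

  ∣R∣≤4^ : ∀ k M y → ∣ y ∣ ℚ.≤ fromℕ M → ∣ R k y ∣ ℚ.≤ fromℕ (4 ℕ.^ M)
  ∣R∣≤4^ k M y h = ℚ.≤-trans (ℚ.≤-reflexive (cong (λ z → ∣ re z ∣) (sym (C-real k y)))) (ℚ.≤-trans (∣re∣≤ (C k (real y))) (ℚ.≤-trans (‖C‖ k (real y))
    (ℚ.≤-trans (R-mono k 0≤‖ real y ‖ (ℚ.≤-trans (ℚ.≤-reflexive (ℚ.+-identityʳ (∣ y ∣))) h)) (R≤4^ k M))))

  ^-distrib : ∀ a b n → (a ℚ.* b) ^ n ≡ a ^ n ℚ.* b ^ n
  ^-distrib a b zero    = refl
  ^-distrib a b (suc n) = trans (cong (a ℚ.* b ℚ.*_) (^-distrib a b n)) (solve 4 (λ a b c d → (a :* b) :* (c :* d) := (a :* c) :* (b :* d)) refl a b (a ^ n) (b ^ n))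
    where open ℚS using (solve; _:*_; _:=_)

  1≤^ : ∀ {a} n → 1ℚ ℚ.≤ a → 1ℚ ℚ.≤ a ^ n
  1≤^ zero    h = ℚ.≤-refl
  1≤^ (suc n) h = *-mono (ℚ.nonNegative⁻¹ 1ℚ) (ℚ.nonNegative⁻¹ 1ℚ) h (1≤^ n h)

  ∣^∣≤ : ∀ {a c} n → ∣ a ∣ ℚ.≤ fromℕ c → ∣ a ^ n ∣ ℚ.≤ fromℕ (c ℕ.^ n)
  ∣^∣≤         zero    h = ℚ.≤-refl
  ∣^∣≤ {a} {c} (suc n) h = ℚ.≤-trans (ℚ.≤-reflexive (ℚ.∣p*q∣≡∣p∣*∣q∣ a (a ^ n)))
    (ℚ.≤-trans (*-mono (ℚ.0≤∣p∣ a) (ℚ.0≤∣p∣ (a ^ n)) h (∣^∣≤ {a} {c} n h)) (ℚ.≤-reflexive (sym (fromℕ-* c (c ℕ.^ n)))))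

  ^2≡ : ∀ a → a ^ 2 ≡ a ℚ.* a
  ^2≡ a = cong (a ℚ.*_) (ℚ.*-identityʳ a)

  exponent-bound : ∀ a M n X d → 1ℚ ℚ.≤ (fromℕ 2 ℚ.* X) ℚ.* d → fromℕ (2 ℕ.^ a ℕ.* 2 ℕ.^ a) ℚ.* (d ^ n) ^ 2 ℚ.≤ fromℕ 4 → ∣ X ∣ ℚ.≤ fromℕ (4 ℕ.^ M) →
    2 ℕ.^ a ℕ.* 2 ℕ.^ a ℕ.≤ ((2 ℕ.* 4 ℕ.^ M) ℕ.^ n ℕ.* (2 ℕ.* 4 ℕ.^ M) ℕ.^ n) ℕ.* 4
  exponent-bound a M n X d 1≤ d≤ X≤ = fromℕ-cancel A² ((w ℕ.^ n ℕ.* w ℕ.^ n) ℕ.* 4) (begin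
    fromℕ A²                                               ≡⟨ sym (ℚ.*-identityʳ (fromℕ A²)) ⟩
    fromℕ A² ℚ.* 1ℚ                                        ≤⟨ *-monoˡ (0≤fromℕ A²) (1≤^ 2 (1≤^ n 1≤)) ⟩
    fromℕ A² ℚ.* ((2X ℚ.* d) ^ n) ^ 2                      ≡⟨ cong (fromℕ A² ℚ.*_) (trans (cong (_^ 2) (^-distrib 2X d n)) (^-distrib (2X ^ n) (d ^ n) 2)) ⟩
    fromℕ A² ℚ.* ((2X ^ n) ^ 2 ℚ.* (d ^ n) ^ 2)            ≡⟨ solve 3 (λ a b c → a :* (b :* c) := b :* (a :* c)) refl (fromℕ A²) ((2X ^ n) ^ 2) ((d ^ n) ^ 2) ⟩
    (2X ^ n) ^ 2 ℚ.* (fromℕ A² ℚ.* (d ^ n) ^ 2)            ≤⟨ *-monoˡ (ℚ.≤-trans (square≥0 (2X ^ n)) (ℚ.≤-reflexive (sym (^2≡ (2X ^ n))))) d≤ ⟩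
    (2X ^ n) ^ 2 ℚ.* fromℕ 4                               ≤⟨ *-monoʳ (0≤fromℕ 4) square≤ ⟩
    fromℕ (w ℕ.^ n ℕ.* w ℕ.^ n) ℚ.* fromℕ 4                ≡⟨ sym (fromℕ-* (w ℕ.^ n ℕ.* w ℕ.^ n) 4) ⟩
    fromℕ ((w ℕ.^ n ℕ.* w ℕ.^ n) ℕ.* 4)                    ∎)
    where
    open ℚ.≤-Reasoning
    open ℚS using (solve; _:*_; _:=_)
    A² w : ℕ
    A² = 2 ℕ.^ a ℕ.* 2 ℕ.^ a
    w = 2 ℕ.* 4 ℕ.^ M
    2X : ℚ
    2X = fromℕ 2 ℚ.* X
    2X≤ : ∣ 2X ∣ ℚ.≤ fromℕ w
    2X≤ = ℚ.≤-trans (ℚ.≤-reflexive (ℚ.∣p*q∣≡∣p∣*∣q∣ (fromℕ 2) X)) (ℚ.≤-trans (*-monoˡ (0≤fromℕ 2) X≤) (ℚ.≤-reflexive (sym (fromℕ-* 2 (4 ℕ.^ M)))))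
    square≤ : (2X ^ n) ^ 2 ℚ.≤ fromℕ (w ℕ.^ n ℕ.* w ℕ.^ n)
    square≤ = ℚ.≤-trans (ℚ.≤-reflexive (trans (^2≡ (2X ^ n)) (square-∣∣ (2X ^ n))))
      (ℚ.≤-trans (*-mono (ℚ.0≤∣p∣ (2X ^ n)) (ℚ.0≤∣p∣ (2X ^ n)) (∣^∣≤ {2X} {w} n 2X≤) (∣^∣≤ {2X} {w} n 2X≤)) (ℚ.≤-reflexive (sym (fromℕ-* (w ℕ.^ n) (w ℕ.^ n)))))

  exponent-compare : ∀ a M n → 2 ℕ.^ a ℕ.* 2 ℕ.^ a ℕ.≤ ((2 ℕ.* 4 ℕ.^ M) ℕ.^ n ℕ.* (2 ℕ.* 4 ℕ.^ M) ℕ.^ n) ℕ.* 4 → a ℕ.≤ suc ((1 ℕ.+ 2 ℕ.* M) ℕ.* n)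
  exponent-compare a M n h = ℕ.*-cancelˡ-≤ 2 (power-cancel (begin
    2 ℕ.^ (2 ℕ.* a)                                        ≡⟨ cong (2 ℕ.^_) (cong (a ℕ.+_) (ℕ.+-identityʳ a)) ⟩
    2 ℕ.^ (a ℕ.+ a)                                        ≡⟨ ℕ.^-distribˡ-+-* 2 a a ⟩
    2 ℕ.^ a ℕ.* 2 ℕ.^ a                                    ≤⟨ h ⟩
    ((2 ℕ.* 4 ℕ.^ M) ℕ.^ n ℕ.* (2 ℕ.* 4 ℕ.^ M) ℕ.^ n) ℕ.* 4   ≡⟨ cong (λ x → (x ℕ.* x) ℕ.* 4) power ⟩
    (2 ℕ.^ b ℕ.* 2 ℕ.^ b) ℕ.* 2 ℕ.^ 2                      ≡⟨ cong (ℕ._* 2 ℕ.^ 2) (sym (ℕ.^-distribˡ-+-* 2 b b)) ⟩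
    2 ℕ.^ (b ℕ.+ b) ℕ.* 2 ℕ.^ 2                            ≡⟨ sym (ℕ.^-distribˡ-+-* 2 (b ℕ.+ b) 2) ⟩
    2 ℕ.^ (b ℕ.+ b ℕ.+ 2)                                  ≡⟨ cong (2 ℕ.^_) (solve 1 (λ b → b :+ b :+ con 2 := con 2 :* (con 1 :+ b)) refl b) ⟩
    2 ℕ.^ (2 ℕ.* suc b)                                    ∎))
    where
    open ℕ.≤-Reasoning
    open +-*-Solver
    b : ℕ
    b = (1 ℕ.+ 2 ℕ.* M) ℕ.* n
    power : (2 ℕ.* 4 ℕ.^ M) ℕ.^ n ≡ 2 ℕ.^ b
    power = trans (cong (λ x → (2 ℕ.* x) ℕ.^ n) (ℕ.^-*-assoc 2 2 M)) (ℕ.^-*-assoc 2 (1 ℕ.+ 2 ℕ.* M) n)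
    power-cancel : ∀ {x y} → 2 ℕ.^ x ℕ.≤ 2 ℕ.^ y → x ℕ.≤ y
    power-cancel {x} {y} h = ℕ.≮⇒≥ λ y<x → ℕ.<⇒≱ (ℕ.^-monoʳ-< 2 (s≤s (s≤s z≤n)) y<x) h

  module _ (A : ℕ) {δ X s μ β : ℚ} where

    exp-inverse : 1ℚ ℚ.≤ X ℚ.* δ ℚ.+ ½ → 1ℚ ℚ.≤ (fromℕ 2 ℚ.* X) ℚ.* δ
    exp-inverse h = begin
      fromℕ 2 ℚ.* (1ℚ ℚ.- ½)                                 ≤⟨ *-monoˡ {fromℕ 2} {1ℚ ℚ.- ½} {X ℚ.* δ} (0≤fromℕ 2) (≲⇒-≤ {1ℚ} {½} {X ℚ.* δ} (ℚ.≤-trans {1ℚ} {X ℚ.* δ ℚ.+ ½} {½ ℚ.+ X ℚ.* δ} h (ℚ.≤-reflexive (ℚ.+-comm (X ℚ.* δ) ½)))) ⟩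
      fromℕ 2 ℚ.* (X ℚ.* δ)                                  ≡⟨ sym (ℚ.*-assoc (fromℕ 2) X δ) ⟩
      (fromℕ 2 ℚ.* X) ℚ.* δ                                  ∎
      where open ℚ.≤-Reasoning

    scaled-mean : fromℕ A ℚ.* (β ℚ.* β) ℚ.≤ 1ℚ → fromℕ A ℚ.* s ℚ.+ fromℕ A ℚ.* s ℚ.≤ 1ℚ → μ ℚ.≤ (β ℚ.* β ℚ.+ β ℚ.* β) ℚ.+ (s ℚ.+ s) →
      fromℕ A ℚ.* (μ ℚ.+ recip A) ℚ.≤ fromℕ 4
    scaled-mean hβ hs hμ = begin
      fromℕ A ℚ.* (μ ℚ.+ recip A)                            ≤⟨ *-monoˡ {fromℕ A} (0≤fromℕ A) (ℚ.+-monoˡ-≤ (recip A) hμ) ⟩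
      fromℕ A ℚ.* (((β ℚ.* β ℚ.+ β ℚ.* β) ℚ.+ (s ℚ.+ s)) ℚ.+ recip A)
        ≡⟨ solve 4 (λ A b s r → A :* (((b :+ b) :+ (s :+ s)) :+ r) := ((A :* b :+ A :* b) :+ (A :* s :+ A :* s)) :+ A :* r) refl (fromℕ A) (β ℚ.* β) s (recip A) ⟩
      ((fromℕ A ℚ.* (β ℚ.* β) ℚ.+ fromℕ A ℚ.* (β ℚ.* β)) ℚ.+ (fromℕ A ℚ.* s ℚ.+ fromℕ A ℚ.* s)) ℚ.+ fromℕ A ℚ.* recip A
        ≤⟨ ℚ.+-mono-≤ (ℚ.+-mono-≤ (ℚ.+-mono-≤ hβ hβ) hs) (ℚ.≤-trans (*-monoʳ (ℚ.<⇒≤ (0<recip A)) (fromℕ-mono A (suc A) (ℕ.n≤1+n A))) (ℚ.≤-reflexive (reciprocal (suc A)))) ⟩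
      ((1ℚ ℚ.+ 1ℚ) ℚ.+ 1ℚ) ℚ.+ 1ℚ                            ∎
      where
      open ℚ.≤-Reasoning
      open ℚS using (solve; _:+_; _:*_; _:=_)

  scaled-square : ∀ a {β} → 0ℚ ℚ.≤ β → fromℕ a ℚ.* β ℚ.≤ 1ℚ → fromℕ (a ℕ.* a) ℚ.* (β ℚ.* β) ℚ.≤ 1ℚ
  scaled-square a {β} 0≤β aβ≤1 = begin
    fromℕ (a ℕ.* a) ℚ.* (β ℚ.* β)            ≡⟨ cong (ℚ._* (β ℚ.* β)) (fromℕ-* a a) ⟩
    (fromℕ a ℚ.* fromℕ a) ℚ.* (β ℚ.* β)      ≡⟨ solve 2 (λ a b → (a :* a) :* (b :* b) := (a :* b) :* (a :* b)) refl (fromℕ a) β ⟩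
    (fromℕ a ℚ.* β) ℚ.* (fromℕ a ℚ.* β)      ≤⟨ *-mono (0≤⇒* (0≤fromℕ a) 0≤β) (0≤⇒* (0≤fromℕ a) 0≤β) aβ≤1 aβ≤1 ⟩
    1ℚ ℚ.* 1ℚ                                ∎
    where
    open ℚ.≤-Reasoning
    open ℚS using (solve; _:*_; _:=_)

  log-inverse-large : ∀ (δ ℓ μ s : ℕ → ℚ) a M n → suc ((1 ℕ.+ 2 ℕ.* M) ℕ.* n) ℕ.< a → IsLogInverse δ ℓ →
    (λ k → (δ k ^ n) ^ 2) ≲ μ →
    (∃[ β ] (0ℚ ℚ.≤ β × fromℕ (2 ℕ.^ a) ℚ.* β ℚ.≤ 1ℚ × ∀ k → μ k ℚ.≤ (β ℚ.* β ℚ.+ β ℚ.* β) ℚ.+ (s k ℚ.+ s k))) → Small s →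
    ∃[ N ] (∀ k → N ℕ.≤ k → fromℕ M ℚ.≤ ∣ ℓ k ∣)
  log-inverse-large δ ℓ μ s a M n bound<a (_ , inv) δ≲ (β , 0≤β , Aβ≤1 , μ≤) s-small = let
      (N₁ , h₁) = inv ½ (ℚ.positive⁻¹ ½)
      (N₂ , h₂) = δ≲ (recip A²) (0<recip A²)
      (N₃ , h₃) = small-+ {λ k → fromℕ A² ℚ.* s k} {λ k → fromℕ A² ℚ.* s k} (small-scale A² {s} s-small) (small-scale A² {s} s-small) 1ℚ (ℚ.positive⁻¹ 1ℚ)
    in N₁ ℕ.+ (N₂ ℕ.+ N₃) , λ k h → conclude k (h₁ k (ℕ.≤-trans (ℕ.m≤m+n N₁ _) h)) (h₂ k (ℕ.≤-trans (ℕ.≤-trans (ℕ.m≤m+n N₂ N₃) (ℕ.m≤n+m _ N₁)) h))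
      (h₃ k (ℕ.≤-trans (ℕ.≤-trans (ℕ.m≤n+m N₃ N₂) (ℕ.m≤n+m _ N₁)) h))
    where
    A² : ℕ
    A² = 2 ℕ.^ a ℕ.* 2 ℕ.^ a
    conclude : ∀ k → 1ℚ ℚ.≤ exp ℓ k ℚ.* δ k ℚ.+ ½ → (δ k ^ n) ^ 2 ℚ.≤ μ k ℚ.+ recip A² → fromℕ A² ℚ.* s k ℚ.+ fromℕ A² ℚ.* s k ℚ.≤ 1ℚ → fromℕ M ℚ.≤ ∣ ℓ k ∣
    conclude k h₁ h₂ h₃ with ℚ.≤-total (fromℕ M) (∣ ℓ k ∣)
    ... | inj₁ h = h
    ... | inj₂ h = contradiction (exponent-compare a M n (exponent-bound a M n (R k (ℓ k)) (δ k)
        (exp-inverse A² {δ k} {R k (ℓ k)} {s k} {μ k} {β} (subst (λ x → 1ℚ ℚ.≤ x ℚ.* δ k ℚ.+ ½) (exp≡R ℓ k) h₁))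
        (ℚ.≤-trans (*-monoˡ {fromℕ A²} (0≤fromℕ A²) h₂)
          (scaled-mean A² {δ k} {R k (ℓ k)} {s k} {μ k} {β} (scaled-square (2 ℕ.^ a) {β} 0≤β Aβ≤1) h₃ (μ≤ k)))
        (∣R∣≤4^ k M (ℓ k) h))) (ℕ.<⇒≱ bound<a)

open RealEstimates

module Parameters where

  K : ℕ → ℕ
  K s = 2 ℕ.* (s ℕ.* s) ℕ.+ (4 ℕ.* s ℕ.+ 93)

  2xy≤x²+y² : ∀ x y → 2 ℕ.* (x ℕ.* y) ℕ.≤ x ℕ.* x ℕ.+ y ℕ.* y
  2xy≤x²+y² x y = case (ℕ.≤-total x y)
    where
    gap : ∀ x d → 2 ℕ.* (x ℕ.* (x ℕ.+ d)) ℕ.≤ x ℕ.* x ℕ.+ (x ℕ.+ d) ℕ.* (x ℕ.+ d)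
    gap x d = ℕ.≤-trans (ℕ.m≤m+n _ (d ℕ.* d)) (ℕ.≤-reflexive (solve 2 (λ x d → con 2 :* (x :* (x :+ d)) :+ d :* d := x :* x :+ (x :+ d) :* (x :+ d)) refl x d))
      where open +-*-Solver
    ordered : ∀ {x y} → x ℕ.≤ y → 2 ℕ.* (x ℕ.* y) ℕ.≤ x ℕ.* x ℕ.+ y ℕ.* y
    ordered {x} {y} x≤y = subst (λ y → 2 ℕ.* (x ℕ.* y) ℕ.≤ x ℕ.* x ℕ.+ y ℕ.* y) (ℕ.m+[n∸m]≡n x≤y) (gap x (y ℕ.∸ x))
    case : x ℕ.≤ y ⊎ y ℕ.≤ x → 2 ℕ.* (x ℕ.* y) ℕ.≤ x ℕ.* x ℕ.+ y ℕ.* y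
    case (inj₁ x≤y) = ordered x≤y
    case (inj₂ y≤x) = subst₂ ℕ._≤_ (cong (2 ℕ.*_) (ℕ.*-comm y x)) (ℕ.+-comm (y ℕ.* y) (x ℕ.* x)) (ordered y≤x)

  n<2^n : ∀ n → n ℕ.< 2 ℕ.^ n
  n<2^n zero    = s≤s z≤n
  n<2^n (suc n) = ℕ.≤-trans (ℕ.+-mono-≤ (ℕ.m^n>0 2 n) (n<2^n n)) (ℕ.≤-reflexive (cong (2 ℕ.^ n ℕ.+_) (sym (ℕ.+-identityʳ (2 ℕ.^ n)))))

  quadratic-beats-linear : ∀ s a m → a ℕ.≤ 18 ℕ.+ (s ℕ.+ m ℕ.* s) → 17 ℕ.+ 4 ℕ.* suc a ℕ.≤ 2 ℕ.* (m ℕ.* m) ℕ.+ K s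
  quadratic-beats-linear s a m h = begin
    17 ℕ.+ 4 ℕ.* suc a                                            ≤⟨ ℕ.+-monoʳ-≤ 17 (ℕ.*-monoʳ-≤ 4 (s≤s h)) ⟩
    17 ℕ.+ 4 ℕ.* suc (18 ℕ.+ (s ℕ.+ m ℕ.* s))                     ≡⟨ solve 2 (λ s m → con 17 :+ con 4 :* (con 1 :+ (con 18 :+ (s :+ m :* s))) := con 2 :* (con 2 :* (m :* s)) :+ (con 4 :* s :+ con 93)) refl s m ⟩
    2 ℕ.* (2 ℕ.* (m ℕ.* s)) ℕ.+ (4 ℕ.* s ℕ.+ 93)                  ≤⟨ ℕ.+-monoˡ-≤ (4 ℕ.* s ℕ.+ 93) (ℕ.*-monoʳ-≤ 2 (2xy≤x²+y² m s)) ⟩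
    2 ℕ.* (m ℕ.* m ℕ.+ s ℕ.* s) ℕ.+ (4 ℕ.* s ℕ.+ 93)              ≡⟨ solve 3 (λ m s z → con 2 :* (m :+ s) :+ z := con 2 :* m :+ (con 2 :* s :+ z)) refl (m ℕ.* m) (s ℕ.* s) (4 ℕ.* s ℕ.+ 93) ⟩
    2 ℕ.* (m ℕ.* m) ℕ.+ K s                                       ∎
    where
    open ℕ.≤-Reasoning
    open +-*-Solver

  division-by : ∀ s .{{_ : NonZero s}} a → ∃[ m ] (a ℕ.≤ 18 ℕ.+ (s ℕ.+ m ℕ.* s) × (m ≡ 0 ⊎ 18 ℕ.+ m ℕ.* s ℕ.≤ a))
  division-by s a with 18 ℕ.≤? a
  ... | no a<18 = 0 , ℕ.≤-trans (ℕ.<⇒≤ (ℕ.≰⇒> a<18)) (ℕ.m≤m+n 18 _) , inj₁ refl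
  ... | yes 18≤a = let
      d = a ℕ.∸ 18
      e : 18 ℕ.+ d ≡ a
      e = ℕ.m+[n∸m]≡n 18≤a
    in d ℕ./ s , ℕ.≤-trans (ℕ.≤-reflexive (sym e)) (ℕ.+-monoʳ-≤ 18 (ℕ.≤-trans (ℕ.≤-reflexive (m≡m%n+[m/n]*n d s)) (ℕ.+-monoˡ-≤ ((d ℕ./ s) ℕ.* s) (ℕ.<⇒≤ (m%n<n d s))))) ,
      inj₂ (ℕ.≤-trans (ℕ.+-monoʳ-≤ 18 (ℕ.≤-trans (ℕ.m≤n+m _ (d ℕ.% s)) (ℕ.≤-reflexive (sym (m≡m%n+[m/n]*n d s))))) (ℕ.≤-reflexive e))

  dyadic : ∀ x z → 1 ℕ.≤ z → ∃[ a ] (x ℕ.≤ 2 ℕ.^ suc a ℕ.* z × (1 ℕ.≤ a → 2 ℕ.^ a ℕ.* z ℕ.≤ x))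
  dyadic x z 1≤z = go x (ℕ.≤-trans (ℕ.≤-trans (ℕ.<⇒≤ (n<2^n x)) (ℕ.^-monoʳ-≤ 2 (ℕ.n≤1+n x))) (ℕ.m≤m*n (2 ℕ.^ suc x) z {{ℕ.>-nonZero 1≤z}}))
    where
    go : ∀ b → x ℕ.≤ 2 ℕ.^ suc b ℕ.* z → ∃[ a ] (x ℕ.≤ 2 ℕ.^ suc a ℕ.* z × (1 ℕ.≤ a → 2 ℕ.^ a ℕ.* z ℕ.≤ x))
    go zero    h = 0 , h , λ ()
    go (suc b) h with x ℕ.≤? 2 ℕ.^ suc b ℕ.* z
    ... | yes h′ = go b h′
    ... | no h′ = suc b , h , λ _ → ℕ.<⇒≤ (ℕ.≰⇒> h′)

  power-split : ∀ n K N e D → e ℕ.≤ N ℕ.+ K → n ℕ.≤ 2 ℕ.^ e ℕ.* D → n ℕ.≤ 2 ℕ.^ K ℕ.* (D ℕ.* 2 ℕ.^ N)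
  power-split n K N e D e≤ n≤ = begin
    n                                   ≤⟨ n≤ ⟩
    2 ℕ.^ e ℕ.* D                       ≤⟨ ℕ.*-monoˡ-≤ D (ℕ.^-monoʳ-≤ 2 e≤) ⟩
    2 ℕ.^ (N ℕ.+ K) ℕ.* D               ≡⟨ cong (ℕ._* D) (ℕ.^-distribˡ-+-* 2 N K) ⟩
    (2 ℕ.^ N ℕ.* 2 ℕ.^ K) ℕ.* D         ≡⟨ solve 3 (λ x k d → (x :* k) :* d := k :* (d :* x)) refl (2 ℕ.^ N) (2 ℕ.^ K) D ⟩
    2 ℕ.^ K ℕ.* (D ℕ.* 2 ℕ.^ N)         ∎
    where
    open ℕ.≤-Reasoning
    open +-*-Solver

  exp-large : ∀ (L ℓ : ℕ → ℚ) m k → 2 ℕ.* (m ℕ.* m) ℕ.≤ k → ½ ℚ.≤ L k → fromℕ (2 ℕ.* m) ℚ.≤ ∣ ℓ k ∣ →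
    fromℕ (2 ℕ.^ (2 ℕ.* (m ℕ.* m))) ℚ.≤ exp (λ j → L j ℚ.* ℓ j ^ 2) k
  exp-large L ℓ m k N≤k ½≤L 2m≤ℓ = begin
    fromℕ (2 ℕ.^ N)                  ≤⟨ 2^≤R N ⟩
    R N (fromℕ N)                    ≤⟨ R-more′ {fromℕ N} {N} {k} N≤k (0≤fromℕ N) ⟩
    R k (fromℕ N)                    ≤⟨ R-mono {fromℕ N} {L k ℚ.* ℓ k ^ 2} k (0≤fromℕ N) N≤ ⟩
    R k (L k ℚ.* ℓ k ^ 2)            ≡⟨ sym (exp≡R (λ j → L j ℚ.* ℓ j ^ 2) k) ⟩
    exp (λ j → L j ℚ.* ℓ j ^ 2) k    ∎
    where
    open ℚ.≤-Reasoning
    N : ℕ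
    N = 2 ℕ.* (m ℕ.* m)
    half-square : ∀ a → ½ ℚ.* ((fromℕ 2 ℚ.* a) ℚ.* (fromℕ 2 ℚ.* a)) ≡ fromℕ 2 ℚ.* (a ℚ.* a)
    half-square = solve 1 (λ a → con ½ :* ((con (fromℕ 2) :* a) :* (con (fromℕ 2) :* a)) := con (fromℕ 2) :* (a :* a)) refl
      where open ℚS using (solve; _:*_; _:=_; con)
    N≤ : fromℕ N ℚ.≤ L k ℚ.* ℓ k ^ 2
    N≤ = begin
      fromℕ N                                                      ≡⟨ trans (fromℕ-* 2 (m ℕ.* m)) (cong (fromℕ 2 ℚ.*_) (fromℕ-* m m)) ⟩
      fromℕ 2 ℚ.* (fromℕ m ℚ.* fromℕ m)                            ≡⟨ sym (half-square (fromℕ m)) ⟩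
      ½ ℚ.* ((fromℕ 2 ℚ.* fromℕ m) ℚ.* (fromℕ 2 ℚ.* fromℕ m))      ≡⟨ cong (λ x → ½ ℚ.* (x ℚ.* x)) (sym (fromℕ-* 2 m)) ⟩
      ½ ℚ.* (fromℕ (2 ℕ.* m) ℚ.* fromℕ (2 ℕ.* m))
        ≤⟨ *-mono {½} {L k} {fromℕ (2 ℕ.* m) ℚ.* fromℕ (2 ℕ.* m)} {∣ ℓ k ∣ ℚ.* ∣ ℓ k ∣} (ℚ.nonNegative⁻¹ ½) (square≥0 (fromℕ (2 ℕ.* m))) ½≤L
             (*-mono {fromℕ (2 ℕ.* m)} {∣ ℓ k ∣} {fromℕ (2 ℕ.* m)} {∣ ℓ k ∣} (0≤fromℕ (2 ℕ.* m)) (0≤fromℕ (2 ℕ.* m)) 2m≤ℓ 2m≤ℓ) ⟩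
      L k ℚ.* (∣ ℓ k ∣ ℚ.* ∣ ℓ k ∣)                                ≡⟨ cong (L k ℚ.*_) (sym (trans (^2≡ (ℓ k)) (square-∣∣ (ℓ k)))) ⟩
      L k ℚ.* ℓ k ^ 2                                              ∎

  scaled : ∀ c A n D x {y} → 0ℚ ℚ.≤ c → c ℚ.* fromℕ A ≡ 1ℚ → n ℕ.≤ A ℕ.* (D ℕ.* x) → fromℕ x ℚ.≤ y → c ℚ.* fromℕ n ℚ.≤ fromℕ D ℚ.* y
  scaled c A n D x {y} 0≤c cA≡1 n≤ x≤y = begin
    c ℚ.* fromℕ n                          ≤⟨ *-monoˡ {c} 0≤c (fromℕ-mono n (A ℕ.* (D ℕ.* x)) n≤) ⟩
    c ℚ.* fromℕ (A ℕ.* (D ℕ.* x))          ≡⟨ cong (c ℚ.*_) (fromℕ-* A (D ℕ.* x)) ⟩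
    c ℚ.* (fromℕ A ℚ.* fromℕ (D ℕ.* x))    ≡⟨ trans (sym (ℚ.*-assoc c (fromℕ A) (fromℕ (D ℕ.* x)))) (trans (cong (ℚ._* fromℕ (D ℕ.* x)) cA≡1) (ℚ.*-identityˡ (fromℕ (D ℕ.* x)))) ⟩
    fromℕ (D ℕ.* x)                        ≡⟨ fromℕ-* D x ⟩
    fromℕ D ℚ.* fromℕ x                    ≤⟨ *-monoˡ {fromℕ D} (0≤fromℕ D) x≤y ⟩
    fromℕ D ℚ.* y                          ∎
    where open ℚ.≤-Reasoning

open Parameters

module Assembly (p : ℕ) .{{nz : NonZero p}} (prime : Prime p) where
  open PrimeField p prime
  open Count p prime
  open MultilinearForms p prime
  open IsotropicSystems p prime
  open DifferenceDegree p prime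
  open PolynomialFunctions p prime
  open CosetPartition p prime
  open GowersMeans p prime

  nulls>0 : ∀ {n} (T : Quad n) → 1 ℕ.≤ Z T
  nulls>0 {n} T = ℕ.≤-trans (Sub.size>0 (Tri.radical (Quad.slice T 𝟘) 𝟘))
    (ℕ.≤-trans (∑-term (λ x → size (Tri.radical (Quad.slice T 𝟘) x)) 𝟘) (∑-term (λ a → Tri.nulls (Quad.slice T a)) 𝟘))

  log-inverse≥ : ∀ {n} (f : V n → F) (T : Quad n) → (∀ a b c d x → Δ* (a ∷ b ∷ c ∷ d ∷ []) f x ≡ Quad.form T a b c d) →
    ∀ δ → IsGowersNorm 4 f δ → ∀ ℓ → IsLogInverse (approx δ) ℓ →
    ∀ a m → suc ((1 ℕ.+ 2 ℕ.* (2 ℕ.* m)) ℕ.* 16) ℕ.< a → 2 ℕ.^ a ℕ.* Z T ℕ.≤ p ℕ.^ n ℕ.* (p ℕ.^ n ℕ.* p ℕ.^ n) →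
    ∃[ N ] (∀ k → N ℕ.≤ k → fromℕ (2 ℕ.* m) ℚ.≤ ∣ ℓ k ∣)
  log-inverse≥ f T Δ≡ δ (π , isPi , _ , δ≲μ , _) ℓ inv a m large aZ≤ =
    log-inverse-large (approx δ) ℓ (λ k → ∣ gowersMean 4 f (root p (approx π) k) ∣²) (λ k → ∣ geo p (root p (approx π) k) ∣²) a (2 ℕ.* m) 16 large inv δ≲μ
      (let (β , 0≤β , aβ≤1 , b) = mean-bound f T Δ≡ (2 ℕ.^ a) aZ≤ in β , 0≤β , aβ≤1 , λ k → b (root p (approx π) k))
      (root-sum-small p (approx π) 1<p isPi)

  codimension : ∀ n (ℓ : ℕ → ℚ) → (λ k → fromℕ n ℚ.- 0ℚ ℚ.* ℓ k) ≲ (λ _ → fromℕ n)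
  codimension n ℓ ε 0<ε = 0 , λ k _ → ℚ.≤-trans (ℚ.≤-reflexive (trans (cong (λ x → fromℕ n ℚ.- x) (ℚ.*-zeroˡ (ℓ k))) (ℚ.+-identityʳ (fromℕ n)))) (≤-+ʳ {fromℕ n} {ε} (ℚ.<⇒≤ 0<ε))

  module _ {n : ℕ} (f : Poly {p} n) (deg≤4 : DegreeAtMost 4 f) where

    private
      T : Quad n
      T = fourth f deg≤4

    eventually-large : ∀ δ → IsGowersNorm 4 (eval f) δ → ∀ ℓ → IsLogInverse (approx δ) ℓ →
      ∀ a m → (1 ℕ.≤ a → 2 ℕ.^ a ℕ.* Z T ℕ.≤ p ℕ.^ n ℕ.* (p ℕ.^ n ℕ.* p ℕ.^ n)) → m ≡ 0 ⊎ 18 ℕ.+ m ℕ.* 64 ℕ.≤ a →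
      ∃[ N ] (∀ k → N ℕ.≤ k → fromℕ (2 ℕ.* m) ℚ.≤ ∣ ℓ k ∣)
    eventually-large δ norm ℓ inv a .0 aZ≤ (inj₁ refl) = 0 , λ k _ → ℚ.0≤∣p∣ (ℓ k)
    eventually-large δ norm ℓ inv a m  aZ≤ (inj₂ h) = log-inverse≥ (eval f) T (λ a b c d → fourth-constant (eval f) (deg-eval 4 f deg≤4) (a ∷ b ∷ c ∷ d ∷ [])) δ norm ℓ inv a m
      (ℕ.≤-trans (ℕ.≤-reflexive (solve 1 (λ m → con 2 :+ (con 1 :+ con 2 :* (con 2 :* m)) :* con 16 := con 18 :+ m :* con 64) refl m)) h)
      (aZ≤ (ℕ.≤-trans (s≤s z≤n) h))
      where open +-*-Solver

    large-system : ∃[ a ] ((1 ℕ.≤ a → 2 ℕ.^ a ℕ.* Z T ℕ.≤ p ℕ.^ n ℕ.* (p ℕ.^ n ℕ.* p ℕ.^ n)) ×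
      Σ (IsotropicSystem T) λ W → 5 ℕ.≤ n → n ℕ.≤ 2 ℕ.^ (17 ℕ.+ 4 ℕ.* suc a) ℕ.* IsotropicSystem.rank W)
    large-system = let (a , bias , upper) = dyadic (p ℕ.^ n ℕ.* (p ℕ.^ n ℕ.* p ℕ.^ n)) (Z T) (nulls>0 T) in
      a , upper , isotropic-system T (quartic-zero T) {suc a} bias

    dimension-bound : ∀ c → 0ℚ ℚ.≤ c → c ℚ.* fromℕ (2 ℕ.^ K 64) ≡ 1ℚ → ∀ δ → IsGowersNorm 4 (eval f) δ → ∀ (ℓ : ℝ) → IsLogInverse (approx δ) (approx ℓ) →
      ∀ (log-p : ℝ) → IsLog (λ _ → fromℕ p) (approx log-p) → ∀ a D → (1 ℕ.≤ a → 2 ℕ.^ a ℕ.* Z T ℕ.≤ p ℕ.^ n ℕ.* (p ℕ.^ n ℕ.* p ℕ.^ n)) →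
      n ℕ.≤ 2 ℕ.^ (17 ℕ.+ 4 ℕ.* suc a) ℕ.* D →
      (λ k → c ℚ.* fromℕ n) ≲ (λ k → fromℕ D ℚ.* exp (λ j → approx log-p j ℚ.* approx ℓ j ^ 2) k)
    dimension-bound c 0≤c cA≡1 δ norm ℓ inv log-p islog a D aZ≤ n≤ ε 0<ε =
      let (m , a≤ , m≤) = division-by 64 a
          (N₁ , h₁) = eventually-large δ norm (approx ℓ) inv a m aZ≤ m≤
          (N₂ , h₂) = log≥½ p log-p 1<p islog
      in (2 ℕ.* (m ℕ.* m)) ℕ.+ (N₁ ℕ.+ N₂) , λ k N≤k →
        ℚ.≤-trans (scaled c (2 ℕ.^ K 64) n D (2 ℕ.^ (2 ℕ.* (m ℕ.* m))) {exp (λ j → approx log-p j ℚ.* approx ℓ j ^ 2) k} 0≤c cA≡1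
          (power-split n (K 64) (2 ℕ.* (m ℕ.* m)) (17 ℕ.+ 4 ℕ.* suc a) D (quadratic-beats-linear 64 a m a≤) n≤)
          (exp-large (approx log-p) (approx ℓ) m k (ℕ.≤-trans (ℕ.m≤m+n (2 ℕ.* (m ℕ.* m)) (N₁ ℕ.+ N₂)) N≤k)
            (h₂ k (ℕ.≤-trans (ℕ.≤-trans (ℕ.m≤n+m N₂ N₁) (ℕ.m≤n+m (N₁ ℕ.+ N₂) (2 ℕ.* (m ℕ.* m)))) N≤k))
            (h₁ k (ℕ.≤-trans (ℕ.≤-trans (ℕ.m≤m+n N₁ N₂) (ℕ.m≤n+m (N₁ ℕ.+ N₂) (2 ℕ.* (m ℕ.* m)))) N≤k))))
          (≤-+ʳ {fromℕ D ℚ.* exp (λ j → approx log-p j ℚ.* approx ℓ j ^ 2) k} {ε} (ℚ.<⇒≤ 0<ε))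

    structure : ∀ c → 0ℚ ℚ.≤ c → c ℚ.* fromℕ (2 ℕ.^ K 64) ≡ 1ℚ → ∀ δ → IsGowersNorm 4 (eval f) δ → ∀ (ℓ : ℝ) → IsLogInverse (approx δ) (approx ℓ) →
      ∀ (log-p : ℝ) → IsLog (λ _ → fromℕ p) (approx log-p) →
      (∃[ a ] ((1 ℕ.≤ a → 2 ℕ.^ a ℕ.* Z T ℕ.≤ p ℕ.^ n ℕ.* (p ℕ.^ n ℕ.* p ℕ.^ n)) ×
        Σ (IsotropicSystem T) λ W → 5 ℕ.≤ n → n ℕ.≤ 2 ℕ.^ (17 ℕ.+ 4 ℕ.* suc a) ℕ.* IsotropicSystem.rank W)) →
      Σ (Subspace {p} n) λ V → Σ ℕ λ m → Σ (Fin m → AffineSubspace {p} n) λ A →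
        IsPartition V A ×
        (λ k → fromℕ n ℚ.- 0ℚ ℚ.* approx ℓ k) ≲ (λ _ → fromℕ (Subspace.dim V)) ×
        (5 ℕ.≤ n → ∀ α → (λ k → c ℚ.* fromℕ n) ≲ (λ k → fromℕ (dimᴬ (A α)) ℚ.* exp (λ j → approx log-p j ℚ.* approx ℓ j ^ 2) k)) ×
        (∀ α → CubicOn (A α) f)
    structure c 0≤c cA≡1 δ norm ℓ inv log-p islog (a , upper , W , n≤) =
      whole n , List.length (representatives f deg≤4 W) , coset f deg≤4 W , partition f deg≤4 W , codimension n (approx ℓ) ,
      (λ 5≤n _ → dimension-bound c 0≤c cA≡1 δ norm ℓ inv log-p islog a (IsotropicSystem.rank W) upper (n≤ 5≤n)) ,
      λ α → cubic f deg≤4 W (coset f deg≤4 W α) refl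

inverse-of : ∀ A → 1 ℕ.≤ A → ∃[ c ] (0ℚ ℚ.< c × c ℚ.* fromℕ A ≡ 1ℚ)
inverse-of (suc k) _ = recip k , 0<recip k , trans (ℚ.*-comm (recip k) (fromℕ (suc k))) (reciprocal (suc k))

-- Abstract, since 2 ^ K 64 has thousands of digits.
abstract
  scale : ∃[ c ] (0ℚ ℚ.< c × c ℚ.* fromℕ (2 ℕ.^ K 64) ≡ 1ℚ)
  scale = inverse-of (2 ℕ.^ K 64) (ℕ.m^n>0 2 (K 64))

theorem4 : Σ ℚ λ C → Σ ℚ λ c → Σ ℕ λ n₀ → 0ℚ ℚ.< c ×
    (∀ (p : ℕ) .{{_ : NonZero p}} → Prime p →
    ∀ (n : ℕ) (f : Poly {p} n) → HasDegree 4 f →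
    ∀ (δ : ℝ) → IsGowersNorm 4 (eval f) δ →
    ∀ (ℓ : ℝ) → IsLogInverse (approx δ) (approx ℓ) →
    ∀ (log-p : ℝ) → IsLog (λ _ → fromℕ p) (approx log-p) →
    Σ (Subspace {p} n) λ V → Σ ℕ λ m → Σ (Fin m → AffineSubspace {p} n) λ A →
    IsPartition V A ×
    (λ k → fromℕ n ℚ.- C ℚ.* approx ℓ k) ≲ (λ _ → fromℕ (Subspace.dim V)) ×
    (n₀ ℕ.≤ n → ∀ α →
    (λ k → c ℚ.* fromℕ n)
    ≲ (λ k → fromℕ (dimᴬ (A α)) ℚ.* exp (λ j → approx log-p j ℚ.* approx ℓ j ^ 2) k)) ×
    (∀ α → CubicOn (A α) f))
theorem4 = 0ℚ , proj₁ scale , 5 , proj₁ (proj₂ scale) , λ p prime n f (deg≤4 , _) δ norm ℓ inv log-p islog →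
  Assembly.structure p prime f deg≤4 (proj₁ scale) (ℚ.<⇒≤ (proj₁ (proj₂ scale))) (proj₂ (proj₂ scale)) δ norm ℓ inv log-p islog (Assembly.large-system p prime f deg≤4)
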